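{- For any $\lambda>0$, $\epsilon>0$ and $\zeta>0$ there exist constants $A,B>0$ and $N$ such that the following holds. For any $n\geq N$ and any degree sequence $\mathcal{D}=(d_1,\dots,d_n)$ on $n$ vertices which satisfies Condition D with constant $\zeta$ and for which $$-\lambda n^{ -1/3}R^{2/3}\le Q\le \lambda n^{ -1/3}R^{2/3},$$ if $G$ is a graph chosen uniformly at random from all simple graphs with degree sequence $\mathcal{D}$ and $\mathcal{C}_{\max}$ denotes a largest connected component of $G$, then \begin{enumerate} \item[(a)] $\Pr\left[|\mathcal{C}_{\max}|\le A n^{2/3}R^{ -1/3}\right]\le\epsilon$; \item[(b)] $\Pr\left[|\mathcal{C}_{\max}|\ge B n^{2/3}R^{ -1/3}\right]\le\epsilon$. \end{enumerate}
   Context: A degree sequence $\mathcal{D}=(d_1,\dots,d_n)$ assigns a degree $d_v$ to each of $n$ vertices; it is assumed that at least one simple graph with this degree sequence exists. Let $|E|=\frac12\sum_v d_v$, let $n_i$ be the number of vertices of degree $i$, and let $\Delta=\max_v d_v$. Define $$Q=Q(\mathcal{D})=\frac{\sum_{u}d_u^2}{2|E|}-2,\qquad R=R(\mathcal{D})=\frac{\sum_{u}d_u(d_u-2)^2}{2|E|}.$$ For a constant $0<\zeta<1/10$, $\mathcal{D}$ satisfies Condition D with constant $\zeta$ if: (a) $\Delta\le n^{1/3}R^{1/3}(\ln n)^{ -1}$; (b) $n_0=0$; (c) $n_2\le(1-\zeta)n$; (d) $|Q|\le \zeta/2$. $|\mathcal{C}_{\max}|$ denotes the number of vertices of the largest 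component.
   Formalization: The constants λ, ε and ζ are taken to be rational numbers instead of arbitrary positive reals (A and B are likewise produced as rationals). -}

module Defs where

open import Data.Bool using (Bool; true; false; _∧_; _∨_; if_then_else_)
open import Data.Nat as ℕ using (ℕ; zero; suc; _≡ᵇ_)
open import Data.Fin using (Fin)
import Data.Fin
import Data.Rational
open import Data.List using (List; []; _∷_; filter; length; map; concatMap; allFin; foldr)
open import Data.Vec using (Vec; lookup) renaming ([] to []ᵥ; _∷_ to _∷ᵥ_)
open import Data.Integer using (+_)
open import Data.Rational using (ℚ; _/_; _+_; _*_; _-_; _≤_; _<_; ∣_∣; 0ℚ; 1ℚ)
open import Relation.Binary.PropositionalEquality using (_≡_)
open import Relation.Nullary.Decidable using (T?)
open import Data.Bool using (T)

ℕtoℚ : ℕ → ℚ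
ℕtoℚ m = + m / 1

-- a / b as a rational; convention a / 0 = 0 (never used under the hypotheses)
_÷ℕ_ : ℕ → ℕ → ℚ
a ÷ℕ zero  = 0ℚ
a ÷ℕ suc b = + a / suc b

_^ℚ_ : ℚ → ℕ → ℚ
q ^ℚ zero  = 1ℚ
q ^ℚ suc k = q * (q ^ℚ k)

sumF : (n : ℕ) → (Fin n → ℕ) → ℕ
sumF n f = foldr (λ v acc → f v ℕ.+ acc) 0 (allFin n)

countF : (n : ℕ) → (Fin n → Bool) → ℕ
countF n p = length (filter (λ v → T? (p v)) (allFin n))

maxF : (n : ℕ) → (Fin n → ℕ) → ℕ
maxF n f = foldr (λ v acc → f v ℕ.⊔ acc) 0 (allFin n)

DegSeq : ℕ → Set
DegSeq n = Fin n → ℕ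

twoE : (n : ℕ) → DegSeq n → ℕ
twoE n d = sumF n d

nDeg : (n : ℕ) → DegSeq n → ℕ → ℕ
nDeg n d i = countF n (λ v → d v ≡ᵇ i)

maxDeg : (n : ℕ) → DegSeq n → ℕ
maxDeg n d = maxF n d

Qof : (n : ℕ) → DegSeq n → ℚ
Qof n d = (sumF n (λ u → d u ℕ.* d u) ÷ℕ twoE n d) - ℕtoℚ 2

absDiff2 : ℕ → ℕ
absDiff2 m = (m ℕ.∸ 2) ℕ.+ (2 ℕ.∸ m)

Rof : (n : ℕ) → DegSeq n → ℚ
Rof n d = sumF n (λ u → d u ℕ.* (absDiff2 (d u) ℕ.* absDiff2 (d u))) ÷ℕ twoE n d

-- Natural logarithm of a natural number, via the classical series
--   ln n = 2 Σ_{j≥0} z^{2j+1}/(2j+1),   z = (n−1)/(n+1)   (n ≥ 1),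
-- whose partial sums lnPartial n m (m terms) are rational, non-decreasing
-- in m and converge to ln n.  Hence for a rational T,
--   c·(ln n)³ ≤ T  (c ≥ 0)  iff  ∀ m, c·(lnPartial n m)³ ≤ T.

lnZ : ℕ → ℚ
lnZ n = (n ℕ.∸ 1) ÷ℕ (suc n)

lnPartial : ℕ → ℕ → ℚ
lnPartial n zero    = 0ℚ
lnPartial n (suc m) =
  lnPartial n m + (ℕtoℚ 2 * ((lnZ n ^ℚ (2 ℕ.* m ℕ.+ 1)) * (1 ÷ℕ (2 ℕ.* m ℕ.+ 1))))

-- Condition D with constant ζ
--  (a) Δ ≤ n^{1/3} R^{1/3} / ln n, stated equivalently (all quantities ≥ 0)
--      as Δ³ (ln n)³ ≤ n R, with (ln n)³ expressed through the series above
--  (b) n_0 = 0   (c) n_2 ≤ (1−ζ) n   (d) |Q| ≤ ζ/2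
-- together with the standing requirement 0 < ζ < 1/10.

record ConditionD (n : ℕ) (d : DegSeq n) (ζ : ℚ) : Set where
  field
    ζ-pos   : 0ℚ < ζ
    ζ-small : ζ < (1 ÷ℕ 10)
    condA   : ∀ m → (ℕtoℚ (maxDeg n d) ^ℚ 3) * (lnPartial n m ^ℚ 3)
                      ≤ ℕtoℚ n * Rof n d
    condB   : nDeg n d 0 ≡ 0
    condC   : ℕtoℚ (nDeg n d 2) ≤ (1ℚ - ζ) * ℕtoℚ n
    condD   : ∣ Qof n d ∣ ≤ ζ * (1 ÷ℕ 2)

-- Graphs on vertex set Fin n: adjacency matrices (Vec (Vec Bool n) n).
-- Simple graphs = symmetric, loopless matrices; they correspond bijectively
-- to simple graphs on the labelled vertex set Fin n.

Graph : ℕ → Set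
Graph n = Vec (Vec Bool n) n

adj : {n : ℕ} → Graph n → Fin n → Fin n → Bool
adj G i j = lookup (lookup G i) j

allVecs : {A : Set} → List A → (m : ℕ) → List (Vec A m)
allVecs xs zero    = []ᵥ ∷ []
allVecs xs (suc m) = concatMap (λ x → map (x ∷ᵥ_) (allVecs xs m)) xs

-- all 2^(n²) adjacency matrices, each exactly once
allGraphs : (n : ℕ) → List (Graph n)
allGraphs n = allVecs (allVecs (true ∷ false ∷ []) n) n

allF : (n : ℕ) → (Fin n → Bool) → Bool
allF n p = foldr (λ v acc → p v ∧ acc) true (allFin n)

anyF : (n : ℕ) → (Fin n → Bool) → Bool
anyF n p = foldr (λ v acc → p v ∨ acc) false (allFin n)

_==B_ : Bool → Bool → Bool
true  ==B b = b
false ==B true  = false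
false ==B false = true

isSimple : {n : ℕ} → Graph n → Bool
isSimple {n} G =
  allF n (λ i → allF n (λ j → adj G i j ==B adj G j i))
  ∧ allF n (λ i → adj G i i ==B false)

degree : {n : ℕ} → Graph n → Fin n → ℕ
degree {n} G v = countF n (λ w → adj G v w)

hasDegSeq : {n : ℕ} → Graph n → DegSeq n → Bool
hasDegSeq {n} G d = allF n (λ v → degree G v ≡ᵇ d v)

walkWithin : {n : ℕ} → Graph n → ℕ → Fin n → Fin n → Bool
walkWithin {n} G zero    v w = eqFin v w
  where
  eqFin : Fin n → Fin n → Bool
  eqFin a b = Data.Fin.toℕ a ≡ᵇ Data.Fin.toℕ b
walkWithin {n} G (suc k) v w =
  walkWithin G k v w ∨ anyF n (λ u → walkWithin G k v u ∧ adj G u w)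

-- v and w lie in the same connected component (walks of length ≤ n suffice)
connected : {n : ℕ} → Graph n → Fin n → Fin n → Bool
connected {n} G v w = walkWithin G n v w

compSize : {n : ℕ} → Graph n → Fin n → ℕ
compSize {n} G v = countF n (λ w → connected G v w)

largestComp : {n : ℕ} → Graph n → ℕ
largestComp {n} G = maxF n (compSize G)

realisations : (n : ℕ) → DegSeq n → List (Graph n)
realisations n d = filter (λ G → T? (isSimple G ∧ hasDegSeq G d)) (allGraphs n)

numGraphs : (n : ℕ) → DegSeq n → ℕ
numGraphs n d = length (realisations n d)

numEvent : (n : ℕ) → DegSeq n → (Graph n → Bool) → ℕ
numEvent n d E = length (filter (λ G → T? (E G)) (realisations n d))

ProbAtMost : (n : ℕ) → DegSeq n → (Graph n → Bool) → ℚ → Set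
ProbAtMost n d E ε = (numEvent n d E ÷ℕ numGraphs n d) ≤ ε

_≤Q?_ : ℚ → ℚ → Bool
p ≤Q? q = Data.Rational._≤ᵇ_ p q

{-# OPTIONS --safe #-}
module Submission where

-- Edges of the random graph are revealed one at a time. For simple graphs the one-step recursion for the number of
-- graphs compatible with a history is dominated by that of the configuration model, so every supermartingale of the
-- configuration-model exploration bounds a number of simple graphs from above, in units of (2|E| − 1)!! / ∏ d_v!.
-- Conversely, as Q ≈ 0 the expected numbers of loops and of pairs of parallel edges in the configuration model are
-- close to 1/2 and 1/4, and the first-moment method gives a positive proportion of simple graphs.
-- Write n^{1/3} R^{1/3} ≈ s, so that the scale of the components is n / s. The number Y of active half-edges has
-- step variance ≈ R and drift at most of order s² / n in absolute value. Upper tail: Y (2h − Y) with h = s / q is a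
-- supermartingale that pays for each discovered vertex and each discovered d (d − 2)². Hence a vertex of degree d
-- lies in a component of size n / s with probability O(d / s), and the expected number of such vertices is O(n / s),
-- whereas a component of size B n / s alone contributes B n / s of them. Lower tail: restarting at vertices of degree
-- 1, Y reaches height s / q within n / s discoveries, and from there it stays positive for another A n / s discoveries,
-- because ((h − Y)₊)² grows slowly.
open import Defs

module Exploration where

  open import Data.Bool using (if_then_else_; Bool; true; false; _∧_; _∨_; not; T; _xor_)
  open import Data.Bool.Properties using (T-≡; ∧-conicalˡ; ∧-conicalʳ; ∨-comm; ∧-comm; ∧-zeroʳ; ∧-identityʳ; ∨-zeroʳ)
  open import Data.Empty using (⊥; ⊥-elim)
  open import Data.Fin using (Fin; zero; suc; toℕ)
  import Data.Fin.Properties as Finₚ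
  open import Data.Integer using (ℤ; ∣_∣; +_; -[1+_]; -_; _+_; _*_; _-_; _≤_; _<_; +≤+; -≤+; nonNegative)
  open import Data.Integer.Properties
  open import Data.Integer.Tactic.RingSolver using (solve-∀)
  open import Data.List using (List; []; _∷_; _++_; filter; length; map; concatMap; foldr; tabulate; allFin; cartesianProductWith)
  open import Data.List.Properties using (length-map; length-++)
  open import Data.List.Membership.Propositional using (_∈_)
  open import Data.List.Membership.Propositional.Properties using (∈-∃++; ∈-filter⁺; ∈-filter⁻; ∈-map⁻; ∈-++⁺ˡ; ∈-++⁺ʳ; ∈-++⁻; ∈-cartesianProductWith⁺)
  open import Data.List.Relation.Unary.All using ([]; _∷_) renaming (lookup to lookupᴬ)
  open import Data.List.Relation.Unary.AllPairs using ([]; _∷_)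
  open import Data.List.Relation.Unary.Any using (here; there)
  open import Data.List.Relation.Unary.Unique.Propositional using (Unique)
  open import Data.List.Relation.Unary.Unique.Propositional.Properties using (map⁺; filter⁺; cartesianProductWith⁺)
  open import Data.Nat as ℕ using (ℕ; zero; suc; pred; _≡ᵇ_; _!)
  import Data.Nat.Properties as ℕₚ
  open import Data.Product using (∃; _×_; _,_; proj₁; proj₂)
  open import Data.Sum using (_⊎_; inj₁; inj₂)
  open import Data.Vec as Vec using (Vec; lookup)
  open import Data.Vec.Properties using (lookup∘tabulate; lookup-replicate; tabulate∘lookup; tabulate-cong; ∷-injective)
  open import Function using (_∘_; id; Equivalence)
  open import Relation.Binary.PropositionalEquality
  open import Relation.Nullary using (¬_; Dec; yes; no)
  open import Relation.Nullary.Decidable using (T?)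

  0≤ℕ : ∀ n → + 0 ≤ + n
  0≤ℕ n = +≤+ ℕ.z≤n

  0≤+ : ∀ {a b} → + 0 ≤ a → + 0 ≤ b → + 0 ≤ a + b
  0≤+ = +-mono-≤

  0≤* : ∀ {a b} → + 0 ≤ a → + 0 ≤ b → + 0 ≤ a * b
  0≤* {a} {b} p q =
    subst (_≤ a * b) (*-zeroʳ a) (*-monoˡ-≤-nonNeg a {{nonNegative p}} q)

  *-monoˡ : ∀ c {a b} → + 0 ≤ c → a ≤ b → c * a ≤ c * b
  *-monoˡ c p q = *-monoˡ-≤-nonNeg c {{nonNegative p}} q

  *-monoʳ : ∀ c {a b} → + 0 ≤ c → a ≤ b → a * c ≤ b * c
  *-monoʳ c p q = *-monoʳ-≤-nonNeg c {{nonNegative p}} q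

  *-mono : ∀ {a b c d} → + 0 ≤ a → + 0 ≤ d → a ≤ b → c ≤ d → a * c ≤ b * d
  *-mono {a} {d = d} 0≤a 0≤d p q = ≤-trans (*-monoˡ a 0≤a q) (*-monoʳ d 0≤d p)

  *-cancelˡ : ∀ c {a b} → + 1 ≤ c → c * a ≤ c * b → a ≤ b
  *-cancelˡ (+ suc k) _ q = *-cancelˡ-≤-pos _ _ (+ suc k) q
  *-cancelˡ (+ zero) (+≤+ ()) _

  ≤-by : ∀ {a b} c → + 0 ≤ c → b ≡ a + c → a ≤ b
  ≤-by {a} c p refl = subst (_≤ a + c) (+-identityʳ a) (+-monoʳ-≤ a p)

  0≤- : ∀ {a b} → a ≤ b → + 0 ≤ b - a
  0≤- = i≤j⇒0≤j-i

  -0≤ : ∀ {a b} → + 0 ≤ b - a → a ≤ b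
  -0≤ = 0≤i-j⇒j≤i

  0≤sq : ∀ a → + 0 ≤ a * a
  0≤sq (+ n) = 0≤* (0≤ℕ n) (0≤ℕ n)
  0≤sq (-[1+ n ]) = +≤+ ℕ.z≤n

  <⇒1+≤ : ∀ {a b} → a < b → a + + 1 ≤ b
  <⇒1+≤ {a} {b} p = subst (_≤ b) (+-comm (+ 1) a) (i<j⇒suc[i]≤j p)

  ≰⇒1+≤ : ∀ {a b} → ¬ (b ≤ a) → a + + 1 ≤ b
  ≰⇒1+≤ p = <⇒1+≤ (≰⇒> p)

  1≤⇒0≤ : ∀ {a} → + 1 ≤ a → + 0 ≤ a
  1≤⇒0≤ = ≤-trans (+≤+ ℕ.z≤n)

  ι : Bool → ℤ
  ι true = + 1
  ι false = + 0

  0≤ι : ∀ b → + 0 ≤ ι b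
  0≤ι true = 0≤ℕ 1
  0≤ι false = 0≤ℕ 0

  ι≤1 : ∀ b → ι b ≤ + 1
  ι≤1 true = ≤-refl
  ι≤1 false = 0≤ℕ 1

  true≢false : ∀ {b} → b ≡ true → b ≡ false → ⊥
  true≢false refl ()

  opaque

    ∑ : ∀ {n} → (Fin n → ℤ) → ℤ
    ∑ {zero} f = + 0
    ∑ {suc n} f = f zero + ∑ (f ∘ suc)

  opaque
    unfolding ∑

    ∑-cong : ∀ {n} {f g : Fin n → ℤ} → (∀ v → f v ≡ g v) → ∑ f ≡ ∑ g
    ∑-cong {zero} e = refl
    ∑-cong {suc n} e = cong₂ _+_ (e zero) (∑-cong (e ∘ suc))

    ∑-mono : ∀ {n} {f g : Fin n → ℤ} → (∀ v → f v ≤ g v) → ∑ f ≤ ∑ g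
    ∑-mono {zero} e = ≤-refl
    ∑-mono {suc n} e = +-mono-≤ (e zero) (∑-mono (e ∘ suc))

    ∑-zero : ∀ n → ∑ {n} (λ _ → + 0) ≡ + 0
    ∑-zero zero = refl
    ∑-zero (suc n) = trans (+-identityˡ _) (∑-zero n)

    ∑-one : ∀ n → ∑ {n} (λ _ → + 1) ≡ + n
    ∑-one zero = refl
    ∑-one (suc n) = cong (_+_ (+ 1)) (∑-one n)

    0≤∑ : ∀ {n} {f : Fin n → ℤ} → (∀ v → + 0 ≤ f v) → + 0 ≤ ∑ f
    0≤∑ {n} {f} e = subst (_≤ ∑ f) (∑-zero n) (∑-mono e)

    ∑-≡0 : ∀ {n} {f : Fin n → ℤ} → (∀ v → f v ≡ + 0) → ∑ f ≡ + 0
    ∑-≡0 {n} e = trans (∑-cong e) (∑-zero n)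

    ∑-+ : ∀ {n} (f g : Fin n → ℤ) → ∑ (λ v → f v + g v) ≡ ∑ f + ∑ g
    ∑-+ {zero} f g = refl
    ∑-+ {suc n} f g =
      trans (cong (_+_ (f zero + g zero)) (∑-+ (f ∘ suc) (g ∘ suc))) (lem (f zero) (g zero) (∑ (f ∘ suc)) (∑ (g ∘ suc)))
      where
      lem : ∀ a b c d → (a + b) + (c + d) ≡ (a + c) + (b + d)
      lem = solve-∀

    ∑-* : ∀ {n} c (f : Fin n → ℤ) → ∑ (λ v → c * f v) ≡ c * ∑ f
    ∑-* {zero} c f = sym (*-zeroʳ c)
    ∑-* {suc n} c f = trans (cong (_+_ (c * f zero)) (∑-* c (f ∘ suc))) (sym (*-distribˡ-+ c (f zero) _))

    ∑-*ʳ : ∀ {n} c (f : Fin n → ℤ) → ∑ (λ v → f v * c) ≡ ∑ f * c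
    ∑-*ʳ c f = trans (∑-cong (λ v → *-comm (f v) c)) (trans (∑-* c f) (*-comm c (∑ f)))

    ∑-neg : ∀ {n} (f : Fin n → ℤ) → ∑ (λ v → - f v) ≡ - ∑ f
    ∑-neg f = trans (∑-cong (λ v → sym (-1*i≡-i (f v)))) (trans (∑-* (- + 1) f) (-1*i≡-i (∑ f)))

    ∑-- : ∀ {n} (f g : Fin n → ℤ) → ∑ (λ v → f v - g v) ≡ ∑ f - ∑ g
    ∑-- f g = trans (∑-+ f (λ v → - g v)) (cong (_+_ (∑ f)) (∑-neg g))

    ∑-comm : ∀ {m n} (f : Fin m → Fin n → ℤ) → ∑ (λ v → ∑ (f v)) ≡ ∑ (λ w → ∑ (λ v → f v w))
    ∑-comm {zero} {n} f = sym (∑-zero n)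
    ∑-comm {suc m} f =
      trans (cong (_+_ (∑ (f zero))) (∑-comm (f ∘ suc))) (sym (∑-+ (f zero) (λ w → ∑ (λ v → f (suc v) w))))

    ∑-update : ∀ {n} (f g : Fin n → ℤ) u → (∀ v → v ≢ u → f v ≡ g v) → ∑ f ≡ ∑ g + (f u - g u)
    ∑-update {suc n} f g zero e = trans (cong (_+_ (f zero)) (∑-cong (λ v → e (suc v) λ ()))) (lem (f zero) (g zero) _)
      where
      lem : ∀ a b c → a + c ≡ b + c + (a - b)
      lem = solve-∀
    ∑-update {suc n} f g (suc u) e =
      trans (cong₂ _+_ (e zero λ ()) (∑-update (f ∘ suc) (g ∘ suc) u (λ v ne → e (suc v) (ne ∘ Finₚ.suc-injective))))
        (sym (+-assoc (g zero) _ _))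

    ∑-term : ∀ {n} (f : Fin n → ℤ) → (∀ v → + 0 ≤ f v) → ∀ u → f u ≤ ∑ f
    ∑-term {suc n} f p zero = subst (_≤ ∑ f) (+-identityʳ (f zero)) (+-monoʳ-≤ (f zero) (0≤∑ (p ∘ suc)))
    ∑-term {suc n} f p (suc u) =
      ≤-trans (∑-term (f ∘ suc) (p ∘ suc) u) (subst (_≤ ∑ f) (+-identityˡ (∑ (f ∘ suc))) (+-monoˡ-≤ (∑ (f ∘ suc)) (p zero)))

    ∑≡0⇒ : ∀ {n} (f : Fin n → ℤ) → (∀ v → + 0 ≤ f v) → ∑ f ≡ + 0 → ∀ u → f u ≡ + 0
    ∑≡0⇒ f p e u = ≤-antisym (subst (f u ≤_) e (∑-term f p u)) (p u)

    ∑-positive : ∀ {n} (f : Fin n → ℤ) → + 1 ≤ ∑ f → ∃ λ u → + 1 ≤ f u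
    ∑-positive {zero} f (+≤+ ())
    ∑-positive {suc n} f p with + 1 ≤? f zero
    ... | yes q = zero , q
    ... | no q with ∑-positive (f ∘ suc) (≤-trans p (subst (∑ f ≤_) (+-identityˡ _) (+-monoˡ-≤ (∑ (f ∘ suc)) (f0≤0))))
      where
      f0≤0 : f zero ≤ + 0
      f0≤0 = -0≤ (subst (+ 0 ≤_) (lem (f zero)) (0≤- (≰⇒1+≤ q)))
        where
        lem : ∀ a → + 1 - (a + + 1) ≡ + 0 - a
        lem = solve-∀
    ...   | u , r = suc u , r

  eqF : ∀ {n} → Fin n → Fin n → Bool
  eqF zero zero = true
  eqF zero (suc v) = false
  eqF (suc u) zero = false
  eqF (suc u) (suc v) = eqF u v

  eqF-refl : ∀ {n} (u : Fin n) → eqF u u ≡ true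
  eqF-refl zero = refl
  eqF-refl (suc u) = eqF-refl u

  eqF⇒≡ : ∀ {n} (u v : Fin n) → eqF u v ≡ true → u ≡ v
  eqF⇒≡ zero zero e = refl
  eqF⇒≡ (suc u) (suc v) e = cong suc (eqF⇒≡ u v e)

  ≢⇒eqF : ∀ {n} {u v : Fin n} → u ≢ v → eqF u v ≡ false
  ≢⇒eqF {u = u} {v} ne with eqF u v in e
  ... | true = ⊥-elim (ne (eqF⇒≡ u v e))
  ... | false = refl

  ∑-eqF : ∀ {n} (u : Fin n) (f : Fin n → ℤ) → ∑ (λ v → ι (eqF v u) * f v) ≡ f u
  ∑-eqF u f = trans (∑-update _ (λ _ → + 0) u off) (trans (cong₂ (λ a b → a + (ι b * f u - + 0)) (∑-zero _) (eqF-refl u)) (lem (f u)))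
    where
    off : ∀ v → v ≢ u → ι (eqF v u) * f v ≡ + 0
    off v ne = trans (cong (λ b → ι b * f v) (≢⇒eqF ne)) (*-zeroˡ (f v))
    lem : ∀ a → + 0 + (+ 1 * a - + 0) ≡ a
    lem = solve-∀

  module _ {A : Set} where

    count : (A → Bool) → List A → ℤ
    count p [] = + 0
    count p (x ∷ xs) = ι (p x) + count p xs

    0≤count : ∀ p xs → + 0 ≤ count p xs
    0≤count p [] = ≤-refl
    0≤count p (x ∷ xs) = 0≤+ (0≤ι (p x)) (0≤count p xs)

    length-filter : ∀ p xs → + length (filter (λ x → T? (p x)) xs) ≡ count p xs
    length-filter p [] = refl
    length-filter p (x ∷ xs) with p x
    ... | true = cong (_+_ (+ 1)) (length-filter p xs)
    ... | false = trans (length-filter p xs) (sym (+-identityˡ _))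

    count-mono : ∀ {p q} xs → (∀ {x} → x ∈ xs → p x ≡ true → q x ≡ true) → count p xs ≤ count q xs
    count-mono [] h = ≤-refl
    count-mono {p} {q} (x ∷ xs) h = +-mono-≤ head (count-mono xs (h ∘ there))
      where
      head : ι (p x) ≤ ι (q x)
      head with p x in e
      ... | false = 0≤ι (q x)
      ... | true rewrite h (here refl) e = ≤-refl

    count-none : ∀ {p} xs → (∀ {x} → x ∈ xs → p x ≡ false) → count p xs ≡ + 0
    count-none [] h = refl
    count-none {p} (x ∷ xs) h rewrite h (here refl) = trans (+-identityˡ _) (count-none xs (h ∘ there))

    count-all : ∀ xs → count (λ _ → true) xs ≡ + length xs
    count-all [] = refl
    count-all (x ∷ xs) = cong (_+_ (+ 1)) (count-all xs)

    count-split : ∀ (p q : A → Bool) xs → count p xs ≡ count (λ x → p x ∧ q x) xs + count (λ x → p x ∧ not (q x)) xs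
    count-split p q [] = refl
    count-split p q (x ∷ xs) =
      trans (cong₂ _+_ (ι-split (p x) (q x)) (count-split p q xs)) (lem (ι (p x ∧ q x)) (ι (p x ∧ not (q x))) (count (λ x → p x ∧ q x) xs) (count (λ x → p x ∧ not (q x)) xs))
      where
      lem : ∀ a b c d → (a + b) + (c + d) ≡ (a + c) + (b + d)
      lem = solve-∀
      ι-split : ∀ a b → ι a ≡ ι (a ∧ b) + ι (a ∧ not b)
      ι-split true true = refl
      ι-split true false = refl
      ι-split false b = refl

    count-≤-∑ : ∀ {n} c p (q : Fin n → A → Bool) xs →
      (∀ {x} → x ∈ xs → c * ι (p x) ≤ ∑ (λ w → ι (q w x))) → c * count p xs ≤ ∑ (λ w → count (q w) xs)
    count-≤-∑ {n} c p q [] h = ≤-reflexive (trans (*-zeroʳ c) (sym (∑-zero n)))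
    count-≤-∑ c p q (x ∷ xs) h = begin
      c * (ι (p x) + count p xs)                       ≡⟨ *-distribˡ-+ c (ι (p x)) _ ⟩
      c * ι (p x) + c * count p xs                     ≤⟨ +-mono-≤ (h (here refl)) (count-≤-∑ c p q xs (h ∘ there)) ⟩
      ∑ (λ w → ι (q w x)) + ∑ (λ w → count (q w) xs)   ≡⟨ ∑-+ _ _ ⟨
      ∑ (λ w → ι (q w x) + count (q w) xs)             ∎
      where open ≤-Reasoning

    ∑-≤-count : ∀ {n} c p (q : Fin n → A → Bool) xs →
      (∀ {x} → x ∈ xs → ∑ (λ w → ι (q w x)) ≤ c * ι (p x)) → ∑ (λ w → count (q w) xs) ≤ c * count p xs
    ∑-≤-count {n} c p q [] h = ≤-reflexive (sym (trans (*-zeroʳ c) (sym (∑-zero n))))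
    ∑-≤-count c p q (x ∷ xs) h = begin
      ∑ (λ w → ι (q w x) + count (q w) xs)             ≡⟨ ∑-+ _ _ ⟩
      ∑ (λ w → ι (q w x)) + ∑ (λ w → count (q w) xs)   ≤⟨ +-mono-≤ (h (here refl)) (∑-≤-count c p q xs (h ∘ there)) ⟩
      c * ι (p x) + c * count p xs                     ≡⟨ *-distribˡ-+ c (ι (p x)) _ ⟨
      c * (ι (p x) + count p xs)                       ∎
      where open ≤-Reasoning

  module _ {k : ℕ} where

    opaque
      unfolding ∑

      foldr-+ : ∀ {n} (f : Fin k → ℕ) (g : Fin n → Fin k) →
        + foldr (λ v acc → f v ℕ.+ acc) 0 (tabulate g) ≡ ∑ (λ v → + f (g v))
      foldr-+ {zero} f g = refl
      foldr-+ {suc n} f g = cong (_+_ (+ f (g zero))) (foldr-+ f (g ∘ suc))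

      count-tabulate : ∀ {n} (p : Fin k → Bool) (g : Fin n → Fin k) → count p (tabulate g) ≡ ∑ (λ v → ι (p (g v)))
      count-tabulate {zero} p g = refl
      count-tabulate {suc n} p g = cong (_+_ (ι (p (g zero)))) (count-tabulate p (g ∘ suc))

    foldr-∧⇒ : ∀ {n} (p : Fin k → Bool) (g : Fin n → Fin k) →
      foldr (λ v acc → p v ∧ acc) true (tabulate g) ≡ true → ∀ v → p (g v) ≡ true
    foldr-∧⇒ {suc n} p g e zero = ∧-conicalˡ _ _ e
    foldr-∧⇒ {suc n} p g e (suc v) = foldr-∧⇒ p (g ∘ suc) (∧-conicalʳ (p (g zero)) _ e) v

    ⇒foldr-∧ : ∀ {n} (p : Fin k → Bool) (g : Fin n → Fin k) →
      (∀ v → p (g v) ≡ true) → foldr (λ v acc → p v ∧ acc) true (tabulate g) ≡ true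
    ⇒foldr-∧ {zero} p g h = refl
    ⇒foldr-∧ {suc n} p g h rewrite h zero = ⇒foldr-∧ p (g ∘ suc) (h ∘ suc)

    foldr-∨⇒ : ∀ {n} (p : Fin k → Bool) (g : Fin n → Fin k) →
      foldr (λ v acc → p v ∨ acc) false (tabulate g) ≡ true → ∃ λ v → p (g v) ≡ true
    foldr-∨⇒ {suc n} p g e with p (g zero) in eq
    ... | true = zero , eq
    ... | false with foldr-∨⇒ p (g ∘ suc) e
    ...   | v , h = suc v , h

    ⇒foldr-∨ : ∀ {n} (p : Fin k → Bool) (g : Fin n → Fin k) v →
      p (g v) ≡ true → foldr (λ v acc → p v ∨ acc) false (tabulate g) ≡ true
    ⇒foldr-∨ {suc n} p g zero h rewrite h = refl
    ⇒foldr-∨ {suc n} p g (suc v) h with p (g zero)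
    ... | true = refl
    ... | false = ⇒foldr-∨ p (g ∘ suc) v h

    foldr-⊔-upper : ∀ {n} (f : Fin k → ℕ) (g : Fin n → Fin k) v →
      f (g v) ℕ.≤ foldr (λ v acc → f v ℕ.⊔ acc) 0 (tabulate g)
    foldr-⊔-upper {suc n} f g zero = ℕₚ.m≤m⊔n _ _
    foldr-⊔-upper {suc n} f g (suc v) = ℕₚ.≤-trans (foldr-⊔-upper f (g ∘ suc) v) (ℕₚ.m≤n⊔m (f (g zero)) _)

    foldr-⊔-attained : ∀ {n} (f : Fin k → ℕ) (g : Fin n → Fin k) → 
      let m = foldr (λ v acc → f v ℕ.⊔ acc) 0 (tabulate g) in (∃ λ v → f (g v) ≡ m) ⊎ (m ≡ 0)
    foldr-⊔-attained {zero} f g = inj₂ refl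
    foldr-⊔-attained {suc n} f g with ℕₚ.⊔-sel (f (g zero)) (foldr (λ v acc → f v ℕ.⊔ acc) 0 (tabulate (g ∘ suc)))
    ... | inj₁ e = inj₁ (zero , sym e)
    ... | inj₂ e with foldr-⊔-attained f (g ∘ suc)
    ...   | inj₁ (v , h) = inj₁ (suc v , trans h (sym e))
    ...   | inj₂ h = inj₂ (trans e h)

  module _ {n : ℕ} where

    countF-∑ : ∀ (p : Fin n → Bool) → + countF n p ≡ ∑ (λ v → ι (p v))
    countF-∑ p = trans (length-filter p (allFin n)) (count-tabulate p id)

    sumF-∑ : ∀ (f : Fin n → ℕ) → + sumF n f ≡ ∑ (λ v → + f v)
    sumF-∑ f = foldr-+ f id

    allF⇒ : ∀ (p : Fin n → Bool) → allF n p ≡ true → ∀ v → p v ≡ true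
    allF⇒ p = foldr-∧⇒ p id

    ⇒allF : ∀ (p : Fin n → Bool) → (∀ v → p v ≡ true) → allF n p ≡ true
    ⇒allF p = ⇒foldr-∧ p id

    anyF⇒ : ∀ (p : Fin n → Bool) → anyF n p ≡ true → ∃ λ v → p v ≡ true
    anyF⇒ p = foldr-∨⇒ p id

    ⇒anyF : ∀ (p : Fin n → Bool) v → p v ≡ true → anyF n p ≡ true
    ⇒anyF p = ⇒foldr-∨ p id

    ≤maxF : ∀ (f : Fin n → ℕ) v → f v ℕ.≤ maxF n f
    ≤maxF f = foldr-⊔-upper f id

    maxF-attained : ∀ (f : Fin n → ℕ) → (∃ λ v → f v ≡ maxF n f) ⊎ (maxF n f ≡ 0)
    maxF-attained f = foldr-⊔-attained f id

  ⇒T : ∀ {b} → b ≡ true → T b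
  ⇒T = Equivalence.from T-≡

  T⇒ : ∀ {b} → T b → b ≡ true
  T⇒ = Equivalence.to T-≡

  module _ {A : Set} where

    length-⊆ : ∀ {xs ys : List A} → Unique xs → (∀ {x} → x ∈ xs → x ∈ ys) → length xs ℕ.≤ length ys
    length-⊆ {[]} u h = ℕ.z≤n
    length-⊆ {x ∷ xs} (x∉ ∷ u) h with ∈-∃++ (h (here refl))
    ... | as , bs , refl = ℕₚ.≤-trans (ℕ.s≤s (length-⊆ u h′)) (ℕₚ.≤-reflexive len)
      where
      h′ : ∀ {y} → y ∈ xs → y ∈ (as ++ bs)
      h′ y∈ with ∈-++⁻ as (h (there y∈))
      ... | inj₁ p = ∈-++⁺ˡ p
      ... | inj₂ (here refl) = ⊥-elim (lookupᴬ x∉ y∈ refl)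
      ... | inj₂ (there p) = ∈-++⁺ʳ as p
      len : suc (length (as ++ bs)) ≡ length (as ++ x ∷ bs)
      len = trans (cong suc (length-++ as)) (sym (trans (length-++ as) (ℕₚ.+-suc (length as) _)))

    count-unique : ∀ p {xs : List A} → Unique xs →
      (∀ {x y} → x ∈ xs → y ∈ xs → p x ≡ true → p y ≡ true → x ≡ y) → count p xs ≤ + 1
    count-unique p {xs} u h = subst (_≤ + 1) (length-filter p xs) (+≤+ (go (filter⁺ (λ x → T? (p x)) u) mem))
      where
      mem : ∀ {x} → x ∈ filter (λ x → T? (p x)) xs → x ∈ xs × T (p x)
      mem = ∈-filter⁻ (λ x → T? (p x)) {xs = xs}
      go : ∀ {ys} → Unique ys → (∀ {x} → x ∈ ys → x ∈ xs × T (p x)) → length ys ℕ.≤ 1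
      go [] m = ℕ.z≤n
      go ([] ∷ u) m = ℕₚ.≤-refl
      go (((x≢y ∷ _)) ∷ u) m with m (here refl) | m (there (here refl))
      ... | x∈ , px | y∈ , py = ⊥-elim (x≢y (h x∈ y∈ (T⇒ px) (T⇒ py)))

  count-injection : ∀ {A B : Set} {p : A → Bool} {q : B → Bool} {xs ys} (f : A → B) → Unique xs →
    (∀ {x y} → f x ≡ f y → x ≡ y) →
    (∀ {x} → x ∈ xs → p x ≡ true → f x ∈ ys × q (f x) ≡ true) → count p xs ≤ count q ys
  count-injection {p = p} {q} {xs} {ys} f u inj h = subst₂ _≤_ (length-filter p xs) (length-filter q ys)
    (+≤+ (subst (ℕ._≤ _) (length-map f (filter (λ x → T? (p x)) xs)) (length-⊆ (map⁺ inj (filter⁺ (λ x → T? (p x)) u)) sub)))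
    where
    sub : ∀ {y} → y ∈ map f (filter (λ x → T? (p x)) xs) → y ∈ filter (λ x → T? (q x)) ys
    sub y∈ with ∈-map⁻ f y∈
    ... | x , x∈ , refl with ∈-filter⁻ (λ x → T? (p x)) {xs = xs} x∈
    ...   | x∈xs , px with h x∈xs (T⇒ px)
    ...     | fx∈ , qx = ∈-filter⁺ (λ x → T? (q x)) fx∈ (⇒T qx)

  allVecs-product : ∀ {A : Set} (xs : List A) m →
    allVecs xs (suc m) ≡ cartesianProductWith Vec._∷_ xs (allVecs xs m)
  allVecs-product xs m = go xs
    where
    go : ∀ ys → concatMap (λ x → map (Vec._∷_ x) (allVecs xs m)) ys ≡ cartesianProductWith Vec._∷_ ys (allVecs xs m)
    go [] = refl
    go (y ∷ ys) = cong (map (Vec._∷_ y) (allVecs xs m) ++_) (go ys)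

  allVecs-unique : ∀ {A : Set} {xs : List A} m → Unique xs → Unique (allVecs xs m)
  allVecs-unique zero u = [] ∷ []
  allVecs-unique {xs = xs} (suc m) u =
    subst Unique (sym (allVecs-product xs m)) (cartesianProductWith⁺ Vec._∷_ ∷-injective u (allVecs-unique m u))

  allVecs-complete : ∀ {A : Set} {xs : List A} {m} → (∀ x → x ∈ xs) → (v : Vec A m) → v ∈ allVecs xs m
  allVecs-complete c Vec.[] = here refl
  allVecs-complete {xs = xs} {suc m} c (x Vec.∷ v) =
    subst ((x Vec.∷ v) ∈_) (sym (allVecs-product xs m)) (∈-cartesianProductWith⁺ Vec._∷_ (c x) (allVecs-complete c v))

  allGraphs-unique : ∀ n → Unique (allGraphs n)
  allGraphs-unique n = allVecs-unique n (allVecs-unique n (((λ ()) ∷ []) ∷ ([] ∷ [])))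

  allGraphs-complete : ∀ {n} (G : Graph n) → G ∈ allGraphs n
  allGraphs-complete = allVecs-complete (allVecs-complete bool)
    where
    bool : ∀ b → b ∈ (true ∷ false ∷ [])
    bool true = here refl
    bool false = there (here refl)

  adj-ext : ∀ {n} {G H : Graph n} → (∀ i j → adj G i j ≡ adj H i j) → G ≡ H
  adj-ext {G = G} {H} e = vec-ext (λ i → vec-ext (e i))
    where
    vec-ext : ∀ {A : Set} {m} {v w : Vec A m} → (∀ i → lookup v i ≡ lookup w i) → v ≡ w
    vec-ext {v = v} {w} e = trans (sym (tabulate∘lookup v)) (trans (tabulate-cong e) (tabulate∘lookup w))

  ==B⇒≡ : ∀ {a b} → (a ==B b) ≡ true → a ≡ b
  ==B⇒≡ {true} {true} e = refl
  ==B⇒≡ {false} {false} e = refl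

  ==B-refl : ∀ b → (b ==B b) ≡ true
  ==B-refl true = refl
  ==B-refl false = refl

  record Realises {n : ℕ} (d : DegSeq n) (G : Graph n) : Set where
    field
      symmetric : ∀ i j → adj G i j ≡ adj G j i
      loopless : ∀ i → adj G i i ≡ false
      degrees : ∀ v → ∑ (λ w → ι (adj G v w)) ≡ + d v

  module _ {n : ℕ} {d : DegSeq n} {G : Graph n} where

    ∈⇒Realises : G ∈ realisations n d → Realises d G
    ∈⇒Realises G∈ = record
      { symmetric = λ i j → ==B⇒≡ (allF⇒ _ (allF⇒ _ (∧-conicalˡ _ _ simple) i) j)
      ; loopless = λ i → ==B⇒≡ (allF⇒ _ (∧-conicalʳ (allF n λ i → allF n λ j → adj G i j ==B adj G j i) _ simple) i)
      ; degrees = λ v → trans (sym (countF-∑ (adj G v)))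
          (cong +_ (ℕₚ.≡ᵇ⇒≡ _ _ (⇒T (allF⇒ _ (∧-conicalʳ (isSimple G) _ both) v)))) }
      where
      both : isSimple G ∧ hasDegSeq G d ≡ true
      both = T⇒ (proj₂ (∈-filter⁻ (λ G → T? (isSimple G ∧ hasDegSeq G d)) {xs = allGraphs n} G∈))
      simple : isSimple G ≡ true
      simple = ∧-conicalˡ _ _ both

    Realises⇒∈ : Realises d G → G ∈ realisations n d
    Realises⇒∈ R = ∈-filter⁺ (λ G → T? (isSimple G ∧ hasDegSeq G d)) (allGraphs-complete G) (⇒T both)
      where
      open Realises R
      ≡⇒==B : ∀ {a b} → a ≡ b → (a ==B b) ≡ true
      ≡⇒==B {a} refl = ==B-refl a
      both : isSimple G ∧ hasDegSeq G d ≡ true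
      both = cong₂ _∧_
        (cong₂ _∧_ (⇒allF _ (λ i → ⇒allF _ (λ j → ≡⇒==B (symmetric i j)))) (⇒allF _ (λ i → ≡⇒==B (loopless i))))
        (⇒allF _ (λ v → T⇒ (ℕₚ.≡⇒≡ᵇ _ _ (+-injective (trans (countF-∑ (adj G v)) (degrees v))))))

  realisations-unique : ∀ n d → Unique (realisations n d)
  realisations-unique n d = filter⁺ (λ G → T? (isSimple G ∧ hasDegSeq G d)) (allGraphs-unique n)

  dec : ∀ {n} → Fin n → (Fin n → ℕ) → Fin n → ℕ
  dec u r v = if eqF v u then pred (r v) else r v
    where open import Data.Bool using (if_then_else_)

  dec-at : ∀ {n} (u : Fin n) r → dec u r u ≡ pred (r u)
  dec-at u r rewrite eqF-refl u = refl

  dec-off : ∀ {n} {u v : Fin n} r → v ≢ u → dec u r v ≡ r v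
  dec-off r ne rewrite ≢⇒eqF ne = refl

  dec-≡ : ∀ {n} (u : Fin n) r → 1 ℕ.≤ r u → ∀ v → + r v ≡ + dec u r v + ι (eqF v u)
  dec-≡ u r p v with eqF v u in e
  ... | false = sym (+-identityʳ _)
  ... | true with eqF⇒≡ v u e
  ...   | refl with r v | p
  ...     | suc k | _ = cong +_ (ℕₚ.+-comm 1 k)

  ∑-dec : ∀ {n} (f : Fin n → ℤ) (u : Fin n) r → 1 ℕ.≤ r u → ∑ (λ v → f v * + dec u r v) ≡ ∑ (λ v → f v * + r v) - f u
  ∑-dec f u r p = sym (trans (cong (_- f u) (trans (∑-cong eq) (trans (∑-+ _ _) (cong (_+_ (∑ λ v → f v * + dec u r v)) (∑-eqF u f))))) (lem _ (f u)))
    where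
    eq : ∀ v → f v * + r v ≡ f v * + dec u r v + ι (eqF v u) * f v
    eq v = trans (cong (f v *_) (dec-≡ u r p v)) (lem′ (f v) (+ dec u r v) (ι (eqF v u)))
      where
      lem′ : ∀ a b c → a * (b + c) ≡ a * b + c * a
      lem′ = solve-∀
    lem : ∀ a b → a + b - b ≡ a
    lem = solve-∀

  ∑-dec₁ : ∀ {n} (u : Fin n) r → 1 ℕ.≤ r u → ∑ (λ v → + dec u r v) ≡ ∑ (λ v → + r v) - + 1
  ∑-dec₁ u r p = trans (sym (∑-cong (λ v → *-identityˡ (+ dec u r v))))
    (trans (∑-dec (λ _ → + 1) u r p) (cong (_- + 1) (∑-cong (λ v → *-identityˡ (+ r v)))))

  factorials : ∀ {n} → (Fin n → ℕ) → ℤ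
  factorials {zero} r = + 1
  factorials {suc n} r = + (r zero !) * factorials (r ∘ suc)

  factorials-cong : ∀ {n} {r r′ : Fin n → ℕ} → (∀ v → r v ≡ r′ v) → factorials r ≡ factorials r′
  factorials-cong {zero} e = refl
  factorials-cong {suc n} e = cong₂ (λ a b → + (a !) * b) (e zero) (factorials-cong (e ∘ suc))

  1≤factorials : ∀ {n} (r : Fin n → ℕ) → + 1 ≤ factorials r
  1≤factorials {zero} r = ≤-refl
  1≤factorials {suc n} r = *-mono (0≤ℕ 1) (1≤⇒0≤ (1≤factorials (r ∘ suc))) (+≤+ (ℕₚ.1≤n! (r zero))) (1≤factorials (r ∘ suc))

  factorials-dec : ∀ {n} u (r : Fin n → ℕ) → 1 ℕ.≤ r u → factorials r ≡ + r u * factorials (dec u r)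
  factorials-dec zero r p with r zero | p
  ... | suc k | _ = trans (cong (_* factorials (r ∘ suc)) (pos-* (suc k) (k !))) (*-assoc (+ suc k) (+ (k !)) _)
  factorials-dec (suc u) r p = trans (cong (+ (r zero !) *_) (factorials-dec u (r ∘ suc) p)) (lem (+ (r zero !)) (+ r (suc u)) _)
    where
    lem : ∀ a b c → a * (b * c) ≡ b * (a * c)
    lem = solve-∀

  -- dd m = (m − 1)!!, the number of perfect matchings of m half-edges (0 when m is odd).
  dd : ℕ → ℤ
  dd 0 = + 1
  dd 1 = + 0
  dd (suc (suc k)) = + suc k * dd k

  0≤dd : ∀ m → + 0 ≤ dd m
  0≤dd 0 = 0≤ℕ 1
  0≤dd 1 = 0≤ℕ 0
  0≤dd (suc (suc k)) = 0≤* (0≤ℕ (suc k)) (0≤dd k)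

  edge : ∀ {n} → Fin n → Fin n → Fin n → Fin n → Bool
  edge u w i j = (eqF i u ∧ eqF j w) ∨ (eqF i w ∧ eqF j u)

  edge-sym : ∀ {n} (u w i j : Fin n) → edge u w i j ≡ edge u w j i
  edge-sym u w i j = trans (∨-comm (eqF i u ∧ eqF j w) _) (cong₂ _∨_ (∧-comm (eqF i w) _) (∧-comm (eqF i u) _))

  edge⇒ : ∀ {n} (u w i j : Fin n) → edge u w i j ≡ true → (i ≡ u × j ≡ w) ⊎ (i ≡ w × j ≡ u)
  edge⇒ u w i j e with eqF i u in iu | eqF j w in jw
  ... | true | true = inj₁ (eqF⇒≡ i u iu , eqF⇒≡ j w jw)
  ... | true | false = inj₂ (eqF⇒≡ i w (∧-conicalˡ _ _ e) , eqF⇒≡ j u (∧-conicalʳ (eqF i w) _ e))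
  ... | false | _ = inj₂ (eqF⇒≡ i w (∧-conicalˡ _ _ e) , eqF⇒≡ j u (∧-conicalʳ (eqF i w) _ e))

  ∑-edge : ∀ {n} {u w : Fin n} → u ≢ w → ∀ i → ∑ (λ j → ι (edge u w i j)) ≡ ι (eqF i u) + ι (eqF i w)
  ∑-edge {u = u} {w} ne i = trans (∑-cong eq) (trans (∑-+ _ _) (cong₂ _+_ (∑-eqF w _) (∑-eqF u _)))
    where
    eq : ∀ j → ι (edge u w i j) ≡ ι (eqF j w) * ι (eqF i u) + ι (eqF j u) * ι (eqF i w)
    eq j with eqF i u in iu | eqF i w in iw
    ... | true | true = ⊥-elim (ne (trans (sym (eqF⇒≡ i u iu)) (eqF⇒≡ i w iw)))
    ... | false | false rewrite *-zeroʳ (ι (eqF j w)) | *-zeroʳ (ι (eqF j u)) = refl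
    ... | true | false with eqF j w | eqF j u
    ...   | true | true = refl
    ...   | true | false = refl
    ...   | false | true = refl
    ...   | false | false = refl
    eq j | false | true with eqF j w | eqF j u
    ...   | true | true = refl
    ...   | true | false = refl
    ...   | false | true = refl
    ...   | false | false = refl

  toggle : ∀ {n} → Fin n → Fin n → Graph n → Graph n
  toggle u w G = Vec.tabulate (λ i → Vec.tabulate (λ j → adj G i j xor edge u w i j))

  adj-toggle : ∀ {n} (u w : Fin n) G i j → adj (toggle u w G) i j ≡ adj G i j xor edge u w i j
  adj-toggle u w G i j = trans (cong (λ v → lookup v j) (lookup∘tabulate _ i)) (lookup∘tabulate _ j)

  toggle-injective : ∀ {n} (u w : Fin n) {G H} → toggle u w G ≡ toggle u w H → G ≡ H
  toggle-injective u w {G} {H} e = adj-ext (λ i j → xor-cancel (edge u w i j)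
    (trans (sym (adj-toggle u w G i j)) (trans (cong (λ X → adj X i j) e) (adj-toggle u w H i j))))
    where
    xor-cancel : ∀ c {a b} → a xor c ≡ b xor c → a ≡ b
    xor-cancel c {true} {true} e = refl
    xor-cancel c {false} {false} e = refl
    xor-cancel true {true} {false} ()
    xor-cancel false {true} {false} ()
    xor-cancel true {false} {true} ()
    xor-cancel false {false} {true} ()

  1≤? : ∀ k → (1 ℕ.≤ k) ⊎ (k ≡ 0)
  1≤? zero = inj₂ refl
  1≤? (suc k) = inj₁ (ℕ.s≤s ℕ.z≤n)

  bool? : ∀ b → b ≡ true ⊎ b ≡ false
  bool? true = inj₁ refl
  bool? false = inj₂ refl

  -- P is what has been learnt about the graph, K the set of revealed edges, S the set of discovered
  -- vertices, r the number of half-edges still unmatched at each vertex and m their total number.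
  record Explored {n} (d : DegSeq n) (P : Graph n → Bool) (K : Fin n → Fin n → Bool)
                  (S : Fin n → Bool) (r : Fin n → ℕ) (m : ℕ) : Set where
    field
      residual : ∀ v → + r v + ∑ (λ w → ι (K v w)) ≡ + d v
      revealed : ∀ {G} → G ∈ realisations n d → P G ≡ true → ∀ i j → K i j ≡ true → adj G i j ≡ true
      K-sym : ∀ i j → K i j ≡ K j i
      within : ∀ i j → K i j ≡ true → S i ≡ true
      total : ∑ (λ v → + r v) ≡ + m

  addEdge : ∀ {n} → (Fin n → Fin n → Bool) → Fin n → Fin n → Fin n → Fin n → Bool
  addEdge K u w i j = K i j ∨ edge u w i j

  learn : ∀ {n} → (Graph n → Bool) → (Fin n → Fin n → Bool) → Fin n → Fin n → Graph n → Bool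
  learn P K u w G = P G ∧ (adj G u w ∧ not (K u w))

  ∧-true : ∀ {a b} → a ∧ b ≡ true → a ≡ true × b ≡ true
  ∧-true {true} {true} e = refl , refl

  ∑-decs : ∀ {n} {u w : Fin n} {r} → u ≢ w → 1 ℕ.≤ r u → 1 ℕ.≤ r w → (f : Fin n → ℤ) →
    ∑ (λ v → f v * + dec w (dec u r) v) ≡ ∑ (λ v → f v * + r v) - f u - f w
  ∑-decs {u = u} {w} {r} ne pu pw f =
    trans (∑-dec f w (dec u r) (subst (1 ℕ.≤_) (sym (dec-off r (ne ∘ sym))) pw)) (cong (_- f w) (∑-dec f u r pu))

  decs-≡ : ∀ {n} {u w : Fin n} {r : Fin n → ℕ} → u ≢ w → 1 ℕ.≤ r u → 1 ℕ.≤ r w → ∀ v →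
    + r v ≡ + dec w (dec u r) v + (ι (eqF v u) + ι (eqF v w))
  decs-≡ {u = u} {w} {r} ne pu pw v =
    trans (dec-≡ u r pu v) (trans (cong (_+ ι (eqF v u)) (dec-≡ w (dec u r) (subst (1 ℕ.≤_) (sym (dec-off r (ne ∘ sym))) pw) v))
      (lem (+ dec w (dec u r) v) (ι (eqF v w)) (ι (eqF v u))))
    where
    lem : ∀ a b c → a + b + c ≡ a + (c + b)
    lem = solve-∀

  module _ {n} {d : DegSeq n} {P K S r m} (E : Explored {n} d P K S r m) where
    open Explored E

    unrevealed : ∀ {G} → G ∈ realisations n d → P G ≡ true → ∀ u →
      ∑ (λ w → ι (adj G u w ∧ not (K u w))) ≡ + r u
    unrevealed {G} G∈ p u = trans (trans (∑-cong eq) (∑-- _ _)) (trans (cong (_- ∑ (λ w → ι (K u w))) (trans (degrees u) (sym (residual u)))) (lem (+ r u) (∑ (λ w → ι (K u w)))))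
      where
      open Realises (∈⇒Realises G∈)
      lem : ∀ a b → a + b - b ≡ a
      lem = solve-∀
      eq : ∀ w → ι (adj G u w ∧ not (K u w)) ≡ ι (adj G u w) - ι (K u w)
      eq w with K u w in k
      ... | true rewrite revealed G∈ p u w k = refl
      ... | false with adj G u w
      ...   | true = refl
      ...   | false = refl

    learn-impossible : ∀ {u w} → (w ≡ u ⊎ r w ≡ 0) ⊎ K u w ≡ true → ∀ {G} → G ∈ realisations n d → learn P K u w G ≡ false
    learn-impossible {u} {w} h {G} G∈ with learn P K u w G in e
    ... | false = refl
    ... | true = ⊥-elim (absurd h)
      where
      open Realises (∈⇒Realises G∈)
      p : P G ≡ true
      p = proj₁ (∧-true e)
      a : adj G u w ≡ true
      a = proj₁ (∧-true (proj₂ (∧-true {P G} e)))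
      k : not (K u w) ≡ true
      k = proj₂ (∧-true {adj G u w} (proj₂ (∧-true {P G} e)))
      absurd : (w ≡ u ⊎ r w ≡ 0) ⊎ K u w ≡ true → ⊥
      absurd (inj₁ (inj₁ refl)) = true≢false a (loopless u)
      absurd (inj₂ k′) = true≢false k (cong not k′)
      absurd (inj₁ (inj₂ r0)) with subst₂ _≤_ one (trans (unrevealed G∈ p w) (cong +_ r0))
          (∑-term (λ v → ι (adj G w v ∧ not (K w v))) (λ v → 0≤ι (adj G w v ∧ not (K w v))) u)
        where
        one : ι (adj G w u ∧ not (K w u)) ≡ + 1
        one rewrite symmetric w u | K-sym w u | a | k = refl
      ... | +≤+ ()

    explore : ∀ {S′ u w} → (∀ v → S v ≡ true → S′ v ≡ true) → S′ u ≡ true → S′ w ≡ true →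
      u ≢ w → 1 ℕ.≤ r u → 1 ℕ.≤ r w → K u w ≡ false →
      Explored d (learn P K u w) (addEdge K u w) S′ (dec w (dec u r)) (m ℕ.∸ 2)
    explore {S′} {u} {w} S⊆ Su Sw ne pu pw k = record
      { residual = λ v → begin-equality
          + dec w (dec u r) v + ∑ (λ j → ι (addEdge K u w v j))
            ≡⟨ cong (_+_ (+ dec w (dec u r) v)) (trans (∑-cong (λ j → disjoint v j)) (∑-+ (λ j → ι (K v j)) (λ j → ι (edge u w v j)))) ⟩
          + dec w (dec u r) v + (∑ (λ j → ι (K v j)) + ∑ (λ j → ι (edge u w v j)))
            ≡⟨ cong (λ x → + dec w (dec u r) v + (∑ (λ j → ι (K v j)) + x)) (∑-edge ne v) ⟩
          + dec w (dec u r) v + (∑ (λ j → ι (K v j)) + (ι (eqF v u) + ι (eqF v w)))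
            ≡⟨ lem (+ dec w (dec u r) v) (∑ (λ j → ι (K v j))) (ι (eqF v u) + ι (eqF v w)) ⟩
          + dec w (dec u r) v + (ι (eqF v u) + ι (eqF v w)) + ∑ (λ j → ι (K v j))
            ≡⟨ cong (_+ ∑ (λ j → ι (K v j))) (decs-≡ ne pu pw v) ⟨
          + r v + ∑ (λ j → ι (K v j))
            ≡⟨ residual v ⟩
          + d v ∎
      ; revealed = revealed′
      ; K-sym = λ i j → cong₂ _∨_ (K-sym i j) (edge-sym u w i j)
      ; within = within′
      ; total = trans (trans (sym (∑-cong (λ v → *-identityˡ (+ dec w (dec u r) v)))) (trans (∑-decs ne pu pw (λ _ → + 1))
          (cong (λ x → x - + 1 - + 1) (trans (∑-cong (λ v → *-identityˡ (+ r v))) total)))) (two m 2≤m) }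
      where
      open ≤-Reasoning
      lem : ∀ a b c → a + (b + c) ≡ a + c + b
      lem = solve-∀
      disjoint : ∀ v j → ι (addEdge K u w v j) ≡ ι (K v j) + ι (edge u w v j)
      disjoint v j with K v j in kv
      ... | false = sym (+-identityˡ _)
      ... | true with edge u w v j in ev
      ...   | false = refl
      ...   | true with edge⇒ u w v j ev
      ...     | inj₁ (refl , refl) = ⊥-elim (true≢false kv k)
      ...     | inj₂ (refl , refl) = ⊥-elim (true≢false kv (trans (K-sym v j) k))
      revealed′ : ∀ {G} → G ∈ realisations n d → learn P K u w G ≡ true → ∀ i j → addEdge K u w i j ≡ true → adj G i j ≡ true
      revealed′ {G} G∈ l i j e with K i j in kij
      ... | true = revealed G∈ (proj₁ (∧-true l)) i j kij
      ... | false with edge⇒ u w i j e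
      ...   | inj₁ (refl , refl) = proj₁ (∧-true (proj₂ (∧-true {P G} l)))
      ...   | inj₂ (refl , refl) = trans (Realises.symmetric (∈⇒Realises G∈) i j) (proj₁ (∧-true (proj₂ (∧-true {P G} l))))
      within′ : ∀ i j → addEdge K u w i j ≡ true → S′ i ≡ true
      within′ i j e with K i j in kij
      ... | true = S⊆ i (within i j kij)
      ... | false with edge⇒ u w i j e
      ...   | inj₁ (refl , refl) = Su
      ...   | inj₂ (refl , refl) = Sw
      2≤m : 2 ℕ.≤ m
      2≤m = drop‿+≤+ (begin
        + 2                                        ≤⟨ +-monoˡ-≤ (+ 1) (+≤+ pw′) ⟩
        + dec u r w + + 1                          ≤⟨ +-monoˡ-≤ (+ 1) (∑-term (λ v → + dec u r v) (λ v → 0≤ℕ _) w) ⟩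
        ∑ (λ v → + dec u r v) + + 1                ≡⟨ cong (_+ + 1) (∑-dec₁ u r pu) ⟩
        ∑ (λ v → + r v) - + 1 + + 1                ≡⟨ lem′ (∑ (λ v → + r v)) ⟩
        ∑ (λ v → + r v)                            ≡⟨ total ⟩
        + m                                        ∎)
        where
        lem′ : ∀ a → a - + 1 + + 1 ≡ a
        lem′ = solve-∀
        pw′ : 1 ℕ.≤ dec u r w
        pw′ = subst (1 ℕ.≤_) (sym (dec-off r (ne ∘ sym))) pw
      two : ∀ m → 2 ℕ.≤ m → + m - + 1 - + 1 ≡ + (m ℕ.∸ 2)
      two (suc (suc m)) _ = refl
      two (suc zero) (ℕ.s≤s ())

    within-r : ∀ v → S v ≡ false → r v ≡ d v
    within-r v s = +-injective (trans (sym (trans (cong (_+_ (+ r v)) (∑-≡0 zeroK)) (+-identityʳ _))) (residual v))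
      where
      zeroK : ∀ w → ι (K v w) ≡ + 0
      zeroK w with K v w in k
      ... | false = refl
      ... | true = ⊥-elim (true≢false (within v w k) s)

  -- (m − 1)!! / ∏ᵥ (r v)! is the weight of all completions in the configuration model, so φ / den bounds a probability.
  record Good {n} (d : DegSeq n) (bad : Graph n → Bool) (den : ℤ) (P : Graph n → Bool) (r : Fin n → ℕ) (m : ℕ) (φ : ℤ) : Set where
    constructor good
    field
      bound : count (λ G → P G ∧ bad G) (realisations n d) * den * factorials r ≤ dd m * φ

  -- Revealing one more edge at u. In the configuration model the partner of the half-edge at u is w with
  -- probability dec u r w / (m − 1), so the last premise says that the mean of ψ is at most φ.
  reveal : ∀ {n} {d : DegSeq n} {P K S r m bad den φ} {ψ : Fin n → ℤ} → Explored d P K S r m → + 0 ≤ den → + 0 ≤ φ →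
    ∀ u → 1 ℕ.≤ r u →
    (∀ w → u ≢ w → 1 ℕ.≤ r w → K u w ≡ false → Good d bad den (learn P K u w) (dec w (dec u r)) (m ℕ.∸ 2) (ψ w)) →
    (∀ w → 1 ℕ.≤ dec u r w → + 0 ≤ ψ w) →
    ∑ (λ w → + dec u r w * ψ w) ≤ (+ m - + 1) * φ → Good d bad den P r m φ
  reveal {n} {d} {P} {K} {S} {r} {m} {bad} {den} {φ} {ψ} E 0≤den 0≤φ u pu next 0≤ψ mean =
    good (*-cancelˡ (+ r u) (+≤+ pu) (begin
      + r u * (N * den * factorials r)                       ≡⟨ lem₁ (+ r u) N den (factorials r) ⟩
      (+ r u * N) * (den * factorials r)                     ≤⟨ *-monoʳ (den * factorials r) 0≤denF (count-≤-∑ (+ r u) _ _ (realisations n d) each) ⟩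
      ∑ Nw * (den * factorials r)                            ≡⟨ ∑-*ʳ (den * factorials r) Nw ⟨
      ∑ (λ w → Nw w * (den * factorials r))                  ≤⟨ ∑-mono claim ⟩
      ∑ (λ w → + r u * dd (m ℕ.∸ 2) * (+ dec u r w * ψ w))   ≡⟨ ∑-* (+ r u * dd (m ℕ.∸ 2)) (λ w → + dec u r w * ψ w) ⟩
      + r u * dd (m ℕ.∸ 2) * ∑ (λ w → + dec u r w * ψ w)     ≤⟨ *-monoˡ (+ r u * dd (m ℕ.∸ 2)) (0≤* (0≤ℕ (r u)) (0≤dd (m ℕ.∸ 2))) mean ⟩
      + r u * dd (m ℕ.∸ 2) * ((+ m - + 1) * φ)               ≡⟨ *-assoc (+ r u) (dd (m ℕ.∸ 2)) ((+ m - + 1) * φ) ⟩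
      + r u * (dd (m ℕ.∸ 2) * ((+ m - + 1) * φ))             ≤⟨ *-monoˡ (+ r u) (0≤ℕ (r u)) (dd-step m total) ⟩
      + r u * (dd m * φ)                                     ∎))
    where
    open ≤-Reasoning
    open Explored E using (total)
    N : ℤ
    N = count (λ G → P G ∧ bad G) (realisations n d)
    Nw : Fin n → ℤ
    Nw w = count (λ G → learn P K u w G ∧ bad G) (realisations n d)
    0≤denF : + 0 ≤ den * factorials r
    0≤denF = 0≤* 0≤den (1≤⇒0≤ (1≤factorials r))
    lem₁ : ∀ a b c e → a * (b * c * e) ≡ a * b * (c * e)
    lem₁ = solve-∀
    each : ∀ {G} → G ∈ realisations n d → + r u * ι (P G ∧ bad G) ≤ ∑ (λ w → ι (learn P K u w G ∧ bad G))
    each {G} G∈ with P G in p | bad G in b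
    ... | false | _ = ≤-reflexive (trans (*-zeroʳ (+ r u)) (sym (∑-zero n)))
    ... | true | false = ≤-reflexive (trans (*-zeroʳ (+ r u)) (sym (∑-≡0 (λ w → cong ι (∧-zeroʳ _)))))
    ... | true | true = ≤-reflexive (trans (*-identityʳ (+ r u))
      (trans (sym (unrevealed E G∈ p u)) (∑-cong (λ w → cong ι (sym (∧-identityʳ _))))))
    0≤rhs : ∀ w → + 0 ≤ + r u * dd (m ℕ.∸ 2) * (+ dec u r w * ψ w)
    0≤rhs w with 1≤? (dec u r w)
    ... | inj₁ p = 0≤* (0≤* (0≤ℕ (r u)) (0≤dd (m ℕ.∸ 2))) (0≤* (0≤ℕ (dec u r w)) (0≤ψ w p))
    ... | inj₂ e rewrite e | *-zeroˡ (ψ w) | *-zeroʳ (+ r u * dd (m ℕ.∸ 2)) = ≤-refl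
    impossible : ∀ w → (w ≡ u ⊎ r w ≡ 0) ⊎ K u w ≡ true →
      Nw w * (den * factorials r) ≤ + r u * dd (m ℕ.∸ 2) * (+ dec u r w * ψ w)
    impossible w h = ≤-trans (≤-reflexive (trans (cong (_* (den * factorials r)) (count-none _ (λ G∈ → cong (_∧ _) (learn-impossible E h G∈))))
      (*-zeroˡ (den * factorials r)))) (0≤rhs w)
    claim : ∀ w → Nw w * (den * factorials r) ≤ + r u * dd (m ℕ.∸ 2) * (+ dec u r w * ψ w)
    claim w with w Finₚ.≟ u | 1≤? (r w) | bool? (K u w)
    ... | yes e | _ | _ = impossible w (inj₁ (inj₁ e))
    ... | no _ | inj₂ e | _ = impossible w (inj₁ (inj₂ e))
    ... | no _ | inj₁ _ | inj₁ k = impossible w (inj₂ k)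
    ... | no ne | inj₁ pw | inj₂ k = begin
      Nw w * (den * factorials r)                            ≡⟨ cong (λ f → Nw w * (den * f)) (trans (factorials-dec u r pu) (cong (+ r u *_) (factorials-dec w (dec u r) pw′))) ⟩
      Nw w * (den * (+ r u * (+ dec u r w * F″)))            ≡⟨ lem₂ (Nw w) den (+ r u) (+ dec u r w) F″ ⟩
      + r u * + dec u r w * (Nw w * den * F″)                ≤⟨ *-monoˡ (+ r u * + dec u r w) (0≤* (0≤ℕ (r u)) (0≤ℕ (dec u r w))) (Good.bound (next w (ne ∘ sym) pw k)) ⟩
      + r u * + dec u r w * (dd (m ℕ.∸ 2) * ψ w)             ≡⟨ lem₃ (+ r u) (+ dec u r w) (dd (m ℕ.∸ 2)) (ψ w) ⟩
      + r u * dd (m ℕ.∸ 2) * (+ dec u r w * ψ w)             ∎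
      where
      pw′ : 1 ℕ.≤ dec u r w
      pw′ = subst (1 ℕ.≤_) (sym (dec-off r ne)) pw
      F″ : ℤ
      F″ = factorials (dec w (dec u r))
      lem₂ : ∀ a b c e f → a * (b * (c * (e * f))) ≡ c * e * (a * b * f)
      lem₂ = solve-∀
      lem₃ : ∀ a b c e → a * b * (c * e) ≡ a * c * (b * e)
      lem₃ = solve-∀
    dd-step : ∀ m → ∑ (λ v → + r v) ≡ + m → dd (m ℕ.∸ 2) * ((+ m - + 1) * φ) ≤ dd m * φ
    dd-step zero t with subst (+ r u ≤_) t (∑-term (λ v → + r v) (λ v → 0≤ℕ _) u)
    ... | +≤+ q with ℕₚ.≤-trans pu q
    ...   | ()
    dd-step (suc zero) t = ≤-reflexive (trans (cong (+ 1 *_) (*-zeroˡ φ)) (sym (*-zeroˡ φ)))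
    dd-step (suc (suc k)) t = ≤-reflexive (lem₄ (dd k) (+ suc k) φ)
      where
      lem₄ : ∀ a b c → a * (b * c) ≡ b * a * c
      lem₄ = solve-∀

  count-bound : ∀ {n} {d : DegSeq n} {P K S r} k m → m ℕ.≤ k → Explored d P K S r m →
    Good d (λ _ → true) (+ 1) P r m (+ 1)
  count-bound {n} {d} {P} {K} {S} {r} k m m≤k E with + 1 ≤? ∑ (λ v → + r v)
  ... | no ¬p = good (begin
    N * + 1 * factorials r   ≡⟨ cong₂ _*_ (*-identityʳ N) F≡1 ⟩
    N * + 1                  ≤⟨ *-monoʳ (+ 1) (0≤ℕ 1) N≤1 ⟩
    + 1                      ≡⟨ cong (λ m → dd m * + 1) m≡0 ⟨
    dd m * + 1               ∎)
    where
    open ≤-Reasoning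
    N : ℤ
    N = count (λ G → P G ∧ true) (realisations n d)
    r≡0 : ∀ v → r v ≡ 0
    r≡0 v with 1≤? (r v)
    ... | inj₂ e = e
    ... | inj₁ q = ⊥-elim (¬p (≤-trans (+≤+ q) (∑-term (λ v → + r v) (λ v → 0≤ℕ _) v)))
    m≡0 : m ≡ 0
    m≡0 = +-injective (trans (sym (Explored.total E)) (∑-≡0 (λ v → cong +_ (r≡0 v))))
    F≡1 : factorials r ≡ + 1
    F≡1 = trans (factorials-cong r≡0) (go n)
      where
      go : ∀ n → factorials {n} (λ _ → 0) ≡ + 1
      go zero = refl
      go (suc n) = trans (*-identityˡ _) (go n)
    same : ∀ {G} → G ∈ realisations n d → P G ∧ true ≡ true → ∀ i j → adj G i j ≡ K i j
    same {G} G∈ p i j with K i j in k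
    ... | true = Explored.revealed E G∈ (proj₁ (∧-true p)) i j k
    ... | false with adj G i j in a
    ...   | false = refl
    ...   | true with trans (sym (cong ι (cong₂ (λ x y → x ∧ not y) a k)))
                     (∑≡0⇒ (λ w → ι (adj G i w ∧ not (K i w))) (λ w → 0≤ι _) (trans (unrevealed E G∈ (proj₁ (∧-true p)) i) (cong +_ (r≡0 i))) j)
    ...     | ()
    N≤1 : N ≤ + 1
    N≤1 = count-unique (λ G → P G ∧ true) (realisations-unique n d)
      (λ x∈ y∈ px py → adj-ext (λ i j → trans (same x∈ px i j) (sym (same y∈ py i j))))
  ... | yes p with ∑-positive (λ v → + r v) p
  ...   | u , +≤+ pu with m | k | m≤k
  ...     | zero | _ | _ = ⊥-elim (¬1≤0 (subst (+ 1 ≤_) (Explored.total E) p))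
    where
    ¬1≤0 : ¬ (+ 1 ≤ + 0)
    ¬1≤0 (+≤+ ())
  ...     | suc m′ | suc k′ | ℕ.s≤s m′≤k′ = reveal {bad = λ _ → true} {φ = + 1} {ψ = λ _ → + 1} E (0≤ℕ 1) (0≤ℕ 1) u pu
    (λ w ne pw k → rec w ne pw k)
    (λ _ _ → 0≤ℕ 1)
    (≤-reflexive (trans (∑-cong (λ w → *-identityʳ (+ dec u r w))) (trans (∑-dec₁ u r pu) (trans (cong (_- + 1) (Explored.total E)) (sym (*-identityʳ (+ suc m′ - + 1)))))))
    where
    rec : ∀ w → u ≢ w → 1 ℕ.≤ r w → K u w ≡ false →
      Good d (λ _ → true) (+ 1) (learn P K u w) (dec w (dec u r)) (suc m′ ℕ.∸ 2) (+ 1)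
    rec w ne pw k = count-bound k′ (suc m′ ℕ.∸ 2) (ℕₚ.≤-trans (ℕₚ.m∸n≤m m′ 1) m′≤k′) (explore E {S′ = λ _ → true} (λ _ _ → refl) refl refl ne pu pw k)

  Good-top : ∀ {n} {d : DegSeq n} {P K S r m bad den φ} → Explored d P K S r m → + 0 ≤ den → den ≤ φ → Good d bad den P r m φ
  Good-top {n} {d} {P} {r = r} {m} {bad} {den} {φ} E 0≤den den≤φ = good (begin
    count (λ G → P G ∧ bad G) Gs * den * factorials r        ≤⟨ *-monoʳ (factorials r) (1≤⇒0≤ (1≤factorials r)) (*-monoʳ den 0≤den (count-mono Gs (λ {G} _ e → trans (∧-identityʳ (P G)) (proj₁ (∧-true e))))) ⟩
    count (λ G → P G ∧ true) Gs * den * factorials r         ≡⟨ lem (count (λ G → P G ∧ true) Gs) den (factorials r) ⟩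
    count (λ G → P G ∧ true) Gs * + 1 * factorials r * den   ≤⟨ *-monoʳ den 0≤den (Good.bound (count-bound m m ℕₚ.≤-refl E)) ⟩
    dd m * + 1 * den                                         ≡⟨ cong (_* den) (*-identityʳ (dd m)) ⟩
    dd m * den                                               ≤⟨ *-monoˡ (dd m) (0≤dd m) den≤φ ⟩
    dd m * φ                                                 ∎)
    where
    open ≤-Reasoning
    Gs : List (Graph n)
    Gs = realisations n d
    lem : ∀ a b c → a * b * c ≡ a * + 1 * c * b
    lem = solve-∀

  Good-none : ∀ {n} {d : DegSeq n} {P r m bad den φ} → + 0 ≤ φ →
    (∀ {G} → G ∈ realisations n d → P G ≡ true → bad G ≡ false) → Good d bad den P r m φ
  Good-none {n} {d} {P} {r} {m} {bad} {den} {φ} 0≤φ h = good (≤-trans (≤-reflexive (trans (cong (λ x → x * den * factorials r) (count-none (realisations n d) none)) (lem den (factorials r)))) (0≤* (0≤dd m) 0≤φ))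
    where
    lem : ∀ a b → + 0 * a * b ≡ + 0
    lem = solve-∀
    none : ∀ {G} → G ∈ realisations n d → P G ∧ bad G ≡ false
    none {G} G∈ with P G in p
    ... | true = h G∈ p
    ... | false = refl

  count-member : ∀ {A : Set} {p : A → Bool} {x xs} → x ∈ xs → p x ≡ true → + 1 ≤ count p xs
  count-member {p = p} {xs = _ ∷ xs} (here refl) e rewrite e = subst (_≤ + 1 + count p xs) (+-identityʳ (+ 1)) (+-monoʳ-≤ (+ 1) (0≤count p xs))
  count-member {p = p} {xs = y ∷ xs} (there x∈) e =
    ≤-trans (count-member x∈ e) (subst (_≤ ι (p y) + count p xs) (+-identityˡ _) (+-monoˡ-≤ (count p xs) (0≤ι (p y))))

  p₂ : ℕ → ℤ
  p₂ k = + k * (+ k - + 1)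

  0≤p₂ : ∀ k → + 0 ≤ p₂ k
  0≤p₂ zero = ≤-refl
  0≤p₂ (suc k) = 0≤* (0≤ℕ (suc k)) (0≤ℕ k)

  -- The truncation pred 0 = 0 is harmless because of the factor k.
  p₂-pred : ∀ k → + k * p₂ (pred k) ≡ + k * p₂ k - + 2 * p₂ k
  p₂-pred zero = refl
  p₂-pred (suc k) = subst (λ x → x * p₂ k ≡ x * (x * (x - + 1)) - + 2 * (x * (x - + 1))) (+-comm (+ k) (+ 1)) (lem (+ k))
    where
    lem : ∀ a → (a + + 1) * (a * (a - + 1)) ≡ (a + + 1) * ((a + + 1) * (a + + 1 - + 1)) - + 2 * ((a + + 1) * (a + + 1 - + 1))
    lem = solve-∀

  ∑-dec-p₂ : ∀ {n} (r : Fin n → ℕ) x → ∑ (λ w → + r w * p₂ (dec w r x)) ≡ (∑ (λ w → + r w) - + 2) * p₂ (r x)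
  ∑-dec-p₂ r x = begin
    ∑ (λ w → + r w * p₂ (dec w r x))
      ≡⟨ ∑-update _ (λ w → + r w * p₂ (r x)) x (λ v ne → cong (λ k → + r v * p₂ k) (dec-off r (ne ∘ sym))) ⟩
    ∑ (λ w → + r w * p₂ (r x)) + (+ r x * p₂ (dec x r x) - + r x * p₂ (r x))
      ≡⟨ cong₂ (λ a b → a + (b - + r x * p₂ (r x))) (∑-*ʳ (p₂ (r x)) (λ w → + r w)) (trans (cong (λ k → + r x * p₂ k) (dec-at x r)) (p₂-pred (r x))) ⟩
    ∑ (λ w → + r w) * p₂ (r x) + (+ r x * p₂ (r x) - + 2 * p₂ (r x) - + r x * p₂ (r x))
      ≡⟨ lem (∑ (λ w → + r w)) (+ r x) (p₂ (r x)) ⟩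
    (∑ (λ w → + r w) - + 2) * p₂ (r x) ∎
    where
    open ≡-Reasoning
    lem : ∀ a b c → a * c + (b * c - + 2 * c - b * c) ≡ (a - + 2) * c
    lem = solve-∀

  ∑-dec-p₂p₂ : ∀ {n} (r : Fin n → ℕ) {x y} → x ≢ y →
    ∑ (λ w → + r w * (p₂ (dec w r x) * p₂ (dec w r y))) ≡ (∑ (λ w → + r w) - + 4) * (p₂ (r x) * p₂ (r y))
  ∑-dec-p₂p₂ r {x} {y} ne = begin
    ∑ (λ w → + r w * (p₂ (dec w r x) * p₂ (dec w r y)))
      ≡⟨ ∑-update _ (λ w → + r w * (p₂ (r x) * p₂ (dec w r y))) x (λ v ne′ → cong (λ k → + r v * (p₂ k * p₂ (dec v r y))) (dec-off r (ne′ ∘ sym))) ⟩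
    ∑ (λ w → + r w * (p₂ (r x) * p₂ (dec w r y))) + (+ r x * (p₂ (dec x r x) * p₂ (dec x r y)) - + r x * (p₂ (r x) * p₂ (dec x r y)))
      ≡⟨ cong₂ _+_ (trans (∑-cong (λ w → lem₁ (+ r w) (p₂ (r x)) (p₂ (dec w r y)))) (trans (∑-* (p₂ (r x)) _) (cong (p₂ (r x) *_) (∑-dec-p₂ r y))))
           (cong₂ (λ j k → + r x * (p₂ j * p₂ k) - + r x * (p₂ (r x) * p₂ k)) (dec-at x r) (dec-off r (ne ∘ sym))) ⟩
    p₂ (r x) * ((∑ (λ w → + r w) - + 2) * p₂ (r y)) + (+ r x * (p₂ (pred (r x)) * p₂ (r y)) - + r x * (p₂ (r x) * p₂ (r y)))
      ≡⟨ cong (λ z → p₂ (r x) * ((∑ (λ w → + r w) - + 2) * p₂ (r y)) + (z - + r x * (p₂ (r x) * p₂ (r y))))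
           (trans (sym (*-assoc (+ r x) (p₂ (pred (r x))) (p₂ (r y)))) (cong (_* p₂ (r y)) (p₂-pred (r x)))) ⟩
    p₂ (r x) * ((∑ (λ w → + r w) - + 2) * p₂ (r y)) + ((+ r x * p₂ (r x) - + 2 * p₂ (r x)) * p₂ (r y) - + r x * (p₂ (r x) * p₂ (r y)))
      ≡⟨ lem₂ (∑ (λ w → + r w)) (+ r x) (p₂ (r x)) (p₂ (r y)) ⟩
    (∑ (λ w → + r w) - + 4) * (p₂ (r x) * p₂ (r y)) ∎
    where
    open ≡-Reasoning
    lem₁ : ∀ a b c → a * (b * c) ≡ b * (a * c)
    lem₁ = solve-∀
    lem₂ : ∀ a b c e → c * ((a - + 2) * e) + ((b * c - + 2 * c) * e - b * (c * e)) ≡ (a - + 4) * (c * e)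
    lem₂ = solve-∀

  ne : ∀ {n} → Fin n → Fin n → ℤ
  ne x y = ι (not (eqF x y))

  pairs : ∀ {n} → (Fin n → Fin n → ℤ) → ℤ
  pairs f = ∑ (λ x → ∑ (λ y → ne x y * f x y))

  0≤ne : ∀ {n} (x y : Fin n) → + 0 ≤ ne x y
  0≤ne x y = 0≤ι (not (eqF x y))

  eqF-comm : ∀ {n} (x y : Fin n) → eqF x y ≡ eqF y x
  eqF-comm zero zero = refl
  eqF-comm zero (suc y) = refl
  eqF-comm (suc x) zero = refl
  eqF-comm (suc x) (suc y) = eqF-comm x y

  pairs-bump : ∀ {n} (u : Fin n) c (p q : Fin n → ℤ) → (∀ x → p x ≡ q x + c * ι (eqF x u)) →
    pairs (λ x y → p x * p y) ≡ pairs (λ x y → q x * q y) + + 2 * c * ∑ (λ y → ne u y * q y)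
  pairs-bump {n} u c p q e = begin
    pairs (λ x y → p x * p y)
      ≡⟨ ∑-cong (λ x → trans (∑-cong (term x)) (trans (∑-+ _ _) (cong₂ _+_ (∑-+ _ _) (∑-eqF u _)))) ⟩
    ∑ (λ x → ∑ (λ y → ne x y * (q x * q y)) + ∑ (λ y → ι (eqF x u) * (c * (ne x y * q y))) + c * (ne x u * q x))
      ≡⟨ trans (∑-+ _ _) (cong₂ _+_ (trans (∑-+ _ _) (cong (_+_ (pairs (λ x y → q x * q y)))
           (trans (∑-cong (λ x → ∑-* (ι (eqF x u)) (λ y → c * (ne x y * q y)))) (trans (∑-eqF u _) (∑-* c _)))))
           (trans (∑-* c _) (cong (c *_) (∑-cong (λ x → cong (λ b → ι (not b) * q x) (eqF-comm x u)))))) ⟩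
    pairs (λ x y → q x * q y) + c * ∑ (λ y → ne u y * q y) + c * ∑ (λ y → ne u y * q y)
      ≡⟨ lem (pairs (λ x y → q x * q y)) c (∑ (λ y → ne u y * q y)) ⟩
    pairs (λ x y → q x * q y) + + 2 * c * ∑ (λ y → ne u y * q y) ∎
    where
    open ≡-Reasoning
    lem : ∀ a b t → a + b * t + b * t ≡ a + + 2 * b * t
    lem = solve-∀
    diag : ∀ x y → ne x y * (ι (eqF x u) * ι (eqF y u)) ≡ + 0
    diag x y with eqF x u in xu | eqF y u in yu
    ... | true | true rewrite eqF⇒≡ x u xu | eqF⇒≡ y u yu | eqF-refl u = refl
    ... | true | false = *-zeroʳ (ne x y)
    ... | false | true = *-zeroʳ (ne x y)
    ... | false | false = *-zeroʳ (ne x y)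
    term : ∀ x y → ne x y * (p x * p y) ≡
      ne x y * (q x * q y) + ι (eqF x u) * (c * (ne x y * q y)) + ι (eqF y u) * (c * (ne x y * q x))
    term x y rewrite e x | e y = trans (lem₁ (ne x y) (q x) (q y) c (ι (eqF x u)) (ι (eqF y u)))
        (trans (cong (λ z → ne x y * (q x * q y) + ι (eqF x u) * (c * (ne x y * q y)) + ι (eqF y u) * (c * (ne x y * q x)) + c * c * z) (diag x y))
          (lem₂ _ c))
      where
      lem₁ : ∀ o a b c i j → o * ((a + c * i) * (b + c * j)) ≡
        o * (a * b) + i * (c * (o * b)) + j * (c * (o * a)) + c * c * (o * (i * j))
      lem₁ = solve-∀
      lem₂ : ∀ z c → z + c * c * + 0 ≡ z
      lem₂ = solve-∀

  pairs-mono : ∀ {n} {f g : Fin n → Fin n → ℤ} → (∀ x y → x ≢ y → f x y ≤ g x y) → pairs f ≤ pairs g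
  pairs-mono {f = f} {g} h = ∑-mono (λ x → ∑-mono (λ y → term x y))
    where
    term : ∀ x y → ne x y * f x y ≤ ne x y * g x y
    term x y with eqF x y in e
    ... | true = ≤-reflexive (trans (*-zeroˡ (f x y)) (sym (*-zeroˡ (g x y))))
    ... | false = *-monoˡ (+ 1) (0≤ℕ 1) (h x y (λ { refl → true≢false (eqF-refl x) e }))

  ∑-pairs : ∀ {n} (c : Fin n → ℤ) (f : Fin n → Fin n → Fin n → ℤ) →
    ∑ (λ w → c w * pairs (f w)) ≡ pairs (λ x y → ∑ (λ w → c w * f w x y))
  ∑-pairs c f = begin
    ∑ (λ w → c w * pairs (f w))
      ≡⟨ ∑-cong (λ w → trans (sym (∑-* (c w) _)) (∑-cong (λ x → sym (∑-* (c w) _)))) ⟩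
    ∑ (λ w → ∑ (λ x → ∑ (λ y → c w * (ne x y * f w x y))))
      ≡⟨ trans (∑-comm _) (∑-cong (λ x → ∑-comm _)) ⟩
    ∑ (λ x → ∑ (λ y → ∑ (λ w → c w * (ne x y * f w x y))))
      ≡⟨ ∑-cong (λ x → ∑-cong (λ y → trans (∑-cong (λ w → lem (c w) (ne x y) (f w x y))) (∑-* (ne x y) _))) ⟩
    pairs (λ x y → ∑ (λ w → c w * f w x y)) ∎
    where
    open ≡-Reasoning
    lem : ∀ a b t → a * (b * t) ≡ b * (a * t)
    lem = solve-∀

  dd-mono : ∀ m j {x} → + 0 ≤ x → (+ m - + suc j) * x * dd (m ℕ.∸ suc (suc j)) ≤ x * dd (m ℕ.∸ j)
  dd-mono m j {x} 0≤x with m ℕ.≤? j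
  ... | yes m≤j = begin
      (+ m - + suc j) * x * dd (m ℕ.∸ suc (suc j))   ≤⟨ *-monoʳ (dd (m ℕ.∸ suc (suc j))) (0≤dd (m ℕ.∸ suc (suc j))) (*-monoʳ x 0≤x neg) ⟩
      + 0 * x * dd (m ℕ.∸ suc (suc j))               ≡⟨ lem x (dd (m ℕ.∸ suc (suc j))) ⟩
      + 0                                            ≤⟨ 0≤* 0≤x (0≤dd (m ℕ.∸ j)) ⟩
      x * dd (m ℕ.∸ j)                               ∎
    where
    open ≤-Reasoning
    neg : + m - + suc j ≤ + 0
    neg = i≤j⇒i-j≤0 (+≤+ (ℕₚ.m≤n⇒m≤1+n m≤j))
    lem : ∀ a b → + 0 * a * b ≡ + 0
    lem = solve-∀
  ... | no m≰j with ℕₚ.m≤n⇒∃[o]m+o≡n (ℕₚ.≰⇒> m≰j)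
  ...   | o , refl = begin
      (+ (suc j ℕ.+ o) - + suc j) * x * dd (suc j ℕ.+ o ℕ.∸ suc (suc j))
        ≡⟨ cong₂ (λ a b → a * x * dd b) (trans (cong (_- + suc j) (pos-+ (suc j) o)) (lem₁ (+ suc j) (+ o))) (trans (cong (λ k → j ℕ.+ o ℕ.∸ k) (ℕₚ.+-comm 1 j)) (ℕₚ.[m+n]∸[m+o]≡n∸o j o 1)) ⟩
      + o * x * dd (o ℕ.∸ 1)       ≤⟨ step o ⟩
      x * dd (suc o)               ≡⟨ cong (λ k → x * dd k) (sym (trans (cong (ℕ._∸ j) (sym (ℕₚ.+-suc j o))) (ℕₚ.m+n∸m≡n j (suc o)))) ⟩
      x * dd (suc j ℕ.+ o ℕ.∸ j)   ∎
    where
    open ≤-Reasoning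
    lem₁ : ∀ a b → a + b - a ≡ b
    lem₁ = solve-∀
    step : ∀ o → + o * x * dd (o ℕ.∸ 1) ≤ x * dd (suc o)
    step zero = ≤-reflexive (lem₂ x)
      where
      lem₂ : ∀ a → + 0 * a * + 1 ≡ a * + 0
      lem₂ = solve-∀
    step (suc o) = ≤-reflexive (lem₂ (+ suc o) x (dd o))
      where
      lem₂ : ∀ a b c → a * b * c ≡ b * (a * c)
      lem₂ = solve-∀

  numReal : ∀ {n} → DegSeq n → ℤ
  numReal {n} d = count (λ _ → true) (realisations n d)

  unexplored : ∀ {n} (d : DegSeq n) S {m} → ∑ (λ v → + d v) ≡ + m →
    Explored d (λ _ → true) (λ _ _ → false) S d m
  unexplored {n} d S t = record
    { residual = λ v → trans (cong (_+_ (+ d v)) (∑-zero n)) (+-identityʳ _)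
    ; revealed = λ _ _ _ _ ()
    ; K-sym = λ _ _ → refl
    ; within = λ _ _ ()
    ; total = t }

  module _ {n} (d : DegSeq n) {u w : Fin n} (u≢w : u ≢ w) (pu : 1 ℕ.≤ d u) (pw : 1 ℕ.≤ d w) where

    private
      d′ : DegSeq n
      d′ = dec w (dec u d)

    dec₂-left : + d′ u ≡ + d u - + 1
    dec₂-left = trans (cong +_ (trans (dec-off (dec u d) u≢w) (dec-at u d))) (go (d u) pu)
      where
      go : ∀ k → 1 ℕ.≤ k → + pred k ≡ + k - + 1
      go (suc k) _ = refl

    dec₂-right : + d′ w ≡ + d w - + 1
    dec₂-right = trans (cong +_ (trans (dec-at w (dec u d)) (cong pred (dec-off d (u≢w ∘ sym))))) (go (d w) pw)
      where
      go : ∀ k → 1 ℕ.≤ k → + pred k ≡ + k - + 1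
      go (suc k) _ = refl

    factorials-dec₂ : factorials d ≡ + d u * (+ d w * factorials d′)
    factorials-dec₂ = trans (factorials-dec u d pu) (cong (+ d u *_)
      (trans (factorials-dec w (dec u d) (subst (1 ℕ.≤_) (sym (dec-off d (u≢w ∘ sym))) pw))
        (cong (λ k → + k * factorials d′) (dec-off d (u≢w ∘ sym)))))

    toggle-realises : ∀ {G} → Realises d′ G → adj G u w ≡ false → Realises d (toggle u w G)
    toggle-realises {G} R a = record
      { symmetric = λ i j → trans (adj-toggle u w G i j) (trans (cong₂ _xor_ (symmetric i j) (edge-sym u w i j)) (sym (adj-toggle u w G j i)))
      ; loopless = λ i → trans (adj-toggle u w G i i) (cong₂ _xor_ (loopless i) (no-loop i))
      ; degrees = λ v → begin
          ∑ (λ j → ι (adj (toggle u w G) v j))                       ≡⟨ ∑-cong (λ j → trans (cong ι (adj-toggle u w G v j)) (disjoint v j)) ⟩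
          ∑ (λ j → ι (adj G v j) + ι (edge u w v j))                 ≡⟨ ∑-+ (λ j → ι (adj G v j)) (λ j → ι (edge u w v j)) ⟩
          ∑ (λ j → ι (adj G v j)) + ∑ (λ j → ι (edge u w v j))       ≡⟨ cong₂ _+_ (degrees v) (∑-edge u≢w v) ⟩
          + d′ v + (ι (eqF v u) + ι (eqF v w))                       ≡⟨ decs-≡ u≢w pu pw v ⟨
          + d v                                                      ∎ }
      where
      open ≡-Reasoning
      open Realises R
      no-loop : ∀ i → edge u w i i ≡ false
      no-loop i with edge u w i i in e
      ... | false = refl
      ... | true with edge⇒ u w i i e
      ...   | inj₁ (p , q) = ⊥-elim (u≢w (trans (sym p) q))
      ...   | inj₂ (p , q) = ⊥-elim (u≢w (trans (sym q) p))
      disjoint : ∀ v j → ι (adj G v j xor edge u w v j) ≡ ι (adj G v j) + ι (edge u w v j)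
      disjoint v j with adj G v j in e | edge u w v j in e′
      ... | false | _ = sym (+-identityˡ _)
      ... | true | false = refl
      ... | true | true with edge⇒ u w v j e′
      ...   | inj₁ (refl , refl) = ⊥-elim (true≢false e a)
      ...   | inj₂ (refl , refl) = ⊥-elim (true≢false (trans (symmetric u w) e) a)

    numReal-dec₂ : numReal d′ ≤ count (λ G → adj G u w) (realisations n d) + count (λ G → adj G u w) (realisations n d′)
    numReal-dec₂ = begin
      numReal d′
        ≡⟨ count-split (λ _ → true) (λ G → adj G u w) (realisations n d′) ⟩
      count (λ G → adj G u w) (realisations n d′) + count (λ G → not (adj G u w)) (realisations n d′)
        ≤⟨ +-monoʳ-≤ (count (λ G → adj G u w) (realisations n d′)) (count-injection (toggle u w) (realisations-unique n d′) (toggle-injective u w) member) ⟩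
      count (λ G → adj G u w) (realisations n d′) + count (λ G → adj G u w) (realisations n d)
        ≡⟨ +-comm (count (λ G → adj G u w) (realisations n d′)) _ ⟩
      count (λ G → adj G u w) (realisations n d) + count (λ G → adj G u w) (realisations n d′) ∎
      where
      open ≤-Reasoning
      member : ∀ {G} → G ∈ realisations n d′ → not (adj G u w) ≡ true → toggle u w G ∈ realisations n d × adj (toggle u w G) u w ≡ true
      member {G} G∈ na = Realises⇒∈ (toggle-realises (∈⇒Realises G∈) (not-true na)) ,
        trans (adj-toggle u w G u w) (cong₂ _xor_ (not-true na) edge-uw)
        where
        not-true : ∀ {b} → not b ≡ true → b ≡ false
        not-true {false} _ = refl
        edge-uw : edge u w u w ≡ true
        edge-uw rewrite eqF-refl u | eqF-refl w = refl

    double-edge-bound : ∀ m → ∑ (λ v → + d′ v) ≡ + m →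
      count (λ G → adj G u w) (realisations n d′) * factorials d′ ≤ (+ d u - + 1) * (+ d w - + 1) * dd (m ℕ.∸ 2)
    double-edge-bound m t = subst₂ (λ a b → X * factorials d′ ≤ a * b * dd (m ℕ.∸ 2)) dec₂-left dec₂-right main
      where
      open ≤-Reasoning
      E : Explored d′ (λ _ → true) (λ _ _ → false) (λ _ → true) d′ m
      E = unexplored d′ (λ _ → true) t
      X Y : ℤ
      X = count (λ G → adj G u w) (realisations n d′)
      Y = count (λ G → learn (λ _ → true) (λ _ _ → false) u w G ∧ true) (realisations n d′)
      X≤Y : X ≤ Y
      X≤Y = count-mono (realisations n d′) (λ {G} _ a → trans (∧-identityʳ (adj G u w ∧ true)) (trans (∧-identityʳ (adj G u w)) a))
      zero-case : (w ≡ u ⊎ d′ w ≡ 0) ⊎ false ≡ true → X * factorials d′ ≤ + d′ u * + d′ w * dd (m ℕ.∸ 2)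
      zero-case h = begin
        X * factorials d′                    ≤⟨ *-monoʳ (factorials d′) (1≤⇒0≤ (1≤factorials d′)) X≤Y ⟩
        Y * factorials d′                    ≡⟨ cong (_* factorials d′) (count-none _ (λ {G} G∈ → trans (∧-identityʳ (learn (λ _ → true) (λ _ _ → false) u w G)) (learn-impossible E h G∈))) ⟩
        + 0 * factorials d′                  ≡⟨ *-zeroˡ (factorials d′) ⟩
        + 0                                  ≤⟨ 0≤* (0≤* (0≤ℕ (d′ u)) (0≤ℕ (d′ w))) (0≤dd (m ℕ.∸ 2)) ⟩
        + d′ u * + d′ w * dd (m ℕ.∸ 2)       ∎
      main : X * factorials d′ ≤ + d′ u * + d′ w * dd (m ℕ.∸ 2)
      main with 1≤? (d′ w) | 1≤? (d′ u)
      ... | inj₂ e | _ = zero-case (inj₁ (inj₂ e))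
      ... | inj₁ _ | inj₂ e = begin
        X * factorials d′                    ≡⟨ cong (_* factorials d′) (count-none _ none) ⟩
        + 0 * factorials d′                  ≡⟨ *-zeroˡ (factorials d′) ⟩
        + 0                                  ≤⟨ 0≤* (0≤* (0≤ℕ (d′ u)) (0≤ℕ (d′ w))) (0≤dd (m ℕ.∸ 2)) ⟩
        + d′ u * + d′ w * dd (m ℕ.∸ 2)       ∎
        where
        none : ∀ {G} → G ∈ realisations n d′ → adj G u w ≡ false
        none {G} G∈ with adj G u w in a
        ... | false = refl
        ... | true with trans (sym (cong ι a)) (∑≡0⇒ (λ j → ι (adj G u j)) (λ j → 0≤ι _) (trans (Realises.degrees (∈⇒Realises G∈) u) (cong +_ e)) w)
        ...   | ()
      ... | inj₁ qw | inj₁ qu = begin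
        X * factorials d′                                ≤⟨ *-monoʳ (factorials d′) (1≤⇒0≤ (1≤factorials d′)) X≤Y ⟩
        Y * factorials d′                                ≡⟨ cong (Y *_) (trans (factorials-dec u d′ qu) (cong (+ d′ u *_) (trans (factorials-dec w (dec u d′) (subst (1 ℕ.≤_) (sym (dec-off d′ (u≢w ∘ sym))) qw)) (cong (λ k → + k * f) (dec-off d′ (u≢w ∘ sym)))))) ⟩
        Y * (+ d′ u * (+ d′ w * f))                      ≡⟨ lem Y (+ d′ u) (+ d′ w) f ⟩
        + d′ u * + d′ w * (Y * + 1 * f)                  ≤⟨ *-monoˡ (+ d′ u * + d′ w) (0≤* (0≤ℕ (d′ u)) (0≤ℕ (d′ w)))
                                                              (Good.bound (count-bound (m ℕ.∸ 2) (m ℕ.∸ 2) ℕₚ.≤-refl (explore E {S′ = λ _ → true} (λ _ _ → refl) refl refl u≢w qu qw refl))) ⟩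
        + d′ u * + d′ w * (dd (m ℕ.∸ 2) * + 1)           ≡⟨ cong (+ d′ u * + d′ w *_) (*-identityʳ (dd (m ℕ.∸ 2))) ⟩
        + d′ u * + d′ w * dd (m ℕ.∸ 2)                   ∎
        where
        f : ℤ
        f = factorials (dec w (dec u d′))
        lem : ∀ a b c e → a * (b * (c * e)) ≡ b * c * (a * + 1 * e)
        lem = solve-∀

    add-edge : ∀ m → ∑ (λ v → + d′ v) ≡ + m →
      + d u * (+ d w * (numReal d′ * factorials d′)) ≤
      count (λ G → adj G u w) (realisations n d) * factorials d + + d u * (+ d w * ((+ d u - + 1) * (+ d w - + 1) * dd (m ℕ.∸ 2)))
    add-edge m t = begin
      + d u * (+ d w * (numReal d′ * factorials d′))               ≤⟨ *-monoˡ (+ d u) (0≤ℕ (d u)) (*-monoˡ (+ d w) (0≤ℕ (d w)) (*-monoʳ (factorials d′) (1≤⇒0≤ (1≤factorials d′)) numReal-dec₂)) ⟩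
      + d u * (+ d w * ((N + X) * factorials d′))                  ≡⟨ lem (+ d u) (+ d w) N X (factorials d′) ⟩
      N * (+ d u * (+ d w * factorials d′)) + + d u * (+ d w * (X * factorials d′))
                                                                   ≤⟨ +-mono-≤ (≤-reflexive (cong (N *_) (sym factorials-dec₂))) (*-monoˡ (+ d u) (0≤ℕ (d u)) (*-monoˡ (+ d w) (0≤ℕ (d w)) (double-edge-bound m t))) ⟩
      N * factorials d + + d u * (+ d w * ((+ d u - + 1) * (+ d w - + 1) * dd (m ℕ.∸ 2))) ∎
      where
      open ≤-Reasoning
      N X : ℤ
      N = count (λ G → adj G u w) (realisations n d)
      X = count (λ G → adj G u w) (realisations n d′)
      lem : ∀ a b x y f → a * (b * ((x + y) * f)) ≡ x * (a * (b * f)) + a * (b * (y * f))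
      lem = solve-∀

  -- The first-moment bound P(simple) ≥ 1 − E[loops] − E[pairs of parallel edges] in the configuration model.
  numReal-lower : ∀ {n} k m (d : DegSeq n) → m ℕ.≤ k → ∑ (λ v → + d v) ≡ + m →
    + 4 * dd m ≤ + 4 * (numReal d * factorials d) + + 2 * ∑ (λ x → p₂ (d x)) * dd (m ℕ.∸ 2)
      + pairs (λ x y → p₂ (d x) * p₂ (d y)) * dd (m ℕ.∸ 4)
  numReal-lower {n} k m d m≤k t with + 1 ≤? ∑ (λ v → + d v)
  ... | no ¬p = begin
    + 4 * dd m                                                     ≡⟨ cong (λ m → + 4 * dd m) m≡0 ⟩
    + 4 * (+ 1 * + 1)                                              ≤⟨ *-monoˡ (+ 4) (0≤ℕ 4) (*-mono (0≤ℕ 1) (1≤⇒0≤ (1≤factorials d)) (count-member (Realises⇒∈ empty) refl) (1≤factorials d)) ⟩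
    + 4 * (numReal d * factorials d)                               ≤⟨ ≤-by (A + B) (0≤+ 0≤A 0≤B) (+-assoc (+ 4 * (numReal d * factorials d)) A B) ⟩
    + 4 * (numReal d * factorials d) + A + B                       ∎
    where
    open ≤-Reasoning
    A B : ℤ
    A = + 2 * ∑ (λ x → p₂ (d x)) * dd (m ℕ.∸ 2)
    B = pairs (λ x y → p₂ (d x) * p₂ (d y)) * dd (m ℕ.∸ 4)
    0≤A : + 0 ≤ A
    0≤A = 0≤* (0≤* (0≤ℕ 2) (0≤∑ (λ x → 0≤p₂ (d x)))) (0≤dd (m ℕ.∸ 2))
    0≤B : + 0 ≤ B
    0≤B = 0≤* (0≤∑ (λ x → 0≤∑ (λ y → 0≤* (0≤ne x y) (0≤* (0≤p₂ (d x)) (0≤p₂ (d y)))))) (0≤dd (m ℕ.∸ 4))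
    d≡0 : ∀ v → d v ≡ 0
    d≡0 v with 1≤? (d v)
    ... | inj₂ e = e
    ... | inj₁ q = ⊥-elim (¬p (≤-trans (+≤+ q) (∑-term (λ v → + d v) (λ v → 0≤ℕ (d v)) v)))
    m≡0 : m ≡ 0
    m≡0 = +-injective (trans (sym t) (∑-≡0 (λ v → cong +_ (d≡0 v))))
    E₀ : Graph n
    E₀ = Vec.replicate n (Vec.replicate n false)
    adj-E₀ : ∀ i j → adj E₀ i j ≡ false
    adj-E₀ i j = trans (cong (λ v → lookup v j) (lookup-replicate i (Vec.replicate n false))) (lookup-replicate j false)
    empty : Realises d E₀
    empty = record
      { symmetric = λ i j → trans (adj-E₀ i j) (sym (adj-E₀ j i))
      ; loopless = λ i → adj-E₀ i i
      ; degrees = λ v → trans (∑-≡0 (λ j → cong ι (adj-E₀ v j))) (cong +_ (sym (d≡0 v))) }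
  ... | yes p with ∑-positive (λ v → + d v) p
  ...   | u , +≤+ pu with m | k | m≤k
  ...     | zero | _ | _ = ⊥-elim (¬1≤0 (subst (+ 1 ≤_) t p))
    where
    ¬1≤0 : ¬ (+ 1 ≤ + 0)
    ¬1≤0 (+≤+ ())
  ...     | suc zero | _ | _ = 0≤+ (0≤+ (0≤* (0≤ℕ 4) (0≤* (0≤count _ (realisations n d)) (1≤⇒0≤ (1≤factorials d))))
      (0≤* (0≤* (0≤ℕ 2) (0≤∑ (λ x → 0≤p₂ (d x)))) (0≤dd 0)))
      (0≤* (0≤∑ (λ x → 0≤∑ (λ y → 0≤* (0≤ne x y) (0≤* (0≤p₂ (d x)) (0≤p₂ (d y)))))) (0≤dd 0))
  ...     | suc (suc m′) | suc k′ | ℕ.s≤s m′≤k′ = combine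
    where
    open ≤-Reasoning
    r : DegSeq n
    r = dec u d
    δ : Fin n → DegSeq n
    δ w = dec w r
    e : ℤ
    e = + d u - + 1
    gF : DegSeq n → ℤ
    gF d = numReal d * factorials d
    a b : DegSeq n → ℤ
    a d = ∑ (λ x → p₂ (d x))
    b d = pairs (λ x y → p₂ (d x) * p₂ (d y))
    0≤a : ∀ d → + 0 ≤ a d
    0≤a d = 0≤∑ (λ x → 0≤p₂ (d x))
    0≤b : ∀ d → + 0 ≤ b d
    0≤b d = 0≤∑ (λ x → 0≤∑ (λ y → 0≤* (0≤ne x y) (0≤* (0≤p₂ (d x)) (0≤p₂ (d y)))))
    W : Fin n → ℤ
    W w = ne w u * + d w
    S : ℤ
    S = ∑ (λ y → ne u y * p₂ (r y))
    X Y Z : ℤ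
    X = dd m′
    Y = dd (m′ ℕ.∸ 2)
    Z = dd (m′ ℕ.∸ 4)

    cases : ∀ w → (w ≡ u ⊎ d w ≡ 0) ⊎ (u ≢ w × 1 ℕ.≤ d w)
    cases w with w Finₚ.≟ u | 1≤? (d w)
    ... | yes q | _ = inj₁ (inj₁ q)
    ... | no _ | inj₂ q = inj₁ (inj₂ q)
    ... | no q | inj₁ pw = inj₂ (q ∘ sym , pw)
    W-zero : ∀ w → w ≡ u ⊎ d w ≡ 0 → W w ≡ + 0
    W-zero w (inj₁ refl) rewrite eqF-refl u = *-zeroˡ (+ d u)
    W-zero w (inj₂ q) rewrite q = *-zeroʳ (ne w u)
    W-pos : ∀ w → u ≢ w → W w ≡ + d w
    W-pos w q rewrite ≢⇒eqF (q ∘ sym) = *-identityˡ (+ d w)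
    W≤r : ∀ w → W w ≤ + r w
    W≤r w with w Finₚ.≟ u
    ... | yes q = ≤-trans (≤-reflexive (W-zero w (inj₁ q))) (0≤ℕ (r w))
    ... | no q = ≤-reflexive (trans (W-pos w (q ∘ sym)) (cong +_ (sym (dec-off d q))))
    ∑W : ∑ W ≡ + suc m′ - e
    ∑W = trans (∑-update W (λ w → + d w) u (λ v q → W-pos v (q ∘ sym)))
      (trans (cong₂ (λ x y → x + (y - + d u)) t (W-zero u (inj₁ refl))) (trans (cong (λ z → z + (+ 0 - + d u)) (pos-+ 1 (suc m′))) (lem (+ suc m′) (+ d u))))
      where
      lem : ∀ x y → + 1 + x + (+ 0 - y) ≡ x - (y - + 1)
      lem = solve-∀
    ∑r : ∑ (λ v → + r v) ≡ + suc m′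
    ∑r = trans (∑-dec₁ u d pu) (cong (_- + 1) t)
    ∑δ : ∀ w → u ≢ w → 1 ℕ.≤ d w → ∑ (λ v → + δ w v) ≡ + m′
    ∑δ w q pw = trans (∑-dec₁ w r (subst (1 ℕ.≤_) (sym (dec-off d (q ∘ sym))) pw)) (cong (_- + 1) ∑r)

    graphs : ∑ (λ w → W w * gF (δ w)) ≤ gF d + ∑ (λ w → W w * (e * (+ d w - + 1) * Y))
    graphs = *-cancelˡ (+ d u) (+≤+ pu) (begin
      + d u * ∑ (λ w → W w * gF (δ w))
        ≡⟨ ∑-* (+ d u) (λ w → W w * gF (δ w)) ⟨
      ∑ (λ w → + d u * (W w * gF (δ w)))
        ≤⟨ ∑-mono each ⟩
      ∑ (λ w → count (λ G → adj G u w) (realisations n d) * factorials d + + d u * (W w * (e * (+ d w - + 1) * Y)))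
        ≡⟨ trans (∑-+ _ _) (cong₂ _+_ (∑-*ʳ (factorials d) (λ w → count (λ G → adj G u w) (realisations n d))) (∑-* (+ d u) (λ w → W w * (e * (+ d w - + 1) * Y)))) ⟩
      ∑ (λ w → count (λ G → adj G u w) (realisations n d)) * factorials d + + d u * ∑ (λ w → W w * (e * (+ d w - + 1) * Y))
        ≤⟨ +-monoˡ-≤ (+ d u * ∑ (λ w → W w * (e * (+ d w - + 1) * Y))) (*-monoʳ (factorials d) (1≤⇒0≤ (1≤factorials d))
            (∑-≤-count (+ d u) (λ _ → true) (λ w G → adj G u w) (realisations n d)
              (λ {G} G∈ → ≤-reflexive (trans (Realises.degrees (∈⇒Realises G∈) u) (sym (*-identityʳ (+ d u))))))) ⟩
      + d u * numReal d * factorials d + + d u * ∑ (λ w → W w * (e * (+ d w - + 1) * Y))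
        ≡⟨ lem (+ d u) (numReal d) (factorials d) (∑ (λ w → W w * (e * (+ d w - + 1) * Y))) ⟩
      + d u * (gF d + ∑ (λ w → W w * (e * (+ d w - + 1) * Y))) ∎)
      where
      lem : ∀ x y z w → x * y * z + x * w ≡ x * (y * z + w)
      lem = solve-∀
      each : ∀ w → + d u * (W w * gF (δ w)) ≤
        count (λ G → adj G u w) (realisations n d) * factorials d + + d u * (W w * (e * (+ d w - + 1) * Y))
      each w with cases w
      ... | inj₂ (q , pw) rewrite W-pos w q = add-edge d q pu pw m′ (∑δ w q pw)
      ... | inj₁ q rewrite W-zero w q = ≤-by (count (λ G → adj G u w) (realisations n d) * factorials d)
            (0≤* (0≤count _ (realisations n d)) (1≤⇒0≤ (1≤factorials d)))
            (lem′ (+ d u) (gF (δ w)) (e * (+ d w - + 1) * Y) (count (λ G → adj G u w) (realisations n d) * factorials d))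
        where
        lem′ : ∀ x y z w → w + x * (+ 0 * z) ≡ x * (+ 0 * y) + w
        lem′ = solve-∀

    weighted : ∀ w → W w * (+ 4 * X) ≤ + 4 * (W w * gF (δ w)) + (+ 2 * Y * (+ r w * a (δ w)) + Z * (+ r w * b (δ w)))
    weighted w with cases w
    ... | inj₁ q rewrite W-zero w q = ≤-by (+ 2 * Y * (+ r w * a (δ w)) + Z * (+ r w * b (δ w)))
          (0≤+ (0≤* (0≤* (0≤ℕ 2) (0≤dd (m′ ℕ.∸ 2))) (0≤* (0≤ℕ (r w)) (0≤a (δ w)))) (0≤* (0≤dd (m′ ℕ.∸ 4)) (0≤* (0≤ℕ (r w)) (0≤b (δ w)))))
          (lem X (gF (δ w)) (+ 2 * Y * (+ r w * a (δ w)) + Z * (+ r w * b (δ w))))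
      where
      lem : ∀ x y z → + 4 * (+ 0 * y) + z ≡ + 0 * (+ 4 * x) + z
      lem = solve-∀
    ... | inj₂ (q , pw) = begin
      W w * (+ 4 * X)
        ≤⟨ *-monoˡ (W w) 0≤W (numReal-lower k′ m′ (δ w) (ℕₚ.≤-trans (ℕₚ.n≤1+n m′) m′≤k′) (∑δ w q pw)) ⟩
      W w * (+ 4 * gF (δ w) + + 2 * a (δ w) * Y + b (δ w) * Z)
        ≡⟨ lem (W w) (gF (δ w)) (a (δ w)) (b (δ w)) Y Z ⟩
      + 4 * (W w * gF (δ w)) + (+ 2 * Y * (W w * a (δ w)) + Z * (W w * b (δ w)))
        ≤⟨ +-monoʳ-≤ (+ 4 * (W w * gF (δ w))) (+-mono-≤
            (*-monoˡ (+ 2 * Y) (0≤* (0≤ℕ 2) (0≤dd (m′ ℕ.∸ 2))) (*-monoʳ (a (δ w)) (0≤a (δ w)) (W≤r w)))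
            (*-monoˡ Z (0≤dd (m′ ℕ.∸ 4)) (*-monoʳ (b (δ w)) (0≤b (δ w)) (W≤r w)))) ⟩
      + 4 * (W w * gF (δ w)) + (+ 2 * Y * (+ r w * a (δ w)) + Z * (+ r w * b (δ w))) ∎
      where
      0≤W : + 0 ≤ W w
      0≤W = 0≤* (0≤ne w u) (0≤ℕ (d w))
      lem : ∀ x g α β y z → x * (+ 4 * g + + 2 * α * y + β * z) ≡ + 4 * (x * g) + (+ 2 * y * (x * α) + z * (x * β))
      lem = solve-∀

    loops : + 2 * Y * ∑ (λ w → + r w * a (δ w)) ≤ + 2 * (a r * X)
    loops = begin
      + 2 * Y * ∑ (λ w → + r w * a (δ w))
        ≡⟨ cong (+ 2 * Y *_) (trans (∑-cong (λ w → sym (∑-* (+ r w) (λ x → p₂ (δ w x))))) (trans (∑-comm _) (trans (∑-cong (λ x → ∑-dec-p₂ r x))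
            (trans (∑-* (∑ (λ w → + r w) - + 2) (λ x → p₂ (r x))) (cong (λ z → (z - + 2) * a r) ∑r))))) ⟩
      + 2 * Y * ((+ suc m′ - + 2) * a r)
        ≡⟨ trans (cong (λ z → + 2 * Y * ((z - + 2) * a r)) (pos-+ 1 m′)) (lem Y (+ m′) (a r)) ⟩
      + 2 * ((+ m′ - + 1) * a r * Y)
        ≤⟨ *-monoˡ (+ 2) (0≤ℕ 2) (dd-mono m′ 0 (0≤a r)) ⟩
      + 2 * (a r * X) ∎
      where
      lem : ∀ y m a → + 2 * y * ((+ 1 + m - + 2) * a) ≡ + 2 * ((m - + 1) * a * y)
      lem = solve-∀

    doubles : Z * ∑ (λ w → + r w * b (δ w)) ≤ b r * Y
    doubles = begin
      Z * ∑ (λ w → + r w * b (δ w))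
        ≡⟨ cong (Z *_) (∑-pairs (λ w → + r w) (λ w x y → p₂ (δ w x) * p₂ (δ w y))) ⟩
      Z * pairs (λ x y → ∑ (λ w → + r w * (p₂ (δ w x) * p₂ (δ w y))))
        ≤⟨ *-monoˡ Z (0≤dd (m′ ℕ.∸ 4)) (pairs-mono (λ x y x≢y → ≤-reflexive (trans (∑-dec-p₂p₂ r x≢y) (cong (λ z → (z - + 4) * (p₂ (r x) * p₂ (r y))) ∑r)))) ⟩
      Z * pairs (λ x y → (+ suc m′ - + 4) * (p₂ (r x) * p₂ (r y)))
        ≡⟨ cong (Z *_) (trans (∑-cong (λ x → trans (∑-cong (λ y → lem₁ (ne x y) (+ suc m′ - + 4) (p₂ (r x) * p₂ (r y)))) (∑-* (+ suc m′ - + 4) _))) (∑-* (+ suc m′ - + 4) _)) ⟩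
      Z * ((+ suc m′ - + 4) * b r)
        ≡⟨ trans (cong (λ z → Z * ((z - + 4) * b r)) (pos-+ 1 m′)) (lem₂ Z (+ m′) (b r)) ⟩
      (+ m′ - + 3) * b r * Z
        ≤⟨ dd-mono m′ 2 (0≤b r) ⟩
      b r * Y ∎
      where
      lem₁ : ∀ o c x → o * (c * x) ≡ c * (o * x)
      lem₁ = solve-∀
      lem₂ : ∀ z m b → z * ((+ 1 + m - + 4) * b) ≡ (m - + 3) * b * z
      lem₂ = solve-∀

    bump : ∀ x → p₂ (d x) ≡ p₂ (r x) + + 2 * e * ι (eqF x u)
    bump x with x Finₚ.≟ u
    ... | no q rewrite ≢⇒eqF q = sym (trans (cong (_+_ (p₂ (d x))) (*-zeroʳ (+ 2 * e))) (+-identityʳ _))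
    ... | yes refl rewrite eqF-refl u = go (d u) pu
      where
      go : ∀ k → 1 ℕ.≤ k → p₂ k ≡ p₂ (pred k) + + 2 * (+ k - + 1) * + 1
      go (suc k) _ = lem (+ k)
        where
        lem : ∀ k → (+ 1 + k) * k ≡ k * (k - + 1) + + 2 * k * + 1
        lem = solve-∀
    a-bump : a d ≡ a r + + 2 * e
    a-bump = trans (∑-cong bump) (trans (∑-+ _ _) (cong (_+_ (a r)) (trans (∑-cong (λ x → *-comm (+ 2 * e) (ι (eqF x u)))) (∑-eqF u (λ _ → + 2 * e)))))
    b-bump : b d ≡ b r + + 2 * (+ 2 * e) * S
    b-bump = pairs-bump u (+ 2 * e) (λ x → p₂ (d x)) (λ x → p₂ (r x)) bump

    error : ∑ (λ w → W w * (e * (+ d w - + 1) * Y)) ≡ e * S * Y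
    error = trans (∑-cong term) (trans (∑-* (e * Y) (λ w → ne u w * p₂ (r w))) (lem e Y S))
      where
      lem : ∀ x y z → x * y * z ≡ x * z * y
      lem = solve-∀
      term : ∀ w → W w * (e * (+ d w - + 1) * Y) ≡ e * Y * (ne u w * p₂ (r w))
      term w with w Finₚ.≟ u
      ... | no q rewrite eqF-comm u w | ≢⇒eqF q = lem′ (+ d w) e Y
        where
        lem′ : ∀ x y z → + 1 * x * (y * (x - + 1) * z) ≡ y * z * (+ 1 * (x * (x - + 1)))
        lem′ = solve-∀
      ... | yes refl rewrite eqF-refl u = lem′ (+ d u) e Y (p₂ (pred (d u)))
        where
        lem′ : ∀ x y z p → + 0 * x * (y * (x - + 1) * z) ≡ y * z * (+ 0 * p)
        lem′ = solve-∀

    combine : + 4 * dd (suc (suc m′)) ≤ + 4 * gF d + + 2 * a d * X + b d * Y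
    combine = begin
      + 4 * (+ suc m′ * X)
        ≡⟨ lem₁ (+ suc m′) e X ⟩
      (+ suc m′ - e) * (+ 4 * X) + + 4 * e * X
        ≡⟨ cong (_+ + 4 * e * X) (trans (cong (_* (+ 4 * X)) (sym ∑W)) (sym (∑-*ʳ (+ 4 * X) W))) ⟩
      ∑ (λ w → W w * (+ 4 * X)) + + 4 * e * X
        ≤⟨ +-monoˡ-≤ (+ 4 * e * X) (∑-mono weighted) ⟩
      ∑ (λ w → + 4 * (W w * gF (δ w)) + (+ 2 * Y * (+ r w * a (δ w)) + Z * (+ r w * b (δ w)))) + + 4 * e * X
        ≡⟨ cong (_+ + 4 * e * X) (trans (∑-+ _ _) (cong₂ _+_ (∑-* (+ 4) _) (trans (∑-+ _ _) (cong₂ _+_ (∑-* (+ 2 * Y) _) (∑-* Z _))))) ⟩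
      + 4 * ∑ (λ w → W w * gF (δ w)) + (+ 2 * Y * ∑ (λ w → + r w * a (δ w)) + Z * ∑ (λ w → + r w * b (δ w))) + + 4 * e * X
        ≤⟨ +-monoˡ-≤ (+ 4 * e * X) (+-mono-≤ (*-monoˡ (+ 4) (0≤ℕ 4) (≤-trans graphs (≤-reflexive (cong (_+_ (gF d)) error)))) (+-mono-≤ loops doubles)) ⟩
      + 4 * (gF d + e * S * Y) + (+ 2 * (a r * X) + b r * Y) + + 4 * e * X
        ≡⟨ lem₂ (gF d) e S Y (a r) X (b r) ⟩
      + 4 * gF d + + 2 * (a r + + 2 * e) * X + (b r + + 2 * (+ 2 * e) * S) * Y
        ≡⟨ cong₂ (λ x y → + 4 * gF d + + 2 * x * X + y * Y) a-bump b-bump ⟨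
      + 4 * gF d + + 2 * a d * X + b d * Y ∎
      where
      lem₁ : ∀ m e x → + 4 * (m * x) ≡ (m - e) * (+ 4 * x) + + 4 * e * x
      lem₁ = solve-∀
      lem₂ : ∀ g e s y α x β → + 4 * (g + e * s * y) + (+ 2 * (α * x) + β * y) + + 4 * e * x ≡
        + 4 * g + + 2 * (α + + 2 * e) * x + (β + + 2 * (+ 2 * e) * s) * y
      lem₂ = solve-∀

  inS outS : ∀ {n} → (Fin n → Bool) → (Fin n → ℤ) → ℤ
  inS S f = ∑ (λ v → ι (S v) * f v)
  outS S f = ∑ (λ v → ι (not (S v)) * f v)

  insert : ∀ {n} → (Fin n → Bool) → Fin n → Fin n → Bool
  insert S w v = S v ∨ eqF v w

  module _ {n} (S : Fin n → Bool) where

    in+out : ∀ f → inS S f + outS S f ≡ ∑ f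
    in+out f = trans (sym (∑-+ _ _)) (∑-cong (λ v → part (S v) (f v)))
      where
      part : ∀ b x → ι b * x + ι (not b) * x ≡ x
      part true x = trans (cong₂ _+_ (*-identityˡ x) (*-zeroˡ x)) (+-identityʳ x)
      part false x = trans (cong₂ _+_ (*-zeroˡ x) (*-identityˡ x)) (+-identityˡ x)

    0≤inS : ∀ {f} → (∀ v → + 0 ≤ f v) → + 0 ≤ inS S f
    0≤inS h = 0≤∑ (λ v → 0≤* (0≤ι (S v)) (h v))

    0≤outS : ∀ {f} → (∀ v → + 0 ≤ f v) → + 0 ≤ outS S f
    0≤outS h = 0≤∑ (λ v → 0≤* (0≤ι (not (S v))) (h v))

    inS-mono : ∀ {f g} → (∀ v → f v ≤ g v) → inS S f ≤ inS S g
    inS-mono h = ∑-mono (λ v → *-monoˡ (ι (S v)) (0≤ι (S v)) (h v))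

    outS-mono : ∀ {f g} → (∀ v → f v ≤ g v) → outS S f ≤ outS S g
    outS-mono h = ∑-mono (λ v → *-monoˡ (ι (not (S v))) (0≤ι (not (S v))) (h v))

    outS≤∑ : ∀ {f} → (∀ v → + 0 ≤ f v) → outS S f ≤ ∑ f
    outS≤∑ {f} h = ≤-by (inS S f) (0≤inS h) (trans (sym (in+out f)) (+-comm (inS S f) (outS S f)))

    inS≤∑ : ∀ {f} → (∀ v → + 0 ≤ f v) → inS S f ≤ ∑ f
    inS≤∑ {f} h = ≤-by (outS S f) (0≤outS h) (sym (in+out f))

    outS-+ : ∀ f g → outS S (λ v → f v + g v) ≡ outS S f + outS S g
    outS-+ f g = trans (∑-cong (λ v → *-distribˡ-+ (ι (not (S v))) (f v) (g v))) (∑-+ _ _)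

    outS-* : ∀ c f → outS S (λ v → c * f v) ≡ c * outS S f
    outS-* c f = trans (∑-cong (λ v → lem (ι (not (S v))) c (f v))) (∑-* c _)
      where
      lem : ∀ a b c → a * (b * c) ≡ b * (a * c)
      lem = solve-∀

    outS-cong : ∀ {f g} → (∀ v → f v ≡ g v) → outS S f ≡ outS S g
    outS-cong h = ∑-cong (λ v → cong (ι (not (S v)) *_) (h v))

    module _ {w} (w∉S : S w ≡ false) where

      ι-insert : ∀ v → ι (insert S w v) ≡ ι (S v) + ι (eqF v w)
      ι-insert v with eqF v w in e
      ... | true rewrite eqF⇒≡ v w e | w∉S = refl
      ... | false with S v
      ...   | true = refl
      ...   | false = refl

      inS-insert : ∀ f → inS (insert S w) f ≡ inS S f + f w
      inS-insert f = trans (∑-cong (λ v → trans (cong (_* f v) (ι-insert v)) (*-distribʳ-+ (f v) (ι (S v)) (ι (eqF v w)))))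
        (trans (∑-+ _ _) (cong (_+_ (inS S f)) (∑-eqF w f)))

  insert-⊇ : ∀ {n} {S : Fin n → Bool} {w} v → S v ≡ true → insert S w v ≡ true
  insert-⊇ v e rewrite e = refl

  insert-new : ∀ {n} (S : Fin n → Bool) w → insert S w w ≡ true
  insert-new S w rewrite eqF-refl w with S w
  ... | true = refl
  ... | false = refl

  active : ∀ {n} → (Fin n → Bool) → (Fin n → ℕ) → ℤ
  active S r = inS S (λ v → + r v)

  0≤active : ∀ {n} (S : Fin n → Bool) r → + 0 ≤ active S r
  0≤active S r = 0≤inS S (λ v → 0≤ℕ (r v))

  active-vertex : ∀ {n} (S : Fin n → Bool) r → + 1 ≤ active S r → ∃ λ u → S u ≡ true × 1 ℕ.≤ r u
  active-vertex S r p with ∑-positive _ p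
  ... | u , q with S u in e
  ...   | true = u , e , drop‿+≤+ (subst (+ 1 ≤_) (*-identityˡ (+ r u)) q)
  ...   | false with subst (+ 1 ≤_) (*-zeroˡ (+ r u)) q
  ...     | +≤+ ()

  module _ {n} {d : DegSeq n} {P K S r m} (E : Explored {n} d P K S r m) where
    open Explored E

    total-split : + m ≡ active S r + outS S (λ v → + d v)
    total-split = trans (sym total) (trans (sym (in+out S (λ v → + r v))) (cong (_+_ (active S r)) (∑-cong outside)))
      where
      outside : ∀ v → ι (not (S v)) * + r v ≡ ι (not (S v)) * + d v
      outside v with bool? (S v)
      ... | inj₁ e rewrite e = trans (*-zeroˡ (+ r v)) (sym (*-zeroˡ (+ d v)))
      ... | inj₂ e rewrite within-r E v e = refl

    active-in : ∀ {u w} → S u ≡ true → S w ≡ true → u ≢ w → 1 ℕ.≤ r u → 1 ℕ.≤ r w →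
      active S (dec w (dec u r)) ≡ active S r - + 2
    active-in {u} {w} Su Sw ne pu pw = trans (∑-decs ne pu pw (λ v → ι (S v)))
      (trans (cong₂ (λ a b → active S r - ι a - ι b) Su Sw) (lem (active S r)))
      where
      lem : ∀ a → a - + 1 - + 1 ≡ a - + 2
      lem = solve-∀

    active-out : ∀ {u w} → S u ≡ true → S w ≡ false → 1 ℕ.≤ r u → 1 ℕ.≤ r w →
      active (insert S w) (dec w (dec u r)) ≡ active S r + (+ d w - + 2)
    active-out {u} {w} Su Sw pu pw = trans (∑-decs u≢w pu pw (λ v → ι (insert S w v)))
      (trans (cong₂ (λ a b → active (insert S w) r - ι a - ι b) (insert-⊇ {S = S} u Su) (insert-new S w))
        (trans (cong (λ x → x - + 1 - + 1) (trans (inS-insert S Sw (λ v → + r v)) (cong (λ k → active S r + + k) (within-r E w Sw)))) (lem (active S r) (+ d w))))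
      where
      u≢w : u ≢ w
      u≢w refl = true≢false Su Sw
      lem : ∀ a b → a + b - + 1 - + 1 ≡ a + (b - + 2)
      lem = solve-∀

    reveal-split : ∀ {bad den φ} ψin (ψout : Fin n → ℤ) → + 0 ≤ den → + 0 ≤ φ → ∀ u → S u ≡ true → 1 ℕ.≤ r u →
      (∀ w → S w ≡ true → u ≢ w → 1 ℕ.≤ r w → K u w ≡ false → Good d bad den (learn P K u w) (dec w (dec u r)) (m ℕ.∸ 2) ψin) →
      (∀ w → S w ≡ false → u ≢ w → 1 ℕ.≤ r w → K u w ≡ false → Good d bad den (learn P K u w) (dec w (dec u r)) (m ℕ.∸ 2) (ψout w)) →
      (+ 2 ≤ active S r → + 0 ≤ ψin) → (∀ w → S w ≡ false → 1 ℕ.≤ r w → + 0 ≤ ψout w) →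
      (active S r - + 1) * (ψin - φ) + outS S (λ w → + d w * (ψout w - φ)) ≤ + 0 →
      Good d bad den P r m φ
    reveal-split {bad} {den} {φ} ψin ψout 0≤den 0≤φ u Su pu next-in next-out 0≤ψin 0≤ψout drift =
      reveal {ψ = ψ} E 0≤den 0≤φ u pu next 0≤ψ mean
      where
      open ≤-Reasoning
      ψ : Fin n → ℤ
      ψ w = if S w then ψin else ψout w
      next : ∀ w → u ≢ w → 1 ℕ.≤ r w → K u w ≡ false → Good d bad den (learn P K u w) (dec w (dec u r)) (m ℕ.∸ 2) (ψ w)
      next w ne pw k with bool? (S w)
      ... | inj₁ e rewrite e = next-in w e ne pw k
      ... | inj₂ e rewrite e = next-out w e ne pw k
      Y-1 : inS S (λ v → + dec u r v) ≡ active S r - + 1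
      Y-1 = trans (∑-dec (λ v → ι (S v)) u r pu) (cong (λ b → active S r - ι b) Su)
      off : ∀ {w} → S w ≡ false → dec u r w ≡ r w
      off {w} e = dec-off r (λ { refl → true≢false Su e })
      0≤ψ : ∀ w → 1 ℕ.≤ dec u r w → + 0 ≤ ψ w
      0≤ψ w p with bool? (S w)
      ... | inj₂ e rewrite e = 0≤ψout w e (subst (1 ℕ.≤_) (off e) p)
      ... | inj₁ e rewrite e = 0≤ψin (begin
        + 2                                      ≤⟨ +-monoˡ-≤ (+ 1) (+≤+ p) ⟩
        + dec u r w + + 1                        ≡⟨ cong (_+ + 1) (trans (sym (*-identityˡ (+ dec u r w))) (cong (λ b → ι b * + dec u r w) (sym e))) ⟩
        ι (S w) * + dec u r w + + 1              ≤⟨ +-monoˡ-≤ (+ 1) (∑-term (λ v → ι (S v) * + dec u r v) (λ v → 0≤* (0≤ι (S v)) (0≤ℕ (dec u r v))) w) ⟩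
        inS S (λ v → + dec u r v) + + 1          ≡⟨ cong (_+ + 1) Y-1 ⟩
        active S r - + 1 + + 1                   ≡⟨ lem (active S r) ⟩
        active S r                               ∎)
        where
        lem : ∀ a → a - + 1 + + 1 ≡ a
        lem = solve-∀
      split : ∀ w → + dec u r w * ψ w ≡ ι (S w) * + dec u r w * ψin + ι (not (S w)) * (+ d w * (ψout w - φ) + φ * + d w)
      split w with bool? (S w)
      ... | inj₁ e rewrite e = lem (+ dec u r w) ψin (+ d w * (ψout w - φ) + φ * + d w)
        where
        lem : ∀ a b c → a * b ≡ + 1 * a * b + + 0 * c
        lem = solve-∀
      ... | inj₂ e rewrite e | off e | within-r E w e = lem (+ d w) ψin (ψout w) φ
        where
        lem : ∀ a b c e → a * c ≡ + 0 * a * b + + 1 * (a * (c - e) + e * a)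
        lem = solve-∀
      O D : ℤ
      O = outS S (λ w → + d w * (ψout w - φ))
      D = outS S (λ w → + d w)
      mean : ∑ (λ w → + dec u r w * ψ w) ≤ (+ m - + 1) * φ
      mean = begin
        ∑ (λ w → + dec u r w * ψ w)
          ≡⟨ trans (∑-cong split) (trans (∑-+ _ _) (cong₂ _+_ (trans (∑-*ʳ ψin _) (cong (_* ψin) Y-1))
              (trans (outS-+ S _ _) (cong (_+_ O) (outS-* S φ (λ w → + d w)))))) ⟩
        (active S r - + 1) * ψin + (O + φ * D)
          ≡⟨ lem₁ (active S r) ψin φ O D ⟩
        (active S r - + 1) * (ψin - φ) + O + (active S r + D - + 1) * φ
          ≤⟨ +-monoˡ-≤ ((active S r + D - + 1) * φ) drift ⟩
        + 0 + (active S r + D - + 1) * φ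
          ≡⟨ trans (+-identityˡ _) (cong (λ z → (z - + 1) * φ) (sym total-split)) ⟩
        (+ m - + 1) * φ ∎
        where
        lem₁ : ∀ y p f o e → (y - + 1) * p + (o + f * e) ≡ (y - + 1) * (p - f) + o + (y + e - + 1) * f
        lem₁ = solve-∀

    closed : active S r ≡ + 0 → ∀ {G} → G ∈ realisations n d → P G ≡ true → ∀ {v w} → S v ≡ true → adj G v w ≡ true → S w ≡ true
    closed Y0 {G} G∈ p {v} {w} Sv a with bool? (K v w)
    ... | inj₁ k = within w v (trans (K-sym w v) k)
    ... | inj₂ k = ⊥-elim (one≢zero (trans (sym one) (∑≡0⇒ (λ j → ι (adj G v j ∧ not (K v j))) (λ j → 0≤ι _) (trans (unrevealed E G∈ p v) rv) w)))
      where
      one≢zero : ¬ (+ 1 ≡ + 0)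
      one≢zero ()
      one : ι (adj G v w ∧ not (K v w)) ≡ + 1
      one rewrite a | k = refl
      rv : + r v ≡ + 0
      rv = trans (sym (trans (cong (λ b → ι b * + r v) Sv) (*-identityˡ (+ r v))))
        (∑≡0⇒ (λ v → ι (S v) * + r v) (λ v → 0≤* (0≤ι (S v)) (0≤ℕ (r v))) Y0 v)

  module _ {n} {G : Graph n} {S : Fin n → Bool} (closed : ∀ {v w} → S v ≡ true → adj G v w ≡ true → S w ≡ true) where

    walk-closed : ∀ k {v w} → S v ≡ true → walkWithin G k v w ≡ true → S w ≡ true
    walk-closed zero {v} {w} Sv e with Finₚ.toℕ-injective (ℕₚ.≡ᵇ⇒≡ (toℕ v) (toℕ w) (⇒T e))
    ... | refl = Sv
    walk-closed (suc k) {v} {w} Sv e with bool? (walkWithin G k v w)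
    ... | inj₁ e′ = walk-closed k Sv e′
    ... | inj₂ e′ with anyF⇒ (λ u → walkWithin G k v u ∧ adj G u w) (trans (cong (_∨ anyF n (λ u → walkWithin G k v u ∧ adj G u w)) (sym e′)) e)
    ...   | u , h = closed (walk-closed k Sv (proj₁ (∧-true h))) (proj₂ (∧-true {walkWithin G k v u} h))

    walk-closed⁻ : (∀ i j → adj G i j ≡ adj G j i) → ∀ k {v w} → S w ≡ true → walkWithin G k v w ≡ true → S v ≡ true
    walk-closed⁻ sm zero {v} {w} Sw e with Finₚ.toℕ-injective (ℕₚ.≡ᵇ⇒≡ (toℕ v) (toℕ w) (⇒T e))
    ... | refl = Sw
    walk-closed⁻ sm (suc k) {v} {w} Sw e with bool? (walkWithin G k v w)
    ... | inj₁ e′ = walk-closed⁻ sm k Sw e′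
    ... | inj₂ e′ with anyF⇒ (λ u → walkWithin G k v u ∧ adj G u w) (trans (cong (_∨ anyF n (λ u → walkWithin G k v u ∧ adj G u w)) (sym e′)) e)
    ...   | u , h = walk-closed⁻ sm k (closed Sw (trans (sm w u) (proj₂ (∧-true {walkWithin G k v u} h)))) (proj₁ (∧-true h))

  size : ∀ {n} → (Fin n → Bool) → ℤ
  size S = inS S (λ _ → + 1)

  size-∑ : ∀ {n} (S : Fin n → Bool) → size S ≡ ∑ (λ v → ι (S v))
  size-∑ S = ∑-cong (λ v → *-identityʳ (ι (S v)))

  ι-mono : ∀ {a b} → (a ≡ true → b ≡ true) → ι a ≤ ι b
  ι-mono {false} {b} h = 0≤ι b
  ι-mono {true} {b} h rewrite h refl = ≤-refl

  η ρ : ℕ → ℤ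
  η k = + k * (+ k - + 2)
  ρ k = + k * ((+ k - + 2) * (+ k - + 2))

  0≤ρ : ∀ k → + 0 ≤ ρ k
  0≤ρ k = 0≤* (0≤ℕ k) (0≤sq (+ k - + 2))

  -1≤η : ∀ k → + 0 ≤ η k + + 1
  -1≤η k = subst (+ 0 ≤_) (lem (+ k)) (0≤sq (+ k - + 1))
    where
    lem : ∀ x → (x - + 1) * (x - + 1) ≡ x * (x - + 2) + + 1
    lem = solve-∀

  -- Stated through a vertex c, not through compSize G v, so that no transitivity of connected is needed.
  inLarge : ∀ {n} → ℕ → Fin n → Graph n → Bool
  inLarge {n} s v G = anyF n (λ c → connected G c v ∧ (n ℕ.≤ᵇ s ℕ.* compSize G c))

  record UpperData {n} (d : DegSeq n) : Set where
    field
      s : ℕ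
      q Λ c : ℤ
      M≤3n : ∑ (λ v → + d v) ≤ + 3 * + n
      s³≤V : + s * + s * + s ≤ ∑ (λ v → ρ (d v))
      V≤24s³ : ∑ (λ v → ρ (d v)) ≤ + 24 * (+ s * + s * + s)
      D≤Λs² : ∑ (λ v → η (d v)) ≤ Λ * (+ s * + s)
      n≤cs³ : + n ≤ c * (+ s * + s * + s)
      8qd≤s : ∀ v → + 8 * q * + d v ≤ + s
      Λ+c≤q : + 8 * (Λ + c) ≤ q
      0≤Λ : + 0 ≤ Λ
      0≤c : + 0 ≤ c
      8≤q : + 8 ≤ q
      1≤s : + 1 ≤ + s
      s²≤n : + s * + s ≤ + n
      1≤d : ∀ v → 1 ℕ.≤ d v

  -- The potential of the exploration of one component. With h = s / q it is, up to scaling,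
  -- Y (2 h − Y) plus multiples of the number of discovered vertices and of Σ_S d (d − 2)²; the variance of
  -- the exploration makes the first term decrease faster than the others increase.
  module Upper {n} {d : DegSeq n} (H : UpperData d) where

    open UpperData H

    private
      N z² z³ z : ℤ
      N = + n
      z = + s
      z² = z * z
      z³ = z * z * z
    open ≤-Reasoning

    0≤q : + 0 ≤ q
    0≤q = ≤-trans (0≤ℕ 8) 8≤q
    0≤z : + 0 ≤ z
    0≤z = 0≤ℕ s
    0≤N : + 0 ≤ N
    0≤N = 0≤ℕ n
    0≤z³ : + 0 ≤ z³
    0≤z³ = 0≤* (0≤* 0≤z 0≤z) 0≤z

    den : ℤ
    den = + 12 * (N * z³)

    0≤den : + 0 ≤ den
    0≤den = 0≤* (0≤ℕ 12) (0≤* 0≤N 0≤z³)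

    potential : ℤ → ℤ → ℤ → ℤ
    potential y k e = + 24 * (N * z * q) * (y * (+ 2 * z - q * y)) + q * q * (z³ * z) * k + N * (q * q) * e

    rem : (Fin n → Bool) → ℤ
    rem S = inS S (λ v → ρ (d v))

    Φ : (Fin n → Bool) → (Fin n → ℕ) → ℤ
    Φ S r = potential (active S r) (size S) (rem S)

    8≤qq : + 64 ≤ q * q
    8≤qq = *-mono (0≤ℕ 8) 0≤q 8≤q 8≤q

    0≤2z-qy : ∀ {y} → + 8 * q * y ≤ + 9 * z → + 0 ≤ + 2 * z - q * y
    0≤2z-qy {y} h = *-cancelˡ (+ 8) (+≤+ (ℕ.s≤s ℕ.z≤n)) (≤-by ((+ 9 * z - + 8 * q * y) + + 7 * z) (0≤+ (0≤- h) (0≤* (0≤ℕ 7) 0≤z)) (lem z q y))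
      where
      lem : ∀ z q y → + 8 * (+ 2 * z - q * y) ≡ + 8 * + 0 + ((+ 9 * z - + 8 * q * y) + + 7 * z)
      lem = solve-∀

    module _ {y k e : ℤ} (0≤y : + 0 ≤ y) (0≤k : + 0 ≤ k) (0≤e : + 0 ≤ e) (bnd : + 8 * q * y ≤ + 9 * z) where

      0≤a : + 0 ≤ + 24 * (N * z * q) * (y * (+ 2 * z - q * y))
      0≤a = 0≤* (0≤* (0≤ℕ 24) (0≤* (0≤* 0≤N 0≤z) 0≤q)) (0≤* 0≤y (0≤2z-qy bnd))
      0≤b : + 0 ≤ q * q * (z³ * z) * k
      0≤b = 0≤* (0≤* (0≤* 0≤q 0≤q) (0≤* 0≤z³ 0≤z)) 0≤k
      0≤c′ : + 0 ≤ N * (q * q) * e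
      0≤c′ = 0≤* (0≤* 0≤N (0≤* 0≤q 0≤q)) 0≤e

      0≤potential : + 0 ≤ potential y k e
      0≤potential = 0≤+ (0≤+ 0≤a 0≤b) 0≤c′

      low-height : ¬ (den ≤ potential y k e) → q * y ≤ z
      low-height ¬p with q * y ≤? z
      ... | yes p = p
      ... | no ¬q = ⊥-elim (¬p (begin
        den
          ≤⟨ ≤-by (+ 9 * (N * z³)) (0≤* (0≤ℕ 9) (0≤* 0≤N 0≤z³)) (lem₁ N z) ⟩
        + 3 * (N * z) * (z * (+ 7 * z))
          ≤⟨ *-monoˡ (+ 3 * (N * z)) (0≤* (0≤ℕ 3) (0≤* 0≤N 0≤z)) (*-mono 0≤z (0≤* (0≤ℕ 8) (0≤2z-qy bnd)) (≤-trans (i≤i+j z (+ 1)) (≰⇒1+≤ ¬q)) 7z≤) ⟩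
        + 3 * (N * z) * (q * y * (+ 8 * (+ 2 * z - q * y)))
          ≡⟨ lem₂ N z q y ⟩
        + 24 * (N * z * q) * (y * (+ 2 * z - q * y))
          ≤⟨ ≤-by (q * q * (z³ * z) * k + N * (q * q) * e) (0≤+ 0≤b 0≤c′) (+-assoc (+ 24 * (N * z * q) * (y * (+ 2 * z - q * y))) (q * q * (z³ * z) * k) (N * (q * q) * e)) ⟩
        potential y k e ∎))
        where
        7z≤ : + 7 * z ≤ + 8 * (+ 2 * z - q * y)
        7z≤ = ≤-by (+ 9 * z - + 8 * q * y) (0≤- bnd) (lem z q y)
          where
          lem : ∀ z q y → + 8 * (+ 2 * z - q * y) ≡ + 7 * z + (+ 9 * z - + 8 * q * y)
          lem = solve-∀
        lem₁ : ∀ N z → + 3 * (N * z) * (z * (+ 7 * z)) ≡ + 12 * (N * (z * z * z)) + + 9 * (N * (z * z * z))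
        lem₁ = solve-∀
        lem₂ : ∀ N z q y → + 3 * (N * z) * (q * y * (+ 8 * (+ 2 * z - q * y))) ≡ + 24 * (N * z * q) * (y * (+ 2 * z - q * y))
        lem₂ = solve-∀

      small-size : ¬ (den ≤ potential y k e) → z * k + + 1 ≤ N
      small-size ¬p with N ≤? z * k
      ... | no ¬q = ≰⇒1+≤ ¬q
      ... | yes p = ⊥-elim (¬p (begin
        den                            ≤⟨ *-mono (0≤ℕ 12) (0≤* (0≤* 0≤z 0≤k) 0≤z³) (≤-trans (+≤+ (ℕₚ.m≤m+n 12 52)) 8≤qq) (*-monoʳ z³ 0≤z³ p) ⟩
        q * q * (z * k * z³)           ≡⟨ lem q z k z³ ⟩
        q * q * (z³ * z) * k           ≤⟨ ≤-by (+ 24 * (N * z * q) * (y * (+ 2 * z - q * y)) + N * (q * q) * e) (0≤+ 0≤a 0≤c′)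
                                            (lem′ (+ 24 * (N * z * q) * (y * (+ 2 * z - q * y))) (q * q * (z³ * z) * k) (N * (q * q) * e)) ⟩
        potential y k e                ∎))
        where
        lem : ∀ q z k t → q * q * (z * k * t) ≡ q * q * (t * z) * k
        lem = solve-∀
        lem′ : ∀ a b c → a + b + c ≡ b + (a + c)
        lem′ = solve-∀

      small-rem : ¬ (den ≤ potential y k e) → + 2 * e ≤ ∑ (λ v → ρ (d v))
      small-rem ¬p with + 2 * e ≤? ∑ (λ v → ρ (d v))
      ... | yes p = p
      ... | no ¬q = ⊥-elim (¬p (*-cancelˡ (+ 2) (+≤+ (ℕ.s≤s ℕ.z≤n)) (begin
        + 2 * den                      ≡⟨ lem N z³ ⟩
        + 24 * (N * z³)                ≤⟨ *-mono (0≤ℕ 24) (0≤* 0≤N (0≤* (0≤ℕ 2) 0≤e)) (≤-trans (+≤+ (ℕₚ.m≤m+n 24 40)) 8≤qq) (*-monoˡ N 0≤N (≤-trans s³≤V (≤-trans (i≤i+j _ (+ 1)) (≰⇒1+≤ ¬q)))) ⟩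
        q * q * (N * (+ 2 * e))        ≡⟨ lem′ N q e ⟩
        + 2 * (N * (q * q) * e)        ≤⟨ *-monoˡ (+ 2) (0≤ℕ 2) (≤-by (+ 24 * (N * z * q) * (y * (+ 2 * z - q * y)) + q * q * (z³ * z) * k) (0≤+ 0≤a 0≤b) (+-comm (+ 24 * (N * z * q) * (y * (+ 2 * z - q * y)) + q * q * (z³ * z) * k) (N * (q * q) * e))) ⟩
        + 2 * potential y k e          ∎)))
        where
        lem : ∀ N t → + 2 * (+ 12 * (N * t)) ≡ + 24 * (N * t)
        lem = solve-∀
        lem′ : ∀ N q e → q * q * (N * (+ 2 * e)) ≡ + 2 * (N * (q * q) * e)
        lem′ = solve-∀

    module _ (S : Fin n → Bool) where

      out-η : z * size S ≤ N → outS S (λ v → η (d v)) ≤ (Λ + c) * z²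
      out-η small = begin
        outS S (λ v → η (d v))                            ≤⟨ ≤-by (inS S (λ v → η (d v) + + 1)) (0≤inS S (λ v → -1≤η (d v))) refl ⟩
        outS S (λ v → η (d v)) + inS S (λ v → η (d v) + + 1)
          ≡⟨ cong (_+_ (outS S (λ v → η (d v)))) (trans (∑-cong (λ v → *-distribˡ-+ (ι (S v)) (η (d v)) (+ 1))) (∑-+ _ _)) ⟩
        outS S (λ v → η (d v)) + (inS S (λ v → η (d v)) + size S)
          ≡⟨ trans (lem (outS S (λ v → η (d v))) (inS S (λ v → η (d v))) (size S)) (cong (_+ size S) (in+out S (λ v → η (d v)))) ⟩
        ∑ (λ v → η (d v)) + size S                        ≤⟨ +-mono-≤ D≤Λs² (*-cancelˡ z 1≤s (≤-trans small (≤-trans n≤cs³ (≤-reflexive (lem′ c z))))) ⟩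
        Λ * z² + c * z²                                   ≡⟨ *-distribʳ-+ z² Λ c ⟨
        (Λ + c) * z²                                      ∎
        where
        lem : ∀ a b c → a + (b + c) ≡ b + a + c
        lem = solve-∀
        lem′ : ∀ c z → c * (z * z * z) ≡ z * (c * (z * z))
        lem′ = solve-∀

      out-ρ : + 2 * rem S ≤ ∑ (λ v → ρ (d v)) → z³ ≤ + 2 * outS S (λ v → ρ (d v))
      out-ρ h = begin
        z³                                    ≤⟨ s³≤V ⟩
        V                                     ≤⟨ ≤-by (V - + 2 * rem S) (0≤- h) refl ⟩
        V + (V - + 2 * rem S)                 ≡⟨ cong (λ v → v + (v - + 2 * rem S)) (in+out S (λ v → ρ (d v))) ⟨
        (rem S + o) + ((rem S + o) - + 2 * rem S)  ≡⟨ lem (rem S) o ⟩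
        + 2 * o                               ∎
        where
        V o : ℤ
        V = ∑ (λ v → ρ (d v))
        o = outS S (λ v → ρ (d v))
        lem : ∀ a b → (a + b) + ((a + b) - + 2 * a) ≡ + 2 * b
        lem = solve-∀

      out-dρ : outS S (λ v → + d v * ρ (d v)) ≤ + 3 * (z³ * z)
      out-dρ = *-cancelˡ (+ 8) (+≤+ (ℕ.s≤s ℕ.z≤n)) (begin
        + 8 * outS S (λ v → + d v * ρ (d v))        ≤⟨ *-monoˡ (+ 8) (0≤ℕ 8) (outS≤∑ S (λ v → 0≤* (0≤ℕ (d v)) (0≤ρ (d v)))) ⟩
        + 8 * ∑ (λ v → + d v * ρ (d v))             ≡⟨ ∑-* (+ 8) (λ v → + d v * ρ (d v)) ⟨
        ∑ (λ v → + 8 * (+ d v * ρ (d v)))           ≤⟨ ∑-mono each ⟩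
        ∑ (λ v → z * ρ (d v))                       ≡⟨ ∑-* z (λ v → ρ (d v)) ⟩
        z * ∑ (λ v → ρ (d v))                       ≤⟨ *-monoˡ z 0≤z V≤24s³ ⟩
        z * (+ 24 * z³)                             ≡⟨ lem z z³ ⟩
        + 8 * (+ 3 * (z³ * z))                      ∎)
        where
        lem : ∀ a b → a * (+ 24 * b) ≡ + 8 * (+ 3 * (b * a))
        lem = solve-∀
        each : ∀ v → + 8 * (+ d v * ρ (d v)) ≤ z * ρ (d v)
        each v = begin
          + 8 * (+ d v * ρ (d v))      ≡⟨ *-assoc (+ 8) (+ d v) (ρ (d v)) ⟨
          + 8 * + d v * ρ (d v)        ≤⟨ *-monoʳ (ρ (d v)) (0≤ρ (d v)) (*-monoʳ (+ d v) (0≤ℕ (d v)) (*-monoˡ (+ 8) (0≤ℕ 8) (≤-trans (+≤+ (ℕ.s≤s ℕ.z≤n)) 8≤q))) ⟩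
          + 8 * q * + d v * ρ (d v)    ≤⟨ *-monoʳ (ρ (d v)) (0≤ρ (d v)) (8qd≤s v) ⟩
          z * ρ (d v)                  ∎

      module _ {y : ℤ} (0≤y : + 0 ≤ y) (1≤y : + 1 ≤ y) (qy≤z : q * y ≤ z) (small : z * size S ≤ N)
               (rem≤ : + 2 * rem S ≤ ∑ (λ v → ρ (d v))) where

        private
          φ ψin : ℤ
          φ = potential y (size S) (rem S)
          ψin = potential (y - + 2) (size S) (rem S)
          ψout : Fin n → ℤ
          ψout w = potential (y + (+ d w - + 2)) (size S + + 1) (rem S + ρ (d w))
          a : ℤ
          a = z - q * y
          oη oρ od odρ : ℤ
          oη = outS S (λ v → η (d v))
          oρ = outS S (λ v → ρ (d v))
          od = outS S (λ v → + d v)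
          odρ = outS S (λ v → + d v * ρ (d v))

        back-step : (y - + 1) * (ψin - φ) ≤ + 0
        back-step = ≤-by ((y - + 1) * (+ 24 * (N * z * q) * (+ 4 * (a + q)))) (0≤* (0≤- 1≤y) (0≤* (0≤* (0≤ℕ 24) (0≤* (0≤* 0≤N 0≤z) 0≤q)) (0≤* (0≤ℕ 4) (0≤+ (0≤- qy≤z) 0≤q))))
          (lem y (+ 24 * (N * z * q)) z q (q * q * (z³ * z) * size S) (N * (q * q) * rem S))
          where
          lem : ∀ y C z q b c → + 0 ≡ (y - + 1) * (C * ((y - + 2) * (+ 2 * z - q * (y - + 2))) + b + c - (C * (y * (+ 2 * z - q * y)) + b + c))
            + (y - + 1) * (C * (+ 4 * (z - q * y + q)))
          lem = solve-∀

        out-expand : outS S (λ w → + d w * (ψout w - φ)) ≡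
          + 48 * (N * z * q) * (a * oη) - + 24 * (N * z * q) * q * oρ + q * q * (z³ * z) * od + N * (q * q) * odρ
        out-expand = trans (outS-cong S (λ w → lem (+ d w) y (N * z * q) z q (q * q * (z³ * z)) (size S) (N * (q * q)) (rem S)))
          (trans (outS-+ S _ _) (cong₂ _+_ (trans (outS-+ S _ _) (cong₂ _+_ (trans (outS-+ S _ _)
            (cong₂ _+_ (trans (outS-* S (+ 48 * (N * z * q) * a) (λ v → η (d v))) (*-assoc (+ 48 * (N * z * q)) a oη))
              (trans (outS-* S (- (+ 24 * (N * z * q) * q)) (λ v → ρ (d v))) (sym (neg-distribˡ-* (+ 24 * (N * z * q) * q) oρ)))))
            (outS-* S (q * q * (z³ * z)) (λ v → + d v)))) (outS-* S (N * (q * q)) (λ v → + d v * ρ (d v)))))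
          where
          lem : ∀ x y C z q b k c e →
            x * ((+ 24 * C * ((y + (x - + 2)) * (+ 2 * z - q * (y + (x - + 2)))) + b * (k + + 1) + c * (e + x * ((x - + 2) * (x - + 2))))
                 - (+ 24 * C * (y * (+ 2 * z - q * y)) + b * k + c * e)) ≡
            + 48 * C * (z - q * y) * (x * (x - + 2)) + - (+ 24 * C * q) * (x * ((x - + 2) * (x - + 2))) + b * x + c * (x * (x * ((x - + 2) * (x - + 2))))
          lem = solve-∀

        drift : (y - + 1) * (ψin - φ) + outS S (λ w → + d w * (ψout w - φ)) ≤ + 0
        drift = begin
          (y - + 1) * (ψin - φ) + outS S (λ w → + d w * (ψout w - φ))
            ≤⟨ +-mono-≤ back-step (≤-reflexive out-expand) ⟩
          + 0 + (+ 48 * C * (a * oη) - + 24 * C * q * oρ + q * q * (z³ * z) * od + N * (q * q) * odρ)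
            ≡⟨ +-identityˡ _ ⟩
          + 48 * C * (a * oη) - + 24 * C * q * oρ + q * q * (z³ * z) * od + N * (q * q) * odρ
            ≤⟨ +-mono-≤ (+-mono-≤ (+-mono-≤ t₁ (neg-mono-≤ t₂)) t₃) t₄ ⟩
          + 6 * U - + 12 * U + + 3 * U + + 3 * U
            ≡⟨ lem U ⟩
          + 0 ∎
          where
          C U : ℤ
          C = N * z * q
          U = C * q * z³
          lem : ∀ u → + 6 * u - + 12 * u + + 3 * u + + 3 * u ≡ + 0
          lem = solve-∀
          0≤C : + 0 ≤ C
          0≤C = 0≤* (0≤* 0≤N 0≤z) 0≤q
          0≤z² : + 0 ≤ z²
          0≤z² = 0≤* 0≤z 0≤z
          0≤Λ+c : + 0 ≤ Λ + c
          0≤Λ+c = 0≤+ 0≤Λ 0≤c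
          t₁ : + 48 * C * (a * oη) ≤ + 6 * U
          t₁ = begin
            + 48 * C * (a * oη)                  ≤⟨ *-monoˡ (+ 48 * C) (0≤* (0≤ℕ 48) 0≤C) (*-monoˡ a (0≤- qy≤z) (out-η small)) ⟩
            + 48 * C * (a * ((Λ + c) * z²))      ≤⟨ *-monoˡ (+ 48 * C) (0≤* (0≤ℕ 48) 0≤C) (*-monoʳ ((Λ + c) * z²) (0≤* 0≤Λ+c 0≤z²) (≤-by {a} {z} (q * y) (0≤* 0≤q 0≤y) (lem₁ z (q * y)))) ⟩
            + 48 * C * (z * ((Λ + c) * z²))      ≡⟨ lem₂ C z (Λ + c) ⟩
            + 6 * (C * (+ 8 * (Λ + c)) * z³)     ≤⟨ *-monoˡ (+ 6) (0≤ℕ 6) (*-monoʳ z³ 0≤z³ (*-monoˡ C 0≤C Λ+c≤q)) ⟩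
            + 6 * U                              ∎
            where
            lem₁ : ∀ a b → a ≡ a - b + b
            lem₁ = solve-∀
            lem₂ : ∀ c z l → + 48 * c * (z * (l * (z * z))) ≡ + 6 * (c * (+ 8 * l) * (z * z * z))
            lem₂ = solve-∀
          t₂ : + 12 * U ≤ + 24 * C * q * oρ
          t₂ = begin
            + 12 * (C * q * z³)                  ≤⟨ *-monoˡ (+ 12) (0≤ℕ 12) (*-monoˡ (C * q) (0≤* 0≤C 0≤q) (out-ρ rem≤)) ⟩
            + 12 * (C * q * (+ 2 * oρ))          ≡⟨ lem₁ C q oρ ⟩
            + 24 * C * q * oρ                    ∎
            where
            lem₁ : ∀ c q o → + 12 * (c * q * (+ 2 * o)) ≡ + 24 * c * q * o
            lem₁ = solve-∀
          t₃ : q * q * (z³ * z) * od ≤ + 3 * U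
          t₃ = begin
            q * q * (z³ * z) * od                ≤⟨ *-monoˡ (q * q * (z³ * z)) (0≤* (0≤* 0≤q 0≤q) (0≤* 0≤z³ 0≤z)) (≤-trans (outS≤∑ S (λ v → 0≤ℕ (d v))) M≤3n) ⟩
            q * q * (z³ * z) * (+ 3 * N)         ≡⟨ lem₁ N z q z³ ⟩
            + 3 * U                              ∎
            where
            lem₁ : ∀ N z q t → q * q * (t * z) * (+ 3 * N) ≡ + 3 * (N * z * q * q * t)
            lem₁ = solve-∀
          t₄ : N * (q * q) * odρ ≤ + 3 * U
          t₄ = begin
            N * (q * q) * odρ                    ≤⟨ *-monoˡ (N * (q * q)) (0≤* 0≤N (0≤* 0≤q 0≤q)) out-dρ ⟩
            N * (q * q) * (+ 3 * (z³ * z))       ≡⟨ lem₁ N z q z³ ⟩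
            + 3 * U                              ∎
            where
            lem₁ : ∀ N z q t → N * (q * q) * (+ 3 * (t * z)) ≡ + 3 * (N * z * q * q * t)
            lem₁ = solve-∀

    size-insert : ∀ {S : Fin n → Bool} {w} → S w ≡ false → size (insert S w) ≡ size S + + 1
    size-insert {S} w∉ = inS-insert S w∉ (λ _ → + 1)

    0≤rem : ∀ S → + 0 ≤ rem S
    0≤rem S = 0≤inS S (λ v → 0≤ρ (d v))

    0≤size : ∀ (S : Fin n → Bool) → + 0 ≤ size S
    0≤size S = 0≤inS S (λ _ → 0≤ℕ 1)

    not-inLarge : ∀ {G} v₀ {S : Fin n → Bool} → Realises d G → S v₀ ≡ true →
      (∀ {v w} → S v ≡ true → adj G v w ≡ true → S w ≡ true) → z * size S + + 1 ≤ N → inLarge s v₀ G ≡ false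
    not-inLarge {G} v₀ {S} R Sv₀ cl small with bool? (inLarge s v₀ G)
    ... | inj₂ e = e
    ... | inj₁ e with anyF⇒ (λ c → connected G c v₀ ∧ (n ℕ.≤ᵇ s ℕ.* compSize G c)) e
    ...   | v , h = ⊥-elim (1+i≰i (≤-trans small (≤-trans (+≤+ large) (≤-trans (≤-reflexive (pos-* s (compSize G v))) (*-monoˡ z 0≤z comp≤)))))
      where
      large : n ℕ.≤ s ℕ.* compSize G v
      large = ℕₚ.≤ᵇ⇒≤ n (s ℕ.* compSize G v) (⇒T (proj₂ (∧-true {connected G v v₀} h)))
      Sv : S v ≡ true
      Sv = walk-closed⁻ cl (Realises.symmetric R) n Sv₀ (proj₁ (∧-true h))
      comp≤ : + compSize G v ≤ size S
      comp≤ = begin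
        + compSize G v                     ≡⟨ countF-∑ (connected G v) ⟩
        ∑ (λ w → ι (connected G v w))      ≤⟨ ∑-mono (λ w → ι-mono (walk-closed cl n {v} {w} Sv)) ⟩
        ∑ (λ w → ι (S w))                  ≡⟨ size-∑ S ⟨
        size S                             ∎
      1+i≰i : ∀ {a} → ¬ (a + + 1 ≤ a)
      1+i≰i {a} p with subst₂ _≤_ (lem a) (+-inverseʳ a) (+-monoˡ-≤ (- a) p)
        where
        lem : ∀ a → a + + 1 - a ≡ + 1
        lem = solve-∀
      ... | +≤+ ()

    step-height : ∀ {y} w → q * y ≤ z → + 8 * q * (y + (+ d w - + 2)) ≤ + 9 * z
    step-height {y} w h = ≤-by (+ 8 * (z - q * y) + (z - + 8 * q * + d w) + + 16 * q) (0≤+ (0≤+ (0≤* (0≤ℕ 8) (0≤- h)) (0≤- (8qd≤s w))) (0≤* (0≤ℕ 16) 0≤q)) (lem z q y (+ d w))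
      where
      lem : ∀ z q y x → + 9 * z ≡ + 8 * q * (y + (x - + 2)) + (+ 8 * (z - q * y) + (z - + 8 * q * x) + + 16 * q)
      lem = solve-∀

    supermartingale : ∀ k m → m ℕ.≤ k → ∀ {P K S r} → Explored d P K S r m → ∀ v₀ → S v₀ ≡ true →
      + 8 * q * active S r ≤ + 9 * z → Good d (inLarge s v₀) den P r m (Φ S r)
    supermartingale k m m≤k {P} {K} {S} {r} E v₀ Sv₀ bnd with den ≤? Φ S r
    ... | yes p = Good-top E 0≤den p
    ... | no ¬p = go k m≤k (+ 1 ≤? active S r)
      where
      0≤y : + 0 ≤ active S r
      0≤y = 0≤active S r
      0≤φ : + 0 ≤ Φ S r
      0≤φ = 0≤potential 0≤y (0≤size S) (0≤rem S) bnd
      small : z * size S + + 1 ≤ N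
      small = small-size 0≤y (0≤size S) (0≤rem S) bnd ¬p
      low : q * active S r ≤ z
      low = low-height 0≤y (0≤size S) (0≤rem S) bnd ¬p
      low-rem : + 2 * rem S ≤ ∑ (λ v → ρ (d v))
      low-rem = small-rem 0≤y (0≤size S) (0≤rem S) bnd ¬p
      go : ∀ k → m ℕ.≤ k → Dec (+ 1 ≤ active S r) → Good d (inLarge s v₀) den P r m (Φ S r)
      go _ _ (no y≰) = Good-none 0≤φ (λ G∈ p → not-inLarge v₀ (∈⇒Realises G∈) Sv₀ (closed E y≡0 G∈ p) small)
        where
        y≡0 : active S r ≡ + 0
        y≡0 = ≤-antisym (subst (_≤ + 0) (lem (active S r)) (i≤j⇒i-j≤0 (≰⇒1+≤ y≰))) 0≤y
          where
          lem : ∀ a → a + + 1 - + 1 ≡ a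
          lem = solve-∀
      go zero m≤0 (yes 1≤y) = ⊥-elim (1≰0 (≤-trans 1≤y (≤-trans (≤-by _ (0≤outS S (λ v → 0≤ℕ (d v))) (total-split E)) (+≤+ m≤0))))
        where
        1≰0 : ¬ (+ 1 ≤ + 0)
        1≰0 (+≤+ ())
      go (suc k) m≤k (yes 1≤y) with active-vertex S r 1≤y
      ... | u , Su , pu = reveal-split E (potential (active S r - + 2) (size S) (rem S))
          (λ w → potential (active S r + (+ d w - + 2)) (size S + + 1) (rem S + ρ (d w)))
          0≤den 0≤φ u Su pu next-in next-out
          (λ 2≤y → 0≤potential (0≤- 2≤y) (0≤size S) (0≤rem S) bnd-in)
          (λ w Sw pw → 0≤potential (0≤out w) (0≤+ (0≤size S) (0≤ℕ 1)) (0≤+ (0≤rem S) (0≤ρ (d w))) (step-height w low))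
          (drift S 0≤y 1≤y low (≤-trans (i≤i+j (z * size S) (+ 1)) small) low-rem)
        where
        m∸2≤ : ∀ {k} → m ℕ.≤ suc k → m ℕ.∸ 2 ℕ.≤ k
        m∸2≤ {k} h = ℕₚ.≤-trans (ℕₚ.∸-monoˡ-≤ 2 h) (ℕₚ.m∸n≤m k 1)
        bnd-in : + 8 * q * (active S r - + 2) ≤ + 9 * z
        bnd-in = ≤-by ((+ 9 * z - + 8 * q * active S r) + + 16 * q) (0≤+ (0≤- bnd) (0≤* (0≤ℕ 16) 0≤q)) (lem z q (active S r))
          where
          lem : ∀ z q y → + 9 * z ≡ + 8 * q * (y - + 2) + ((+ 9 * z - + 8 * q * y) + + 16 * q)
          lem = solve-∀
        0≤out : ∀ w → + 0 ≤ active S r + (+ d w - + 2)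
        0≤out w = subst (+ 0 ≤_) (lem (active S r) (+ d w)) (0≤+ (0≤- 1≤y) (0≤- (+≤+ (1≤d w))))
          where
          lem : ∀ a b → (a - + 1) + (b - + 1) ≡ a + (b - + 2)
          lem = solve-∀
        next-in : ∀ w → S w ≡ true → u ≢ w → 1 ℕ.≤ r w → K u w ≡ false →
          Good d (inLarge s v₀) den (learn P K u w) (dec w (dec u r)) (m ℕ.∸ 2) (potential (active S r - + 2) (size S) (rem S))
        next-in w Sw ne pw kuw = subst (λ y → Good d (inLarge s v₀) den (learn P K u w) (dec w (dec u r)) (m ℕ.∸ 2) (potential y (size S) (rem S))) y≡
          (supermartingale k (m ℕ.∸ 2) (m∸2≤ m≤k) (explore E (λ _ e → e) Su Sw ne pu pw kuw) v₀ Sv₀ (subst (λ y → + 8 * q * y ≤ + 9 * z) (sym y≡) bnd-in))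
          where
          y≡ : active S (dec w (dec u r)) ≡ active S r - + 2
          y≡ = active-in E Su Sw ne pu pw
        next-out : ∀ w → S w ≡ false → u ≢ w → 1 ℕ.≤ r w → K u w ≡ false →
          Good d (inLarge s v₀) den (learn P K u w) (dec w (dec u r)) (m ℕ.∸ 2) (potential (active S r + (+ d w - + 2)) (size S + + 1) (rem S + ρ (d w)))
        next-out w Sw ne pw kuw = subst (λ φ → Good d (inLarge s v₀) den (learn P K u w) (dec w (dec u r)) (m ℕ.∸ 2) φ) φ≡
          (supermartingale k (m ℕ.∸ 2) (m∸2≤ m≤k) (explore E (insert-⊇ {S = S}) (insert-⊇ {S = S} u Su) (insert-new S w) ne pu pw kuw) v₀ (insert-⊇ {S = S} v₀ Sv₀)
            (subst (λ y → + 8 * q * y ≤ + 9 * z) (sym y≡) (step-height w low)))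
          where
          y≡ : active (insert S w) (dec w (dec u r)) ≡ active S r + (+ d w - + 2)
          y≡ = active-out E Su Sw pu pw
          φ≡ : Φ (insert S w) (dec w (dec u r)) ≡ potential (active S r + (+ d w - + 2)) (size S + + 1) (rem S + ρ (d w))
          φ≡ = trans (cong₂ (λ y k → potential y k (rem (insert S w))) y≡ (size-insert {S} {w} Sw)) (cong (potential (active S r + (+ d w - + 2)) (size S + + 1)) (inS-insert S Sw (λ v → ρ (d v))))

  count-≤-*∑ : ∀ {A : Set} {n} c c′ (p : A → Bool) (q : Fin n → A → Bool) xs →
    (∀ {x} → x ∈ xs → c * ι (p x) ≤ c′ * ∑ (λ w → ι (q w x))) → c * count p xs ≤ c′ * ∑ (λ w → count (q w) xs)
  count-≤-*∑ {n = n} c c′ p q [] h = ≤-reflexive (trans (*-zeroʳ c) (sym (trans (cong (c′ *_) (∑-zero n)) (*-zeroʳ c′))))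
  count-≤-*∑ c c′ p q (x ∷ xs) h = begin
    c * (ι (p x) + count p xs)                                    ≡⟨ *-distribˡ-+ c (ι (p x)) _ ⟩
    c * ι (p x) + c * count p xs                                  ≤⟨ +-mono-≤ (h (here refl)) (count-≤-*∑ c c′ p q xs (h ∘ there)) ⟩
    c′ * ∑ (λ w → ι (q w x)) + c′ * ∑ (λ w → count (q w) xs)      ≡⟨ *-distribˡ-+ c′ (∑ (λ w → ι (q w x))) _ ⟨
    c′ * (∑ (λ w → ι (q w x)) + ∑ (λ w → count (q w) xs))         ≡⟨ cong (c′ *_) (sym (∑-+ _ _)) ⟩
    c′ * ∑ (λ w → ι (q w x) + count (q w) xs)                     ∎
    where open ≤-Reasoning

  pairs≤square : ∀ {n} (p : Fin n → ℤ) → (∀ v → + 0 ≤ p v) → pairs (λ x y → p x * p y) ≤ ∑ p * ∑ p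
  pairs≤square p 0≤p = begin
    pairs (λ x y → p x * p y)            ≤⟨ ∑-mono (λ x → ∑-mono (λ y → *-monoʳ (p x * p y) (0≤* (0≤p x) (0≤p y)) (ι≤1 (not (eqF x y))))) ⟩
    ∑ (λ x → ∑ (λ y → + 1 * (p x * p y))) ≡⟨ ∑-cong (λ x → trans (∑-cong (λ y → *-identityˡ (p x * p y))) (∑-* (p x) p)) ⟩
    ∑ (λ x → p x * ∑ p)                  ≡⟨ ∑-*ʳ (∑ p) p ⟩
    ∑ p * ∑ p                            ∎
    where open ≤-Reasoning

  simple-arithmetic : ∀ μ a X g → + 0 ≤ X → + 0 ≤ a → + 79 ≤ μ → + 10 * a ≤ + 11 * (+ 4 + μ) →
    + 4 * ((+ 3 + μ) * ((+ 1 + μ) * X)) ≤ + 4 * g + + 2 * a * ((+ 1 + μ) * X) + a * a * X →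
    (+ 3 + μ) * ((+ 1 + μ) * X) ≤ + 8 * g
  simple-arithmetic μ a X g 0≤X 0≤a 79≤μ a≤ h = *-cancelˡ (+ 50) (+≤+ (ℕ.s≤s ℕ.z≤n)) (begin
    + 50 * ((+ 3 + μ) * ((+ 1 + μ) * X))
      ≤⟨ ≤-by (((+ 4 + μ) * (+ 9 * (μ - + 79) + + 7) + + 1050 + (+ 11 * (+ 4 + μ) - + 10 * a) * (+ 20 * (+ 1 + μ) + (+ 11 * (+ 4 + μ) + + 10 * a))) * X)
          (0≤* (0≤+ (0≤+ (0≤* (0≤+ (0≤ℕ 4) 0≤μ) (0≤+ (0≤* (0≤ℕ 9) (0≤- 79≤μ)) (0≤ℕ 7))) (0≤ℕ 1050))
            (0≤* (0≤- a≤) (0≤+ (0≤* (0≤ℕ 20) (0≤+ (0≤ℕ 1) 0≤μ)) (0≤+ (0≤* (0≤ℕ 11) (0≤+ (0≤ℕ 4) 0≤μ)) (0≤* (0≤ℕ 10) 0≤a))))) 0≤X)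
          (lem₁ μ a X) ⟩
    + 100 * (+ 4 * ((+ 3 + μ) * ((+ 1 + μ) * X)) - + 2 * a * ((+ 1 + μ) * X) - a * a * X)
      ≤⟨ *-monoˡ (+ 100) (0≤ℕ 100) (≤-by (+ 4 * g + + 2 * a * ((+ 1 + μ) * X) + a * a * X - + 4 * ((+ 3 + μ) * ((+ 1 + μ) * X))) (0≤- h)
           (lem₂ (+ 4 * ((+ 3 + μ) * ((+ 1 + μ) * X))) (+ 2 * a * ((+ 1 + μ) * X)) (a * a * X) (+ 4 * g))) ⟩
    + 100 * (+ 4 * g)
      ≡⟨ lem₃ g ⟩
    + 50 * (+ 8 * g) ∎)
    where
    open ≤-Reasoning
    0≤μ : + 0 ≤ μ
    0≤μ = ≤-trans (0≤ℕ 79) 79≤μ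
    lem₁ : ∀ μ a X → + 100 * (+ 4 * ((+ 3 + μ) * ((+ 1 + μ) * X)) - + 2 * a * ((+ 1 + μ) * X) - a * a * X) ≡
      + 50 * ((+ 3 + μ) * ((+ 1 + μ) * X)) +
      ((+ 4 + μ) * (+ 9 * (μ - + 79) + + 7) + + 1050 + (+ 11 * (+ 4 + μ) - + 10 * a) * (+ 20 * (+ 1 + μ) + (+ 11 * (+ 4 + μ) + + 10 * a))) * X
    lem₁ = solve-∀
    lem₂ : ∀ p q r g → g ≡ p - q - r + (g + q + r - p)
    lem₂ = solve-∀
    lem₃ : ∀ g → + 100 * (+ 4 * g) ≡ + 50 * (+ 8 * g)
    lem₃ = solve-∀

  -- Near criticality E[loops] + E[pairs of parallel edges] is close to 1/2 + 1/4, so simple graphs have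
  -- positive probability.
  numReal-positive : ∀ {n} (d : DegSeq n) m → ∑ (λ v → + d v) ≡ + m → 83 ℕ.≤ m →
    + 10 * ∑ (λ v → η (d v)) ≤ + m → dd m ≤ + 8 * (numReal d * factorials d)
  numReal-positive {n} d m t 83≤m D≤ with ℕₚ.m≤n⇒∃[o]m+o≡n (ℕₚ.≤-trans (ℕₚ.m≤m+n 4 79) 83≤m)
  ... | j , refl = ≤-trans (≤-reflexive dd≡) (simple-arithmetic (+ j) a X (numReal d * factorials d) (0≤dd j) 0≤a (+≤+ (ℕₚ.+-cancelˡ-≤ 4 79 j 83≤m)) a≤ main)
    where
    open ≤-Reasoning
    X μ a : ℤ
    X = dd j
    μ = + j
    a = ∑ (λ v → p₂ (d v))
    dd≡ : dd (4 ℕ.+ j) ≡ (+ 3 + μ) * ((+ 1 + μ) * X)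
    dd≡ = cong₂ (λ x y → x * (y * X)) (pos-+ 3 j) (pos-+ 1 j)
    0≤a : + 0 ≤ a
    0≤a = 0≤∑ (λ v → 0≤p₂ (d v))
    a≡ : a ≡ ∑ (λ v → η (d v)) + (+ 4 + μ)
    a≡ = trans (trans (∑-cong (λ v → lem₁ (+ d v))) (∑-+ _ _)) (cong (_+_ (∑ (λ v → η (d v)))) (trans t (pos-+ 4 j)))
      where
      lem₁ : ∀ x → x * (x - + 1) ≡ x * (x - + 2) + x
      lem₁ = solve-∀
    a≤ : + 10 * a ≤ + 11 * (+ 4 + μ)
    a≤ = ≤-trans (≤-reflexive (cong (+ 10 *_) a≡)) (≤-by ((+ 4 + μ) - + 10 * ∑ (λ v → η (d v))) (0≤- (≤-trans D≤ (≤-reflexive (pos-+ 4 j)))) (lem₂ (+ 4 + μ) (∑ (λ v → η (d v)))))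
      where
      lem₂ : ∀ m e → + 11 * m ≡ + 10 * (e + m) + (m - + 10 * e)
      lem₂ = solve-∀
    main : + 4 * ((+ 3 + μ) * ((+ 1 + μ) * X)) ≤ + 4 * (numReal d * factorials d) + + 2 * a * ((+ 1 + μ) * X) + a * a * X
    main = begin
      + 4 * ((+ 3 + μ) * ((+ 1 + μ) * X))
        ≡⟨ cong (+ 4 *_) (sym dd≡) ⟩
      + 4 * dd (4 ℕ.+ j)
        ≤⟨ numReal-lower (4 ℕ.+ j) (4 ℕ.+ j) d ℕₚ.≤-refl t ⟩
      + 4 * (numReal d * factorials d) + + 2 * a * (+ (1 ℕ.+ j) * X) + pairs (λ x y → p₂ (d x) * p₂ (d y)) * X
        ≤⟨ +-mono-≤ (≤-reflexive (cong (λ x → + 4 * (numReal d * factorials d) + + 2 * a * (x * X)) (pos-+ 1 j))) (*-monoʳ X (0≤dd j) (pairs≤square (λ v → p₂ (d v)) (λ v → 0≤p₂ (d v)))) ⟩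
      + 4 * (numReal d * factorials d) + + 2 * a * ((+ 1 + μ) * X) + a * a * X ∎

  module UpperTail {n} {d : DegSeq n} (H : UpperData d)
    (simple : ∀ m → ∑ (λ v → + d v) ≡ + m → dd m ≤ + 8 * (numReal d * factorials d))
    {m : ℕ} (total : ∑ (λ v → + d v) ≡ + m)
    where

    open UpperData H
    open Upper H
    open ≤-Reasoning

    private
      N z Cb : ℤ
      N = + n
      z = + s
      Cb = + 48 * q + + 2 * (q * q)
      F : ℤ
      F = factorials d
      1≤N : + 1 ≤ N
      1≤N = ≤-trans (*-mono (0≤ℕ 1) 0≤z 1≤s 1≤s) s²≤n
      X : Fin n → ℤ
      X v = count (inLarge s v) (realisations n d)

    0≤Cb : + 0 ≤ Cb
    0≤Cb = 0≤+ (0≤* (0≤ℕ 48) 0≤q) (0≤* (0≤ℕ 2) (0≤* 0≤q 0≤q))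

    d≤s : ∀ v → + d v ≤ z
    d≤s v = ≤-trans (≤-trans (≤-reflexive (sym (*-identityˡ (+ d v)))) (*-monoʳ (+ d v) (0≤ℕ (d v)) 1≤8q)) (8qd≤s v)
      where
      1≤8q : + 1 ≤ + 8 * q
      1≤8q = *-mono {+ 1} {+ 8} {+ 1} {q} (0≤ℕ 1) 0≤q (+≤+ (ℕ.s≤s ℕ.z≤n)) (≤-trans (+≤+ (ℕ.s≤s ℕ.z≤n)) 8≤q)

    initial : ∀ v → potential (+ d v) (+ 1) (ρ (d v)) ≤ Cb * + d v * (N * (z * z))
    initial v = ≤-by (+ 24 * (N * z * q) * (q * (x * x)) + q * q * (z * z) * ((N - z * z) + N * (x - + 1)) + N * (q * q) * x * ((z * z - x * x) + + 4 * (x - + 1)))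
      (0≤+ (0≤+ (0≤* (0≤* (0≤ℕ 24) (0≤* (0≤* 0≤N 0≤z) 0≤q)) (0≤* 0≤q (0≤* 0≤x 0≤x)))
        (0≤* (0≤* (0≤* 0≤q 0≤q) (0≤* 0≤z 0≤z)) (0≤+ (0≤- s²≤n) (0≤* 0≤N 0≤x-1))))
        (0≤* (0≤* (0≤* 0≤N (0≤* 0≤q 0≤q)) 0≤x) (0≤+ (0≤- (*-mono 0≤x 0≤z (d≤s v) (d≤s v))) (0≤* (0≤ℕ 4) 0≤x-1))))
      (lem N z q x)
      where
      x : ℤ
      x = + d v
      0≤x : + 0 ≤ x
      0≤x = 0≤ℕ (d v)
      0≤x-1 : + 0 ≤ x - + 1
      0≤x-1 = 0≤- (+≤+ (1≤d v))
      lem : ∀ N z q x → (+ 48 * q + + 2 * (q * q)) * x * (N * (z * z)) ≡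
        + 24 * (N * z * q) * (x * (+ 2 * z - q * x)) + q * q * (z * z * z * z) * + 1 + N * (q * q) * (x * ((x - + 2) * (x - + 2)))
        + (+ 24 * (N * z * q) * (q * (x * x)) + q * q * (z * z) * ((N - z * z) + N * (x - + 1)) + N * (q * q) * x * ((z * z - x * x) + + 4 * (x - + 1)))
      lem = solve-∀

    vertex-bound : ∀ v → + 12 * z * F * X v ≤ dd m * Cb * + d v
    vertex-bound v = *-cancelˡ (N * (z * z)) (*-mono (0≤ℕ 1) (0≤* 0≤z 0≤z) 1≤N (*-mono (0≤ℕ 1) 0≤z 1≤s 1≤s)) (begin
      N * (z * z) * (+ 12 * z * F * X v)                 ≡⟨ lem₁ N z F (X v) ⟩
      X v * den * F                                      ≤⟨ Good.bound (supermartingale m m ℕₚ.≤-refl (unexplored d S₀ total) v (eqF-refl v) height) ⟩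
      dd m * Φ S₀ d                                      ≡⟨ cong (dd m *_) Φ₀ ⟩
      dd m * potential (+ d v) (+ 1) (ρ (d v))           ≤⟨ *-monoˡ (dd m) (0≤dd m) (initial v) ⟩
      dd m * (Cb * + d v * (N * (z * z)))                ≡⟨ lem₂ (dd m) Cb (+ d v) (N * (z * z)) ⟩
      N * (z * z) * (dd m * Cb * + d v)                  ∎)
      where
      S₀ : Fin n → Bool
      S₀ x = eqF x v
      Φ₀ : Φ S₀ d ≡ potential (+ d v) (+ 1) (ρ (d v))
      Φ₀ = trans (cong₂ (λ y k → potential y k (rem S₀)) (∑-eqF v (λ v → + d v)) (∑-eqF v (λ _ → + 1))) (cong (potential (+ d v) (+ 1)) (∑-eqF v (λ v → ρ (d v))))
      height : + 8 * q * active S₀ d ≤ + 9 * z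
      height = ≤-trans (≤-reflexive (cong (+ 8 * q *_) (∑-eqF v (λ v → + d v)))) (≤-trans (8qd≤s v) (≤-by (+ 8 * z) (0≤* (0≤ℕ 8) 0≤z) (lem z)))
        where
        lem : ∀ z → + 9 * z ≡ z + + 8 * z
        lem = solve-∀
      lem₁ : ∀ N z f x → N * (z * z) * (+ 12 * z * f * x) ≡ x * (+ 12 * (N * (z * z * z))) * f
      lem₁ = solve-∀
      lem₂ : ∀ a b c e → a * (b * c * e) ≡ e * (a * b * c)
      lem₂ = solve-∀

    -- Every vertex of a largest component lies in a large component.
    upper-tail : ∀ B (event : Graph n → Bool) → + 2 ≤ B →
      (∀ {G} → G ∈ realisations n d → event G ≡ true → B * N ≤ + 2 * (+ largestComp G * z)) →
      B * count event (realisations n d) ≤ + 4 * Cb * numReal d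
    upper-tail B event 2≤B large = *-cancelˡ (+ 6 * F) (*-mono {+ 1} {+ 6} (0≤ℕ 1) (1≤⇒0≤ (1≤factorials d)) (+≤+ (ℕ.s≤s ℕ.z≤n)) (1≤factorials d))
      (*-cancelˡ (N * z) (*-mono (0≤ℕ 1) 0≤z 1≤N 1≤s) (begin
      N * z * (+ 6 * F * (B * cnt))                            ≡⟨ lem₁ N z F B cnt ⟩
      + 6 * z * F * (B * N * cnt)                              ≤⟨ *-monoˡ (+ 6 * z * F) 0≤6zF (count-≤-*∑ (B * N) (+ 2 * z) event (inLarge s) (realisations n d) each) ⟩
      + 6 * z * F * (+ 2 * z * ∑ X)                            ≡⟨ trans (lem₂ z F (∑ X)) (cong (z *_) (sym (∑-* (+ 12 * z * F) X))) ⟩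
      z * ∑ (λ v → + 12 * z * F * X v)                         ≤⟨ *-monoˡ z 0≤z (∑-mono vertex-bound) ⟩
      z * ∑ (λ v → dd m * Cb * + d v)                          ≡⟨ cong (z *_) (∑-* (dd m * Cb) (λ v → + d v)) ⟩
      z * (dd m * Cb * ∑ (λ v → + d v))                        ≤⟨ *-monoˡ z 0≤z (*-mono (0≤* (0≤dd m) 0≤Cb) (0≤* (0≤ℕ 3) 0≤N) (*-monoʳ Cb 0≤Cb (simple m total)) M≤3n) ⟩
      z * (+ 8 * (numReal d * F) * Cb * (+ 3 * N))             ≡⟨ lem₃ z (numReal d) F Cb N ⟩
      N * z * (+ 6 * F * (+ 4 * Cb * numReal d))               ∎))
      where
      cnt : ℤ
      cnt = count event (realisations n d)
      0≤6zF : + 0 ≤ + 6 * z * F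
      0≤6zF = 0≤* (0≤* (0≤ℕ 6) 0≤z) (1≤⇒0≤ (1≤factorials d))
      lem₁ : ∀ N z F B c → N * z * (+ 6 * F * (B * c)) ≡ + 6 * z * F * (B * N * c)
      lem₁ = solve-∀
      lem₂ : ∀ z F X → + 6 * z * F * (+ 2 * z * X) ≡ z * (+ 12 * z * F * X)
      lem₂ = solve-∀
      lem₃ : ∀ z g F C N → z * (+ 8 * (g * F) * C * (+ 3 * N)) ≡ N * z * (+ 6 * F * (+ 4 * C * g))
      lem₃ = solve-∀
      each : ∀ {G} → G ∈ realisations n d → B * N * ι (event G) ≤ + 2 * z * ∑ (λ w → ι (inLarge s w G))
      each {G} G∈ with bool? (event G)
      ... | inj₂ e rewrite e = ≤-trans (≤-reflexive (*-zeroʳ (B * N))) (0≤* (0≤* (0≤ℕ 2) 0≤z) (0≤∑ (λ w → 0≤ι (inLarge s w G))))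
      ... | inj₁ e rewrite e with maxF-attained (compSize G)
      ...   | inj₂ L≡0 = ⊥-elim (1≰0 (≤-trans (≤-trans (*-mono {+ 1} {B} (0≤ℕ 1) 0≤N (≤-trans (+≤+ (ℕ.s≤s ℕ.z≤n)) 2≤B) 1≤N) (large G∈ e)) (≤-reflexive (trans (cong (λ L → + 2 * (+ L * z)) L≡0) (cong (+ 2 *_) (*-zeroˡ z))))))
        where
        1≰0 : ¬ (+ 1 ≤ + 0)
        1≰0 (+≤+ ())
      ...   | inj₁ (v , L) = begin
        B * N * + 1                                    ≡⟨ *-identityʳ (B * N) ⟩
        B * N                                          ≤⟨ large G∈ e ⟩
        + 2 * (+ largestComp G * z)                    ≡⟨ lem (+ largestComp G) z ⟩
        + 2 * z * + largestComp G                      ≡⟨ cong (λ k → + 2 * z * + k) (sym L) ⟩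
        + 2 * z * + compSize G v                       ≤⟨ *-monoˡ (+ 2 * z) (0≤* (0≤ℕ 2) 0≤z) (≤-trans (≤-reflexive (countF-∑ (connected G v))) (∑-mono (λ w → ι-mono (member w)))) ⟩
        + 2 * z * ∑ (λ w → ι (inLarge s w G))          ∎
        where
        lem : ∀ a b → + 2 * (a * b) ≡ + 2 * b * a
        lem = solve-∀
        n≤ : n ℕ.≤ s ℕ.* compSize G v
        n≤ = drop‿+≤+ (*-cancelˡ (+ 2) (+≤+ (ℕ.s≤s ℕ.z≤n)) (begin
          + 2 * N                            ≤⟨ *-monoʳ N 0≤N 2≤B ⟩
          B * N                              ≤⟨ large G∈ e ⟩
          + 2 * (+ largestComp G * z)        ≡⟨ cong (+ 2 *_) (trans (cong (λ k → + k * z) (sym L)) (trans (*-comm (+ compSize G v) z) (sym (pos-* s (compSize G v))))) ⟩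
          + 2 * + (s ℕ.* compSize G v)       ∎))
        member : ∀ w → connected G v w ≡ true → inLarge s w G ≡ true
        member w con = ⇒anyF (λ c → connected G c w ∧ (n ℕ.≤ᵇ s ℕ.* compSize G c)) v (cong₂ _∧_ con (T⇒ (ℕₚ.≤⇒≤ᵇ n≤)))

  ρ⁺ : ℕ → ℤ
  ρ⁺ k = + k * + (k ℕ.∸ 2)

  0≤ρ⁺ : ∀ k → + 0 ≤ ρ⁺ k
  0≤ρ⁺ k = 0≤* (0≤ℕ k) (0≤ℕ (k ℕ.∸ 2))

  η≤ρ⁺ : ∀ k → η k ≤ ρ⁺ k
  η≤ρ⁺ zero = ≤-refl
  η≤ρ⁺ (suc zero) = -≤+
  η≤ρ⁺ (suc (suc k)) = ≤-refl

  k*ρ⁺≤3ρ : ∀ k → + k * ρ⁺ k ≤ + 3 * ρ k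
  k*ρ⁺≤3ρ zero = ≤-refl
  k*ρ⁺≤3ρ (suc zero) = 0≤ℕ 3
  k*ρ⁺≤3ρ (suc (suc zero)) = ≤-refl
  k*ρ⁺≤3ρ (suc (suc (suc j))) = ≤-by (+ 2 * + (3 ℕ.+ j) * (+ (suc j) * + j)) (0≤* (0≤* (0≤ℕ 2) (0≤ℕ (3 ℕ.+ j))) (0≤* (0≤ℕ (suc j)) (0≤ℕ j)))
    (lem (+ j))
    where
    lem : ∀ j → + 3 * ((+ 3 + j) * ((+ 1 + j) * (+ 1 + j))) ≡ (+ 3 + j) * ((+ 3 + j) * (+ 1 + j)) + + 2 * (+ 3 + j) * ((+ 1 + j) * j)
    lem = solve-∀

  pos : ℤ → ℤ
  pos (+ n) = + n
  pos -[1+ n ] = + 0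

  0≤pos : ∀ a → + 0 ≤ pos a
  0≤pos (+ n) = 0≤ℕ n
  0≤pos -[1+ n ] = ≤-refl

  pos-nonneg : ∀ {a} → + 0 ≤ a → pos a ≡ a
  pos-nonneg {+ n} p = refl

  pos-nonpos : ∀ {a} → a ≤ + 0 → pos a ≡ + 0
  pos-nonpos { + zero} p = refl
  pos-nonpos { + suc n} (+≤+ ())
  pos-nonpos { -[1+ n ]} p = refl

  pos-≤ : ∀ {a b} → a ≤ b → + 0 ≤ b → pos a ≤ b
  pos-≤ { + n} p q = p
  pos-≤ { -[1+ n ]} p q = q

  -- The second derivative of x ↦ (pos x)² is at most 2.
  pos²-step : ∀ a t → pos (a - t) * pos (a - t) ≤ pos a * pos a - + 2 * t * pos a + t * t
  pos²-step a t with + 0 ≤? a - t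
  ... | no ¬p = ≤-trans (≤-reflexive (cong (λ x → x * x) (pos-nonpos (<⇒≤ (≰⇒> ¬p))))) (subst (+ 0 ≤_) (lem (pos a) t) (0≤sq (pos a - t)))
    where
    lem : ∀ p t → (p - t) * (p - t) ≡ p * p - + 2 * t * p + t * t
    lem = solve-∀
  ... | yes p with + 0 ≤? a
  ...   | yes q rewrite pos-nonneg p | pos-nonneg q = ≤-reflexive (lem a t)
    where
    lem : ∀ p t → (p - t) * (p - t) ≡ p * p - + 2 * t * p + t * t
    lem = solve-∀
  ...   | no ¬q rewrite pos-nonneg p | pos-nonpos (<⇒≤ (≰⇒> ¬q)) =
    ≤-by ((- a) * ((a - t) + (- t))) (0≤* 0≤-a (0≤+ p (≤-trans p (≤-by (- a) 0≤-a (lem₁ a t))))) (lem₂ a t)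
    where
    0≤-a : + 0 ≤ - a
    0≤-a = neg-mono-≤ (<⇒≤ (≰⇒> ¬q))
    lem₁ : ∀ a t → - t ≡ a - t + - a
    lem₁ = solve-∀
    lem₂ : ∀ a t → + 0 * + 0 - + 2 * t * + 0 + t * t ≡ (a - t) * (a - t) + (- a) * ((a - t) + (- t))
    lem₂ = solve-∀

  walk-mono : ∀ {n} {G : Graph n} {v w} {j k} → j ℕ.≤ k → walkWithin G j v w ≡ true → walkWithin G k v w ≡ true
  walk-mono {j = j} {k} j≤k e with ℕₚ.m≤n⇒∃[o]m+o≡n j≤k
  walk-mono {n} {G} {v} {w} {j} {k} j≤k e | o , refl = go o
    where
    go : ∀ o → walkWithin G (j ℕ.+ o) v w ≡ true
    go zero = trans (cong (λ k → walkWithin G k v w) (ℕₚ.+-identityʳ j)) e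
    go (suc o) = trans (cong (λ k → walkWithin G k v w) (ℕₚ.+-suc j o)) (cong (_∨ anyF n (λ u → walkWithin G (j ℕ.+ o) v u ∧ adj G u w)) (go o))

  walk-snoc : ∀ {n} {G : Graph n} k {v u w} → walkWithin G k v u ≡ true → adj G u w ≡ true → walkWithin G (suc k) v w ≡ true
  walk-snoc {n} {G} k {v} {u} {w} e a =
    trans (cong (walkWithin G k v w ∨_) (⇒anyF (λ u → walkWithin G k v u ∧ adj G u w) u (cong₂ _∧_ e a))) (∨-zeroʳ (walkWithin G k v w))

  -- The exploration of the whole graph: C ⊆ S is the component being explored, found vertices have been
  -- discovered along edges and restarts vertices (of degree 1) without.
  record Exploring {n} (d : DegSeq n) (Δ : ℤ) (P : Graph n → Bool) (K : Fin n → Fin n → Bool)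
                   (S C : Fin n → Bool) (r : Fin n → ℕ) (m : ℕ) (found restarts : ℤ) : Set where
    field
      explored : Explored d P K S r m
      C⊆S : ∀ v → C v ≡ true → S v ≡ true
      exhausted : ∀ v → S v ≡ true → C v ≡ false → r v ≡ 0
      root : Fin n
      radius : ℕ
      reach : ∀ {G} → G ∈ realisations n d → P G ≡ true → ∀ v → C v ≡ true → walkWithin G radius root v ≡ true
      radius-size : + suc radius ≡ size C
      weight : inS S (λ v → + d v) ≤ Δ * found + restarts
      0≤found : + 0 ≤ found
      0≤restarts : + 0 ≤ restarts

  size≤n : ∀ {n} (S : Fin n → Bool) → size S ≤ + n
  size≤n {n} S = ≤-trans (inS≤∑ S (λ _ → 0≤ℕ 1)) (≤-reflexive (∑-one n))

  insert-false : ∀ {n} {S : Fin n → Bool} {w} v → insert S w v ≡ false → S v ≡ false × v ≢ w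
  insert-false {S = S} {w} v e with S v | eqF v w in e′
  ... | false | false = refl , (λ { refl → true≢false (eqF-refl v) e′ })

  insert-true : ∀ {n} {S : Fin n → Bool} {w} v → insert S w v ≡ true → S v ≡ true ⊎ v ≡ w
  insert-true {S = S} {w} v e with S v | eqF v w in e′
  ... | true | _ = inj₁ refl
  ... | false | true = inj₂ (eqF⇒≡ v w e′)

  dec-zero : ∀ {n} (u v : Fin n) r → r v ≡ 0 → dec u r v ≡ 0
  dec-zero u v r e with eqF v u
  ... | true = cong pred e
  ... | false = e

  module _ {n} {d : DegSeq n} {Δ : ℤ} {P K S C r m found restarts}
           (I : Exploring {n} d Δ P K S C r m found restarts) where
    open Exploring I

    active⇒C : ∀ {u} → S u ≡ true → 1 ℕ.≤ r u → C u ≡ true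
    active⇒C {u} Su pu with bool? (C u)
    ... | inj₁ e = e
    ... | inj₂ e with subst (1 ℕ.≤_) (exhausted u Su e) pu
    ...   | ()

    exploring-in : ∀ {u w} → S u ≡ true → S w ≡ true → u ≢ w → 1 ℕ.≤ r u → 1 ℕ.≤ r w → K u w ≡ false →
      Exploring d Δ (learn P K u w) (addEdge K u w) S C (dec w (dec u r)) (m ℕ.∸ 2) found restarts
    exploring-in {u} {w} Su Sw u≢w pu pw k = record
      { explored = explore explored (λ _ e → e) Su Sw u≢w pu pw k
      ; C⊆S = C⊆S
      ; exhausted = λ v Sv Cv → dec-zero w v (dec u r) (dec-zero u v r (exhausted v Sv Cv))
      ; root = root ; radius = radius
      ; reach = λ G∈ p → reach G∈ (proj₁ (∧-true p))
      ; radius-size = radius-size ; weight = weight ; 0≤found = 0≤found ; 0≤restarts = 0≤restarts }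

    exploring-out : (∀ v → + d v ≤ Δ) → ∀ {u w} → S u ≡ true → S w ≡ false → u ≢ w → 1 ℕ.≤ r u → 1 ℕ.≤ r w → K u w ≡ false →
      Exploring d Δ (learn P K u w) (addEdge K u w) (insert S w) (insert C w) (dec w (dec u r)) (m ℕ.∸ 2) (found + + 1) restarts
    exploring-out d≤Δ {u} {w} Su Sw u≢w pu pw k = record
      { explored = explore explored (insert-⊇ {S = S}) (insert-⊇ {S = S} u Su) (insert-new S w) u≢w pu pw k
      ; C⊆S = C⊆S′
      ; exhausted = exhausted′
      ; root = root ; radius = suc radius
      ; reach = reach′
      ; radius-size = trans (cong (_+_ (+ 1)) radius-size) (trans (+-comm (+ 1) (size C)) (sym (inS-insert C Cw (λ _ → + 1))))
      ; weight = ≤-trans (≤-reflexive (inS-insert S Sw (λ v → + d v))) (≤-trans (+-mono-≤ weight (d≤Δ w)) (≤-reflexive (lem Δ found restarts)))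
      ; 0≤found = 0≤+ 0≤found (0≤ℕ 1)
      ; 0≤restarts = 0≤restarts }
      where
      lem : ∀ a b c → a * b + c + a ≡ a * (b + + 1) + c
      lem = solve-∀
      Cw : C w ≡ false
      Cw with bool? (C w)
      ... | inj₁ e = ⊥-elim (true≢false (C⊆S w e) Sw)
      ... | inj₂ e = e
      C⊆S′ : ∀ v → insert C w v ≡ true → insert S w v ≡ true
      C⊆S′ v e with insert-true {S = C} v e
      ... | inj₁ Cv = insert-⊇ {S = S} v (C⊆S v Cv)
      ... | inj₂ refl = insert-new S w
      exhausted′ : ∀ v → insert S w v ≡ true → insert C w v ≡ false → dec w (dec u r) v ≡ 0
      exhausted′ v Sv Cv with insert-false {S = C} v Cv | insert-true {S = S} v Sv
      ... | Cv′ , v≢w | inj₂ e = ⊥-elim (v≢w e)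
      ... | Cv′ , v≢w | inj₁ Sv′ = dec-zero w v (dec u r) (dec-zero u v r (exhausted v Sv′ Cv′))
      reach′ : ∀ {G} → G ∈ realisations n d → learn P K u w G ≡ true → ∀ v → insert C w v ≡ true → walkWithin G (suc radius) root v ≡ true
      reach′ {G} G∈ p v e with insert-true {S = C} v e
      ... | inj₁ Cv = walk-mono (ℕₚ.n≤1+n radius) (reach G∈ (proj₁ (∧-true p)) v Cv)
      ... | inj₂ refl = walk-snoc radius (reach G∈ (proj₁ (∧-true p)) u (active⇒C Su pu)) (proj₁ (∧-true (proj₂ (∧-true {P G} p))))

    C-component : ∀ {G} → G ∈ realisations n d → P G ≡ true → size C ≤ + largestComp G
    C-component {G} G∈ p = begin
      size C                                     ≡⟨ size-∑ C ⟩
      ∑ (λ v → ι (C v))                          ≤⟨ ∑-mono (λ v → ι-mono (λ Cv → walk-mono radius≤n (reach G∈ p v Cv))) ⟩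
      ∑ (λ v → ι (connected G root v))           ≡⟨ countF-∑ (connected G root) ⟨
      + compSize G root                          ≤⟨ +≤+ (≤maxF (compSize G) root) ⟩
      + largestComp G                            ∎
      where
      open ≤-Reasoning
      radius≤n : radius ℕ.≤ n
      radius≤n = ℕₚ.≤-trans (ℕₚ.n≤1+n radius) (drop‿+≤+ (≤-trans (≤-reflexive radius-size) (size≤n C)))

  exploring-restart : ∀ {n} {d : DegSeq n} {Δ P K S r m found restarts v} → Explored d P K S r m → active S r ≡ + 0 →
    inS S (λ v → + d v) ≤ Δ * found + restarts → + 0 ≤ found → + 0 ≤ restarts → S v ≡ false → d v ≡ 1 →
    Exploring d Δ P K (insert S v) (λ x → eqF x v) r m found (restarts + + 1)
  exploring-restart {n} {d} {Δ} {P} {K} {S} {r} {m} {found} {restarts} {v} E Y0 weight 0≤found 0≤restarts Sv dv = record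
    { explored = record { residual = residual ; revealed = revealed ; K-sym = K-sym ; within = λ i j k → insert-⊇ {S = S} i (within i j k) ; total = total }
    ; C⊆S = λ x e → trans (cong (S x ∨_) e) (∨-zeroʳ (S x))
    ; exhausted = exhausted
    ; root = v ; radius = 0
    ; reach = λ _ _ x e → trans (cong (λ y → toℕ v ≡ᵇ toℕ y) (eqF⇒≡ x v e)) (T⇒ (ℕₚ.≡⇒≡ᵇ (toℕ v) (toℕ v) refl))
    ; radius-size = sym (∑-eqF v (λ _ → + 1))
    ; weight = ≤-trans (≤-reflexive (trans (inS-insert S Sv (λ v → + d v)) (cong (λ k → inS S (λ v → + d v) + + k) dv)))
        (≤-trans (+-monoˡ-≤ (+ 1) weight) (≤-reflexive (+-assoc (Δ * found) restarts (+ 1))))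
    ; 0≤found = 0≤found ; 0≤restarts = 0≤+ 0≤restarts (0≤ℕ 1) }
    where
    open Explored E
    exhausted : ∀ x → insert S v x ≡ true → eqF x v ≡ false → r x ≡ 0
    exhausted x e x≢v with insert-true {S = S} x e
    ... | inj₂ refl = ⊥-elim (true≢false (eqF-refl x) x≢v)
    ... | inj₁ Sx = +-injective (trans (sym (trans (cong (λ b → ι b * + r x) Sx) (*-identityˡ (+ r x))))
            (∑≡0⇒ (λ v → ι (S v) * + r v) (λ v → 0≤* (0≤ι (S v)) (0≤ℕ (r v))) Y0 x))

  record LowerData {n} (d : DegSeq n) : Set where
    field
      s : ℕ
      g q τ Λ Δ c : ℤ
      n≤M : + n ≤ ∑ (λ v → + d v)
      M≤3n : ∑ (λ v → + d v) ≤ + 3 * + n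
      s³≤V : + s * + s * + s ≤ ∑ (λ v → ρ (d v))
      V≤24s³ : ∑ (λ v → ρ (d v)) ≤ + 24 * (+ s * + s * + s)
      -Λs²≤D : - (Λ * (+ s * + s)) ≤ ∑ (λ v → η (d v))
      d≤Δ : ∀ v → + d v ≤ Δ
      8Δ≤s : + 8 * Δ ≤ + s
      qΔ≤s : q * Δ ≤ + s
      4cΔ≤s : + 4 * c * Δ ≤ + s
      1≤c : + 1 ≤ c
      n≤cn₁ : + n ≤ c * ∑ (λ v → ι (d v ≡ᵇ 1))
      0≤Λ : + 0 ≤ Λ
      8≤g : + 8 ≤ g
      144≤q : + 144 ≤ q
      72g≤q² : + 72 * g ≤ q * q
      8Λ≤q : + 8 * (Λ + + 1) ≤ q
      τ-large : + 2 * g * (+ 2 * q * (Λ + + 1) + + 24 * (q * q) + + 96) ≤ τ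
      q≤s : q ≤ + s
      4cs²≤n : + 4 * c * (+ s * + s) ≤ + n
      τs≤n : τ * + s ≤ + n
      1≤d : ∀ v → 1 ℕ.≤ d v
      event : Graph n → Bool
      small : ∀ {G} → G ∈ realisations n d → event G ≡ true → + 2 * (τ * + s * + largestComp G) ≤ + n

  -- The exploration first climbs to height s / q (phase one, driven by the variance) and then stays
  -- positive for n / (τ s) further discoveries (phase two), because the drift is small compared with s / q.
  module Lower {n} {d : DegSeq n} (H : LowerData d) where

    open LowerData H

    private
      N z z² z³ V : ℤ
      N = + n
      z = + s
      z² = z * z
      z³ = z * z * z
      V = ∑ (λ v → ρ (d v))
    open ≤-Reasoning

    1≤g : + 1 ≤ g
    1≤g = ≤-trans (+≤+ (ℕ.s≤s ℕ.z≤n)) 8≤g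
    1≤q : + 1 ≤ q
    1≤q = ≤-trans (+≤+ (ℕ.s≤s ℕ.z≤n)) 144≤q
    0≤g : + 0 ≤ g
    0≤g = 1≤⇒0≤ 1≤g
    0≤q : + 0 ≤ q
    0≤q = 1≤⇒0≤ 1≤q
    0≤qq : + 0 ≤ q * q
    0≤qq = 0≤* 0≤q 0≤q
    1≤z : + 1 ≤ z
    1≤z = ≤-trans 1≤q q≤s
    0≤z : + 0 ≤ z
    0≤z = 0≤ℕ s
    0≤N : + 0 ≤ N
    0≤N = 0≤ℕ n
    0≤c : + 0 ≤ c
    0≤c = 1≤⇒0≤ 1≤c
    0≤z² : + 0 ≤ z²
    0≤z² = 0≤* 0≤z 0≤z
    0≤z³ : + 0 ≤ z³
    0≤z³ = 0≤* 0≤z² 0≤z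
    1≤z² : + 1 ≤ z²
    1≤z² = *-mono (0≤ℕ 1) 0≤z 1≤z 1≤z
    0≤W : + 0 ≤ + 2 * q * (Λ + + 1) + + 24 * (q * q) + + 96
    0≤W = 0≤+ (0≤+ (0≤* (0≤* (0≤ℕ 2) 0≤q) (0≤+ 0≤Λ (0≤ℕ 1))) (0≤* (0≤ℕ 24) 0≤qq)) (0≤ℕ 96)
    1≤τ : + 1 ≤ τ
    1≤τ = ≤-trans (*-mono (0≤ℕ 1) 0≤W (*-mono {+ 1} {+ 2} (0≤ℕ 1) 0≤g (+≤+ (ℕ.s≤s ℕ.z≤n)) 1≤g)
      (≤-trans (+≤+ (ℕ.s≤s ℕ.z≤n)) (≤-by (+ 2 * q * (Λ + + 1) + + 24 * (q * q)) (0≤+ (0≤* (0≤* (0≤ℕ 2) 0≤q) (0≤+ 0≤Λ (0≤ℕ 1))) (0≤* (0≤ℕ 24) 0≤qq)) (+-comm (+ 2 * q * (Λ + + 1) + + 24 * (q * q)) (+ 96))))) τ-large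
    0≤τ : + 0 ≤ τ
    0≤τ = 1≤⇒0≤ 1≤τ
    1≤N : + 1 ≤ N
    1≤N = ≤-trans (*-mono (0≤ℕ 1) 0≤z 1≤τ 1≤z) τs≤n
    0≤gN : + 0 ≤ g * N
    0≤gN = 0≤* 0≤g 0≤N
    0≤gNz : + 0 ≤ g * N * z
    0≤gNz = 0≤* 0≤gN 0≤z

    den : ℤ
    den = g * N * z³
    0≤den : + 0 ≤ den
    0≤den = 0≤* 0≤gN 0≤z³

    rem rem⁺ : (Fin n → Bool) → ℤ
    rem S = inS S (λ v → ρ (d v))
    rem⁺ S = inS S (λ v → ρ⁺ (d v))
    0≤rem : ∀ S → + 0 ≤ rem S
    0≤rem S = 0≤inS S (λ v → 0≤ρ (d v))
    0≤rem⁺ : ∀ S → + 0 ≤ rem⁺ S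
    0≤rem⁺ S = 0≤inS S (λ v → 0≤ρ⁺ (d v))
    0≤size : ∀ (S : Fin n → Bool) → + 0 ≤ size S
    0≤size S = 0≤inS S (λ _ → 0≤ℕ 1)

    out-η : ∀ S → rem⁺ S ≤ z² → - ((Λ + + 1) * z²) ≤ outS S (λ v → η (d v))
    out-η S h = begin
      - ((Λ + + 1) * z²)                                    ≡⟨ lem Λ z² ⟩
      - (Λ * z²) - z²                                       ≤⟨ +-mono-≤ -Λs²≤D (neg-mono-≤ (≤-trans (inS-mono S (λ v → η≤ρ⁺ (d v))) h)) ⟩
      ∑ (λ v → η (d v)) - inS S (λ v → η (d v))             ≡⟨ cong (_- inS S (λ v → η (d v))) (in+out S (λ v → η (d v))) ⟨
      inS S (λ v → η (d v)) + outS S (λ v → η (d v)) - inS S (λ v → η (d v)) ≡⟨ lem′ (inS S (λ v → η (d v))) (outS S (λ v → η (d v))) ⟩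
      outS S (λ v → η (d v))                                ∎
      where
      lem : ∀ a b → - ((a + + 1) * b) ≡ - (a * b) - b
      lem = solve-∀
      lem′ : ∀ a b → a + b - a ≡ b
      lem′ = solve-∀

    out-dρ⁺ : ∀ S → outS S (λ v → + d v * ρ⁺ (d v)) ≤ + 72 * z³
    out-dρ⁺ S = begin
      outS S (λ v → + d v * ρ⁺ (d v))    ≤⟨ outS≤∑ S (λ v → 0≤* (0≤ℕ (d v)) (0≤ρ⁺ (d v))) ⟩
      ∑ (λ v → + d v * ρ⁺ (d v))         ≤⟨ ∑-mono (λ v → k*ρ⁺≤3ρ (d v)) ⟩
      ∑ (λ v → + 3 * ρ (d v))            ≡⟨ ∑-* (+ 3) (λ v → ρ (d v)) ⟩
      + 3 * V                            ≤⟨ *-monoˡ (+ 3) (0≤ℕ 3) V≤24s³ ⟩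
      + 3 * (+ 24 * z³)                  ≡⟨ *-assoc (+ 3) (+ 24) z³ ⟨
      + 72 * z³                          ∎

    success : ∀ {P K S C r m found restarts φ} → Exploring d Δ P K S C r m found restarts → + 0 ≤ φ →
      N ≤ τ * z * size C → Good d event den P r m φ
    success {C = C} {φ = φ} I 0≤φ h = Good-none 0≤φ none
      where
      none : ∀ {G} → G ∈ realisations n d → _ → event G ≡ false
      none {G} G∈ p with bool? (event G)
      ... | inj₂ e = e
      ... | inj₁ e = ⊥-elim (absurd (begin
          + 2 * N                                ≤⟨ *-monoˡ (+ 2) (0≤ℕ 2) (≤-trans h (*-monoˡ (τ * z) (0≤* 0≤τ 0≤z) (C-component I G∈ p))) ⟩
          + 2 * (τ * z * + largestComp G)        ≤⟨ small G∈ e ⟩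
          N                                      ∎))
        where
        absurd : ¬ (+ 2 * N ≤ N)
        absurd q with ≤-trans 1≤N (subst₂ _≤_ (lem N) (+-inverseʳ N) (+-monoˡ-≤ (- N) q))
          where
          lem : ∀ a → + 2 * a - a ≡ a
          lem = solve-∀
        ... | +≤+ ()

    m∸2≤ : ∀ {m k} → m ℕ.≤ suc k → m ℕ.∸ 2 ℕ.≤ k
    m∸2≤ {m} {k} h = ℕₚ.≤-trans (ℕₚ.∸-monoˡ-≤ 2 h) (ℕₚ.m∸n≤m k 1)

    1≰0 : ¬ (+ 1 ≤ + 0)
    1≰0 (+≤+ ())

    ≰⇒≤ : ∀ {a b} → ¬ (a ≤ b) → b ≤ a
    ≰⇒≤ p = <⇒≤ (≰⇒> p)

    no-active : ∀ (S : Fin n → Bool) r → ¬ (+ 1 ≤ active S r) → active S r ≡ + 0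
    no-active S r y≰ = ≤-antisym (subst (_≤ + 0) (lem (active S r)) (i≤j⇒i-j≤0 (≰⇒1+≤ y≰))) (0≤active S r)
      where
      lem : ∀ a → a + + 1 - + 1 ≡ a
      lem = solve-∀

    size-insert : ∀ {S : Fin n → Bool} {w} → S w ≡ false → size (insert S w) ≡ size S + + 1
    size-insert {S} w∉ = inS-insert S w∉ (λ _ → + 1)

    C∌ : ∀ {P K S C r m found restarts} → Exploring d Δ P K S C r m found restarts → ∀ {w} → S w ≡ false → C w ≡ false
    C∌ {C = C} I {w} Sw with bool? (C w)
    ... | inj₁ e = ⊥-elim (true≢false (Exploring.C⊆S I w e) Sw)
    ... | inj₂ e = e

    1≤out : ∀ {y} w → + 1 ≤ y → + 0 ≤ y + (+ d w - + 2)
    1≤out {y} w 1≤y = subst (+ 0 ≤_) (lem y (+ d w)) (0≤+ (0≤- 1≤y) (0≤- (+≤+ (1≤d w))))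
      where
      lem : ∀ a b → (a - + 1) + (b - + 1) ≡ a + (b - + 2)
      lem = solve-∀

    Good-mono : ∀ {P r m φ φ′} → φ ≤ φ′ → Good d event den P r m φ → Good d event den P r m φ′
    Good-mono {m = m} h (good b) = good (≤-trans b (*-monoˡ (dd m) (0≤dd m) h))


    f : ℤ → ℤ
    f y = pos (z - q * y) * pos (z - q * y)

    0≤f : ∀ y → + 0 ≤ f y
    0≤f y = 0≤sq (pos (z - q * y))

    f-step : ∀ y x → f (y + x) ≤ f y - + 2 * (q * x) * pos (z - q * y) + (q * x) * (q * x)
    f-step y x = ≤-trans (≤-reflexive (cong (λ a → pos a * pos a) (lem z q y x))) (pos²-step (z - q * y) (q * x))
      where
      lem : ∀ z q y x → z - q * (y + x) ≡ z - q * y - q * x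
      lem = solve-∀

    p≤z : ∀ {y} → + 0 ≤ y → pos (z - q * y) ≤ z
    p≤z {y} 0≤y = pos-≤ (≤-by (q * y) (0≤* 0≤q 0≤y) (lem z (q * y))) 0≤z
      where
      lem : ∀ a b → a ≡ a - b + b
      lem = solve-∀

    back₂ : ∀ {y} → + 1 ≤ y → (y - + 1) * (f (y - + 2) - f y) ≤ + 24 * z³
    back₂ {y} 1≤y with q * y ≤? z + + 2 * q
    ... | yes qy≤ = begin
      (y - + 1) * (f (y - + 2) - f y)
        ≤⟨ *-monoˡ (y - + 1) 0≤y-1 (≤-trans (+-monoˡ-≤ (- f y) (f-step y (- + 2))) (≤-reflexive (lem₁ (f y) q p))) ⟩
      (y - + 1) * (+ 4 * q * (p + q))
        ≡⟨ lem₂ y q p ⟩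
      (q * y - q) * (+ 4 * (p + q))
        ≤⟨ *-mono (subst (+ 0 ≤_) (lem₃ q y) (0≤* 0≤q 0≤y-1)) (0≤* (0≤ℕ 4) (0≤+ 0≤z 0≤z)) (≤-trans (+-monoˡ-≤ (- q) qy≤) (≤-trans (≤-reflexive (lem₄ z q)) (+-monoʳ-≤ z q≤s)))
             (*-monoˡ (+ 4) (0≤ℕ 4) (+-mono-≤ (p≤z (1≤⇒0≤ 1≤y)) q≤s)) ⟩
      (z + z) * (+ 4 * (z + z))
        ≤⟨ ≤-by (+ 8 * z³ + + 16 * (z² * (z - + 1))) (0≤+ (0≤* (0≤ℕ 8) 0≤z³) (0≤* (0≤ℕ 16) (0≤* 0≤z² (0≤- 1≤z)))) (lem₅ z) ⟩
      + 24 * z³ ∎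
      where
      p : ℤ
      p = pos (z - q * y)
      0≤y-1 : + 0 ≤ y - + 1
      0≤y-1 = 0≤- 1≤y
      lem₁ : ∀ f q p → f - + 2 * (q * - + 2) * p + (q * - + 2) * (q * - + 2) - f ≡ + 4 * q * (p + q)
      lem₁ = solve-∀
      lem₂ : ∀ y q p → (y - + 1) * (+ 4 * q * (p + q)) ≡ (q * y - q) * (+ 4 * (p + q))
      lem₂ = solve-∀
      lem₃ : ∀ q y → q * (y - + 1) ≡ q * y - q
      lem₃ = solve-∀
      lem₄ : ∀ z q → z + + 2 * q - q ≡ z + q
      lem₄ = solve-∀
      lem₅ : ∀ z → + 24 * (z * z * z) ≡ (z + z) * (+ 4 * (z + z)) + (+ 8 * (z * z * z) + + 16 * (z * z * (z - + 1)))
      lem₅ = solve-∀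
    ... | no ¬qy = begin
      (y - + 1) * (f (y - + 2) - f y)      ≡⟨ cong (λ x → (y - + 1) * (x * x - f y)) (pos-nonpos (subst (_≤ + 0) (lem z q y) (i≤j⇒i-j≤0 (≰⇒≤ ¬qy)))) ⟩
      (y - + 1) * (+ 0 - f y)              ≤⟨ ≤-by ((y - + 1) * f y) (0≤* (0≤- 1≤y) (0≤f y)) (lem′ (y - + 1) (f y)) ⟩
      + 0                                  ≤⟨ 0≤* (0≤ℕ 24) 0≤z³ ⟩
      + 24 * z³                            ∎
      where
      lem : ∀ z q y → z + + 2 * q - q * y ≡ z - q * (y - + 2)
      lem = solve-∀
      lem′ : ∀ a b → + 0 ≡ a * (+ 0 - b) + a * b
      lem′ = solve-∀

    -- f vanishes above height s / q and equals s² at height 0, where the potential reaches den.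
    pot₂ : ℤ → ℤ → ℤ → ℤ
    pot₂ y k e = g * N * z * (f y + e) + z³ * (N + τ * z - τ * z * k)

    0≤pot₂ : ∀ {y k e} → + 0 ≤ e → τ * z * k ≤ N + τ * z → + 0 ≤ pot₂ y k e
    0≤pot₂ {y} 0≤e h = 0≤+ (0≤* 0≤gNz (0≤+ (0≤f y) 0≤e)) (0≤* 0≤z³ (0≤- h))

    half-out : ∀ {S k found restarts} → inS S (λ v → + d v) ≤ Δ * found + restarts → + 0 ≤ found → z * found ≤ N + z * k →
      τ * z * k ≤ N → + 4 * restarts ≤ N → N ≤ + 2 * outS S (λ v → + d v)
    half-out {S} {k} {found} {restarts} weight 0≤found zf τzk rs = *-cancelˡ (+ 2) (+≤+ (ℕ.s≤s ℕ.z≤n)) (begin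
      + 2 * N                                      ≤⟨ ≤-by (+ 2 * N - + 4 * i) (0≤- 4i≤) refl ⟩
      + 2 * N + (+ 2 * N - + 4 * i)                ≡⟨ lem N i ⟩
      + 4 * N - + 4 * i                            ≤⟨ +-monoˡ-≤ (- (+ 4 * i)) (*-monoˡ (+ 4) (0≤ℕ 4) n≤M) ⟩
      + 4 * ∑ (λ v → + d v) - + 4 * i              ≡⟨ cong (λ x → + 4 * x - + 4 * i) (sym (in+out S (λ v → + d v))) ⟩
      + 4 * (i + o) - + 4 * i                      ≡⟨ lem′ i o ⟩
      + 2 * (+ 2 * o)                              ∎)
      where
      i o : ℤ
      i = inS S (λ v → + d v)
      o = outS S (λ v → + d v)
      lem : ∀ a b → + 2 * a + (+ 2 * a - + 4 * b) ≡ + 4 * a - + 4 * b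
      lem = solve-∀
      lem′ : ∀ a b → + 4 * (a + b) - + 4 * a ≡ + 2 * (+ 2 * b)
      lem′ = solve-∀
      lem₂ : ∀ D f r → + 2 * (+ 4 * (D * f + r)) ≡ + 8 * D * f + + 2 * (+ 4 * r)
      lem₂ = solve-∀
      lem₃ : ∀ a → a + a + + 2 * a ≡ + 2 * (+ 2 * a)
      lem₃ = solve-∀
      zk≤N : z * k ≤ N
      zk≤N with + 0 ≤? k
      ... | yes 0≤k = ≤-trans (≤-by ((τ - + 1) * (z * k)) (0≤* (0≤- 1≤τ) (0≤* 0≤z 0≤k)) (lem₄ τ z k)) τzk
        where
        lem₄ : ∀ t z k → t * z * k ≡ z * k + (t - + 1) * (z * k)
        lem₄ = solve-∀
      ... | no ¬0≤k = ≤-trans (*-monoˡ z 0≤z (≰⇒≤ ¬0≤k)) (≤-trans (≤-reflexive (*-zeroʳ z)) 0≤N)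
      4i≤ : + 4 * i ≤ + 2 * N
      4i≤ = *-cancelˡ (+ 2) (+≤+ (ℕ.s≤s ℕ.z≤n)) (begin
        + 2 * (+ 4 * i)                            ≤⟨ *-monoˡ (+ 2) (0≤ℕ 2) (*-monoˡ (+ 4) (0≤ℕ 4) weight) ⟩
        + 2 * (+ 4 * (Δ * found + restarts))       ≡⟨ lem₂ Δ found restarts ⟩
        + 8 * Δ * found + + 2 * (+ 4 * restarts)   ≤⟨ +-mono-≤ (≤-trans (*-monoʳ found 0≤found 8Δ≤s) (≤-trans zf (+-monoʳ-≤ N zk≤N))) (*-monoˡ (+ 2) (0≤ℕ 2) rs) ⟩
        N + N + + 2 * N                            ≡⟨ lem₃ N ⟩
        + 2 * (+ 2 * N)                            ∎)

    drift₂ : ∀ S {y k} → + 1 ≤ y → rem⁺ S ≤ z² → N ≤ + 2 * outS S (λ v → + d v) →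
      (y - + 1) * (pot₂ (y - + 2) k (rem⁺ S) - pot₂ y k (rem⁺ S)) +
      outS S (λ w → + d w * (pot₂ (y + (+ d w - + 2)) (k + + 1) (rem⁺ S + ρ⁺ (d w)) - pot₂ y k (rem⁺ S))) ≤ + 0
    drift₂ S {y} {k} 1≤y e≤z² half = *-cancelˡ (+ 2) (+≤+ (ℕ.s≤s ℕ.z≤n)) (begin
      + 2 * ((y - + 1) * (pot₂ (y - + 2) k e - pot₂ y k e) + outS S (λ w → + d w * (pot₂ (y + (+ d w - + 2)) (k + + 1) (e + ρ⁺ (d w)) - pot₂ y k e)))
        ≤⟨ *-monoˡ (+ 2) (0≤ℕ 2) (+-mono-≤ (≤-reflexive (lem₁ y (f (y - + 2)) (f y) G e (z³ * (N + τ * z - τ * z * k)))) (outS-mono S each)) ⟩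
      + 2 * (G * ((y - + 1) * (f (y - + 2) - f y)) + outS S (λ w → - (+ 2 * q * p * G) * η (d w) + q * q * G * ρ (d w) + G * (+ d w * ρ⁺ (d w)) + - (z³ * (τ * z)) * + d w))
        ≡⟨ cong (λ x → + 2 * (G * ((y - + 1) * (f (y - + 2) - f y)) + x)) expand ⟩
      + 2 * (G * ((y - + 1) * (f (y - + 2) - f y)) + (- (+ 2 * q * p * G) * oη + q * q * G * oρ + G * oρ⁺ + - (z³ * (τ * z)) * od))
        ≡⟨ lem₂ G ((y - + 1) * (f (y - + 2) - f y)) q p oη oρ oρ⁺ (z³ * (τ * z)) od ⟩
      + 2 * G * ((y - + 1) * (f (y - + 2) - f y) + + 2 * q * (p * - oη) + q * q * oρ + oρ⁺) - z³ * (τ * z) * (+ 2 * od)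
        ≤⟨ +-mono-≤ (*-monoˡ (+ 2 * G) (0≤* (0≤ℕ 2) 0≤gNz) (+-mono-≤ (+-mono-≤ (+-mono-≤ (back₂ 1≤y) (*-monoˡ (+ 2 * q) (0≤* (0≤ℕ 2) 0≤q) pη)) (*-monoˡ (q * q) 0≤qq (≤-trans (outS≤∑ S (λ v → 0≤ρ (d v))) V≤24s³))) (out-dρ⁺ S)))
             (neg-mono-≤ (*-monoˡ (z³ * (τ * z)) (0≤* 0≤z³ (0≤* 0≤τ 0≤z)) half)) ⟩
      + 2 * G * (+ 24 * z³ + + 2 * q * (z * ((Λ + + 1) * z²)) + q * q * (+ 24 * z³) + + 72 * z³) - z³ * (τ * z) * N
        ≡⟨ lem₃ g N z q Λ τ ⟩
      - (N * (z³ * z) * (τ - + 2 * g * (+ 2 * q * (Λ + + 1) + + 24 * (q * q) + + 96)))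
        ≤⟨ neg-mono-≤ (0≤* (0≤* 0≤N (0≤* 0≤z³ 0≤z)) (0≤- τ-large)) ⟩
      + 2 * + 0 ∎)
      where
      e p G oη oρ oρ⁺ od : ℤ
      e = rem⁺ S
      p = pos (z - q * y)
      G = g * N * z
      oη = outS S (λ v → η (d v))
      oρ = outS S (λ v → ρ (d v))
      oρ⁺ = outS S (λ v → + d v * ρ⁺ (d v))
      od = outS S (λ v → + d v)
      lem₁ : ∀ y a b G e c → (y - + 1) * (G * (a + e) + c - (G * (b + e) + c)) ≡ G * ((y - + 1) * (a - b))
      lem₁ = solve-∀
      lem₂ : ∀ G B q p h r s t o → + 2 * (G * B + (- (+ 2 * q * p * G) * h + q * q * G * r + G * s + - t * o)) ≡
        + 2 * G * (B + + 2 * q * (p * - h) + q * q * r + s) - t * (+ 2 * o)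
      lem₂ = solve-∀
      lem₃ : ∀ g N z q l t → + 2 * (g * N * z) * (+ 24 * (z * z * z) + + 2 * q * (z * ((l + + 1) * (z * z))) + q * q * (+ 24 * (z * z * z)) + + 72 * (z * z * z)) - z * z * z * (t * z) * N
        ≡ - (N * (z * z * z * z) * (t - + 2 * g * (+ 2 * q * (l + + 1) + + 24 * (q * q) + + 96)))
      lem₃ = solve-∀
      pη : p * - oη ≤ z * ((Λ + + 1) * z²)
      pη = *-mono (0≤pos (z - q * y)) (0≤* (0≤+ 0≤Λ (0≤ℕ 1)) 0≤z²) (p≤z (1≤⇒0≤ 1≤y))
        (≤-trans (neg-mono-≤ (out-η S e≤z²)) (≤-reflexive (neg-involutive ((Λ + + 1) * z²))))
      each : ∀ w → + d w * (pot₂ (y + (+ d w - + 2)) (k + + 1) (e + ρ⁺ (d w)) - pot₂ y k e) ≤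
        - (+ 2 * q * p * G) * η (d w) + q * q * G * ρ (d w) + G * (+ d w * ρ⁺ (d w)) + - (z³ * (τ * z)) * + d w
      each w = begin
        x * (pot₂ (y + (x - + 2)) (k + + 1) (e + ρ⁺ (d w)) - pot₂ y k e)
          ≡⟨ lemA x G (f (y + (x - + 2))) (f y) e (ρ⁺ (d w)) z³ N (τ * z) k ⟩
        G * x * (f (y + (x - + 2)) - f y) + (G * (x * ρ⁺ (d w)) + - (z³ * (τ * z)) * x)
          ≤⟨ +-monoˡ-≤ (G * (x * ρ⁺ (d w)) + - (z³ * (τ * z)) * x) (*-monoˡ (G * x) (0≤* 0≤gNz (0≤ℕ (d w))) (+-monoˡ-≤ (- f y) (f-step y (x - + 2)))) ⟩
        G * x * (f y - + 2 * (q * (x - + 2)) * p + (q * (x - + 2)) * (q * (x - + 2)) - f y) + (G * (x * ρ⁺ (d w)) + - (z³ * (τ * z)) * x)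
          ≡⟨ lemB G x (f y) q p (G * (x * ρ⁺ (d w))) (z³ * (τ * z)) ⟩
        - (+ 2 * q * p * G) * η (d w) + q * q * G * ρ (d w) + G * (x * ρ⁺ (d w)) + - (z³ * (τ * z)) * x ∎
        where
        x : ℤ
        x = + d w
        lemA : ∀ x G a b e r t N u k → x * (G * (a + (e + r)) + t * (N + u - u * (k + + 1)) - (G * (b + e) + t * (N + u - u * k))) ≡
          G * x * (a - b) + (G * (x * r) + - (t * u) * x)
        lemA = solve-∀
        lemB : ∀ G x f q p r t → G * x * (f - + 2 * (q * (x - + 2)) * p + (q * (x - + 2)) * (q * (x - + 2)) - f) + (r + - t * x) ≡
          - (+ 2 * q * p * G) * (x * (x - + 2)) + q * q * G * (x * ((x - + 2) * (x - + 2))) + r + - t * x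
        lemB = solve-∀
      expand : outS S (λ w → - (+ 2 * q * p * G) * η (d w) + q * q * G * ρ (d w) + G * (+ d w * ρ⁺ (d w)) + - (z³ * (τ * z)) * + d w) ≡
        - (+ 2 * q * p * G) * oη + q * q * G * oρ + G * oρ⁺ + - (z³ * (τ * z)) * od
      expand = trans (outS-+ S _ _) (cong₂ _+_ (trans (outS-+ S _ _) (cong₂ _+_ (trans (outS-+ S _ _)
        (cong₂ _+_ (outS-* S (- (+ 2 * q * p * G)) (λ v → η (d v))) (outS-* S (q * q * G) (λ v → ρ (d v)))))
        (outS-* S G (λ v → + d v * ρ⁺ (d v))))) (outS-* S (- (z³ * (τ * z))) (λ v → + d v)))

    phase₂ : ∀ k m → m ℕ.≤ k → ∀ {P K S C r found restarts} → Exploring d Δ P K S C r m found restarts →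
      z * found ≤ N + z * size C → + 4 * restarts ≤ N → τ * z * size C ≤ N + τ * z →
      Good d event den P r m (pot₂ (active S r) (size C) (rem⁺ S))
    phase₂ k m m≤k {P} {K} {S} {C} {r} {found} {restarts} I zf rs τzk with N ≤? τ * z * size C | den ≤? pot₂ (active S r) (size C) (rem⁺ S)
    ... | yes p | _ = success I (0≤pot₂ (0≤rem⁺ S) τzk) p
    ... | no _ | yes p = Good-top (Exploring.explored I) 0≤den p
    ... | no ¬succ | no ¬top = go k m≤k (+ 1 ≤? active S r)
      where
      open Exploring I
      y e φ : ℤ
      y = active S r
      e = rem⁺ S
      φ = pot₂ y (size C) e
      0≤φ : + 0 ≤ φ
      0≤φ = 0≤pot₂ (0≤rem⁺ S) τzk
      τzk≤N : τ * z * size C ≤ N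
      τzk≤N = ≰⇒≤ ¬succ
      f+e≤ : f y + e ≤ z²
      f+e≤ with f y + e ≤? z²
      ... | yes p = p
      ... | no ¬p = ⊥-elim (¬top (begin
        g * N * (z * z * z)          ≡⟨ lem (g * N) z ⟩
        g * N * z * z²               ≤⟨ *-monoˡ (g * N * z) 0≤gNz (≰⇒≤ ¬p) ⟩
        g * N * z * (f y + e)        ≤⟨ ≤-by (z³ * (N + τ * z - τ * z * size C)) (0≤* 0≤z³ (0≤- τzk)) refl ⟩
        φ                            ∎))
        where
        lem : ∀ a z → a * (z * z * z) ≡ a * z * (z * z)
        lem = solve-∀
      e≤ : e ≤ z²
      e≤ = ≤-trans (≤-by (f y) (0≤f y) (+-comm (f y) e)) f+e≤
      go : ∀ k → m ℕ.≤ k → Dec (+ 1 ≤ y) → Good d event den P r m φ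
      go _ _ (no y≰) = Good-top explored 0≤den (begin
        g * N * (z * z * z)                    ≤⟨ ≤-by (g * N * z * e + z³ * (N + τ * z - τ * z * size C)) (0≤+ (0≤* 0≤gNz (0≤rem⁺ S)) (0≤* 0≤z³ (0≤- τzk))) (lem (g * N) z e (z³ * (N + τ * z - τ * z * size C))) ⟩
        g * N * z * (z * z + e) + z³ * (N + τ * z - τ * z * size C)
          ≡⟨ cong (λ x → g * N * z * (x * x + e) + z³ * (N + τ * z - τ * z * size C)) (sym (pos-nonneg 0≤z)) ⟩
        g * N * z * (pos z * pos z + e) + z³ * (N + τ * z - τ * z * size C)
          ≡⟨ cong (λ x → g * N * z * (pos x * pos x + e) + z³ * (N + τ * z - τ * z * size C)) (sym (trans (cong (λ y → z - q * y) (no-active S r y≰)) (lem′ z q))) ⟩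
        φ                                      ∎)
        where
        lem : ∀ a z e c → a * z * (z * z + e) + c ≡ a * (z * z * z) + (a * z * e + c)
        lem = solve-∀
        lem′ : ∀ z q → z - q * + 0 ≡ z
        lem′ = solve-∀
      go zero m≤0 (yes 1≤y) = ⊥-elim (1≰0 (≤-trans 1≤y (≤-trans (≤-by (outS S (λ v → + d v)) (0≤outS S (λ v → 0≤ℕ (d v))) (total-split explored)) (+≤+ m≤0))))
      go (suc k) m≤k (yes 1≤y) with active-vertex S r 1≤y
      ... | u , Su , pu = reveal-split explored (pot₂ (y - + 2) (size C) e) (λ w → pot₂ (y + (+ d w - + 2)) (size C + + 1) (e + ρ⁺ (d w)))
          0≤den 0≤φ u Su pu next-in next-out (λ _ → 0≤pot₂ (0≤rem⁺ S) τzk) (λ w _ _ → 0≤pot₂ (0≤+ (0≤rem⁺ S) (0≤ρ⁺ (d w))) τzk+1)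
          (drift₂ S 1≤y e≤ (half-out {S} {size C} {found} {restarts} weight 0≤found zf τzk≤N rs))
        where
        τzk+1 : τ * z * (size C + + 1) ≤ N + τ * z
        τzk+1 = ≤-trans (≤-reflexive (lem (τ * z) (size C))) (+-monoˡ-≤ (τ * z) τzk≤N)
          where
          lem : ∀ a k → a * (k + + 1) ≡ a * k + a
          lem = solve-∀
        next-in : ∀ w → S w ≡ true → u ≢ w → 1 ℕ.≤ r w → K u w ≡ false →
          Good d event den (learn P K u w) (dec w (dec u r)) (m ℕ.∸ 2) (pot₂ (y - + 2) (size C) e)
        next-in w Sw ne pw kuw = subst (λ y → Good d event den (learn P K u w) (dec w (dec u r)) (m ℕ.∸ 2) (pot₂ y (size C) e))
          (active-in explored Su Sw ne pu pw)
          (phase₂ k (m ℕ.∸ 2) (m∸2≤ m≤k) (exploring-in I Su Sw ne pu pw kuw) zf rs τzk)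
        next-out : ∀ w → S w ≡ false → u ≢ w → 1 ℕ.≤ r w → K u w ≡ false →
          Good d event den (learn P K u w) (dec w (dec u r)) (m ℕ.∸ 2) (pot₂ (y + (+ d w - + 2)) (size C + + 1) (e + ρ⁺ (d w)))
        next-out w Sw ne pw kuw = subst (λ φ → Good d event den (learn P K u w) (dec w (dec u r)) (m ℕ.∸ 2) φ) φ≡
          (phase₂ k (m ℕ.∸ 2) (m∸2≤ m≤k) (exploring-out I d≤Δ Su Sw ne pu pw kuw) zf′ rs
            (subst (λ x → τ * z * x ≤ N + τ * z) (sym C+1) τzk+1))
          where
          C+1 : size (insert C w) ≡ size C + + 1
          C+1 = size-insert {C} {w} (C∌ I Sw)
          zf′ : z * (found + + 1) ≤ N + z * size (insert C w)
          zf′ = ≤-trans (≤-reflexive (*-distribˡ-+ z found (+ 1))) (≤-trans (+-monoˡ-≤ (z * + 1) zf)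
            (≤-reflexive (trans (lem N z (size C)) (cong (λ x → N + z * x) (sym C+1)))))
            where
            lem : ∀ n z k → n + z * k + z * + 1 ≡ n + z * (k + + 1)
            lem = solve-∀
          φ≡ : pot₂ (active (insert S w) (dec w (dec u r))) (size (insert C w)) (rem⁺ (insert S w)) ≡ pot₂ (y + (+ d w - + 2)) (size C + + 1) (e + ρ⁺ (d w))
          φ≡ = trans (cong₂ (λ y k → pot₂ y k (rem⁺ (insert S w))) (active-out explored Su Sw pu pw) C+1)
            (cong (pot₂ (y + (+ d w - + 2)) (size C + + 1)) (inS-insert S Sw (λ v → ρ⁺ (d v))))


    -- Each of s * found ≥ n, 2 e ≥ V, e⁺ ≥ s² and 4 c * restarts ≥ n makes a single term at least den.
    pot₁ : ℤ → ℤ → ℤ → ℤ → ℤ → ℤ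
    pot₁ y found e e⁺ restarts = + 36 * (N * z) * (+ 4 * z² - q * y * (q * y)) + q * q * (z³ * z) * found + + 2 * g * N * e
      + g * N * z * e⁺ + + 4 * c * g * z³ * restarts + z³ * (N + τ * z)

    module _ {y found e e⁺ restarts : ℤ} (0≤y : + 0 ≤ y) (qy≤2z : q * y ≤ + 2 * z) (0≤found : + 0 ≤ found) (0≤e : + 0 ≤ e)
             (0≤e⁺ : + 0 ≤ e⁺) (0≤restarts : + 0 ≤ restarts) where

      private
        a₁ a₂ a₃ a₄ a₅ a₆ φ : ℤ
        a₁ = + 36 * (N * z) * (+ 4 * z² - q * y * (q * y))
        a₂ = q * q * (z³ * z) * found
        a₃ = + 2 * g * N * e
        a₄ = g * N * z * e⁺
        a₅ = + 4 * c * g * z³ * restarts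
        a₆ = z³ * (N + τ * z)
        φ = pot₁ y found e e⁺ restarts
        0≤a₁ : + 0 ≤ a₁
        0≤a₁ = 0≤* (0≤* (0≤ℕ 36) (0≤* 0≤N 0≤z)) (0≤- (≤-trans (*-mono (0≤* 0≤q 0≤y) (0≤* (0≤ℕ 2) 0≤z) qy≤2z qy≤2z) (≤-reflexive (lem z))))
          where
          lem : ∀ z → + 2 * z * (+ 2 * z) ≡ + 4 * (z * z)
          lem = solve-∀
        0≤a₂ : + 0 ≤ a₂
        0≤a₂ = 0≤* (0≤* 0≤qq (0≤* 0≤z³ 0≤z)) 0≤found
        0≤a₃ : + 0 ≤ a₃
        0≤a₃ = 0≤* (0≤* (0≤* (0≤ℕ 2) 0≤g) 0≤N) 0≤e
        0≤a₄ : + 0 ≤ a₄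
        0≤a₄ = 0≤* 0≤gNz 0≤e⁺
        0≤a₅ : + 0 ≤ a₅
        0≤a₅ = 0≤* (0≤* (0≤* (0≤* (0≤ℕ 4) 0≤c) 0≤g) 0≤z³) 0≤restarts
        0≤a₆ : + 0 ≤ a₆
        0≤a₆ = 0≤* 0≤z³ (0≤+ 0≤N (0≤* 0≤τ 0≤z))

      0≤pot₁ : + 0 ≤ pot₁ y found e e⁺ restarts
      0≤pot₁ = 0≤+ (0≤+ (0≤+ (0≤+ (0≤+ 0≤a₁ 0≤a₂) 0≤a₃) 0≤a₄) 0≤a₅) 0≤a₆

      pot₂≤pot₁ : ∀ {k} → + 0 ≤ k → z ≤ q * y → pot₂ y k e⁺ ≤ pot₁ y found e e⁺ restarts
      pot₂≤pot₁ {k} 0≤k z≤qy = begin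
        g * N * z * (f y + e⁺) + z³ * (N + τ * z - τ * z * k)
          ≡⟨ cong (λ x → g * N * z * (x * x + e⁺) + z³ * (N + τ * z - τ * z * k)) (pos-nonpos (i≤j⇒i-j≤0 z≤qy)) ⟩
        g * N * z * (+ 0 * + 0 + e⁺) + z³ * (N + τ * z - τ * z * k)
          ≤⟨ ≤-by (a₁ + a₂ + a₃ + a₅ + z³ * (τ * z * k)) (0≤+ (0≤+ (0≤+ (0≤+ 0≤a₁ 0≤a₂) 0≤a₃) 0≤a₅) (0≤* 0≤z³ (0≤* (0≤* 0≤τ 0≤z) 0≤k)))
              (lem a₁ a₂ a₃ (g * N * z) e⁺ a₅ z³ (N + τ * z) (τ * z * k)) ⟩
        pot₁ y found e e⁺ restarts ∎
        where
        lem : ∀ a b c G e h t N u → a + b + c + G * e + h + t * N ≡ G * (+ 0 * + 0 + e) + t * (N - u) + (a + b + c + h + t * u)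
        lem = solve-∀

      g≤qq : g ≤ q * q
      g≤qq = ≤-trans (≤-by (+ 71 * g) (0≤* (0≤ℕ 71) 0≤g) (lem g)) 72g≤q²
        where
        lem : ∀ g → + 72 * g ≡ g + + 71 * g
        lem = solve-∀

      module _ (¬top : ¬ (den ≤ pot₁ y found e e⁺ restarts)) where

        few-found : z * found ≤ N
        few-found with z * found ≤? N
        ... | yes p = p
        ... | no ¬p = ⊥-elim (¬top (begin
          g * N * z³                ≤⟨ *-monoʳ z³ 0≤z³ (*-mono 0≤g (0≤* 0≤z 0≤found) g≤qq (≰⇒≤ ¬p)) ⟩
          q * q * (z * found) * z³  ≡⟨ lem (q * q) z found z³ ⟩
          a₂                        ≤⟨ ≤-by (a₁ + a₃ + a₄ + a₅ + a₆) (0≤+ (0≤+ (0≤+ (0≤+ 0≤a₁ 0≤a₃) 0≤a₄) 0≤a₅) 0≤a₆) (lem′ a₁ a₂ a₃ a₄ a₅ a₆) ⟩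
          φ                         ∎))
          where
          lem : ∀ a z b t → a * (z * b) * t ≡ a * (t * z) * b
          lem = solve-∀
          lem′ : ∀ a b c d e f → a + b + c + d + e + f ≡ b + (a + c + d + e + f)
          lem′ = solve-∀

        low-rem : + 2 * e ≤ V
        low-rem with + 2 * e ≤? V
        ... | yes p = p
        ... | no ¬p = ⊥-elim (¬top (begin
          g * N * z³                ≤⟨ *-monoˡ (g * N) 0≤gN (≤-trans s³≤V (≰⇒≤ ¬p)) ⟩
          g * N * (+ 2 * e)         ≡⟨ lem (g) N e ⟩
          a₃                        ≤⟨ ≤-by (a₁ + a₂ + a₄ + a₅ + a₆) (0≤+ (0≤+ (0≤+ (0≤+ 0≤a₁ 0≤a₂) 0≤a₄) 0≤a₅) 0≤a₆) (lem′ a₁ a₂ a₃ a₄ a₅ a₆) ⟩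
          φ                         ∎))
          where
          lem : ∀ g N e → g * N * (+ 2 * e) ≡ + 2 * g * N * e
          lem = solve-∀
          lem′ : ∀ a b c d e f → a + b + c + d + e + f ≡ c + (a + b + d + e + f)
          lem′ = solve-∀

        low-rem⁺ : e⁺ ≤ z²
        low-rem⁺ with e⁺ ≤? z²
        ... | yes p = p
        ... | no ¬p = ⊥-elim (¬top (begin
          g * N * z³                ≡⟨ lem (g * N) z ⟩
          g * N * z * z²            ≤⟨ *-monoˡ (g * N * z) 0≤gNz (≰⇒≤ ¬p) ⟩
          a₄                        ≤⟨ ≤-by (a₁ + a₂ + a₃ + a₅ + a₆) (0≤+ (0≤+ (0≤+ (0≤+ 0≤a₁ 0≤a₂) 0≤a₃) 0≤a₅) 0≤a₆) (lem′ a₁ a₂ a₃ a₄ a₅ a₆) ⟩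
          φ                         ∎))
          where
          lem : ∀ a z → a * (z * z * z) ≡ a * z * (z * z)
          lem = solve-∀
          lem′ : ∀ a b c d e f → a + b + c + d + e + f ≡ d + (a + b + c + e + f)
          lem′ = solve-∀

        few-restarts : + 4 * c * restarts ≤ N
        few-restarts with + 4 * c * restarts ≤? N
        ... | yes p = p
        ... | no ¬p = ⊥-elim (¬top (begin
          g * N * z³                               ≤⟨ *-monoʳ z³ 0≤z³ (*-monoˡ g 0≤g (≰⇒≤ ¬p)) ⟩
          g * (+ 4 * c * restarts) * z³            ≡⟨ lem g c restarts z³ ⟩
          a₅                                       ≤⟨ ≤-by (a₁ + a₂ + a₃ + a₄ + a₆) (0≤+ (0≤+ (0≤+ (0≤+ 0≤a₁ 0≤a₂) 0≤a₃) 0≤a₄) 0≤a₆) (lem′ a₁ a₂ a₃ a₄ a₅ a₆) ⟩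
          φ                                        ∎))
          where
          lem : ∀ g c r t → g * (+ 4 * c * r) * t ≡ + 4 * c * g * t * r
          lem = solve-∀
          lem′ : ∀ a b c d e f → a + b + c + d + e + f ≡ e + (a + b + c + d + f)
          lem′ = solve-∀

    drift₁ : ∀ S {y found restarts} → + 1 ≤ y → q * y ≤ z → + 2 * rem S ≤ V → rem⁺ S ≤ z² →
      (y - + 1) * (pot₁ (y - + 2) found (rem S) (rem⁺ S) restarts - pot₁ y found (rem S) (rem⁺ S) restarts) +
      outS S (λ w → + d w * (pot₁ (y + (+ d w - + 2)) (found + + 1) (rem S + ρ (d w)) (rem⁺ S + ρ⁺ (d w)) restarts
        - pot₁ y found (rem S) (rem⁺ S) restarts)) ≤ + 0
    drift₁ S {y} {found} {restarts} 1≤y qy≤z e≤ e⁺≤ = begin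
      (y - + 1) * (pot₁ (y - + 2) found e e⁺ restarts - pot₁ y found e e⁺ restarts) + outS S (λ w → + d w * (ψ w - pot₁ y found e e⁺ restarts))
        ≡⟨ cong₂ _+_ (lem₁ y A z q (q * q * (z³ * z) * found) (+ 2 * g * N * e) (g * N * z * e⁺) (+ 4 * c * g * z³ * restarts) (z³ * (N + τ * z))) expand ⟩
      + 4 * A * ((q * y - q) * (q * y - q)) + (- (+ 2 * A * q * (q * y)) * oη + - (A * q * q) * oρ + q * q * (z³ * z) * od + + 2 * g * N * odρ + g * N * z * odρ⁺)
        ≡⟨ lem₂ A (q * y) q oη oρ (q * q * (z³ * z) * od) (+ 2 * g * N * odρ) (g * N * z * odρ⁺) ⟩
      + 4 * A * ((q * y - q) * (q * y - q)) + + 2 * A * q * (q * y * - oη) - A * q * q * oρ + q * q * (z³ * z) * od + + 2 * g * N * odρ + g * N * z * odρ⁺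
        ≤⟨ +-mono-≤ (+-mono-≤ (+-mono-≤ (+-mono-≤ (+-mono-≤ t₁ t₂) (neg-mono-≤ t₃)) t₄) t₅) t₆ ⟩
      U + + 9 * U - + 18 * U + + 3 * U + U + U
        ≡⟨ lem₃ U ⟩
      - (+ 3 * U)
        ≤⟨ neg-mono-≤ (0≤* (0≤ℕ 3) 0≤U) ⟩
      + 0 ∎
      where
      e e⁺ A U oη oρ od odρ odρ⁺ : ℤ
      e = rem S
      e⁺ = rem⁺ S
      A = + 36 * (N * z)
      U = N * (q * q) * (z³ * z)
      oη = outS S (λ v → η (d v))
      oρ = outS S (λ v → ρ (d v))
      od = outS S (λ v → + d v)
      odρ = outS S (λ v → + d v * ρ (d v))
      odρ⁺ = outS S (λ v → + d v * ρ⁺ (d v))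
      ψ : Fin n → ℤ
      ψ w = pot₁ (y + (+ d w - + 2)) (found + + 1) (e + ρ (d w)) (e⁺ + ρ⁺ (d w)) restarts
      0≤U : + 0 ≤ U
      0≤U = 0≤* (0≤* 0≤N 0≤qq) (0≤* 0≤z³ 0≤z)
      0≤A : + 0 ≤ A
      0≤A = 0≤* (0≤ℕ 36) (0≤* 0≤N 0≤z)
      0≤qy : + 0 ≤ q * y
      0≤qy = 0≤* 0≤q (1≤⇒0≤ 1≤y)
      0≤qy-q : + 0 ≤ q * y - q
      0≤qy-q = subst (+ 0 ≤_) (lem q y) (0≤* 0≤q (0≤- 1≤y))
        where
        lem : ∀ q y → q * (y - + 1) ≡ q * y - q
        lem = solve-∀
      lem₁ : ∀ y A z q a b c d e → (y - + 1) * ((A * (+ 4 * (z * z) - q * (y - + 2) * (q * (y - + 2))) + a + b + c + d + e) - (A * (+ 4 * (z * z) - q * y * (q * y)) + a + b + c + d + e))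
        ≡ + 4 * A * ((q * y - q) * (q * y - q))
      lem₁ = solve-∀
      lem₂ : ∀ A y q h r a b c → + 4 * A * ((y - q) * (y - q)) + (- (+ 2 * A * q * y) * h + - (A * q * q) * r + a + b + c) ≡
        + 4 * A * ((y - q) * (y - q)) + + 2 * A * q * (y * - h) - A * q * q * r + a + b + c
      lem₂ = solve-∀
      lem₃ : ∀ u → u + + 9 * u - + 18 * u + + 3 * u + u + u ≡ - (+ 3 * u)
      lem₃ = solve-∀
      expand : outS S (λ w → + d w * (ψ w - pot₁ y found e e⁺ restarts)) ≡
        - (+ 2 * A * q * (q * y)) * oη + - (A * q * q) * oρ + q * q * (z³ * z) * od + + 2 * g * N * odρ + g * N * z * odρ⁺
      expand = trans (outS-cong S (λ w → lem (+ d w) y A z q (q * q * (z³ * z)) found (+ 2 * g * N) e (g * N * z) e⁺ (ρ⁺ (d w)) (+ 4 * c * g * z³ * restarts) (z³ * (N + τ * z))))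
        (trans (outS-+ S _ _) (cong₂ _+_ (trans (outS-+ S _ _) (cong₂ _+_ (trans (outS-+ S _ _) (cong₂ _+_ (trans (outS-+ S _ _)
          (cong₂ _+_ (outS-* S (- (+ 2 * A * q * (q * y))) (λ v → η (d v))) (outS-* S (- (A * q * q)) (λ v → ρ (d v)))))
          (outS-* S (q * q * (z³ * z)) (λ v → + d v)))) (outS-* S (+ 2 * g * N) (λ v → + d v * ρ (d v))))) (outS-* S (g * N * z) (λ v → + d v * ρ⁺ (d v)))))
        where
        lem : ∀ x y A z q B h C e G k r a b →
          x * ((A * (+ 4 * (z * z) - q * (y + (x - + 2)) * (q * (y + (x - + 2)))) + B * (h + + 1) + C * (e + x * ((x - + 2) * (x - + 2))) + G * (k + r) + a + b)
            - (A * (+ 4 * (z * z) - q * y * (q * y)) + B * h + C * e + G * k + a + b)) ≡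
          - (+ 2 * A * q * (q * y)) * (x * (x - + 2)) + - (A * q * q) * (x * ((x - + 2) * (x - + 2))) + B * x + C * (x * (x * ((x - + 2) * (x - + 2)))) + G * (x * r)
        lem = solve-∀
      t₁ : + 4 * A * ((q * y - q) * (q * y - q)) ≤ U
      t₁ = begin
        + 4 * A * ((q * y - q) * (q * y - q))    ≤⟨ *-monoˡ (+ 4 * A) (0≤* (0≤ℕ 4) 0≤A) (*-mono 0≤qy-q 0≤z ≤z ≤z) ⟩
        + 4 * A * (z * z)                        ≡⟨ lem N z ⟩
        N * + 144 * z³                           ≤⟨ *-monoʳ z³ 0≤z³ (*-monoˡ N 0≤N (≤-trans 144≤q (≤-by (q * (q * z - + 1)) (0≤* 0≤q (0≤- (*-mono {+ 1} {q} (0≤ℕ 1) 0≤z 1≤q 1≤z))) (lem′ q z)))) ⟩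
        N * (q * q * z) * z³                     ≡⟨ lem″ N (q * q) z z³ ⟩
        U                                        ∎
        where
        ≤z : q * y - q ≤ z
        ≤z = ≤-trans (≤-by q 0≤q (lem₄ (q * y) q)) qy≤z
          where
          lem₄ : ∀ a b → a ≡ a - b + b
          lem₄ = solve-∀
        lem : ∀ N z → + 4 * (+ 36 * (N * z)) * (z * z) ≡ N * + 144 * (z * z * z)
        lem = solve-∀
        lem′ : ∀ q z → q * q * z ≡ q + q * (q * z - + 1)
        lem′ = solve-∀
        lem″ : ∀ N a z t → N * (a * z) * t ≡ N * a * (t * z)
        lem″ = solve-∀
      t₂ : + 2 * A * q * (q * y * - oη) ≤ + 9 * U
      t₂ = begin
        + 2 * A * q * (q * y * - oη)               ≤⟨ *-monoˡ (+ 2 * A * q) (0≤* (0≤* (0≤ℕ 2) 0≤A) 0≤q) (*-mono 0≤qy (0≤* (0≤+ 0≤Λ (0≤ℕ 1)) 0≤z²) qy≤z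
                                                        (≤-trans (neg-mono-≤ (out-η S e⁺≤)) (≤-reflexive (neg-involutive ((Λ + + 1) * z²))))) ⟩
        + 2 * A * q * (z * ((Λ + + 1) * z²))       ≡⟨ lem N z q (Λ + + 1) ⟩
        + 9 * (N * q * (z³ * z) * (+ 8 * (Λ + + 1))) ≤⟨ *-monoˡ (+ 9) (0≤ℕ 9) (*-monoˡ (N * q * (z³ * z)) (0≤* (0≤* 0≤N 0≤q) (0≤* 0≤z³ 0≤z)) 8Λ≤q) ⟩
        + 9 * (N * q * (z³ * z) * q)               ≡⟨ lem′ N q (z³ * z) ⟩
        + 9 * U                                    ∎
        where
        lem : ∀ N z q l → + 2 * (+ 36 * (N * z)) * q * (z * (l * (z * z))) ≡ + 9 * (N * q * (z * z * z * z) * (+ 8 * l))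
        lem = solve-∀
        lem′ : ∀ N q t → + 9 * (N * q * t * q) ≡ + 9 * (N * (q * q) * t)
        lem′ = solve-∀
      t₃ : + 18 * U ≤ A * q * q * oρ
      t₃ = begin
        + 18 * U                                   ≡⟨ lem N q z ⟩
        + 18 * (N * z) * (q * q) * z³              ≤⟨ *-monoˡ (+ 18 * (N * z) * (q * q)) (0≤* (0≤* (0≤ℕ 18) (0≤* 0≤N 0≤z)) 0≤qq) z³≤ ⟩
        + 18 * (N * z) * (q * q) * (+ 2 * oρ)      ≡⟨ lem′ N z q oρ ⟩
        A * q * q * oρ                             ∎
        where
        lem : ∀ N q z → + 18 * (N * (q * q) * (z * z * z * z)) ≡ + 18 * (N * z) * (q * q) * (z * z * z)
        lem = solve-∀
        lem′ : ∀ N z q o → + 18 * (N * z) * (q * q) * (+ 2 * o) ≡ + 36 * (N * z) * q * q * o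
        lem′ = solve-∀
        z³≤ : z³ ≤ + 2 * oρ
        z³≤ = begin
          z³                                       ≤⟨ s³≤V ⟩
          V                                        ≤⟨ ≤-by (V - + 2 * e) (0≤- e≤) refl ⟩
          V + (V - + 2 * e)                        ≡⟨ cong (λ v → v + (v - + 2 * e)) (in+out S (λ v → ρ (d v))) ⟨
          (e + oρ) + ((e + oρ) - + 2 * e)          ≡⟨ lem₄ e oρ ⟩
          + 2 * oρ                                 ∎
          where
          lem₄ : ∀ a b → (a + b) + ((a + b) - + 2 * a) ≡ + 2 * b
          lem₄ = solve-∀
      t₄ : q * q * (z³ * z) * od ≤ + 3 * U
      t₄ = begin
        q * q * (z³ * z) * od                      ≤⟨ *-monoˡ (q * q * (z³ * z)) (0≤* 0≤qq (0≤* 0≤z³ 0≤z)) (≤-trans (outS≤∑ S (λ v → 0≤ℕ (d v))) M≤3n) ⟩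
        q * q * (z³ * z) * (+ 3 * N)               ≡⟨ lem N (q * q) (z³ * z) ⟩
        + 3 * U                                    ∎
        where
        lem : ∀ N a b → a * b * (+ 3 * N) ≡ + 3 * (N * a * b)
        lem = solve-∀
      t₅ : + 2 * g * N * odρ ≤ U
      t₅ = begin
        + 2 * g * N * odρ                          ≤⟨ *-monoˡ (+ 2 * g * N) (0≤* (0≤* (0≤ℕ 2) 0≤g) 0≤N) out-dρ ⟩
        + 2 * g * N * (+ 3 * (z³ * z))             ≡⟨ lem g N (z³ * z) ⟩
        + 6 * g * (N * (z³ * z))                   ≤⟨ *-monoʳ (N * (z³ * z)) (0≤* 0≤N (0≤* 0≤z³ 0≤z)) (≤-trans (≤-by {+ 6 * g} (+ 66 * g) (0≤* (0≤ℕ 66) 0≤g) (lem₄ g)) 72g≤q²) ⟩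
        q * q * (N * (z³ * z))                     ≡⟨ lem′ (q * q) N (z³ * z) ⟩
        U                                          ∎
        where
        lem : ∀ g N t → + 2 * g * N * (+ 3 * t) ≡ + 6 * g * (N * t)
        lem = solve-∀
        lem₄ : ∀ g → + 72 * g ≡ + 6 * g + + 66 * g
        lem₄ = solve-∀
        lem′ : ∀ a b c → a * (b * c) ≡ b * a * c
        lem′ = solve-∀
        out-dρ : odρ ≤ + 3 * (z³ * z)
        out-dρ = *-cancelˡ (+ 8) (+≤+ (ℕ.s≤s ℕ.z≤n)) (begin
          + 8 * odρ                                ≤⟨ *-monoˡ (+ 8) (0≤ℕ 8) (outS≤∑ S (λ v → 0≤* (0≤ℕ (d v)) (0≤ρ (d v)))) ⟩
          + 8 * ∑ (λ v → + d v * ρ (d v))          ≡⟨ ∑-* (+ 8) (λ v → + d v * ρ (d v)) ⟨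
          ∑ (λ v → + 8 * (+ d v * ρ (d v)))        ≤⟨ ∑-mono each ⟩
          ∑ (λ v → z * ρ (d v))                    ≡⟨ ∑-* z (λ v → ρ (d v)) ⟩
          z * V                                    ≤⟨ *-monoˡ z 0≤z V≤24s³ ⟩
          z * (+ 24 * z³)                          ≡⟨ lem₅ z z³ ⟩
          + 8 * (+ 3 * (z³ * z))                   ∎)
          where
          lem₅ : ∀ a b → a * (+ 24 * b) ≡ + 8 * (+ 3 * (b * a))
          lem₅ = solve-∀
          each : ∀ v → + 8 * (+ d v * ρ (d v)) ≤ z * ρ (d v)
          each v = ≤-trans (≤-reflexive (sym (*-assoc (+ 8) (+ d v) (ρ (d v))))) (*-monoʳ (ρ (d v)) (0≤ρ (d v)) (≤-trans (*-monoˡ (+ 8) (0≤ℕ 8) (d≤Δ v)) 8Δ≤s))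
      t₆ : g * N * z * odρ⁺ ≤ U
      t₆ = begin
        g * N * z * odρ⁺                           ≤⟨ *-monoˡ (g * N * z) 0≤gNz (out-dρ⁺ S) ⟩
        g * N * z * (+ 72 * z³)                    ≡⟨ lem g N z z³ ⟩
        + 72 * g * (N * (z³ * z))                  ≤⟨ *-monoʳ (N * (z³ * z)) (0≤* 0≤N (0≤* 0≤z³ 0≤z)) 72g≤q² ⟩
        q * q * (N * (z³ * z))                     ≡⟨ lem′ (q * q) N (z³ * z) ⟩
        U                                          ∎
        where
        lem : ∀ g N z t → g * N * z * (+ 72 * t) ≡ + 72 * g * (N * (t * z))
        lem = solve-∀
        lem′ : ∀ a b c → a * (b * c) ≡ b * a * c
        lem′ = solve-∀

    fresh-leaf : ∀ {S found restarts} → inS S (λ v → + d v) ≤ Δ * found + restarts → + 0 ≤ found → z * found ≤ N → + 4 * c * restarts ≤ N →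
      ∃ λ v → S v ≡ false × d v ≡ 1
    fresh-leaf {S} {found} {restarts} weight 0≤found zf rs with + 1 ≤? outS S (λ v → ι (d v ≡ᵇ 1))
    ... | yes p with ∑-positive (λ v → ι (not (S v)) * ι (d v ≡ᵇ 1)) p
    ...   | v , h with S v in Sv | d v ≡ᵇ 1 in dv
    ...     | false | true = v , Sv , ℕₚ.≡ᵇ⇒≡ (d v) 1 (⇒T dv)
    ...     | false | false = ⊥-elim (1≰0 h)
    ...     | true | true = ⊥-elim (1≰0 h)
    ...     | true | false = ⊥-elim (1≰0 h)
    fresh-leaf {S} {found} {restarts} weight 0≤found zf rs | no ¬p = ⊥-elim (absurd (begin
      + 4 * N                                              ≤⟨ *-monoˡ (+ 4) (0≤ℕ 4) n≤cn₁ ⟩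
      + 4 * (c * ∑ (λ v → ι (d v ≡ᵇ 1)))                   ≡⟨ *-assoc (+ 4) c (∑ (λ v → ι (d v ≡ᵇ 1))) ⟨
      + 4 * c * ∑ (λ v → ι (d v ≡ᵇ 1))                     ≡⟨ cong (+ 4 * c *_) (sym (in+out S (λ v → ι (d v ≡ᵇ 1)))) ⟩
      + 4 * c * (inS S (λ v → ι (d v ≡ᵇ 1)) + outS S (λ v → ι (d v ≡ᵇ 1)))
        ≤⟨ *-monoˡ (+ 4 * c) 0≤4c (+-mono-≤ (≤-trans (inS-mono S leaf≤) weight) out≤0) ⟩
      + 4 * c * (Δ * found + restarts + + 0)               ≡⟨ lem c Δ found restarts ⟩
      + 4 * c * Δ * found + + 4 * c * restarts             ≤⟨ +-mono-≤ (≤-trans (*-monoʳ found 0≤found 4cΔ≤s) zf) rs ⟩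
      N + N                                                ∎))
      where
      0≤4c : + 0 ≤ + 4 * c
      0≤4c = 0≤* (0≤ℕ 4) 0≤c
      out≤0 : outS S (λ v → ι (d v ≡ᵇ 1)) ≤ + 0
      out≤0 = subst (_≤ + 0) (lem₀ (outS S (λ v → ι (d v ≡ᵇ 1)))) (i≤j⇒i-j≤0 (≰⇒1+≤ ¬p))
        where
        lem₀ : ∀ a → a + + 1 - + 1 ≡ a
        lem₀ = solve-∀
      leaf≤ : ∀ v → ι (d v ≡ᵇ 1) ≤ + d v
      leaf≤ v = ≤-trans (ι≤1 (d v ≡ᵇ 1)) (+≤+ (1≤d v))
      lem : ∀ c D f r → + 4 * c * (D * f + r + + 0) ≡ + 4 * c * D * f + + 4 * c * r
      lem = solve-∀
      absurd : ¬ (+ 4 * N ≤ N + N)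
      absurd h = 1≰0 (≤-trans 1≤N (≤-trans (≤-by N 0≤N (lem₁ N)) (subst₂ _≤_ (lem₂ N) (+-inverseʳ (N + N)) (+-monoˡ-≤ (- (N + N)) h))))
        where
        lem₁ : ∀ a → + 2 * a ≡ a + a
        lem₁ = solve-∀
        lem₂ : ∀ a → + 4 * a - (a + a) ≡ + 2 * a
        lem₂ = solve-∀

    Φ₁ : (Fin n → Bool) → (Fin n → ℕ) → ℤ → ℤ → ℤ
    Φ₁ S r found restarts = pot₁ (active S r) found (rem S) (rem⁺ S) restarts

    -- A restart raises the number of active half-edges from 0 to 1, which pays for itself.
    restart-pot : ∀ found e e⁺ restarts → pot₁ (+ 0 + + 1) found (e + + 1) (e⁺ + + 0) (restarts + + 1) ≤ pot₁ (+ 0) found e e⁺ restarts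
    restart-pot found e e⁺ restarts = ≤-by (+ 2 * N * (q * q * z - g) + g * z * (N - + 4 * c * (z * z)) + (+ 34 * (q * q) - g) * (N * z))
      (0≤+ (0≤+ (0≤* (0≤* (0≤ℕ 2) 0≤N) (0≤- (≤-trans g≤q² (≤-by (q * q * (z - + 1)) (0≤* 0≤qq (0≤- 1≤z)) (lem₁ (q * q) z)))))
        (0≤* (0≤* 0≤g 0≤z) (0≤- 4cs²≤n))) (0≤* (0≤- (≤-trans g≤q² (≤-by (+ 33 * (q * q)) (0≤* (0≤ℕ 33) 0≤qq) (lem₂ (q * q))))) (0≤* 0≤N 0≤z)))
      (lem N z q g c (q * q * (z³ * z) * found) e (g * N * z) e⁺ restarts (z³ * (N + τ * z)))
      where
      g≤q² : g ≤ q * q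
      g≤q² = ≤-trans (≤-by (+ 71 * g) (0≤* (0≤ℕ 71) 0≤g) (lem₃ g)) 72g≤q²
        where
        lem₃ : ∀ g → + 72 * g ≡ g + + 71 * g
        lem₃ = solve-∀
      lem₁ : ∀ a z → a * z ≡ a + a * (z - + 1)
      lem₁ = solve-∀
      lem₂ : ∀ a → + 34 * a ≡ a + + 33 * a
      lem₂ = solve-∀
      lem : ∀ N z q g c B e G k r T →
        + 36 * (N * z) * (+ 4 * (z * z) - q * + 0 * (q * + 0)) + B + + 2 * g * N * e + G * k + + 4 * c * g * (z * z * z) * r + T ≡
        + 36 * (N * z) * (+ 4 * (z * z) - q * (+ 0 + + 1) * (q * (+ 0 + + 1))) + B + + 2 * g * N * (e + + 1) + G * (k + + 0) + + 4 * c * g * (z * z * z) * (r + + 1) + T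
        + (+ 2 * N * (q * q * z - g) + g * z * (N - + 4 * c * (z * z)) + (+ 34 * (q * q) - g) * (N * z))
      lem = solve-∀

    restart : ∀ {P K S r m found restarts} → Explored d P K S r m → active S r ≡ + 0 →
      inS S (λ v → + d v) ≤ Δ * found + restarts → + 0 ≤ found → + 0 ≤ restarts →
      (¬ (den ≤ Φ₁ S r found restarts)) →
      (∀ {S C} → Exploring d Δ P K S C r m found (restarts + + 1) → active S r ≡ + 1 → ¬ (den ≤ Φ₁ S r found (restarts + + 1)) → Good d event den P r m (Φ₁ S r found (restarts + + 1))) →
      Good d event den P r m (Φ₁ S r found restarts)
    restart {P} {K} {S} {r} {m} {found} {restarts} E Y0 weight 0≤found 0≤restarts ¬top next with
      fresh-leaf {S} {found} {restarts} weight 0≤found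
        (few-found {active S r} {found} {rem S} {rem⁺ S} {restarts} (0≤active S r) qy (0≤found) (0≤rem S) (0≤rem⁺ S) 0≤restarts ¬top)
        (few-restarts {active S r} {found} {rem S} {rem⁺ S} {restarts} (0≤active S r) qy (0≤found) (0≤rem S) (0≤rem⁺ S) 0≤restarts ¬top)
      where
      qy : q * active S r ≤ + 2 * z
      qy = ≤-trans (≤-reflexive (trans (cong (q *_) Y0) (*-zeroʳ q))) (0≤* (0≤ℕ 2) 0≤z)
    ... | v , Sv , dv = Good-mono φ≤ (next (exploring-restart E Y0 weight 0≤found 0≤restarts Sv dv) Y1 (λ h → ¬top (≤-trans h φ≤)))
      where
      Y≡ : active (insert S v) r ≡ + 0 + + 1
      Y≡ = trans (inS-insert S Sv (λ v → + r v)) (cong₂ (λ a k → a + + k) Y0 (trans (within-r E v Sv) dv))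
      Y1 : active (insert S v) r ≡ + 1
      Y1 = Y≡
      φ≤ : Φ₁ (insert S v) r found (restarts + + 1) ≤ Φ₁ S r found restarts
      φ≤ = begin
        Φ₁ (insert S v) r found (restarts + + 1)
          ≡⟨ cong₂ (λ y e → pot₁ y found e (rem⁺ (insert S v)) (restarts + + 1)) Y≡ (trans (inS-insert S Sv (λ v → ρ (d v))) (cong (λ k → rem S + ρ k) dv)) ⟩
        pot₁ (+ 0 + + 1) found (rem S + + 1) (rem⁺ (insert S v)) (restarts + + 1)
          ≡⟨ cong (λ e → pot₁ (+ 0 + + 1) found (rem S + + 1) e (restarts + + 1)) (trans (inS-insert S Sv (λ v → ρ⁺ (d v))) (cong (λ k → rem⁺ S + ρ⁺ k) dv)) ⟩
        pot₁ (+ 0 + + 1) found (rem S + + 1) (rem⁺ S + + 0) (restarts + + 1)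
          ≤⟨ restart-pot found (rem S) (rem⁺ S) restarts ⟩
        pot₁ (+ 0) found (rem S) (rem⁺ S) restarts
          ≡⟨ cong (λ y → pot₁ y found (rem S) (rem⁺ S) restarts) (sym Y0) ⟩
        Φ₁ S r found restarts ∎

    phase₁ : ∀ k m → m ℕ.≤ k → ∀ {P K S C r found restarts} → Exploring d Δ P K S C r m found restarts →
      q * active S r ≤ + 2 * z → Good d event den P r m (Φ₁ S r found restarts)

    climb : ∀ k m → m ℕ.≤ k → ∀ {P K S C r found restarts} → Exploring d Δ P K S C r m found restarts →
      + 1 ≤ active S r → q * active S r ≤ z → ¬ (den ≤ Φ₁ S r found restarts) → Good d event den P r m (Φ₁ S r found restarts)

    phase₁ k m m≤k {P} {K} {S} {C} {r} {found} {restarts} I qy≤2z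
      with N ≤? τ * z * size C | den ≤? Φ₁ S r found restarts | z ≤? q * active S r | + 1 ≤? active S r
    ... | yes p | _ | _ | _ = success I (0≤pot₁ (0≤active S r) qy≤2z (Exploring.0≤found I) (0≤rem S) (0≤rem⁺ S) (Exploring.0≤restarts I)) p
    ... | no _ | yes p | _ | _ = Good-top (Exploring.explored I) 0≤den p
    ... | no ¬succ | no ¬top | yes z≤qy | _ =
          Good-mono (pot₂≤pot₁ (0≤active S r) qy≤2z 0≤found (0≤rem S) (0≤rem⁺ S) 0≤restarts (0≤size C) z≤qy)
            (phase₂ m m ℕₚ.≤-refl I (≤-trans (few-found (0≤active S r) qy≤2z 0≤found (0≤rem S) (0≤rem⁺ S) 0≤restarts ¬top) (≤-by (z * size C) (0≤* 0≤z (0≤size C)) refl))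
              (≤-trans (*-monoʳ restarts 0≤restarts (*-monoˡ (+ 4) (0≤ℕ 4) 1≤c)) (few-restarts (0≤active S r) qy≤2z 0≤found (0≤rem S) (0≤rem⁺ S) 0≤restarts ¬top))
              (≤-trans (≰⇒≤ ¬succ) (≤-by (τ * z) (0≤* 0≤τ 0≤z) refl)))
      where open Exploring I
    ... | no _ | no ¬top | no z≰qy | yes 1≤y = climb k m m≤k I 1≤y (≰⇒≤ z≰qy) ¬top
    ... | no _ | no ¬top | no z≰qy | no y≰ = restart explored (no-active S r y≰) weight 0≤found 0≤restarts ¬top
          (λ I′ y≡1 → climb k m m≤k I′ (≤-reflexive (sym y≡1)) (≤-trans (≤-reflexive (trans (cong (q *_) y≡1) (*-identityʳ q))) q≤s))
      where open Exploring I

    climb zero m m≤0 {S = S} I 1≤y _ _ = ⊥-elim (1≰0 (≤-trans 1≤y (≤-trans (≤-by (outS S (λ v → + d v)) (0≤outS S (λ v → 0≤ℕ (d v))) (total-split (Exploring.explored I))) (+≤+ m≤0))))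
    climb (suc k) m m≤k {P} {K} {S} {C} {r} {found} {restarts} I 1≤y qy≤z ¬top with active-vertex S r 1≤y
    ... | u , Su , pu = reveal-split explored (pot₁ (y - + 2) found e e⁺ restarts)
        (λ w → pot₁ (y + (+ d w - + 2)) (found + + 1) (e + ρ (d w)) (e⁺ + ρ⁺ (d w)) restarts)
        0≤den (0≤pot₁ 0≤y qy≤2z 0≤found (0≤rem S) (0≤rem⁺ S) 0≤restarts) u Su pu next-in next-out
        (λ 2≤y → 0≤pot₁ (0≤- 2≤y) qy-in 0≤found (0≤rem S) (0≤rem⁺ S) 0≤restarts)
        (λ w _ _ → 0≤pot₁ (1≤out w 1≤y) (qy-out w) (0≤+ 0≤found (0≤ℕ 1)) (0≤+ (0≤rem S) (0≤ρ (d w))) (0≤+ (0≤rem⁺ S) (0≤ρ⁺ (d w))) 0≤restarts)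
        (drift₁ S 1≤y qy≤z (low-rem 0≤y qy≤2z 0≤found (0≤rem S) (0≤rem⁺ S) 0≤restarts ¬top) (low-rem⁺ 0≤y qy≤2z 0≤found (0≤rem S) (0≤rem⁺ S) 0≤restarts ¬top))
      where
      open Exploring I
      y e e⁺ : ℤ
      y = active S r
      e = rem S
      e⁺ = rem⁺ S
      0≤y : + 0 ≤ y
      0≤y = 0≤active S r
      z≤2z : z ≤ + 2 * z
      z≤2z = ≤-by z 0≤z (lem z)
        where
        lem : ∀ z → + 2 * z ≡ z + z
        lem = solve-∀
      qy≤2z : q * y ≤ + 2 * z
      qy≤2z = ≤-trans qy≤z z≤2z
      qy-in : q * (y - + 2) ≤ + 2 * z
      qy-in = ≤-trans (≤-by (+ 2 * q) (0≤* (0≤ℕ 2) 0≤q) (lem q y)) qy≤2z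
        where
        lem : ∀ q y → q * y ≡ q * (y - + 2) + + 2 * q
        lem = solve-∀
      qy-out : ∀ w → q * (y + (+ d w - + 2)) ≤ + 2 * z
      qy-out w = ≤-by ((z - q * y) + (z - q * Δ) + q * (Δ - + d w) + + 2 * q) (0≤+ (0≤+ (0≤+ (0≤- qy≤z) (0≤- qΔ≤s)) (0≤* 0≤q (0≤- (d≤Δ w)))) (0≤* (0≤ℕ 2) 0≤q)) (lem z q y Δ (+ d w))
        where
        lem : ∀ z q y D x → + 2 * z ≡ q * (y + (x - + 2)) + ((z - q * y) + (z - q * D) + q * (D - x) + + 2 * q)
        lem = solve-∀
      next-in : ∀ w → S w ≡ true → u ≢ w → 1 ℕ.≤ r w → K u w ≡ false →
        Good d event den (learn P K u w) (dec w (dec u r)) (m ℕ.∸ 2) (pot₁ (y - + 2) found e e⁺ restarts)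
      next-in w Sw ne pw kuw = subst (λ y → Good d event den (learn P K u w) (dec w (dec u r)) (m ℕ.∸ 2) (pot₁ y found e e⁺ restarts)) y≡
        (phase₁ k (m ℕ.∸ 2) (m∸2≤ m≤k) (exploring-in I Su Sw ne pu pw kuw) (subst (λ y → q * y ≤ + 2 * z) (sym y≡) qy-in))
        where
        y≡ : active S (dec w (dec u r)) ≡ y - + 2
        y≡ = active-in explored Su Sw ne pu pw
      next-out : ∀ w → S w ≡ false → u ≢ w → 1 ℕ.≤ r w → K u w ≡ false →
        Good d event den (learn P K u w) (dec w (dec u r)) (m ℕ.∸ 2) (pot₁ (y + (+ d w - + 2)) (found + + 1) (e + ρ (d w)) (e⁺ + ρ⁺ (d w)) restarts)
      next-out w Sw ne pw kuw = subst (λ φ → Good d event den (learn P K u w) (dec w (dec u r)) (m ℕ.∸ 2) φ) φ≡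
        (phase₁ k (m ℕ.∸ 2) (m∸2≤ m≤k) (exploring-out I d≤Δ Su Sw ne pu pw kuw) (subst (λ y → q * y ≤ + 2 * z) (sym y≡) (qy-out w)))
        where
        y≡ : active (insert S w) (dec w (dec u r)) ≡ y + (+ d w - + 2)
        y≡ = active-out explored Su Sw pu pw
        φ≡ : Φ₁ (insert S w) (dec w (dec u r)) (found + + 1) restarts ≡ pot₁ (y + (+ d w - + 2)) (found + + 1) (e + ρ (d w)) (e⁺ + ρ⁺ (d w)) restarts
        φ≡ = trans (cong₂ (λ y e → pot₁ y (found + + 1) e (rem⁺ (insert S w)) restarts) y≡ (inS-insert S Sw (λ v → ρ (d v))))
          (cong (λ e → pot₁ (y + (+ d w - + 2)) (found + + 1) (rem S + ρ (d w)) e restarts) (inS-insert S Sw (λ v → ρ⁺ (d v))))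

    lower-tail : ∀ {m} → ∑ (λ v → + d v) ≡ + m → dd m ≤ + 8 * (numReal d * factorials d) →
      g * count event (realisations n d) ≤ + 1168 * numReal d
    lower-tail {m} total simple = *-cancelˡ (N * z³ * factorials d) (*-mono {+ 1} {N * z³} (0≤ℕ 1) 0≤F (*-mono (0≤ℕ 1) 0≤z³ 1≤N (*-mono (0≤ℕ 1) 0≤z 1≤z² 1≤z)) (1≤factorials d)) (begin
      N * z³ * factorials d * (g * cnt)                        ≡⟨ lem₁ N z³ (factorials d) g cnt ⟩
      cnt * den * factorials d                                 ≤⟨ Good.bound bound ⟩
      dd m * (+ 146 * (N * z³))                                ≤⟨ *-monoʳ (+ 146 * (N * z³)) (0≤* (0≤ℕ 146) (0≤* 0≤N 0≤z³)) simple ⟩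
      + 8 * (numReal d * factorials d) * (+ 146 * (N * z³))    ≡⟨ lem₂ (numReal d) (factorials d) (N * z³) ⟩
      N * z³ * factorials d * (+ 1168 * numReal d)             ∎)
      where
      cnt : ℤ
      cnt = count event (realisations n d)
      0≤F : + 0 ≤ factorials d
      0≤F = 1≤⇒0≤ (1≤factorials d)
      lem₁ : ∀ N t F g c → N * t * F * (g * c) ≡ c * (g * N * t) * F
      lem₁ = solve-∀
      lem₂ : ∀ r F t → + 8 * (r * F) * (+ 146 * t) ≡ t * F * (+ 1168 * r)
      lem₂ = solve-∀
      ∅ : Fin n → Bool
      ∅ _ = false
      inS-∅ : ∀ f → inS ∅ f ≡ + 0
      inS-∅ f = ∑-≡0 (λ v → *-zeroˡ (f v))
      Φ∅ : Φ₁ ∅ d (+ 0) (+ 0) ≤ + 146 * (N * z³)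
      Φ∅ = begin
        Φ₁ ∅ d (+ 0) (+ 0)
          ≡⟨ trans (cong₂ (λ y e → pot₁ y (+ 0) e (rem⁺ ∅) (+ 0)) (inS-∅ (λ v → + d v)) (inS-∅ (λ v → ρ (d v)))) (cong (λ e → pot₁ (+ 0) (+ 0) (+ 0) e (+ 0)) (inS-∅ (λ v → ρ⁺ (d v)))) ⟩
        pot₁ (+ 0) (+ 0) (+ 0) (+ 0) (+ 0)
          ≤⟨ ≤-by (z³ * (N - τ * z)) (0≤* 0≤z³ (0≤- τs≤n)) (lem N z q g c τ) ⟩
        + 146 * (N * z³) ∎
        where
        lem : ∀ N z q g c t → + 146 * (N * (z * z * z)) ≡ + 36 * (N * z) * (+ 4 * (z * z) - q * + 0 * (q * + 0)) + q * q * (z * z * z * z) * + 0 + + 2 * g * N * + 0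
          + g * N * z * + 0 + + 4 * c * g * (z * z * z) * + 0 + z * z * z * (N + t * z) + (z * z * z * (N - t * z))
        lem = solve-∀
      E : Explored d (λ _ → true) (λ _ _ → false) ∅ d m
      E = unexplored d ∅ total
      bound : Good d event den (λ _ → true) d m (+ 146 * (N * z³))
      bound with den ≤? Φ₁ ∅ d (+ 0) (+ 0)
      ... | yes p = Good-top E 0≤den (≤-trans p Φ∅)
      ... | no ¬top = Good-mono Φ∅ (restart E (inS-∅ (λ v → + d v)) (≤-reflexive (trans (inS-∅ (λ v → + d v)) (sym (trans (cong (_+ + 0) (*-zeroʳ Δ)) refl)))) ≤-refl ≤-refl ¬top
          (λ I y≡1 → climb m m ℕₚ.≤-refl I (≤-reflexive (sym y≡1)) (≤-trans (≤-reflexive (trans (cong (q *_) y≡1) (*-identityʳ q))) q≤s)))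

  cube-cancel : ∀ {a b} → + 0 ≤ b → a * a * a ≤ b * b * b → a ≤ b
  cube-cancel {a} {b} 0≤b h with a ≤? b
  ... | yes p = p
  ... | no ¬p = ⊥-elim (absurd (≤-trans (*-mono (0≤* 0≤b+1 0≤b+1) 0≤a (*-mono 0≤b+1 0≤a b<a b<a) b<a) h))
    where
    b<a : b + + 1 ≤ a
    b<a = ≰⇒1+≤ ¬p
    0≤b+1 : + 0 ≤ b + + 1
    0≤b+1 = 0≤+ 0≤b (0≤ℕ 1)
    0≤a : + 0 ≤ a
    0≤a = ≤-trans 0≤b+1 b<a
    absurd : ¬ ((b + + 1) * (b + + 1) * (b + + 1) ≤ b * b * b)
    absurd q with subst (+ 1 ≤_) (lem₂ b) (≤-trans (≤-by (+ 3 * (b * b) + + 3 * b) (0≤+ (0≤* (0≤ℕ 3) (0≤* 0≤b 0≤b)) (0≤* (0≤ℕ 3) 0≤b)) (lem₁ b)) (+-monoʳ-≤ ((b + + 1) * (b + + 1) * (b + + 1) - b * b * b) (0≤- q)))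
      where
      lem₁ : ∀ b → (b + + 1) * (b + + 1) * (b + + 1) - b * b * b + + 0 ≡ + 1 + (+ 3 * (b * b) + + 3 * b)
      lem₁ = solve-∀
      lem₂ : ∀ b → (b + + 1) * (b + + 1) * (b + + 1) - b * b * b + (b * b * b - (b + + 1) * (b + + 1) * (b + + 1)) ≡ + 0
      lem₂ = solve-∀
    ... | +≤+ ()

  cube-root : ∀ {M X} → + 1 ≤ M → + 0 ≤ X → ∃ λ s →
    + s * + s * + s * M ≤ X × X ≤ (+ s + + 1) * (+ s + + 1) * (+ s + + 1) * M × ¬ ((+ s + + 1) * (+ s + + 1) * (+ s + + 1) * M ≤ X)
  cube-root {M} {X} 1≤M 0≤X with search (suc ∣ X ∣)
    where
    Root : Set
    Root = ∃ λ s → + s * + s * + s * M ≤ X × X ≤ (+ s + + 1) * (+ s + + 1) * (+ s + + 1) * M × ¬ ((+ s + + 1) * (+ s + + 1) * (+ s + + 1) * M ≤ X)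
    search : ∀ k → Root ⊎ (+ k * + k * + k * M ≤ X)
    search zero = inj₂ (≤-trans (≤-reflexive (*-zeroˡ M)) 0≤X)
    search (suc k) with search k
    ... | inj₁ r = inj₁ r
    ... | inj₂ p with (+ k + + 1) * (+ k + + 1) * (+ k + + 1) * M ≤? X
    ...   | yes q = inj₂ (subst (λ x → x * x * x * M ≤ X) (+-comm (+ k) (+ 1)) q)
    ...   | no ¬q = inj₁ (k , p , <⇒≤ (≰⇒> ¬q) , ¬q)
  ... | inj₁ r = r
  ... | inj₂ p = ⊥-elim (absurd (≤-trans (≤-trans X+1≤ p) (≤-reflexive (sym (0≤i⇒+∣i∣≡i 0≤X)))))
    where
    k : ℤ
    k = + suc ∣ X ∣
    0≤k : + 0 ≤ k
    0≤k = 0≤ℕ (suc ∣ X ∣)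
    1≤k : + 1 ≤ k
    1≤k = +≤+ (ℕ.s≤s ℕ.z≤n)
    X+1≤ : k ≤ k * k * k * M
    X+1≤ = ≤-trans (≤-reflexive (lem k)) (*-mono {k * + 1 * + 1} (0≤* (0≤* 0≤k (0≤ℕ 1)) (0≤ℕ 1)) (1≤⇒0≤ 1≤M)
      (*-mono (0≤* 0≤k (0≤ℕ 1)) 0≤k (*-monoˡ k 0≤k 1≤k) 1≤k) 1≤M)
      where
      lem : ∀ k → k ≡ k * + 1 * + 1 * + 1
      lem = solve-∀
    absurd : ¬ (k ≤ + ∣ X ∣)
    absurd (+≤+ q) = ℕₚ.1+n≰n q

  ρ-nontrivial : ∀ k → 1 ℕ.≤ k → + 1 ≤ ι (k ≡ᵇ 2) + ρ k
  ρ-nontrivial (suc zero) _ = ≤-refl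
  ρ-nontrivial (suc (suc zero)) _ = ≤-refl
  ρ-nontrivial (suc (suc (suc j))) _ = ≤-trans (*-mono {+ 1} {+ (3 ℕ.+ j)} {+ 1} {+ suc j * + suc j} (0≤ℕ 1) (0≤* (0≤ℕ (suc j)) (0≤ℕ (suc j))) (+≤+ (ℕ.s≤s ℕ.z≤n))
    (*-mono {+ 1} {+ suc j} {+ 1} {+ suc j} (0≤ℕ 1) (0≤ℕ (suc j)) (+≤+ (ℕ.s≤s ℕ.z≤n)) (+≤+ (ℕ.s≤s ℕ.z≤n)))) (≤-reflexive (sym (+-identityˡ _)))

  leaves-needed : ∀ k → 1 ℕ.≤ k → + 1 ≤ ι (k ≡ᵇ 2) + + 2 * ι (k ≡ᵇ 1) + η k
  leaves-needed (suc zero) _ = ≤-refl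
  leaves-needed (suc (suc zero)) _ = ≤-refl
  leaves-needed (suc (suc (suc j))) _ = ≤-trans (*-mono {+ 1} {+ (3 ℕ.+ j)} {+ 1} {+ suc j} (0≤ℕ 1) (0≤ℕ (suc j)) (+≤+ (ℕ.s≤s ℕ.z≤n)) (+≤+ (ℕ.s≤s ℕ.z≤n))) (≤-reflexive (sym (+-identityˡ _)))

  k≤2+η : ∀ k → 1 ℕ.≤ k → + k ≤ + 2 + η k
  k≤2+η (suc j) _ = ≤-by (+ j * (+ j - + 1)) (0≤p₂′ j) (lem (+ j))
    where
    0≤p₂′ : ∀ j → + 0 ≤ + j * (+ j - + 1)
    0≤p₂′ zero = ≤-refl
    0≤p₂′ (suc j) = 0≤* (0≤ℕ (suc j)) (0≤ℕ j)
    lem : ∀ j → + 2 + (+ 1 + j) * (+ 1 + j - + 2) ≡ + 1 + j + j * (j - + 1)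
    lem = solve-∀

  ρ≤Δ : ∀ {Δ} k → 1 ℕ.≤ k → + k ≤ Δ → ρ k ≤ Δ * (η k + + 2)
  ρ≤Δ {Δ} (suc zero) _ h = ≤-trans h (≤-reflexive (sym (*-identityʳ Δ)))
  ρ≤Δ {Δ} (suc (suc j)) _ h = ≤-by ((Δ - + (2 ℕ.+ j)) * ((+ 2 + + j) * + j) + + 2 * Δ + + 2 * ((+ 2 + + j) * + j))
    (0≤+ (0≤+ (0≤* (0≤- h) (0≤* (0≤+ (0≤ℕ 2) (0≤ℕ j)) (0≤ℕ j))) (0≤* (0≤ℕ 2) (≤-trans (0≤ℕ (2 ℕ.+ j)) h))) (0≤* (0≤ℕ 2) (0≤* (0≤+ (0≤ℕ 2) (0≤ℕ j)) (0≤ℕ j)))) (lem Δ (+ j))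
    where
    lem : ∀ D j → D * ((+ 2 + j) * j + + 2) ≡ (+ 2 + j) * (j * j) + ((D - (+ 2 + j)) * ((+ 2 + j) * j) + + 2 * D + + 2 * ((+ 2 + j) * j))
    lem = solve-∀

  record ParameterData {n : ℕ} (d : DegSeq n) : Set where
    field
      M Δ : ℕ
      ℓ z K L : ℤ
      1≤n : 1 ℕ.≤ n
      1≤d : ∀ v → 1 ℕ.≤ d v
      d≤Δ : ∀ v → d v ℕ.≤ Δ
      1≤Δ : 1 ℕ.≤ Δ
      total : ∑ (λ v → + d v) ≡ + M
      drift : + 20 * + ∣ ∑ (λ v → η (d v)) ∣ ≤ + M
      degree-bound : (+ Δ * K) * (+ Δ * K) * (+ Δ * K) * + M ≤ + n * ∑ (λ v → ρ (d v))
      window : + ∣ ∑ (λ v → η (d v)) ∣ * + ∣ ∑ (λ v → η (d v)) ∣ * + ∣ ∑ (λ v → η (d v)) ∣ * + n ≤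
               ℓ * ℓ * ℓ * (∑ (λ v → ρ (d v)) * ∑ (λ v → ρ (d v))) * + M
      share : z * ∑ (λ v → ι (d v ≡ᵇ 2)) + + n ≤ z * + n
      1≤ℓ : + 1 ≤ ℓ
      1≤z : + 1 ≤ z
      1≤L : + 1 ≤ L
      L-large : + 2 * z * (+ 12 * ℓ) ≤ L
      K-large : + 12 * ℓ + + 2 * L ≤ K

  -- With s the integer cube root of n R (up to rounding), R ≈ s³ / n and the scale n^{2/3} R^{-1/3} is n / s.
  module Parameters {n : ℕ} {d : DegSeq n} (H : ParameterData d) where

    open ParameterData H

    private
      N V D Λ aD : ℤ
      N = + n
      V = ∑ (λ v → ρ (d v))
      D = ∑ (λ v → η (d v))
      Λ = + 12 * ℓ
      aD = + ∣ D ∣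
    open ≤-Reasoning

    1≤N : + 1 ≤ N
    1≤N = +≤+ 1≤n
    0≤N : + 0 ≤ N
    0≤N = 0≤ℕ n
    0≤V : + 0 ≤ V
    0≤V = 0≤∑ (λ v → 0≤ρ (d v))
    0≤ℓ : + 0 ≤ ℓ
    0≤ℓ = 1≤⇒0≤ 1≤ℓ
    0≤Λ : + 0 ≤ Λ
    0≤Λ = 0≤* (0≤ℕ 12) 0≤ℓ
    0≤z : + 0 ≤ z
    0≤z = 1≤⇒0≤ 1≤z
    0≤L : + 0 ≤ L
    0≤L = 1≤⇒0≤ 1≤L

    n≤M : N ≤ + M
    n≤M = ≤-trans (≤-reflexive (sym (∑-one n))) (≤-trans (∑-mono (λ v → +≤+ (1≤d v))) (≤-reflexive total))
    1≤M : + 1 ≤ + M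
    1≤M = ≤-trans 1≤N n≤M
    0≤M : + 0 ≤ + M
    0≤M = 0≤ℕ M

    D≤aD : D ≤ aD
    D≤aD = i≤+∣i∣ D
      where
      i≤+∣i∣ : ∀ i → i ≤ + ∣ i ∣
      i≤+∣i∣ (+ n) = ≤-refl
      i≤+∣i∣ -[1+ n ] = -≤+
    -aD≤D : - aD ≤ D
    -aD≤D = go D
      where
      go : ∀ i → - + ∣ i ∣ ≤ i
      go (+ n) = ≤-trans (neg-mono-≤ (0≤ℕ n)) (0≤ℕ n)
      go -[1+ n ] = ≤-refl

    M≤2n+D : + M ≤ + 2 * N + D
    M≤2n+D = begin
      + M                              ≡⟨ total ⟨
      ∑ (λ v → + d v)                  ≤⟨ ∑-mono (λ v → k≤2+η (d v) (1≤d v)) ⟩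
      ∑ (λ v → + 2 + η (d v))          ≡⟨ trans (∑-+ _ _) (cong (_+ D) (trans (∑-cong {g = λ _ → + 2 * + 1} (λ _ → refl)) (trans (∑-* (+ 2) (λ _ → + 1)) (cong (+ 2 *_) (∑-one n))))) ⟩
      + 2 * N + D                      ∎

    10D≤M : + 10 * D ≤ + M
    10D≤M = ≤-trans (*-monoˡ (+ 10) (0≤ℕ 10) D≤aD) (≤-trans (≤-by (+ 10 * aD) (0≤* (0≤ℕ 10) (0≤ℕ ∣ D ∣)) (lem aD)) drift)
      where
      lem : ∀ a → + 20 * a ≡ + 10 * a + + 10 * a
      lem = solve-∀

    M≤3n : + M ≤ + 3 * N
    M≤3n = *-cancelˡ (+ 9) (+≤+ (ℕ.s≤s ℕ.z≤n)) (≤-by (+ 10 * (+ 2 * N + D - + M) + (+ M - + 10 * D) + + 7 * N)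
      (0≤+ (0≤+ (0≤* (0≤ℕ 10) (0≤- M≤2n+D)) (0≤- 10D≤M)) (0≤* (0≤ℕ 7) 0≤N)) (lem N D (+ M)))
      where
      lem : ∀ n d m → + 9 * (+ 3 * n) ≡ + 9 * m + (+ 10 * (+ 2 * n + d - m) + (m - + 10 * d) + + 7 * n)
      lem = solve-∀

    root : ∃ λ s → + s * + s * + s * + M ≤ N * V × N * V ≤ (+ s + + 1) * (+ s + + 1) * (+ s + + 1) * + M × ¬ ((+ s + + 1) * (+ s + + 1) * (+ s + + 1) * + M ≤ N * V)
    root = cube-root 1≤M (0≤* 0≤N 0≤V)

    s : ℕ
    s = proj₁ root

    private
      y : ℤ
      y = + s
      0≤y : + 0 ≤ y
      0≤y = 0≤ℕ s

    s³M≤nV : y * y * y * + M ≤ N * V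
    s³M≤nV = proj₁ (proj₂ root)

    nV≤ : N * V ≤ (y + + 1) * (y + + 1) * (y + + 1) * + M
    nV≤ = proj₁ (proj₂ (proj₂ root))

    KΔ≤s : K * + Δ ≤ y
    KΔ≤s with K * + Δ ≤? y
    ... | yes p = p
    ... | no ¬p = ⊥-elim (proj₂ (proj₂ (proj₂ root)) (begin
      (y + + 1) * (y + + 1) * (y + + 1) * + M        ≤⟨ *-monoʳ (+ M) 0≤M (*-mono (0≤* 0≤y+1 0≤y+1) 0≤x (*-mono 0≤y+1 0≤x y<x y<x) y<x) ⟩
      (+ Δ * K) * (+ Δ * K) * (+ Δ * K) * + M        ≤⟨ degree-bound ⟩
      N * V                                          ∎))
      where
      0≤y+1 : + 0 ≤ y + + 1
      0≤y+1 = 0≤+ 0≤y (0≤ℕ 1)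
      y<x : y + + 1 ≤ + Δ * K
      y<x = ≤-trans (≰⇒1+≤ ¬p) (≤-reflexive (*-comm K (+ Δ)))
      0≤x : + 0 ≤ + Δ * K
      0≤x = ≤-trans 0≤y+1 y<x

    1≤K : + 1 ≤ K
    1≤K = ≤-trans (≤-trans 1≤L (≤-by (Λ + L) (0≤+ 0≤Λ 0≤L) (lem Λ L))) K-large
      where
      lem : ∀ a b → a + + 2 * b ≡ b + (a + b)
      lem = solve-∀
    0≤K : + 0 ≤ K
    0≤K = 1≤⇒0≤ 1≤K

    K≤s : K ≤ y
    K≤s = ≤-trans (≤-trans (≤-reflexive (sym (*-identityʳ K))) (*-monoˡ K 0≤K (+≤+ 1≤Δ))) KΔ≤s

    1≤s : + 1 ≤ y
    1≤s = ≤-trans 1≤K K≤s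

    0≤y³ : + 0 ≤ y * y * y
    0≤y³ = 0≤* (0≤* 0≤y 0≤y) 0≤y

    s³≤V : y * y * y ≤ V
    s³≤V = *-cancelˡ N 1≤N (≤-trans (≤-reflexive (*-comm N (y * y * y))) (≤-trans (*-monoˡ (y * y * y) 0≤y³ n≤M) s³M≤nV))

    nV≤8s³M : N * V ≤ (+ 2 * y) * (+ 2 * y) * (+ 2 * y) * + M
    nV≤8s³M = ≤-trans nV≤ (*-monoʳ (+ M) 0≤M (*-mono (0≤* 0≤y+1 0≤y+1) 0≤2y (*-mono 0≤y+1 0≤2y ≤2y ≤2y) ≤2y))
      where
      0≤y+1 : + 0 ≤ y + + 1
      0≤y+1 = 0≤+ 0≤y (0≤ℕ 1)
      0≤2y : + 0 ≤ + 2 * y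
      0≤2y = 0≤* (0≤ℕ 2) 0≤y
      ≤2y : y + + 1 ≤ + 2 * y
      ≤2y = ≤-trans (+-monoʳ-≤ y 1≤s) (≤-reflexive (lem y))
        where
        lem : ∀ y → y + y ≡ + 2 * y
        lem = solve-∀

    V≤24s³ : V ≤ + 24 * (y * y * y)
    V≤24s³ = *-cancelˡ N 1≤N (begin
      N * V                                      ≤⟨ nV≤8s³M ⟩
      (+ 2 * y) * (+ 2 * y) * (+ 2 * y) * + M    ≤⟨ *-monoˡ ((+ 2 * y) * (+ 2 * y) * (+ 2 * y)) (0≤* (0≤* 0≤2y 0≤2y) 0≤2y) M≤3n ⟩
      (+ 2 * y) * (+ 2 * y) * (+ 2 * y) * (+ 3 * N) ≡⟨ lem y N ⟩
      N * (+ 24 * (y * y * y))                   ∎)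
      where
      0≤2y : + 0 ≤ + 2 * y
      0≤2y = 0≤* (0≤ℕ 2) 0≤y
      lem : ∀ y n → (+ 2 * y) * (+ 2 * y) * (+ 2 * y) * (+ 3 * n) ≡ n * (+ 24 * (y * y * y))
      lem = solve-∀

    aD≤Λs² : aD ≤ Λ * (y * y)
    aD≤Λs² = cube-cancel (0≤* 0≤Λ (0≤* 0≤y 0≤y)) (*-cancelˡ N 1≤N (begin
      N * (aD * aD * aD)                                 ≡⟨ *-comm N (aD * aD * aD) ⟩
      aD * aD * aD * N                                   ≤⟨ window ⟩
      ℓ * ℓ * ℓ * (V * V) * + M                          ≤⟨ *-mono (0≤* 0≤ℓ³ (0≤* 0≤V 0≤V)) (0≤* (0≤ℕ 3) 0≤N)
                                                              (*-monoˡ (ℓ * ℓ * ℓ) 0≤ℓ³ (*-mono 0≤V (0≤* (0≤ℕ 24) 0≤y³) V≤24s³ V≤24s³)) M≤3n ⟩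
      ℓ * ℓ * ℓ * (+ 24 * (y * y * y) * (+ 24 * (y * y * y))) * (+ 3 * N) ≡⟨ lem ℓ y N ⟩
      N * (Λ * (y * y) * (Λ * (y * y)) * (Λ * (y * y)))  ∎))
      where
      0≤ℓ³ : + 0 ≤ ℓ * ℓ * ℓ
      0≤ℓ³ = 0≤* (0≤* 0≤ℓ 0≤ℓ) 0≤ℓ
      lem : ∀ l y n → l * l * l * (+ 24 * (y * y * y) * (+ 24 * (y * y * y))) * (+ 3 * n) ≡
        n * (+ 12 * l * (y * y) * (+ 12 * l * (y * y)) * (+ 12 * l * (y * y)))
      lem = solve-∀

    D≤Λs² : D ≤ Λ * (y * y)
    D≤Λs² = ≤-trans D≤aD aD≤Λs²

    -Λs²≤D : - (Λ * (y * y)) ≤ D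
    -Λs²≤D = ≤-trans (neg-mono-≤ aD≤Λs²) -aD≤D

    Ls²≤n : L * (y * y) ≤ N
    Ls²≤n = *-cancelˡ (+ 2) (+≤+ (ℕ.s≤s ℕ.z≤n)) (*-cancelˡ y 1≤s (begin
      y * (+ 2 * (L * (y * y)))                        ≡⟨ lem₁ y L Λ ⟩
      (Λ + + 2 * L) * (y * y * y) - y * (Λ * (y * y))  ≤⟨ +-monoˡ-≤ (- (y * (Λ * (y * y)))) (begin
          (Λ + + 2 * L) * (y * y * y)                    ≤⟨ *-mono (0≤+ 0≤Λ (0≤* (0≤ℕ 2) 0≤L)) 0≤V K-large s³≤V ⟩
          K * V                                          ≤⟨ *-monoˡ K 0≤K V≤ ⟩
          K * (+ Δ * (D + + 2 * N))                      ≡⟨ *-assoc K (+ Δ) (D + + 2 * N) ⟨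
          K * + Δ * (D + + 2 * N)                        ≤⟨ *-mono (0≤* 0≤K (0≤ℕ Δ)) (0≤+ (0≤* 0≤Λ (0≤* 0≤y 0≤y)) (0≤* (0≤ℕ 2) 0≤N)) KΔ≤s (+-monoˡ-≤ (+ 2 * N) D≤Λs²) ⟩
          y * (Λ * (y * y) + + 2 * N)                    ∎) ⟩
      y * (Λ * (y * y) + + 2 * N) - y * (Λ * (y * y))  ≡⟨ lem₂ y (Λ * (y * y)) N ⟩
      y * (+ 2 * N)                                    ∎))
      where
      lem₁ : ∀ y l a → y * (+ 2 * (l * (y * y))) ≡ (a + + 2 * l) * (y * y * y) - y * (a * (y * y))
      lem₁ = solve-∀
      lem₂ : ∀ y a n → y * (a + + 2 * n) - y * a ≡ y * (+ 2 * n)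
      lem₂ = solve-∀
      V≤ : V ≤ + Δ * (D + + 2 * N)
      V≤ = begin
        V                                    ≤⟨ ∑-mono (λ v → ρ≤Δ (d v) (1≤d v) (+≤+ (d≤Δ v))) ⟩
        ∑ (λ v → + Δ * (η (d v) + + 2))      ≡⟨ trans (∑-* (+ Δ) _) (cong (+ Δ *_) (trans (∑-+ _ _) (cong (_+_ D) (trans (∑-cong {g = λ _ → + 2 * + 1} (λ _ → refl)) (trans (∑-* (+ 2) (λ _ → + 1)) (cong (+ 2 *_) (∑-one n))))))) ⟩
        + Δ * (D + + 2 * N)                  ∎

    private
      n₁ n₂ : ℤ
      n₁ = ∑ (λ v → ι (d v ≡ᵇ 1))
      n₂ = ∑ (λ v → ι (d v ≡ᵇ 2))

    n≤zV : N ≤ z * V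
    n≤zV = begin
      N                          ≤⟨ ≤-by (z * N - (z * n₂ + N)) (0≤- share) refl ⟩
      N + (z * N - (z * n₂ + N)) ≡⟨ lem₁ z N n₂ ⟩
      z * N - z * n₂             ≤⟨ +-monoˡ-≤ (- (z * n₂)) (*-monoˡ z 0≤z n≤) ⟩
      z * (n₂ + V) - z * n₂      ≡⟨ lem₂ z n₂ V ⟩
      z * V                      ∎
      where
      n≤ : N ≤ n₂ + V
      n≤ = ≤-trans (≤-reflexive (sym (∑-one n))) (≤-trans (∑-mono (λ v → ρ-nontrivial (d v) (1≤d v))) (≤-reflexive (∑-+ _ _)))
      lem₁ : ∀ z n a → n + (z * n - (z * a + n)) ≡ z * n - z * a
      lem₁ = solve-∀
      lem₂ : ∀ z a v → z * (a + v) - z * a ≡ z * v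
      lem₂ = solve-∀

    n≤24zs³ : N ≤ + 24 * z * (y * y * y)
    n≤24zs³ = ≤-trans n≤zV (≤-trans (*-monoˡ z 0≤z V≤24s³) (≤-reflexive (lem z (y * y * y))))
      where
      lem : ∀ z a → z * (+ 24 * a) ≡ + 24 * z * a
      lem = solve-∀

    n≤4zn₁ : N ≤ + 4 * z * n₁
    n≤4zn₁ = ≤-by ((z * (n₂ + + 2 * n₁ + D) - z * N) + (z * (n₂ + + 2 * n₁ + D) - z * N) + (z * N - (z * n₂ + N)) + (z * N - (z * n₂ + N)) + (N - + 2 * (z * D)))
      (0≤+ (0≤+ (0≤+ (0≤+ 0≤a 0≤a) (0≤- share)) (0≤- share)) (0≤- 2zD≤n)) (lem z N n₁ n₂ D)
      where
      0≤a : + 0 ≤ z * (n₂ + + 2 * n₁ + D) - z * N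
      0≤a = 0≤- (*-monoˡ z 0≤z (≤-trans (≤-reflexive (sym (∑-one n))) (≤-trans (∑-mono (λ v → leaves-needed (d v) (1≤d v)))
        (≤-reflexive (trans (∑-+ _ _) (cong (_+ D) (trans (∑-+ _ _) (cong (_+_ n₂) (∑-* (+ 2) _)))))))))
      2zD≤n : + 2 * (z * D) ≤ N
      2zD≤n = begin
        + 2 * (z * D)                ≤⟨ *-monoˡ (+ 2) (0≤ℕ 2) (*-monoˡ z 0≤z D≤Λs²) ⟩
        + 2 * (z * (Λ * (y * y)))    ≡⟨ lem′ z Λ (y * y) ⟩
        + 2 * z * Λ * (y * y)        ≤⟨ *-monoʳ (y * y) (0≤* 0≤y 0≤y) L-large ⟩
        L * (y * y)                  ≤⟨ Ls²≤n ⟩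
        N                            ∎
        where
        lem′ : ∀ z l a → + 2 * (z * (l * a)) ≡ + 2 * z * l * a
        lem′ = solve-∀
      lem : ∀ z n a b e → + 4 * z * a ≡ n + ((z * (b + + 2 * a + e) - z * n) + (z * (b + + 2 * a + e) - z * n) + (z * n - (z * b + n)) + (z * n - (z * b + n)) + (n - + 2 * (z * e)))
      lem = solve-∀

    small-scaled : ∀ {t} L → + 0 ≤ t → (t * + L) * (t * + L) * (t * + L) * V ≤ N * N * + M → t * + L * y ≤ N
    small-scaled {t} L 0≤t h = cube-cancel 0≤N (*-cancelˡ (+ M) 1≤M (begin
      + M * (x * y * (x * y) * (x * y))      ≡⟨ lem₁ (+ M) x y ⟩
      x * x * x * (y * y * y * + M)          ≤⟨ *-monoˡ (x * x * x) (0≤* (0≤* 0≤x 0≤x) 0≤x) s³M≤nV ⟩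
      x * x * x * (N * V)                    ≡⟨ lem₂ x N V ⟩
      N * (x * x * x * V)                    ≤⟨ *-monoˡ N 0≤N h ⟩
      N * (N * N * + M)                      ≡⟨ lem₃ N (+ M) ⟩
      + M * (N * N * N)                      ∎))
      where
      x : ℤ
      x = t * + L
      0≤x : + 0 ≤ x
      0≤x = 0≤* 0≤t (0≤ℕ L)
      lem₁ : ∀ m x y → m * (x * y * (x * y) * (x * y)) ≡ x * x * x * (y * y * y * m)
      lem₁ = solve-∀
      lem₂ : ∀ x n v → x * x * x * (n * v) ≡ n * (x * x * x * v)
      lem₂ = solve-∀
      lem₃ : ∀ n m → n * (n * n * m) ≡ m * (n * n * n)
      lem₃ = solve-∀

    large-scaled : ∀ {B} L → B * B * B * (N * N) * + M ≤ + L * + L * + L * V → B * N ≤ + 2 * (+ L * y)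
    large-scaled {B} L h = cube-cancel (0≤* (0≤ℕ 2) (0≤* (0≤ℕ L) 0≤y)) (*-cancelˡ (+ M) 1≤M (begin
      + M * (B * N * (B * N) * (B * N))                    ≡⟨ lem₁ (+ M) B N ⟩
      N * (B * B * B * (N * N) * + M)                      ≤⟨ *-monoˡ N 0≤N h ⟩
      N * (+ L * + L * + L * V)                            ≡⟨ lem₂ N (+ L) V ⟩
      + L * + L * + L * (N * V)                            ≤⟨ *-monoˡ (+ L * + L * + L) (0≤* (0≤* (0≤ℕ L) (0≤ℕ L)) (0≤ℕ L)) nV≤8s³M ⟩
      + L * + L * + L * ((+ 2 * y) * (+ 2 * y) * (+ 2 * y) * + M) ≡⟨ lem₃ (+ M) (+ L) y ⟩
      + M * (+ 2 * (+ L * y) * (+ 2 * (+ L * y)) * (+ 2 * (+ L * y))) ∎))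
      where
      lem₁ : ∀ m b n → m * (b * n * (b * n) * (b * n)) ≡ n * (b * b * b * (n * n) * m)
      lem₁ = solve-∀
      lem₂ : ∀ n l v → n * (l * l * l * v) ≡ l * l * l * (n * v)
      lem₂ = solve-∀
      lem₃ : ∀ m l y → l * l * l * ((+ 2 * y) * (+ 2 * y) * (+ 2 * y) * m) ≡ m * (+ 2 * (l * y) * (+ 2 * (l * y)) * (+ 2 * (l * y)))
      lem₃ = solve-∀

module Rationals where

  open import Data.Integer as ℤ using (ℤ; +_; -[1+_])
  import Data.Integer.Properties as ℤₚ
  import Data.Integer.Tactic.RingSolver as ℤ-Solver
  open import Data.Nat as ℕ using (ℕ; zero; suc)
  import Data.Nat.Properties as ℕₚ
  open import Data.Product using (∃; _×_; _,_)
  open import Data.Rational hiding (_÷_)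
  open import Data.Rational.Properties
  open import Data.Rational.Unnormalised as ℚᵘ using (ℚᵘ; mkℚᵘ; *≡*)
  import Data.Rational.Unnormalised.Properties as ℚᵘₚ
  open import Level using (0ℓ)
  open import Relation.Binary.PropositionalEquality
  open import Relation.Nullary.Decidable using (dec⇒maybe)
  open import Tactic.RingSolver using (solve-∀)
  open import Tactic.RingSolver.Core.AlmostCommutativeRing using (AlmostCommutativeRing; fromCommutativeRing)

  ℚ-ring : AlmostCommutativeRing 0ℓ 0ℓ
  ℚ-ring = fromCommutativeRing +-*-commutativeRing (λ x → dec⇒maybe (0ℚ ≟ x))

  ⟦_⟧ : ℤ → ℚ
  ⟦ i ⟧ = i / 1

  toℚᵘ-⟦⟧ : ∀ i → toℚᵘ ⟦ i ⟧ ℚᵘ.≃ mkℚᵘ i 0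
  toℚᵘ-⟦⟧ i = toℚᵘ-fromℚᵘ (mkℚᵘ i 0)

  ⟦⟧-* : ∀ i j → ⟦ i ⟧ * ⟦ j ⟧ ≡ ⟦ i ℤ.* j ⟧
  ⟦⟧-* i j = toℚᵘ-injective (ℚᵘₚ.≃-trans (toℚᵘ-homo-* ⟦ i ⟧ ⟦ j ⟧)
    (ℚᵘₚ.≃-trans (ℚᵘₚ.*-cong (toℚᵘ-⟦⟧ i) (toℚᵘ-⟦⟧ j)) (ℚᵘₚ.≃-sym (toℚᵘ-⟦⟧ (i ℤ.* j)))))

  ⟦⟧-+ : ∀ i j → ⟦ i ⟧ + ⟦ j ⟧ ≡ ⟦ i ℤ.+ j ⟧
  ⟦⟧-+ i j = toℚᵘ-injective (ℚᵘₚ.≃-trans (toℚᵘ-homo-+ ⟦ i ⟧ ⟦ j ⟧)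
    (ℚᵘₚ.≃-trans (ℚᵘₚ.+-cong (toℚᵘ-⟦⟧ i) (toℚᵘ-⟦⟧ j)) (ℚᵘₚ.≃-trans (*≡* (lem i j)) (ℚᵘₚ.≃-sym (toℚᵘ-⟦⟧ (i ℤ.+ j))))))
    where
    lem : ∀ i j → (i ℤ.* + 1 ℤ.+ j ℤ.* + 1) ℤ.* + 1 ≡ (i ℤ.+ j) ℤ.* + 1
    lem = ℤ-Solver.solve-∀

  ⟦⟧-mono : ∀ {i j} → i ℤ.≤ j → ⟦ i ⟧ ≤ ⟦ j ⟧
  ⟦⟧-mono {i} {j} p = toℚᵘ-cancel-≤ (ℚᵘₚ.≤-respˡ-≃ (ℚᵘₚ.≃-sym (toℚᵘ-⟦⟧ i)) (ℚᵘₚ.≤-respʳ-≃ (ℚᵘₚ.≃-sym (toℚᵘ-⟦⟧ j))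
    (ℚᵘ.*≤* (subst₂ ℤ._≤_ (sym (ℤₚ.*-identityʳ i)) (sym (ℤₚ.*-identityʳ j)) p))))

  ⟦⟧-cancel : ∀ {i j} → ⟦ i ⟧ ≤ ⟦ j ⟧ → i ℤ.≤ j
  ⟦⟧-cancel {i} {j} p with ℚᵘₚ.≤-respˡ-≃ (toℚᵘ-⟦⟧ i) (ℚᵘₚ.≤-respʳ-≃ (toℚᵘ-⟦⟧ j) (toℚᵘ-mono-≤ p))
  ... | ℚᵘ.*≤* q = subst₂ ℤ._≤_ (ℤₚ.*-identityʳ i) (ℤₚ.*-identityʳ j) q

  0≤⟦⟧ : ∀ n → 0ℚ ≤ ⟦ + n ⟧
  0≤⟦⟧ n = ⟦⟧-mono {+ 0} {+ n} (ℤ.+≤+ ℕ.z≤n)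

  ÷-*-cancel : ∀ a {b} → 1 ℕ.≤ b → (a ÷ℕ b) * ⟦ + b ⟧ ≡ ⟦ + a ⟧
  ÷-*-cancel a {suc b} _ = toℚᵘ-injective (ℚᵘₚ.≃-trans (toℚᵘ-homo-* (+ a / suc b) ⟦ + suc b ⟧)
    (ℚᵘₚ.≃-trans (ℚᵘₚ.*-cong (toℚᵘ-fromℚᵘ (mkℚᵘ (+ a) b)) (toℚᵘ-⟦⟧ (+ suc b)))
      (ℚᵘₚ.≃-trans (*≡* (trans (ℤₚ.*-identityʳ _) (cong (λ k → + a ℤ.* + k) (sym (ℕₚ.*-identityʳ (suc b)))))) (ℚᵘₚ.≃-sym (toℚᵘ-⟦⟧ (+ a))))))

  *-monoˡ : ∀ c {a b} → 0ℚ ≤ c → a ≤ b → c * a ≤ c * b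
  *-monoˡ c p q = *-monoˡ-≤-nonNeg c {{nonNegative p}} q

  *-monoʳ : ∀ c {a b} → 0ℚ ≤ c → a ≤ b → a * c ≤ b * c
  *-monoʳ c p q = *-monoʳ-≤-nonNeg c {{nonNegative p}} q

  *-mono : ∀ {a b c d} → 0ℚ ≤ a → 0ℚ ≤ d → a ≤ b → c ≤ d → a * c ≤ b * d
  *-mono {a} {d = d} 0≤a 0≤d p q = ≤-trans (*-monoˡ a 0≤a q) (*-monoʳ d 0≤d p)

  0≤* : ∀ {a b} → 0ℚ ≤ a → 0ℚ ≤ b → 0ℚ ≤ a * b
  0≤* {a} {b} p q = subst (_≤ a * b) (*-zeroʳ a) (*-monoˡ a p q)

  cancel-⟦⟧ : ∀ n {a b} → 1 ℕ.≤ n → a * ⟦ + n ⟧ ≤ b * ⟦ + n ⟧ → a ≤ b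
  cancel-⟦⟧ (suc n) _ p = *-cancelʳ-≤-pos ⟦ + suc n ⟧ {{positive (<-≤-trans 0<1 (⟦⟧-mono {+ 1} {+ suc n} (ℤ.+≤+ (ℕ.s≤s ℕ.z≤n))))}} p
    where
    0<1 : 0ℚ < ⟦ + 1 ⟧
    0<1 = *<* (ℤ.+<+ (ℕ.s≤s ℕ.z≤n))

  0≤÷ : ∀ a b → 0ℚ ≤ a ÷ℕ b
  0≤÷ a zero = ≤-refl
  0≤÷ a (suc b) = cancel-⟦⟧ (suc b) (ℕ.s≤s ℕ.z≤n) (≤-trans (≤-reflexive (*-zeroˡ ⟦ + suc b ⟧)) (≤-trans (0≤⟦⟧ a) (≤-reflexive (sym (÷-*-cancel a {suc b} (ℕ.s≤s ℕ.z≤n))))))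

  0≤^ : ∀ {q} k → 0ℚ ≤ q → 0ℚ ≤ q ^ℚ k
  0≤^ zero p = 0≤⟦⟧ 1
  0≤^ (suc k) p = 0≤* p (0≤^ k p)

  ^-mono : ∀ {a b} k → 0ℚ ≤ a → a ≤ b → a ^ℚ k ≤ b ^ℚ k
  ^-mono zero p q = ≤-refl
  ^-mono (suc k) p q = *-mono p (0≤^ k (≤-trans p q)) q (^-mono k p q)

  ^-* : ∀ a b k → (a * b) ^ℚ k ≡ (a ^ℚ k) * (b ^ℚ k)
  ^-* a b zero = refl
  ^-* a b (suc k) = trans (cong (a * b *_) (^-* a b k)) (lem a b (a ^ℚ k) (b ^ℚ k))
    where
    lem : ∀ a b c d → a * b * (c * d) ≡ a * c * (b * d)
    lem = solve-∀ ℚ-ring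

  ⟦⟧-cube : ∀ i → ⟦ i ⟧ ^ℚ 3 ≡ ⟦ i ℤ.* i ℤ.* i ⟧
  ⟦⟧-cube i = trans (lem ⟦ i ⟧) (trans (cong (_* ⟦ i ⟧) (⟦⟧-* i i)) (⟦⟧-* (i ℤ.* i) i))
    where
    lem : ∀ a → a * (a * (a * 1ℚ)) ≡ a * a * a
    lem = solve-∀ ℚ-ring

  ⟦⟧-square : ∀ i → ⟦ i ⟧ ^ℚ 2 ≡ ⟦ i ℤ.* i ⟧
  ⟦⟧-square i = trans (cong (⟦ i ⟧ *_) (*-identityʳ ⟦ i ⟧)) (⟦⟧-* i i)

  -- The partial sums of the logarithm series are unbounded: by Bernoulli z ^ (2 j + 1) ≥ 1/2 for small j, and
  -- the harmonic series is summed in dyadic blocks.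

  module _ {n : ℕ} (1≤n : 1 ℕ.≤ n) where

    private
      z w : ℚ
      z = lnZ n
      w = 2 ÷ℕ suc n
      0≤z : 0ℚ ≤ z
      0≤z = 0≤÷ (n ℕ.∸ 1) (suc n)
      0≤w : 0ℚ ≤ w
      0≤w = 0≤÷ 2 (suc n)
      0<1+n : 1 ℕ.≤ suc n
      0<1+n = ℕ.s≤s ℕ.z≤n

    z+w : z + w ≡ 1ℚ
    z+w = ≤-antisym (cancel-⟦⟧ (suc n) 0<1+n (≤-reflexive eq)) (cancel-⟦⟧ (suc n) 0<1+n (≤-reflexive (sym eq)))
      where
      open ≡-Reasoning
      n-1+2 : ∀ n → 1 ℕ.≤ n → + (n ℕ.∸ 1) ℤ.+ + 2 ≡ + suc n
      n-1+2 (suc n) _ = cong +_ (ℕₚ.+-comm n 2)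
      eq : (z + w) * ⟦ + suc n ⟧ ≡ 1ℚ * ⟦ + suc n ⟧
      eq = begin
        (z + w) * ⟦ + suc n ⟧                      ≡⟨ *-distribʳ-+ ⟦ + suc n ⟧ z w ⟩
        z * ⟦ + suc n ⟧ + w * ⟦ + suc n ⟧          ≡⟨ cong₂ _+_ (÷-*-cancel (n ℕ.∸ 1) 0<1+n) (÷-*-cancel 2 0<1+n) ⟩
        ⟦ + (n ℕ.∸ 1) ⟧ + ⟦ + 2 ⟧                  ≡⟨ ⟦⟧-+ (+ (n ℕ.∸ 1)) (+ 2) ⟩
        ⟦ + (n ℕ.∸ 1) ℤ.+ + 2 ⟧                    ≡⟨ cong ⟦_⟧ (n-1+2 n 1≤n) ⟩
        ⟦ + suc n ⟧                                ≡⟨ *-identityˡ ⟦ + suc n ⟧ ⟨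
        1ℚ * ⟦ + suc n ⟧                           ∎

    bernoulli : ∀ k → 1ℚ ≤ z ^ℚ k + ⟦ + k ⟧ * w
    bernoulli zero = ≤-reflexive (sym (trans (cong (_+_ 1ℚ) (*-zeroˡ w)) (+-identityʳ 1ℚ)))
    bernoulli (suc k) = begin
      1ℚ                                             ≡⟨ z+w ⟨
      z + w                                          ≡⟨ cong (_+ w) (*-identityʳ z) ⟨
      z * 1ℚ + w                                     ≤⟨ +-monoˡ-≤ w (*-monoˡ z 0≤z (bernoulli k)) ⟩
      z * (z ^ℚ k + ⟦ + k ⟧ * w) + w                 ≡⟨ lem₁ z (z ^ℚ k) ⟦ + k ⟧ w ⟩
      z * z ^ℚ k + (z * (⟦ + k ⟧ * w) + w)           ≤⟨ +-monoʳ-≤ (z * z ^ℚ k) (+-monoˡ-≤ w (*-monoʳ (⟦ + k ⟧ * w) (0≤* (0≤⟦⟧ k) 0≤w) z≤1)) ⟩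
      z * z ^ℚ k + (1ℚ * (⟦ + k ⟧ * w) + w)          ≡⟨ cong (_+_ (z * z ^ℚ k)) (lem₂ ⟦ + k ⟧ w) ⟩
      z * z ^ℚ k + (1ℚ + ⟦ + k ⟧) * w                ≡⟨ cong (λ x → z * z ^ℚ k + x * w) (⟦⟧-+ (+ 1) (+ k)) ⟩
      z * z ^ℚ k + ⟦ + suc k ⟧ * w                   ∎
      where
      open ≤-Reasoning
      z≤1 : z ≤ 1ℚ
      z≤1 = ≤-trans (≤-reflexive (sym (+-identityʳ z))) (≤-trans (+-monoʳ-≤ z 0≤w) (≤-reflexive z+w))
      lem₁ : ∀ z p k w → z * (p + k * w) + w ≡ z * p + (z * (k * w) + w)
      lem₁ = solve-∀ ℚ-ring
      lem₂ : ∀ k w → 1ℚ * (k * w) + w ≡ (1ℚ + k) * w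
      lem₂ = solve-∀ ℚ-ring

    half-power : ∀ k → 4 ℕ.* k ℕ.≤ suc n → 1ℚ ≤ ⟦ + 2 ⟧ * z ^ℚ k
    half-power k 4k≤ = ≤-trans (≤-reflexive (lem₁ (⟦ + 2 ⟧ * (⟦ + k ⟧ * w))))
      (≤-trans (+-mono-≤ (≤-trans two≤ (≤-reflexive refl)) (neg-antimono-≤ small)) (≤-reflexive (lem₃ ⟦ + 2 ⟧ (z ^ℚ k) (⟦ + k ⟧ * w))))
      where
      two : ⟦ + 2 ⟧ ≡ 1ℚ + 1ℚ
      two = sym (⟦⟧-+ (+ 1) (+ 1))
      lem₁ : ∀ x → 1ℚ ≡ 1ℚ + 1ℚ + - 1ℚ
      lem₁ x = refl
      two≤ : 1ℚ + 1ℚ ≤ ⟦ + 2 ⟧ * (z ^ℚ k + ⟦ + k ⟧ * w)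
      two≤ = ≤-trans (≤-reflexive (trans (sym two) (sym (*-identityʳ ⟦ + 2 ⟧)))) (*-monoˡ ⟦ + 2 ⟧ (0≤⟦⟧ 2) (bernoulli k))
      small : ⟦ + 2 ⟧ * (⟦ + k ⟧ * w) ≤ 1ℚ
      small = cancel-⟦⟧ (suc n) 0<1+n (begin
        ⟦ + 2 ⟧ * (⟦ + k ⟧ * w) * ⟦ + suc n ⟧        ≡⟨ lem ⟦ + 2 ⟧ ⟦ + k ⟧ w ⟦ + suc n ⟧ ⟩
        ⟦ + 2 ⟧ * (⟦ + k ⟧ * (w * ⟦ + suc n ⟧))      ≡⟨ cong (λ x → ⟦ + 2 ⟧ * (⟦ + k ⟧ * x)) (÷-*-cancel 2 0<1+n) ⟩
        ⟦ + 2 ⟧ * (⟦ + k ⟧ * ⟦ + 2 ⟧)                ≡⟨ trans (cong (⟦ + 2 ⟧ *_) (⟦⟧-* (+ k) (+ 2))) (⟦⟧-* (+ 2) (+ k ℤ.* + 2)) ⟩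
        ⟦ + 2 ℤ.* (+ k ℤ.* + 2) ⟧                    ≤⟨ ⟦⟧-mono (ℤₚ.≤-trans (ℤₚ.≤-reflexive (trans (lem′ (+ k)) (sym (ℤₚ.pos-* 4 k)))) (ℤ.+≤+ 4k≤)) ⟩
        ⟦ + suc n ⟧                                  ≡⟨ *-identityˡ ⟦ + suc n ⟧ ⟨
        1ℚ * ⟦ + suc n ⟧                             ∎)
        where
        open ≤-Reasoning
        lem : ∀ a k w m → a * (k * w) * m ≡ a * (k * (w * m))
        lem = solve-∀ ℚ-ring
        lem′ : ∀ k → + 2 ℤ.* (k ℤ.* + 2) ≡ + 4 ℤ.* k
        lem′ = ℤ-Solver.solve-∀
      lem₃ : ∀ t p x → t * (p + x) + - (t * x) ≡ t * p
      lem₃ = solve-∀ ℚ-ring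

    lnTerm : ℕ → ℚ
    lnTerm j = ℕtoℚ 2 * ((z ^ℚ (2 ℕ.* j ℕ.+ 1)) * (1 ÷ℕ (2 ℕ.* j ℕ.+ 1)))

    lnTerm-lower : ∀ j c → 2 ℕ.* j ℕ.+ 1 ℕ.≤ c → 4 ℕ.* c ℕ.≤ suc n → 1ℚ ≤ ⟦ + c ⟧ * lnTerm j
    lnTerm-lower j c k≤c 4c≤ = begin
      1ℚ                                             ≡⟨ ÷-*-cancel 1 1≤k ⟨
      (1 ÷ℕ k) * ⟦ + k ⟧                             ≤⟨ *-monoˡ (1 ÷ℕ k) (0≤÷ 1 k) (⟦⟧-mono (ℤ.+≤+ k≤c)) ⟩
      (1 ÷ℕ k) * ⟦ + c ⟧                             ≡⟨ *-identityˡ _ ⟨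
      1ℚ * ((1 ÷ℕ k) * ⟦ + c ⟧)                      ≤⟨ *-monoʳ ((1 ÷ℕ k) * ⟦ + c ⟧) (0≤* (0≤÷ 1 k) (0≤⟦⟧ c)) (half-power k (ℕₚ.≤-trans (ℕₚ.*-monoʳ-≤ 4 k≤c) 4c≤)) ⟩
      ⟦ + 2 ⟧ * z ^ℚ k * ((1 ÷ℕ k) * ⟦ + c ⟧)        ≡⟨ lem ⟦ + 2 ⟧ (z ^ℚ k) (1 ÷ℕ k) ⟦ + c ⟧ ⟩
      ⟦ + c ⟧ * lnTerm j                             ∎
      where
      open ≤-Reasoning
      k : ℕ
      k = 2 ℕ.* j ℕ.+ 1
      1≤k : 1 ℕ.≤ k
      1≤k = ℕₚ.m≤n+m 1 (2 ℕ.* j)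
      lem : ∀ t p v c → t * p * (v * c) ≡ c * (t * (p * v))
      lem = solve-∀ ℚ-ring

    lnPartial-block : ∀ m i c → 2 ℕ.* (m ℕ.+ i) ℕ.≤ c → 4 ℕ.* c ℕ.≤ suc n →
      ⟦ + c ⟧ * lnPartial n m + ⟦ + i ⟧ ≤ ⟦ + c ⟧ * lnPartial n (m ℕ.+ i)
    lnPartial-block m zero c _ _ = ≤-reflexive (trans (+-identityʳ _) (cong (λ k → ⟦ + c ⟧ * lnPartial n k) (sym (ℕₚ.+-identityʳ m))))
    lnPartial-block m (suc i) c h 4c≤ = begin
      ⟦ + c ⟧ * lnPartial n m + ⟦ + suc i ⟧                    ≡⟨ cong (_+_ (⟦ + c ⟧ * lnPartial n m)) (trans (sym (⟦⟧-+ (+ 1) (+ i))) (+-comm ⟦ + 1 ⟧ ⟦ + i ⟧)) ⟩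
      ⟦ + c ⟧ * lnPartial n m + (⟦ + i ⟧ + 1ℚ)                 ≡⟨ +-assoc (⟦ + c ⟧ * lnPartial n m) ⟦ + i ⟧ 1ℚ ⟨
      ⟦ + c ⟧ * lnPartial n m + ⟦ + i ⟧ + 1ℚ                   ≤⟨ +-mono-≤ (lnPartial-block m i c (ℕₚ.≤-trans (ℕₚ.*-monoʳ-≤ 2 (ℕₚ.+-monoʳ-≤ m (ℕₚ.n≤1+n i))) h) 4c≤) (lnTerm-lower (m ℕ.+ i) c k≤c 4c≤) ⟩
      ⟦ + c ⟧ * lnPartial n (m ℕ.+ i) + ⟦ + c ⟧ * lnTerm (m ℕ.+ i) ≡⟨ *-distribˡ-+ ⟦ + c ⟧ (lnPartial n (m ℕ.+ i)) (lnTerm (m ℕ.+ i)) ⟨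
      ⟦ + c ⟧ * lnPartial n (suc (m ℕ.+ i))                    ≡⟨ cong (λ k → ⟦ + c ⟧ * lnPartial n k) (ℕₚ.+-suc m i) ⟨
      ⟦ + c ⟧ * lnPartial n (m ℕ.+ suc i)                      ∎
      where
      open ≤-Reasoning
      k≤c : 2 ℕ.* (m ℕ.+ i) ℕ.+ 1 ℕ.≤ c
      k≤c = ℕₚ.≤-trans (ℕₚ.+-monoʳ-≤ (2 ℕ.* (m ℕ.+ i)) (ℕ.s≤s ℕ.z≤n)) (ℕₚ.≤-trans (ℕₚ.≤-reflexive eq) h)
        where
        eq : 2 ℕ.* (m ℕ.+ i) ℕ.+ 2 ≡ 2 ℕ.* (m ℕ.+ suc i)
        eq = trans (ℕₚ.+-comm _ 2) (trans (sym (ℕₚ.*-suc 2 (m ℕ.+ i))) (cong (2 ℕ.*_) (sym (ℕₚ.+-suc m i))))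

    lnPartial-dyadic : ∀ i → 16 ℕ.* 2 ℕ.^ i ℕ.≤ suc n → ⟦ + i ⟧ ≤ ⟦ + 4 ⟧ * lnPartial n (2 ℕ.^ i)
    lnPartial-dyadic zero h = begin
      ⟦ + 0 ⟧                                    ≤⟨ 0≤⟦⟧ 1 ⟩
      1ℚ                                         ≤⟨ lnTerm-lower 0 1 ℕₚ.≤-refl (ℕₚ.≤-trans (ℕₚ.m≤m+n 4 12) h) ⟩
      ⟦ + 1 ⟧ * lnTerm 0                         ≤⟨ *-monoʳ (lnTerm 0) (0≤* (0≤⟦⟧ 2) (0≤* (0≤^ 1 0≤z) (0≤÷ 1 1))) (⟦⟧-mono {+ 1} {+ 4} (ℤ.+≤+ (ℕ.s≤s ℕ.z≤n))) ⟩
      ⟦ + 4 ⟧ * lnTerm 0                         ≡⟨ cong (⟦ + 4 ⟧ *_) (+-identityˡ (lnTerm 0)) ⟨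
      ⟦ + 4 ⟧ * lnPartial n 1                    ∎
      where open ≤-Reasoning
    lnPartial-dyadic (suc i) h = begin
      ⟦ + suc i ⟧                                        ≡⟨ ⟦⟧-+ (+ 1) (+ i) ⟨
      1ℚ + ⟦ + i ⟧                                       ≤⟨ +-monoʳ-≤ 1ℚ (lnPartial-dyadic i (ℕₚ.≤-trans (ℕₚ.*-monoʳ-≤ 16 (ℕₚ.m≤m+n (2 ℕ.^ i) _)) h)) ⟩
      1ℚ + ⟦ + 4 ⟧ * lnPartial n p                       ≤⟨ cancel-⟦⟧ p 1≤p (begin
          (1ℚ + ⟦ + 4 ⟧ * lnPartial n p) * ⟦ + p ⟧           ≡⟨ lem ⟦ + 4 ⟧ (lnPartial n p) ⟦ + p ⟧ ⟩
          ⟦ + 4 ⟧ * ⟦ + p ⟧ * lnPartial n p + ⟦ + p ⟧        ≡⟨ cong (λ x → x * lnPartial n p + ⟦ + p ⟧) 4p ⟩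
          ⟦ + (4 ℕ.* p) ⟧ * lnPartial n p + ⟦ + p ⟧          ≤⟨ lnPartial-block p p (4 ℕ.* p) 2[p+p]≤ 16p≤ ⟩
          ⟦ + (4 ℕ.* p) ⟧ * lnPartial n (p ℕ.+ p)            ≡⟨ cong₂ _*_ (sym 4p) (cong (λ k → lnPartial n (p ℕ.+ k)) (sym (ℕₚ.+-identityʳ p))) ⟩
          ⟦ + 4 ⟧ * ⟦ + p ⟧ * lnPartial n (2 ℕ.^ suc i)      ≡⟨ lem′ ⟦ + 4 ⟧ ⟦ + p ⟧ (lnPartial n (2 ℕ.^ suc i)) ⟩
          ⟦ + 4 ⟧ * lnPartial n (2 ℕ.^ suc i) * ⟦ + p ⟧      ∎) ⟩
      ⟦ + 4 ⟧ * lnPartial n (2 ℕ.^ suc i)                ∎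
      where
      open ≤-Reasoning
      p : ℕ
      p = 2 ℕ.^ i
      1≤p : 1 ℕ.≤ p
      1≤p = ℕₚ.m^n>0 2 i
      4p : ⟦ + 4 ⟧ * ⟦ + p ⟧ ≡ ⟦ + (4 ℕ.* p) ⟧
      4p = trans (⟦⟧-* (+ 4) (+ p)) (cong ⟦_⟧ (sym (ℤₚ.pos-* 4 p)))
      2[p+p]≤ : 2 ℕ.* (p ℕ.+ p) ℕ.≤ 4 ℕ.* p
      2[p+p]≤ = ℕₚ.≤-reflexive (trans (cong (λ k → 2 ℕ.* (p ℕ.+ k)) (sym (ℕₚ.+-identityʳ p))) (sym (ℕₚ.*-assoc 2 2 p)))
      16p≤ : 4 ℕ.* (4 ℕ.* p) ℕ.≤ suc n
      16p≤ = ℕₚ.≤-trans (ℕₚ.≤-reflexive (sym (ℕₚ.*-assoc 4 4 p))) (ℕₚ.≤-trans (ℕₚ.*-monoʳ-≤ 16 (ℕₚ.m≤m+n p _)) h)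
      lem : ∀ t l p → (1ℚ + t * l) * p ≡ t * p * l + p
      lem = solve-∀ ℚ-ring
      lem′ : ∀ t p l → t * p * l ≡ t * l * p
      lem′ = solve-∀ ℚ-ring

  lnPartial-unbounded : ∀ K n → 16 ℕ.* 2 ℕ.^ (4 ℕ.* K) ℕ.≤ n → ∃ λ m → ⟦ + K ⟧ ≤ lnPartial n m
  lnPartial-unbounded K n h = 2 ℕ.^ (4 ℕ.* K) , cancel-⟦⟧ 4 (ℕ.s≤s ℕ.z≤n) (begin
    ⟦ + K ⟧ * ⟦ + 4 ⟧                          ≡⟨ trans (*-comm ⟦ + K ⟧ ⟦ + 4 ⟧) (trans (⟦⟧-* (+ 4) (+ K)) (cong ⟦_⟧ (sym (ℤₚ.pos-* 4 K)))) ⟩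
    ⟦ + (4 ℕ.* K) ⟧                            ≤⟨ lnPartial-dyadic 1≤n (4 ℕ.* K) (ℕₚ.≤-trans h (ℕₚ.n≤1+n n)) ⟩
    ⟦ + 4 ⟧ * lnPartial n (2 ℕ.^ (4 ℕ.* K))    ≡⟨ *-comm ⟦ + 4 ⟧ (lnPartial n (2 ℕ.^ (4 ℕ.* K))) ⟩
    lnPartial n (2 ℕ.^ (4 ℕ.* K)) * ⟦ + 4 ⟧    ∎)
    where
    open ≤-Reasoning
    1≤n : 1 ℕ.≤ n
    1≤n = ℕₚ.≤-trans (ℕₚ.≤-trans (ℕₚ.m^n>0 2 (4 ℕ.* K)) (ℕₚ.m≤m+n _ _)) h

  -- R and Q enter only through R M = V and Q M = D.

  module _ {n M V : ℕ} {R : ℚ} (RM : R * ⟦ + M ⟧ ≡ ⟦ + V ⟧) where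

    degree-cleared : ∀ {Δ K p} → ⟦ + K ⟧ ≤ p → (ℕtoℚ Δ ^ℚ 3) * (p ^ℚ 3) ≤ ℕtoℚ n * R →
      (+ Δ ℤ.* + K) ℤ.* (+ Δ ℤ.* + K) ℤ.* (+ Δ ℤ.* + K) ℤ.* + M ℤ.≤ + n ℤ.* + V
    degree-cleared {Δ} {K} {p} K≤p h = ⟦⟧-cancel (begin
      ⟦ x ℤ.* x ℤ.* x ℤ.* + M ⟧                    ≡⟨ trans (cong (_* ⟦ + M ⟧) (⟦⟧-cube x)) (⟦⟧-* (x ℤ.* x ℤ.* x) (+ M)) ⟨
      (⟦ x ⟧ ^ℚ 3) * ⟦ + M ⟧                       ≡⟨ cong (_* ⟦ + M ⟧) (trans (cong (_^ℚ 3) (sym (⟦⟧-* (+ Δ) (+ K)))) (^-* ⟦ + Δ ⟧ ⟦ + K ⟧ 3)) ⟩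
      (⟦ + Δ ⟧ ^ℚ 3) * (⟦ + K ⟧ ^ℚ 3) * ⟦ + M ⟧    ≤⟨ *-monoʳ ⟦ + M ⟧ (0≤⟦⟧ M) (≤-trans (*-monoˡ (⟦ + Δ ⟧ ^ℚ 3) (0≤^ 3 (0≤⟦⟧ Δ)) (^-mono 3 (0≤⟦⟧ K) K≤p)) h) ⟩
      ⟦ + n ⟧ * R * ⟦ + M ⟧                        ≡⟨ trans (*-assoc ⟦ + n ⟧ R ⟦ + M ⟧) (trans (cong (⟦ + n ⟧ *_) RM) (⟦⟧-* (+ n) (+ V))) ⟩
      ⟦ + n ℤ.* + V ⟧                              ∎)
      where
      open ≤-Reasoning
      x : ℤ
      x = + Δ ℤ.* + K

    window-cleared : ∀ {Q D lam ℓ} → ∣ Q ∣ * ⟦ + M ⟧ ≡ ⟦ + D ⟧ → 0ℚ ≤ lam → lam ≤ ⟦ + ℓ ⟧ → (∣ Q ∣ ^ℚ 3) * ℕtoℚ n ≤ (lam ^ℚ 3) * (R ^ℚ 2) →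
      + D ℤ.* + D ℤ.* + D ℤ.* + n ℤ.≤ + ℓ ℤ.* + ℓ ℤ.* + ℓ ℤ.* (+ V ℤ.* + V) ℤ.* + M
    window-cleared {Q} {D} {lam} {ℓ} QM 0≤lam lam≤ h = ⟦⟧-cancel (begin
      ⟦ + D ℤ.* + D ℤ.* + D ℤ.* + n ⟧              ≡⟨ trans (cong (_* ⟦ + n ⟧) (⟦⟧-cube (+ D))) (⟦⟧-* (+ D ℤ.* + D ℤ.* + D) (+ n)) ⟨
      (⟦ + D ⟧ ^ℚ 3) * ⟦ + n ⟧                     ≡⟨ cong (λ x → (x ^ℚ 3) * ⟦ + n ⟧) (sym QM) ⟩
      ((∣ Q ∣ * ⟦ + M ⟧) ^ℚ 3) * ⟦ + n ⟧           ≡⟨ lem₁ ∣ Q ∣ ⟦ + M ⟧ ⟦ + n ⟧ ⟩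
      (∣ Q ∣ ^ℚ 3) * ⟦ + n ⟧ * (⟦ + M ⟧ ^ℚ 3)      ≤⟨ *-monoʳ (⟦ + M ⟧ ^ℚ 3) (0≤^ 3 (0≤⟦⟧ M)) h ⟩
      (lam ^ℚ 3) * (R ^ℚ 2) * (⟦ + M ⟧ ^ℚ 3)       ≡⟨ lem₂ (lam ^ℚ 3) R ⟦ + M ⟧ ⟩
      (lam ^ℚ 3) * (((R * ⟦ + M ⟧) ^ℚ 2) * ⟦ + M ⟧) ≤⟨ *-monoʳ (((R * ⟦ + M ⟧) ^ℚ 2) * ⟦ + M ⟧) (0≤* (0≤^ 2 (≤-trans (0≤⟦⟧ V) (≤-reflexive (sym RM)))) (0≤⟦⟧ M)) (^-mono 3 0≤lam lam≤) ⟩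
      (⟦ + ℓ ⟧ ^ℚ 3) * (((R * ⟦ + M ⟧) ^ℚ 2) * ⟦ + M ⟧)
        ≡⟨ cong₂ (λ x y → x * (y * ⟦ + M ⟧)) (⟦⟧-cube (+ ℓ)) (trans (cong (_^ℚ 2) RM) (⟦⟧-square (+ V))) ⟩
      ⟦ + ℓ ℤ.* + ℓ ℤ.* + ℓ ⟧ * (⟦ + V ℤ.* + V ⟧ * ⟦ + M ⟧)
        ≡⟨ trans (sym (*-assoc ⟦ + ℓ ℤ.* + ℓ ℤ.* + ℓ ⟧ ⟦ + V ℤ.* + V ⟧ ⟦ + M ⟧)) (trans (cong (_* ⟦ + M ⟧) (⟦⟧-* (+ ℓ ℤ.* + ℓ ℤ.* + ℓ) (+ V ℤ.* + V))) (⟦⟧-* (+ ℓ ℤ.* + ℓ ℤ.* + ℓ ℤ.* (+ V ℤ.* + V)) (+ M))) ⟩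
      ⟦ + ℓ ℤ.* + ℓ ℤ.* + ℓ ℤ.* (+ V ℤ.* + V) ℤ.* + M ⟧ ∎)
      where
      open ≤-Reasoning
      lem₁ : ∀ q m n → (q * m) * ((q * m) * ((q * m) * 1ℚ)) * n ≡ q * (q * (q * 1ℚ)) * n * (m * (m * (m * 1ℚ)))
      lem₁ = solve-∀ ℚ-ring
      lem₂ : ∀ l r m → l * (r * (r * 1ℚ)) * (m * (m * (m * 1ℚ))) ≡ l * ((r * m) * ((r * m) * 1ℚ) * m)
      lem₂ = solve-∀ ℚ-ring

    small-cleared : ∀ {L A t} → A * ⟦ + t ⟧ ≡ 1ℚ → (ℕtoℚ L ^ℚ 3) * R ≤ (A ^ℚ 3) * (ℕtoℚ n ^ℚ 2) →
      (+ t ℤ.* + L) ℤ.* (+ t ℤ.* + L) ℤ.* (+ t ℤ.* + L) ℤ.* + V ℤ.≤ + n ℤ.* + n ℤ.* + M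
    small-cleared {L} {A} {t} At h = ⟦⟧-cancel (begin
      ⟦ x ℤ.* x ℤ.* x ℤ.* + V ⟧                        ≡⟨ trans (cong (_* ⟦ + V ⟧) (⟦⟧-cube x)) (⟦⟧-* (x ℤ.* x ℤ.* x) (+ V)) ⟨
      (⟦ x ⟧ ^ℚ 3) * ⟦ + V ⟧                           ≡⟨ cong₂ (λ a b → (a ^ℚ 3) * b) (sym (⟦⟧-* (+ t) (+ L))) (sym RM) ⟩
      ((⟦ + t ⟧ * ⟦ + L ⟧) ^ℚ 3) * (R * ⟦ + M ⟧)       ≡⟨ lem₁ ⟦ + t ⟧ ⟦ + L ⟧ R ⟦ + M ⟧ ⟩
      (⟦ + L ⟧ ^ℚ 3) * R * ((⟦ + t ⟧ ^ℚ 3) * ⟦ + M ⟧)  ≤⟨ *-monoʳ ((⟦ + t ⟧ ^ℚ 3) * ⟦ + M ⟧) (0≤* (0≤^ 3 (0≤⟦⟧ t)) (0≤⟦⟧ M)) h ⟩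
      (A ^ℚ 3) * (⟦ + n ⟧ ^ℚ 2) * ((⟦ + t ⟧ ^ℚ 3) * ⟦ + M ⟧) ≡⟨ lem₂ A ⟦ + n ⟧ ⟦ + t ⟧ ⟦ + M ⟧ ⟩
      ((A * ⟦ + t ⟧) ^ℚ 3) * ((⟦ + n ⟧ ^ℚ 2) * ⟦ + M ⟧) ≡⟨ trans (cong (λ a → (a ^ℚ 3) * ((⟦ + n ⟧ ^ℚ 2) * ⟦ + M ⟧)) At) (*-identityˡ _) ⟩
      (⟦ + n ⟧ ^ℚ 2) * ⟦ + M ⟧                         ≡⟨ trans (cong (_* ⟦ + M ⟧) (⟦⟧-square (+ n))) (⟦⟧-* (+ n ℤ.* + n) (+ M)) ⟩
      ⟦ + n ℤ.* + n ℤ.* + M ⟧                          ∎)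
      where
      open ≤-Reasoning
      x : ℤ
      x = + t ℤ.* + L
      lem₁ : ∀ t l r m → (t * l) * ((t * l) * ((t * l) * 1ℚ)) * (r * m) ≡ l * (l * (l * 1ℚ)) * r * (t * (t * (t * 1ℚ)) * m)
      lem₁ = solve-∀ ℚ-ring
      lem₂ : ∀ a n t m → a * (a * (a * 1ℚ)) * (n * (n * 1ℚ)) * (t * (t * (t * 1ℚ)) * m) ≡ (a * t) * ((a * t) * ((a * t) * 1ℚ)) * (n * (n * 1ℚ) * m)
      lem₂ = solve-∀ ℚ-ring

    large-cleared : ∀ {L B} → (ℕtoℚ B ^ℚ 3) * (ℕtoℚ n ^ℚ 2) ≤ (ℕtoℚ L ^ℚ 3) * R →
      + B ℤ.* + B ℤ.* + B ℤ.* (+ n ℤ.* + n) ℤ.* + M ℤ.≤ + L ℤ.* + L ℤ.* + L ℤ.* + V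
    large-cleared {L} {B} h = ⟦⟧-cancel (begin
      ⟦ + B ℤ.* + B ℤ.* + B ℤ.* (+ n ℤ.* + n) ℤ.* + M ⟧
        ≡⟨ trans (cong (_* ⟦ + M ⟧) (trans (cong₂ _*_ (⟦⟧-cube (+ B)) (⟦⟧-square (+ n))) (⟦⟧-* (+ B ℤ.* + B ℤ.* + B) (+ n ℤ.* + n)))) (⟦⟧-* (+ B ℤ.* + B ℤ.* + B ℤ.* (+ n ℤ.* + n)) (+ M)) ⟨
      (⟦ + B ⟧ ^ℚ 3) * (⟦ + n ⟧ ^ℚ 2) * ⟦ + M ⟧        ≤⟨ *-monoʳ ⟦ + M ⟧ (0≤⟦⟧ M) h ⟩
      (⟦ + L ⟧ ^ℚ 3) * R * ⟦ + M ⟧                     ≡⟨ trans (*-assoc (⟦ + L ⟧ ^ℚ 3) R ⟦ + M ⟧) (cong₂ _*_ (⟦⟧-cube (+ L)) RM) ⟩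
      ⟦ + L ℤ.* + L ℤ.* + L ⟧ * ⟦ + V ⟧                ≡⟨ ⟦⟧-* (+ L ℤ.* + L ℤ.* + L) (+ V) ⟩
      ⟦ + L ℤ.* + L ℤ.* + L ℤ.* + V ⟧                  ∎)
      where open ≤-Reasoning

  share-cleared : ∀ {a n z ζ} → 1ℚ ≤ ⟦ + z ⟧ * ζ → ℕtoℚ a ≤ (1ℚ - ζ) * ℕtoℚ n → + z ℤ.* + a ℤ.+ + n ℤ.≤ + z ℤ.* + n
  share-cleared {a} {n} {z} {ζ} zζ h = ⟦⟧-cancel (begin
    ⟦ + z ℤ.* + a ℤ.+ + n ⟧                            ≡⟨ trans (cong₂ _+_ (⟦⟧-* (+ z) (+ a)) (*-identityˡ ⟦ + n ⟧)) (⟦⟧-+ (+ z ℤ.* + a) (+ n)) ⟨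
    ⟦ + z ⟧ * ⟦ + a ⟧ + 1ℚ * ⟦ + n ⟧                   ≤⟨ +-mono-≤ (*-monoˡ ⟦ + z ⟧ (0≤⟦⟧ z) h) (*-monoʳ ⟦ + n ⟧ (0≤⟦⟧ n) zζ) ⟩
    ⟦ + z ⟧ * ((1ℚ - ζ) * ⟦ + n ⟧) + ⟦ + z ⟧ * ζ * ⟦ + n ⟧ ≡⟨ lem ⟦ + z ⟧ ζ ⟦ + n ⟧ ⟩
    ⟦ + z ⟧ * ⟦ + n ⟧                                  ≡⟨ ⟦⟧-* (+ z) (+ n) ⟩
    ⟦ + z ℤ.* + n ⟧                                    ∎)
    where
    open ≤-Reasoning
    lem : ∀ z ζ n → z * ((1ℚ - ζ) * n) + z * ζ * n ≡ z * n
    lem = solve-∀ ℚ-ring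

  drift-cleared : ∀ {Q ζ D M} → ∣ Q ∣ * ⟦ + M ⟧ ≡ ⟦ + D ⟧ → ζ < 1 ÷ℕ 10 → ∣ Q ∣ ≤ ζ * (1 ÷ℕ 2) → + 20 ℤ.* + D ℤ.≤ + M
  drift-cleared {Q} {ζ} {D} {M} QM ζ< h = ⟦⟧-cancel (begin
    ⟦ + 20 ℤ.* + D ⟧                                   ≡⟨ ⟦⟧-* (+ 20) (+ D) ⟨
    ⟦ + 20 ⟧ * ⟦ + D ⟧                                 ≡⟨ trans (cong (⟦ + 20 ⟧ *_) (sym QM)) (sym (*-assoc ⟦ + 20 ⟧ ∣ Q ∣ ⟦ + M ⟧)) ⟩
    ⟦ + 20 ⟧ * ∣ Q ∣ * ⟦ + M ⟧                         ≤⟨ *-monoʳ ⟦ + M ⟧ (0≤⟦⟧ M) (*-monoˡ ⟦ + 20 ⟧ (0≤⟦⟧ 20) (≤-trans h (*-monoʳ (1 ÷ℕ 2) (0≤÷ 1 2) (<⇒≤ ζ<)))) ⟩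
    ⟦ + 20 ⟧ * ((1 ÷ℕ 10) * (1 ÷ℕ 2)) * ⟦ + M ⟧        ≡⟨ *-identityˡ ⟦ + M ⟧ ⟩
    ⟦ + M ⟧                                            ∎)
    where open ≤-Reasoning

  probability-bound : ∀ {e N E ε} → 1 ℕ.≤ N → 1ℚ ≤ ⟦ + E ⟧ * ε → + E ℤ.* + e ℤ.≤ + N → 1 ℕ.≤ E → (e ÷ℕ N) ≤ ε
  probability-bound {e} {N} {E} {ε} 1≤N Eε h 1≤E = cancel-⟦⟧ E 1≤E (begin
    (e ÷ℕ N) * ⟦ + E ⟧         ≤⟨ cancel-⟦⟧ N 1≤N (begin
        (e ÷ℕ N) * ⟦ + E ⟧ * ⟦ + N ⟧     ≡⟨ lem (e ÷ℕ N) ⟦ + E ⟧ ⟦ + N ⟧ ⟩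
        ⟦ + E ⟧ * ((e ÷ℕ N) * ⟦ + N ⟧)   ≡⟨ trans (cong (⟦ + E ⟧ *_) (÷-*-cancel e 1≤N)) (⟦⟧-* (+ E) (+ e)) ⟩
        ⟦ + E ℤ.* + e ⟧                  ≤⟨ ⟦⟧-mono h ⟩
        ⟦ + N ⟧                          ≡⟨ *-identityˡ ⟦ + N ⟧ ⟨
        1ℚ * ⟦ + N ⟧                     ∎) ⟩
    1ℚ                         ≤⟨ Eε ⟩
    ⟦ + E ⟧ * ε                ≡⟨ *-comm ⟦ + E ⟧ ε ⟩
    ε * ⟦ + E ⟧                ∎)
    where
    open ≤-Reasoning
    lem : ∀ p e n → p * e * n ≡ e * (p * n)
    lem = solve-∀ ℚ-ring

  archimedean : ∀ p → 0ℚ < p → ∃ λ k → 1 ℕ.≤ k × 1ℚ ≤ ⟦ + k ⟧ * p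
  archimedean p@(mkℚ (+ suc a) b _) _ = suc b , ℕ.s≤s ℕ.z≤n , ≤-trans (⟦⟧-mono {+ 1} {+ suc a} (ℤ.+≤+ (ℕ.s≤s ℕ.z≤n)))
    (≤-reflexive (trans (sym (÷-*-cancel (suc a) {suc b} (ℕ.s≤s ℕ.z≤n))) (trans (cong (_* ⟦ + suc b ⟧) (fromℚᵘ-toℚᵘ p)) (*-comm p ⟦ + suc b ⟧))))
  archimedean (mkℚ (+ zero) b _) (*<* (ℤ.+<+ ()))
  archimedean (mkℚ -[1+ a ] b _) (*<* ())

  bounded : ∀ p → 0ℚ < p → ∃ λ k → 1 ℕ.≤ k × p ≤ ⟦ + k ⟧
  bounded p@(mkℚ (+ suc a) b _) _ = suc a , ℕ.s≤s ℕ.z≤n , (begin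
    p                        ≡⟨ *-identityʳ p ⟨
    p * 1ℚ                   ≤⟨ *-monoˡ p 0≤p (⟦⟧-mono {+ 1} {+ suc b} (ℤ.+≤+ (ℕ.s≤s ℕ.z≤n))) ⟩
    p * ⟦ + suc b ⟧          ≡⟨ trans (cong (_* ⟦ + suc b ⟧) (sym (fromℚᵘ-toℚᵘ p))) (÷-*-cancel (suc a) {suc b} (ℕ.s≤s ℕ.z≤n)) ⟩
    ⟦ + suc a ⟧              ∎)
    where
    open ≤-Reasoning
    0≤p : 0ℚ ≤ p
    0≤p = subst (0ℚ ≤_) (fromℚᵘ-toℚᵘ p) (0≤÷ (suc a) (suc b))
  bounded (mkℚ (+ zero) b _) (*<* (ℤ.+<+ ()))
  bounded (mkℚ -[1+ a ] b _) (*<* ())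

  ∣⟦⟧∣ : ∀ i → ∣ ⟦ i ⟧ ∣ ≡ ⟦ + ℤ.∣ i ∣ ⟧
  ∣⟦⟧∣ (+ n) = 0≤p⇒∣p∣≡p (0≤⟦⟧ n)
  ∣⟦⟧∣ -[1+ n ] = trans (∣-p∣≡∣p∣ ⟦ + suc n ⟧) (0≤p⇒∣p∣≡p (0≤⟦⟧ (suc n)))

  excess-cleared : ∀ {S D M} → 1 ℕ.≤ M → + S ≡ D ℤ.+ + 2 ℤ.* + M → ∣ (S ÷ℕ M) - ℕtoℚ 2 ∣ * ⟦ + M ⟧ ≡ ⟦ + ℤ.∣ D ∣ ⟧
  excess-cleared {S} {D} {M} 1≤M e = begin
    ∣ (S ÷ℕ M) - ℕtoℚ 2 ∣ * ⟦ + M ⟧                 ≡⟨ cong (∣ (S ÷ℕ M) - ℕtoℚ 2 ∣ *_) (sym (0≤p⇒∣p∣≡p (0≤⟦⟧ M))) ⟩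
    ∣ (S ÷ℕ M) - ℕtoℚ 2 ∣ * ∣ ⟦ + M ⟧ ∣             ≡⟨ ∣p*q∣≡∣p∣*∣q∣ ((S ÷ℕ M) - ℕtoℚ 2) ⟦ + M ⟧ ⟨
    ∣ ((S ÷ℕ M) - ℕtoℚ 2) * ⟦ + M ⟧ ∣               ≡⟨ cong ∣_∣ clear ⟩
    ∣ ⟦ D ⟧ ∣                                        ≡⟨ ∣⟦⟧∣ D ⟩
    ⟦ + ℤ.∣ D ∣ ⟧                                    ∎
    where
    open ≡-Reasoning
    lem₁ : ∀ x t m → (x - t) * m ≡ x * m - t * m
    lem₁ = solve-∀ ℚ-ring
    lem₂ : ∀ a b → a + b - b ≡ a
    lem₂ = solve-∀ ℚ-ring
    clear : ((S ÷ℕ M) - ℕtoℚ 2) * ⟦ + M ⟧ ≡ ⟦ D ⟧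
    clear = begin
      ((S ÷ℕ M) - ℕtoℚ 2) * ⟦ + M ⟧                 ≡⟨ lem₁ (S ÷ℕ M) (ℕtoℚ 2) ⟦ + M ⟧ ⟩
      (S ÷ℕ M) * ⟦ + M ⟧ - ⟦ + 2 ⟧ * ⟦ + M ⟧         ≡⟨ cong₂ _-_ (trans (÷-*-cancel S 1≤M) (trans (cong ⟦_⟧ e) (sym (⟦⟧-+ D (+ 2 ℤ.* + M))))) (⟦⟧-* (+ 2) (+ M)) ⟩
      ⟦ D ⟧ + ⟦ + 2 ℤ.* + M ⟧ - ⟦ + 2 ℤ.* + M ⟧      ≡⟨ lem₂ ⟦ D ⟧ ⟦ + 2 ℤ.* + M ⟧ ⟩
      ⟦ D ⟧                                          ∎

  0<÷ : ∀ {a b} → 1 ℕ.≤ a → 1 ℕ.≤ b → 0ℚ < a ÷ℕ b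
  0<÷ {suc a} {suc b} _ _ = positive⁻¹ (+ suc a / suc b) {{normalize-pos (suc a) (suc b)}}

module CriticalWindow where

  open import Data.Bool using (Bool; true)
  open import Data.Empty using (⊥-elim)
  open import Data.Fin using (zero)
  open import Data.Integer using (ℤ; ∣_∣; +_; -_; _+_; _*_; _-_; _≤_; +≤+)
  open import Data.Integer.Properties
  open import Data.Integer.Tactic.RingSolver using (solve-∀)
  open import Data.Nat as ℕ using (ℕ; zero; suc; _≡ᵇ_)
  import Data.Nat.Properties as ℕₚ
  open import Data.Product using (∃; _,_)
  open import Data.Sum using (inj₁; inj₂)
  open import Relation.Binary.PropositionalEquality
  open import Relation.Nullary using (¬_)
  import Data.Rational as ℚ
  import Data.Rational.Properties as ℚₚ
  open ℚ using (ℚ; 0ℚ; 1ℚ)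
  open Exploration
  open Rationals using (⟦_⟧; ÷-*-cancel; lnPartial-unbounded; degree-cleared; window-cleared; small-cleared; large-cleared; share-cleared; drift-cleared; excess-cleared; probability-bound)

  -- All requirements on the constants: ℓ ≥ lam, z ≥ 1 / ζ, E ≥ 1 / ε; the theorem holds with A = 1 / t and B = b.
  record Constants (ℓ E z : ℕ) : Set where
    field
      t K′ b : ℕ
      qᵤ qₗ g τ L K B : ℤ
      t≡ : + t ≡ + 2 * τ
      1≤t : 1 ℕ.≤ t
      K≡ : + K′ ≡ K
      b≡ : + b ≡ B
      8≤qᵤ : + 8 ≤ qᵤ
      qᵤ-large : + 8 * (+ 12 * + ℓ + + 24 * + z) ≤ qᵤ
      8≤g : + 8 ≤ g
      g-large : + 1168 * + E ≤ g
      144≤qₗ : + 144 ≤ qₗ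
      72g≤qₗ² : + 72 * g ≤ qₗ * qₗ
      qₗ-large : + 8 * (+ 12 * + ℓ + + 1) ≤ qₗ
      τ-large : + 2 * g * (+ 2 * qₗ * (+ 12 * + ℓ + + 1) + + 24 * (qₗ * qₗ) + + 96) ≤ τ
      1≤L : + 1 ≤ L
      τ≤L : τ ≤ L
      16z≤L : + 4 * (+ 4 * + z) ≤ L
      24zℓ≤L : + 2 * + z * (+ 12 * + ℓ) ≤ L
      L≤K : + 12 * + ℓ + + 2 * L ≤ K
      8qᵤ≤K : + 8 * qᵤ ≤ K
      qₗ≤K : qₗ ≤ K
      8≤K : + 8 ≤ K
      16z≤K : + 4 * (+ 4 * + z) ≤ K
      2≤B : + 2 ≤ B
      B≡ : B ≡ + 4 * (+ 48 * qᵤ + + 2 * (qᵤ * qᵤ)) * + E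

  module _ {ℓ E z : ℕ} (1≤ℓ : + 1 ≤ + ℓ) (1≤E : + 1 ≤ + E) (1≤z : + 1 ≤ + z) where

    k≤k*a : ∀ k {a} → + 1 ≤ a → + suc k ≤ + suc k * a
    k≤k*a k h = ≤-trans (≤-reflexive (sym (*-identityʳ (+ suc k)))) (*-monoˡ (+ suc k) (0≤ℕ (suc k)) h)

    constants-from : ∀ qᵤ g qₗ τ L K B →
      qᵤ ≡ + 8 * (+ 12 * + ℓ + + 24 * + z) + + 8 → g ≡ + 1168 * + E → qₗ ≡ + 72 * g + + 8 * (+ 12 * + ℓ + + 1) →
      τ ≡ + 2 * g * (+ 2 * qₗ * (+ 12 * + ℓ + + 1) + + 24 * (qₗ * qₗ) + + 96) →
      L ≡ τ + + 4 * (+ 4 * + z) + + 2 * + z * (+ 12 * + ℓ) →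
      K ≡ + 12 * + ℓ + + 2 * L + + 8 * qᵤ + qₗ + + 8 + + 4 * (+ 4 * + z) →
      B ≡ + 4 * (+ 48 * qᵤ + + 2 * (qᵤ * qᵤ)) * + E → Constants ℓ E z
    constants-from qᵤ g qₗ τ L K B eqᵤ eg eqₗ eτ eL eK eB = record
      { t = ∣ + 2 * τ ∣ ; K′ = ∣ K ∣ ; b = ∣ B ∣ ; qᵤ = qᵤ ; qₗ = qₗ ; g = g ; τ = τ ; L = L ; K = K ; B = B
      ; t≡ = t≡
      ; 1≤t = drop‿+≤+ (subst (+ 1 ≤_) (sym t≡) (≤-trans (+≤+ (ℕ.s≤s ℕ.z≤n)) (k≤k*a 1 1≤τ)))
      ; K≡ = 0≤i⇒+∣i∣≡i 0≤K
      ; b≡ = 0≤i⇒+∣i∣≡i (≤-trans (0≤ℕ 2) 2≤B)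
      ; 8≤qᵤ = 8≤qᵤ
      ; qᵤ-large = ≤-by (+ 8) (0≤ℕ 8) eqᵤ
      ; 8≤g = 8≤g
      ; g-large = ≤-reflexive (sym eg)
      ; 144≤qₗ = ≤-trans (≤-trans (+≤+ (ℕₚ.m≤m+n 144 432)) (*-monoˡ (+ 72) (0≤ℕ 72) 8≤g)) 72g≤qₗ
      ; 72g≤qₗ² = ≤-trans 72g≤qₗ (≤-trans (≤-reflexive (sym (*-identityʳ qₗ))) (*-monoˡ qₗ 0≤qₗ 1≤qₗ))
      ; qₗ-large = ≤-by (+ 72 * g) (0≤* (0≤ℕ 72) 0≤g) (trans eqₗ (+-comm (+ 72 * g) (+ 8 * (+ 12 * + ℓ + + 1))))
      ; τ-large = ≤-reflexive (sym eτ)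
      ; 1≤L = ≤-trans 1≤τ τ≤L
      ; τ≤L = τ≤L
      ; 16z≤L = ≤-by (τ + a₂) (0≤+ 0≤τ 0≤a₂) (trans eL (lem₁ τ a₁ a₂))
      ; 24zℓ≤L = ≤-by (τ + a₁) (0≤+ 0≤τ 0≤a₁) (trans eL (+-comm (τ + a₁) a₂))
      ; L≤K = ≤-by (+ 8 * qᵤ + qₗ + + 8 + a₁) (0≤+ (0≤+ (0≤+ 0≤8qᵤ 0≤qₗ) (0≤ℕ 8)) 0≤a₁) (trans eK (lem₂ b₀ (+ 8 * qᵤ) qₗ a₁))
      ; 8qᵤ≤K = ≤-by (b₀ + qₗ + + 8 + a₁) (0≤+ (0≤+ (0≤+ 0≤b₀ 0≤qₗ) (0≤ℕ 8)) 0≤a₁) (trans eK (lem₃ b₀ (+ 8 * qᵤ) qₗ a₁))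
      ; qₗ≤K = ≤-by (b₀ + + 8 * qᵤ + + 8 + a₁) (0≤+ (0≤+ (0≤+ 0≤b₀ 0≤8qᵤ) (0≤ℕ 8)) 0≤a₁) (trans eK (lem₄ b₀ (+ 8 * qᵤ) qₗ a₁))
      ; 8≤K = ≤-by (b₀ + + 8 * qᵤ + qₗ + a₁) (0≤+ (0≤+ (0≤+ 0≤b₀ 0≤8qᵤ) 0≤qₗ) 0≤a₁) (trans eK (lem₅ b₀ (+ 8 * qᵤ) qₗ a₁))
      ; 16z≤K = ≤-by (b₀ + + 8 * qᵤ + qₗ + + 8) (0≤+ (0≤+ (0≤+ 0≤b₀ 0≤8qᵤ) 0≤qₗ) (0≤ℕ 8)) (trans eK (+-comm (b₀ + + 8 * qᵤ + qₗ + + 8) a₁))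
      ; 2≤B = 2≤B
      ; B≡ = eB }
      where
      0≤ℓ : + 0 ≤ + ℓ
      0≤ℓ = 0≤ℕ ℓ
      a₁ a₂ b₀ : ℤ
      a₁ = + 4 * (+ 4 * + z)
      a₂ = + 2 * + z * (+ 12 * + ℓ)
      b₀ = + 12 * + ℓ + + 2 * L
      0≤a₁ : + 0 ≤ a₁
      0≤a₁ = 0≤* (0≤ℕ 4) (0≤* (0≤ℕ 4) (0≤ℕ z))
      0≤a₂ : + 0 ≤ a₂
      0≤a₂ = 0≤* (0≤* (0≤ℕ 2) (0≤ℕ z)) (0≤* (0≤ℕ 12) 0≤ℓ)
      8≤qᵤ : + 8 ≤ qᵤ
      8≤qᵤ = ≤-by (+ 8 * (+ 12 * + ℓ + + 24 * + z)) (0≤* (0≤ℕ 8) (0≤+ (0≤* (0≤ℕ 12) 0≤ℓ) (0≤* (0≤ℕ 24) (0≤ℕ z)))) (trans eqᵤ (+-comm (+ 8 * (+ 12 * + ℓ + + 24 * + z)) (+ 8)))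
      0≤8qᵤ : + 0 ≤ + 8 * qᵤ
      0≤8qᵤ = 0≤* (0≤ℕ 8) (≤-trans (0≤ℕ 8) 8≤qᵤ)
      8≤g : + 8 ≤ g
      8≤g = ≤-trans (≤-trans (+≤+ (ℕₚ.m≤m+n 8 1160)) (k≤k*a 1167 1≤E)) (≤-reflexive (sym eg))
      0≤g : + 0 ≤ g
      0≤g = ≤-trans (0≤ℕ 8) 8≤g
      72g≤qₗ : + 72 * g ≤ qₗ
      72g≤qₗ = ≤-by (+ 8 * (+ 12 * + ℓ + + 1)) (0≤* (0≤ℕ 8) (0≤+ (0≤* (0≤ℕ 12) 0≤ℓ) (0≤ℕ 1))) eqₗ
      1≤qₗ : + 1 ≤ qₗ
      1≤qₗ = ≤-trans (≤-trans (+≤+ (ℕ.s≤s ℕ.z≤n)) (k≤k*a 71 (≤-trans (+≤+ (ℕ.s≤s ℕ.z≤n)) 8≤g))) 72g≤qₗ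
      0≤qₗ : + 0 ≤ qₗ
      0≤qₗ = 1≤⇒0≤ 1≤qₗ
      1≤τ : + 1 ≤ τ
      1≤τ = ≤-trans (*-mono {+ 1} {+ 2 * g} {+ 1} {W} (0≤ℕ 1) 0≤W (≤-trans (+≤+ (ℕ.s≤s ℕ.z≤n)) (k≤k*a 1 (≤-trans (+≤+ (ℕ.s≤s ℕ.z≤n)) 8≤g)))
        (≤-trans (+≤+ (ℕ.s≤s ℕ.z≤n)) (≤-by {+ 96} (+ 2 * qₗ * (+ 12 * + ℓ + + 1) + + 24 * (qₗ * qₗ)) 0≤W′ (+-comm (+ 2 * qₗ * (+ 12 * + ℓ + + 1) + + 24 * (qₗ * qₗ)) (+ 96))))) (≤-reflexive (sym eτ))
        where
        W : ℤ
        W = + 2 * qₗ * (+ 12 * + ℓ + + 1) + + 24 * (qₗ * qₗ) + + 96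
        0≤W′ : + 0 ≤ + 2 * qₗ * (+ 12 * + ℓ + + 1) + + 24 * (qₗ * qₗ)
        0≤W′ = 0≤+ (0≤* (0≤* (0≤ℕ 2) 0≤qₗ) (0≤+ (0≤* (0≤ℕ 12) 0≤ℓ) (0≤ℕ 1))) (0≤* (0≤ℕ 24) (0≤* 0≤qₗ 0≤qₗ))
        0≤W : + 0 ≤ W
        0≤W = 0≤+ 0≤W′ (0≤ℕ 96)
      0≤τ : + 0 ≤ τ
      0≤τ = 1≤⇒0≤ 1≤τ
      t≡ : + ∣ + 2 * τ ∣ ≡ + 2 * τ
      t≡ = 0≤i⇒+∣i∣≡i (0≤* (0≤ℕ 2) 0≤τ)
      τ≤L : τ ≤ L
      τ≤L = ≤-by (a₁ + a₂) (0≤+ 0≤a₁ 0≤a₂) (trans eL (+-assoc τ a₁ a₂))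
      0≤b₀ : + 0 ≤ b₀
      0≤b₀ = 0≤+ (0≤* (0≤ℕ 12) 0≤ℓ) (0≤* (0≤ℕ 2) (≤-trans 0≤τ τ≤L))
      0≤K : + 0 ≤ K
      0≤K = subst (+ 0 ≤_) (sym eK) (0≤+ (0≤+ (0≤+ (0≤+ 0≤b₀ 0≤8qᵤ) 0≤qₗ) (0≤ℕ 8)) 0≤a₁)
      2≤B : + 2 ≤ B
      2≤B = ≤-trans (+≤+ (ℕₚ.m≤m+n 2 2)) (≤-trans (*-mono {+ 4} {+ 4 * C} {+ 1} {+ E} (0≤ℕ 4) (0≤ℕ E) (k≤k*a 3 1≤C) 1≤E) (≤-reflexive (sym eB)))
        where
        C : ℤ
        C = + 48 * qᵤ + + 2 * (qᵤ * qᵤ)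
        0≤qᵤ : + 0 ≤ qᵤ
        0≤qᵤ = ≤-trans (0≤ℕ 8) 8≤qᵤ
        1≤C : + 1 ≤ C
        1≤C = ≤-trans (≤-trans (+≤+ (ℕ.s≤s ℕ.z≤n)) (k≤k*a 47 (≤-trans (+≤+ (ℕ.s≤s ℕ.z≤n)) 8≤qᵤ))) (≤-by (+ 2 * (qᵤ * qᵤ)) (0≤* (0≤ℕ 2) (0≤* 0≤qᵤ 0≤qᵤ)) refl)
      lem₁ : ∀ a b c → a + b + c ≡ b + (a + c)
      lem₁ = solve-∀
      lem₂ : ∀ a b c e → a + b + c + + 8 + e ≡ a + (b + c + + 8 + e)
      lem₂ = solve-∀
      lem₃ : ∀ a b c e → a + b + c + + 8 + e ≡ b + (a + c + + 8 + e)
      lem₃ = solve-∀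
      lem₄ : ∀ a b c e → a + b + c + + 8 + e ≡ c + (a + b + + 8 + e)
      lem₄ = solve-∀
      lem₅ : ∀ a b c e → a + b + c + + 8 + e ≡ + 8 + (a + b + c + e)
      lem₅ = solve-∀

    opaque
      constants : Constants ℓ E z
      constants = constants-from _ _ _ _ _ _ _ refl refl refl refl refl refl refl

  module Window (lam ε ζ : ℚ) (0<lam : 0ℚ ℚ.< lam) {ℓ E z : ℕ}
    (lam≤ℓ : lam ℚ.≤ ⟦ + ℓ ⟧) (1≤zζ : 1ℚ ℚ.≤ ⟦ + z ⟧ ℚ.* ζ) (1≤Eε : 1ℚ ℚ.≤ ⟦ + E ⟧ ℚ.* ε)
    (1≤ℓ : + 1 ≤ + ℓ) (1≤z : + 1 ≤ + z) (1≤E : 1 ℕ.≤ E) (consts : Constants ℓ E z)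
    {n : ℕ} (83≤n : 83 ℕ.≤ n) (n-large : 16 ℕ.* 2 ℕ.^ (4 ℕ.* Constants.K′ consts) ℕ.≤ n)
    (d : DegSeq n) (realisable : 1 ℕ.≤ numGraphs n d) (D : ConditionD n d ζ)
    (critical : (ℚ.∣ Qof n d ∣ ^ℚ 3) ℚ.* ℕtoℚ n ℚ.≤ (lam ^ℚ 3) ℚ.* (Rof n d ^ℚ 2))
    where

    open Constants consts
    open ConditionD D

    private
      M V S₂ Δ : ℕ
      M = twoE n d
      V = sumF n (λ u → d u ℕ.* (absDiff2 (d u) ℕ.* absDiff2 (d u)))
      S₂ = sumF n (λ u → d u ℕ.* d u)
      Δ = maxDeg n d

    1≤n : 1 ℕ.≤ n
    1≤n = ℕₚ.≤-trans (ℕ.s≤s ℕ.z≤n) 83≤n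

    1≤d : ∀ v → 1 ℕ.≤ d v
    1≤d v with 1≤? (d v)
    ... | inj₁ p = p
    ... | inj₂ e = ⊥-elim (1≢0 (trans (cong (λ k → ι (k ≡ᵇ 0)) (sym e)) (∑≡0⇒ (λ v → ι (d v ≡ᵇ 0)) (λ v → 0≤ι (d v ≡ᵇ 0)) (trans (sym (countF-∑ (λ v → d v ≡ᵇ 0))) (cong +_ condB)) v)))
      where
      1≢0 : ¬ (+ 1 ≡ + 0)
      1≢0 ()

    d≤Δ : ∀ v → d v ℕ.≤ Δ
    d≤Δ = ≤maxF d

    1≤Δ : 1 ℕ.≤ Δ
    1≤Δ = go n 1≤n d 1≤d
      where
      go : ∀ n → 1 ℕ.≤ n → (d : DegSeq n) → (∀ v → 1 ℕ.≤ d v) → 1 ℕ.≤ maxDeg n d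
      go (suc n) _ d h = ℕₚ.≤-trans (h zero) (≤maxF d zero)

    total : ∑ (λ v → + d v) ≡ + M
    total = sym (sumF-∑ d)

    n≤M : n ℕ.≤ M
    n≤M = drop‿+≤+ (≤-trans (≤-reflexive (sym (∑-one n))) (≤-trans (∑-mono (λ v → +≤+ (1≤d v))) (≤-reflexive total)))

    1≤M : 1 ℕ.≤ M
    1≤M = ℕₚ.≤-trans 1≤n n≤M

    V≡ : + V ≡ ∑ (λ v → ρ (d v))
    V≡ = trans (sumF-∑ (λ u → d u ℕ.* (absDiff2 (d u) ℕ.* absDiff2 (d u)))) (∑-cong (λ v → square (d v)))
      where
      square : ∀ k → + (k ℕ.* (absDiff2 k ℕ.* absDiff2 k)) ≡ ρ k
      square zero = refl
      square (suc zero) = refl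
      square (suc (suc k)) = trans (pos-* (2 ℕ.+ k) (a ℕ.* a)) (cong (+ (2 ℕ.+ k) *_) (trans (cong (λ x → + (x ℕ.* x)) (trans (cong (k ℕ.+_) (ℕₚ.0∸n≡0 k)) (ℕₚ.+-identityʳ k))) (pos-* k k)))
        where
        a : ℕ
        a = absDiff2 (2 ℕ.+ k)

    S₂≡ : + S₂ ≡ ∑ (λ v → η (d v)) + + 2 * + M
    S₂≡ = trans (sumF-∑ (λ u → d u ℕ.* d u)) (trans (∑-cong (λ v → trans (pos-* (d v) (d v)) (lem (+ d v)))) (trans (∑-+ _ _) (cong (_+_ (∑ (λ v → η (d v)))) (trans (∑-* (+ 2) (λ v → + d v)) (cong (+ 2 *_) total)))))
      where
      lem : ∀ x → x * x ≡ x * (x - + 2) + + 2 * x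
      lem = solve-∀

    RM : Rof n d ℚ.* ⟦ + M ⟧ ≡ ⟦ + V ⟧
    RM = ÷-*-cancel V 1≤M

    QM : ℚ.∣ Qof n d ∣ ℚ.* ⟦ + M ⟧ ≡ ⟦ + ∣ ∑ (λ v → η (d v)) ∣ ⟧
    QM = excess-cleared {S₂} {∑ (λ v → η (d v))} {M} 1≤M S₂≡

    drift : + 20 * + ∣ ∑ (λ v → η (d v)) ∣ ≤ + M
    drift = drift-cleared {Qof n d} {ζ} {∣ ∑ (λ v → η (d v)) ∣} {M} QM ζ-small condD

    degree-bound : (+ Δ * K) * (+ Δ * K) * (+ Δ * K) * + M ≤ + n * ∑ (λ v → ρ (d v))
    degree-bound = go (lnPartial-unbounded K′ n n-large)
      where
      go : (∃ λ m → ⟦ + K′ ⟧ ℚ.≤ lnPartial n m) → (+ Δ * K) * (+ Δ * K) * (+ Δ * K) * + M ≤ + n * ∑ (λ v → ρ (d v))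
      go (m , K≤) = subst₂ (λ k v → (+ Δ * k) * (+ Δ * k) * (+ Δ * k) * + M ≤ + n * v) K≡ V≡ (degree-cleared {n} {M} {V} {Rof n d} RM {Δ} {K′} {lnPartial n m} K≤ (condA m))

    window : + ∣ ∑ (λ v → η (d v)) ∣ * + ∣ ∑ (λ v → η (d v)) ∣ * + ∣ ∑ (λ v → η (d v)) ∣ * + n ≤
             + ℓ * + ℓ * + ℓ * (∑ (λ v → ρ (d v)) * ∑ (λ v → ρ (d v))) * + M
    window = subst (λ v → + ∣ ∑ (λ v → η (d v)) ∣ * + ∣ ∑ (λ v → η (d v)) ∣ * + ∣ ∑ (λ v → η (d v)) ∣ * + n ≤ + ℓ * + ℓ * + ℓ * (v * v) * + M) V≡
      (window-cleared {n} {M} {V} {Rof n d} RM {Qof n d} {∣ ∑ (λ v → η (d v)) ∣} {lam} {ℓ} QM (ℚₚ.<⇒≤ 0<lam) lam≤ℓ critical)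

    share : + z * ∑ (λ v → ι (d v ≡ᵇ 2)) + + n ≤ + z * + n
    share = subst (λ a → + z * a + + n ≤ + z * + n) (countF-∑ (λ v → d v ≡ᵇ 2)) (share-cleared {nDeg n d 2} {n} {z} {ζ} 1≤zζ condC)

    parameters : ParameterData d
    parameters = record
      { M = M ; Δ = Δ ; ℓ = + ℓ ; z = + z ; K = K ; L = L ; 1≤n = 1≤n ; 1≤d = 1≤d ; d≤Δ = d≤Δ ; 1≤Δ = 1≤Δ ; total = total ; drift = drift
      ; degree-bound = degree-bound ; window = window ; share = share ; 1≤ℓ = 1≤ℓ ; 1≤z = 1≤z ; 1≤L = 1≤L ; L-large = 24zℓ≤L ; K-large = L≤K }

    open Parameters parameters
      using (M≤3n; s; s³≤V; V≤24s³; D≤Λs²; -Λs²≤D; KΔ≤s; K≤s; 1≤s; Ls²≤n; n≤24zs³; n≤4zn₁; 10D≤M; small-scaled; large-scaled)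
      renaming (n≤M to +n≤M)

    private
      y : ℤ
      y = + s
      0≤y : + 0 ≤ y
      0≤y = 0≤ℕ s

    from-K : ∀ {a} → a ≤ K → a * + Δ ≤ y
    from-K h = ≤-trans (*-monoʳ (+ Δ) (0≤ℕ Δ) h) KΔ≤s

    from-L : ∀ {a} → a ≤ L → a * (y * y) ≤ + n
    from-L h = ≤-trans (*-monoʳ (y * y) (0≤* 0≤y 0≤y) h) Ls²≤n

    simple : ∀ m → ∑ (λ v → + d v) ≡ + m → dd m ≤ + 8 * (numReal d * factorials d)
    simple m e = numReal-positive d m e (ℕₚ.≤-trans 83≤n (ℕₚ.≤-trans n≤M (ℕₚ.≤-reflexive (+-injective (trans (sym total) e))))) (≤-trans 10D≤M (≤-reflexive (trans (sym total) e)))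

    numGraphs≡ : numReal d ≡ + numGraphs n d
    numGraphs≡ = count-all (realisations n d)

    finish : ∀ event → + E * count event (realisations n d) ≤ numReal d → ProbAtMost n d event ε
    finish event h = probability-bound {numEvent n d event} {numGraphs n d} {E} {ε} realisable 1≤Eε
      (subst₂ (λ a b → + E * a ≤ b) (sym (length-filter event (realisations n d))) numGraphs≡ h) 1≤E

    small-holds : ∀ {G : Graph n} → (((ℕtoℚ (largestComp G) ^ℚ 3) ℚ.* Rof n d) ≤Q? (((1 ÷ℕ t) ^ℚ 3) ℚ.* (ℕtoℚ n ^ℚ 2))) ≡ true → + 2 * (τ * y * + largestComp G) ≤ + n
    small-holds {G} e = ≤-trans (≤-reflexive (trans (lem τ y (+ largestComp G)) (cong (λ x → x * + largestComp G * y) (sym t≡))))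
      (small-scaled {+ t} (largestComp G) (0≤ℕ t) (subst (λ v → (+ t * + largestComp G) * (+ t * + largestComp G) * (+ t * + largestComp G) * v ≤ + n * + n * + M) V≡
        (small-cleared {n} {M} {V} {Rof n d} RM {largestComp G} {1 ÷ℕ t} {t} (÷-*-cancel 1 1≤t) (ℚₚ.≤ᵇ⇒≤ {(ℕtoℚ (largestComp G) ^ℚ 3) ℚ.* Rof n d} {((1 ÷ℕ t) ^ℚ 3) ℚ.* (ℕtoℚ n ^ℚ 2)} (⇒T e)))))
      where
      lem : ∀ a b c → + 2 * (a * b * c) ≡ + 2 * a * c * b
      lem = solve-∀

    large-holds : ∀ {G : Graph n} → (((ℕtoℚ b ^ℚ 3) ℚ.* (ℕtoℚ n ^ℚ 2)) ≤Q? ((ℕtoℚ (largestComp G) ^ℚ 3) ℚ.* Rof n d)) ≡ true → B * + n ≤ + 2 * (+ largestComp G * y)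
    large-holds {G} e = large-scaled {B} (largestComp G) (subst₂ (λ B v → B * B * B * (+ n * + n) * + M ≤ + largestComp G * + largestComp G * + largestComp G * v) b≡ V≡
      (large-cleared {n} {M} {V} {Rof n d} RM {largestComp G} {b} (ℚₚ.≤ᵇ⇒≤ {(ℕtoℚ b ^ℚ 3) ℚ.* (ℕtoℚ n ^ℚ 2)} {(ℕtoℚ (largestComp G) ^ℚ 3) ℚ.* Rof n d} (⇒T e))))

    0≤qᵤ : + 0 ≤ qᵤ
    0≤qᵤ = ≤-trans (0≤ℕ 8) 8≤qᵤ

    upper-from : ∀ (event : Graph n → Bool) → (∀ {G} → event G ≡ true → B * + n ≤ + 2 * (+ largestComp G * y)) → ProbAtMost n d event ε
    upper-from event holds = finish event (*-cancelˡ (+ 4 * C) 1≤4C (≤-trans (≤-reflexive (trans (sym (*-assoc (+ 4 * C) (+ E) cnt)) (cong (_* cnt) (sym B≡))))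
        (UpperTail.upper-tail upper-data simple total B event 2≤B (λ _ → holds))))
      where
      C cnt : ℤ
      C = + 48 * qᵤ + + 2 * (qᵤ * qᵤ)
      cnt = count event (realisations n d)
      M≤3n′ : ∑ (λ v → + d v) ≤ + 3 * + n
      M≤3n′ = ≤-trans (≤-reflexive total) M≤3n
      s²≤n : y * y ≤ + n
      s²≤n = ≤-trans (≤-reflexive (sym (*-identityˡ (y * y)))) (from-L 1≤L)
      upper-data : UpperData d
      upper-data = record
        { s = s ; q = qᵤ ; Λ = + 12 * + ℓ ; c = + 24 * + z ; M≤3n = M≤3n′ ; s³≤V = s³≤V ; V≤24s³ = V≤24s³ ; D≤Λs² = D≤Λs² ; n≤cs³ = n≤24zs³
        ; 8qd≤s = λ v → ≤-trans (*-monoˡ (+ 8 * qᵤ) (0≤* (0≤ℕ 8) 0≤qᵤ) (+≤+ (d≤Δ v))) (from-K 8qᵤ≤K)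
        ; Λ+c≤q = qᵤ-large ; 0≤Λ = 0≤* (0≤ℕ 12) (0≤ℕ ℓ) ; 0≤c = 0≤* (0≤ℕ 24) (0≤ℕ z) ; 8≤q = 8≤qᵤ ; 1≤s = 1≤s ; s²≤n = s²≤n ; 1≤d = 1≤d }
      1≤4C : + 1 ≤ + 4 * C
      1≤4C = *-mono {+ 1} {+ 4} {+ 1} {C} (0≤ℕ 1) (0≤+ (0≤* (0≤ℕ 48) 0≤qᵤ) (0≤* (0≤ℕ 2) (0≤* 0≤qᵤ 0≤qᵤ))) (+≤+ (ℕ.s≤s ℕ.z≤n))
        (≤-trans (*-mono {+ 1} {+ 48} {+ 1} {qᵤ} (0≤ℕ 1) 0≤qᵤ (+≤+ (ℕ.s≤s ℕ.z≤n)) (≤-trans (+≤+ (ℕ.s≤s ℕ.z≤n)) 8≤qᵤ)) (≤-by (+ 2 * (qᵤ * qᵤ)) (0≤* (0≤ℕ 2) (0≤* 0≤qᵤ 0≤qᵤ)) refl))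

    lower-from : ∀ (event : Graph n → Bool) → (∀ {G} → event G ≡ true → + 2 * (τ * y * + largestComp G) ≤ + n) → ProbAtMost n d event ε
    lower-from event holds = finish event (*-cancelˡ (+ 1168) (+≤+ (ℕ.s≤s ℕ.z≤n)) (≤-trans (≤-reflexive (sym (*-assoc (+ 1168) (+ E) cnt)))
        (≤-trans (*-monoʳ cnt (0≤count event (realisations n d)) g-large)
          (Lower.lower-tail lower-data total (simple M total)))))
      where
      cnt : ℤ
      cnt = count event (realisations n d)
      n≤M′ : + n ≤ ∑ (λ v → + d v)
      n≤M′ = ≤-trans +n≤M (≤-reflexive (sym total))
      M≤3n′ : ∑ (λ v → + d v) ≤ + 3 * + n
      M≤3n′ = ≤-trans (≤-reflexive total) M≤3n
      0≤L : + 0 ≤ L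
      0≤L = 1≤⇒0≤ 1≤L
      τs≤n : τ * y ≤ + n
      τs≤n = ≤-trans (*-monoʳ y 0≤y τ≤L) (≤-trans (*-monoˡ L 0≤L (≤-trans (≤-reflexive (sym (*-identityʳ y))) (*-monoˡ y 0≤y 1≤s))) Ls²≤n)
      lower-data : LowerData d
      lower-data = record
        { s = s ; g = g ; q = qₗ ; τ = τ ; Λ = + 12 * + ℓ ; Δ = + Δ ; c = + 4 * + z ; n≤M = n≤M′ ; M≤3n = M≤3n′ ; s³≤V = s³≤V ; V≤24s³ = V≤24s³
        ; -Λs²≤D = -Λs²≤D ; d≤Δ = λ v → +≤+ (d≤Δ v) ; 8Δ≤s = from-K 8≤K ; qΔ≤s = from-K qₗ≤K ; 4cΔ≤s = from-K 16z≤K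
        ; 1≤c = *-mono {+ 1} {+ 4} (0≤ℕ 1) (0≤ℕ z) (+≤+ (ℕ.s≤s ℕ.z≤n)) 1≤z ; n≤cn₁ = n≤4zn₁ ; 0≤Λ = 0≤* (0≤ℕ 12) (0≤ℕ ℓ)
        ; 8≤g = 8≤g ; 144≤q = 144≤qₗ ; 72g≤q² = 72g≤qₗ² ; 8Λ≤q = qₗ-large ; τ-large = τ-large ; q≤s = ≤-trans qₗ≤K K≤s
        ; 4cs²≤n = from-L 16z≤L ; τs≤n = τs≤n ; 1≤d = 1≤d ; event = event ; small = λ _ → holds }

    upper : ProbAtMost n d (λ G → ((ℕtoℚ b ^ℚ 3) ℚ.* (ℕtoℚ n ^ℚ 2)) ≤Q? ((ℕtoℚ (largestComp G) ^ℚ 3) ℚ.* Rof n d)) ε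
    upper = upper-from (λ G → ((ℕtoℚ b ^ℚ 3) ℚ.* (ℕtoℚ n ^ℚ 2)) ≤Q? ((ℕtoℚ (largestComp G) ^ℚ 3) ℚ.* Rof n d)) (λ {G} → large-holds {G})

    lower : ProbAtMost n d (λ G → ((ℕtoℚ (largestComp G) ^ℚ 3) ℚ.* Rof n d) ≤Q? (((1 ÷ℕ t) ^ℚ 3) ℚ.* (ℕtoℚ n ^ℚ 2))) ε
    lower = lower-from (λ G → ((ℕtoℚ (largestComp G) ^ℚ 3) ℚ.* Rof n d) ≤Q? (((1 ÷ℕ t) ^ℚ 3) ℚ.* (ℕtoℚ n ^ℚ 2))) (λ {G} → small-holds {G})

open import Data.Nat using (ℕ; _≤_)
open import Data.Product using (Σ; _×_; _,_; proj₁; proj₂)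
open import Data.Rational using (ℚ; _*_; _<_; ∣_∣; 0ℚ) renaming (_≤_ to _≤ℚ_)
import Data.Integer.Properties as ℤₚ
import Data.Nat as ℕ
import Data.Nat.Properties as ℕₚ
open import Data.Integer using (+≤+)
open import Relation.Binary.PropositionalEquality using (sym)
open CriticalWindow
open Rationals using (bounded; archimedean; 0<÷)

theorem1 : (lam ε ζ : ℚ) → 0ℚ < lam → 0ℚ < ε → 0ℚ < ζ →
    Σ ℚ (λ A → Σ ℚ (λ B → Σ ℕ (λ N →
    (0ℚ < A) × (0ℚ < B) ×
    ((n : ℕ) → N ≤ n → (d : DegSeq n) →
    1 ≤ numGraphs n d →
    ConditionD n d ζ →
    ((∣ Qof n d ∣ ^ℚ 3) * ℕtoℚ n ≤ℚ (lam ^ℚ 3) * (Rof n d ^ℚ 2)) →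
    ProbAtMost n d
    (λ G → ((ℕtoℚ (largestComp G) ^ℚ 3) * Rof n d) ≤Q? ((A ^ℚ 3) * (ℕtoℚ n ^ℚ 2)))
    ε
    ×
    ProbAtMost n d
    (λ G → ((B ^ℚ 3) * (ℕtoℚ n ^ℚ 2)) ≤Q? ((ℕtoℚ (largestComp G) ^ℚ 3) * Rof n d))
    ε))))
theorem1 lam ε ζ 0<lam 0<ε 0<ζ =
    1 ÷ℕ t , ℕtoℚ b , N₀ , 0<÷ {1} {t} ℕₚ.≤-refl 1≤t , 0<÷ {b} {1} 1≤b ℕₚ.≤-refl ,
    λ n N≤n d realisable D critical →
      let n-large = ℕₚ.≤-trans (ℕₚ.m≤n⊔m 83 N₁) N≤n
          83≤n = ℕₚ.≤-trans (ℕₚ.m≤m⊔n 83 N₁) N≤n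
      in Window.lower lam ε ζ 0<lam lam≤ℓ 1≤zζ 1≤Eε (+≤+ 1≤ℓ) (+≤+ 1≤z) 1≤E C 83≤n n-large d realisable D critical ,
         Window.upper lam ε ζ 0<lam lam≤ℓ 1≤zζ 1≤Eε (+≤+ 1≤ℓ) (+≤+ 1≤z) 1≤E C 83≤n n-large d realisable D critical
  where
  ℓ-spec = bounded lam 0<lam
  E-spec = archimedean ε 0<ε
  z-spec = archimedean ζ 0<ζ
  ℓ E z : ℕ
  ℓ = proj₁ ℓ-spec
  E = proj₁ E-spec
  z = proj₁ z-spec
  1≤ℓ = proj₁ (proj₂ ℓ-spec)
  1≤E = proj₁ (proj₂ E-spec)
  1≤z = proj₁ (proj₂ z-spec)
  lam≤ℓ = proj₂ (proj₂ ℓ-spec)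
  1≤Eε = proj₂ (proj₂ E-spec)
  1≤zζ = proj₂ (proj₂ z-spec)
  C : Constants ℓ E z
  C = constants (+≤+ 1≤ℓ) (+≤+ 1≤E) (+≤+ 1≤z)
  open Constants C using (t; K′; b; 1≤t; b≡; 2≤B)
  N₁ N₀ : ℕ
  N₁ = 16 ℕ.* 2 ℕ.^ (4 ℕ.* K′)
  N₀ = 83 ℕ.⊔ N₁
  1≤b : 1 ℕ.≤ b
  1≤b = ℕₚ.≤-trans (ℕ.s≤s ℕ.z≤n) (ℤₚ.drop‿+≤+ (ℤₚ.≤-trans 2≤B (ℤₚ.≤-reflexive (sym b≡))))
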